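{- Let $\mathcal H$ be a hypergraph on $n$ vertices (multiple copies of the same hyperedge are allowed) that contains no Berge-$C_4$. Then $$\sum_{h\in \mathcal H}(|h|-3)\leq (1+o(1))\frac12 n^{3/2},$$ where $o(1)\to 0$ as $n\to\infty$. Furthermore, for every $n$ there exists a Berge-$C_4$-free hypergraph $\mathcal H$ on $n$ vertices such that $$\sum_{h\in \mathcal H}(|h|-3)\geq (1+o(1))\frac{1}{2\sqrt6}n^{3/2}.$$
   Context: A Berge cycle of length $k$ (Berge-$C_k$) in a hypergraph is an alternating sequence $v_1,h_1,v_2,h_2,\ldots,v_k,h_k$ of distinct vertices $v_i$ and distinct hyperedges $h_i$ such that $v_i,v_{i+1}\in h_i$ for each $i\in\{1,\ldots,k-1\}$ and $v_k,v_1\in h_k$. A hypergraph is Berge-$C_4$-free if it contains no Berge cycle of length $4$. Hypergraphs may contain several copies of the same hyperedge, and the sum is over all hyperedges counted with multiplicity. -}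

module Defs where

open import Data.Nat as ℕ using (ℕ; suc; _^_)
open import Data.Integer as ℤ using (ℤ; +_)
open import Data.Rational as ℚ using (ℚ; _/_)
open import Data.Fin using (Fin)
open import Data.Fin.Subset using (Subset; _∈_; ∣_∣)
open import Data.List using (List; length; lookup; map; foldr)
open import Data.Product using (_×_; Σ)
open import Data.Sum using (_⊎_)
open import Relation.Binary.PropositionalEquality using (_≢_)
open import Relation.Nullary using (¬_)

Hypergraph : ℕ → Set
Hypergraph n = List (Subset n)

edge : ∀ {n} (H : Hypergraph n) → Fin (length H) → Subset n
edge H i = lookup H i

record BergeC4 {n : ℕ} (H : Hypergraph n) : Set where
  field
    v₁ v₂ v₃ v₄ : Fin n
    h₁ h₂ h₃ h₄ : Fin (length H)
    v-distinct : (v₁ ≢ v₂) × (v₁ ≢ v₃) × (v₁ ≢ v₄) × (v₂ ≢ v₃) × (v₂ ≢ v₄) × (v₃ ≢ v₄)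
    h-distinct : (h₁ ≢ h₂) × (h₁ ≢ h₃) × (h₁ ≢ h₄) × (h₂ ≢ h₃) × (h₂ ≢ h₄) × (h₃ ≢ h₄)
    in₁ : (v₁ ∈ edge H h₁) × (v₂ ∈ edge H h₁)
    in₂ : (v₂ ∈ edge H h₂) × (v₃ ∈ edge H h₂)
    in₃ : (v₃ ∈ edge H h₃) × (v₄ ∈ edge H h₃)
    in₄ : (v₄ ∈ edge H h₄) × (v₁ ∈ edge H h₄)

BergeC4Free : ∀ {n} → Hypergraph n → Set
BergeC4Free H = ¬ BergeC4 H

weight : ∀ {n} → Hypergraph n → ℤ
weight H = foldr ℤ._+_ (+ 0) (map (λ h → + ∣ h ∣ ℤ.- + 3) H)

ℤ→ℚ : ℤ → ℚ
ℤ→ℚ z = z / 1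

ℕ→ℚ : ℕ → ℚ
ℕ→ℚ m = + m / 1

-- For c ≥ 0:  x ≤ c · √N   (written without square roots)
AtMostSqrt : ℚ → ℚ → ℚ → Set
AtMostSqrt x c N = (x ℚ.≤ ℚ.0ℚ) ⊎ (x ℚ.* x ℚ.≤ c ℚ.* c ℚ.* N)

-- For c ≥ 0:  x ≥ c · √N
AtLeastSqrt : ℚ → ℚ → ℚ → Set
AtLeastSqrt x c N = (ℚ.0ℚ ℚ.≤ x) × (c ℚ.* c ℚ.* N ℚ.≤ x ℚ.* x)

ε : ℕ → ℚ
ε k = + 1 / suc k

-- Upper bound. In every hyperedge h join the pairs of vertices at distance at most 8 in the order of h, except the bad
-- pairs, those lying in more than three hyperedges. A path of three bad pairs inside h would extend to a Berge cycle, so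
-- bad pairs form stars and triangles and at least 3 (|h| - 3) pairs of h are joined. Count cherries x e z f y, where z is
-- joined to x in e and to y in f ≠ e. Two cherries over the same x, y with distinct middles share a hyperedge; up to an
-- excess linear in the number M of joined ordered pairs, this leaves at most 3 · 3 cherries over each x, y. Then
-- Cauchy–Schwarz gives M² ≤ 9 n³ + O(n M), while 6 ∑ (|h| - 3) ≤ M.
--
-- Lower bound. In an affine plane of prime order q replace each point and each line by three vertices, and each incidence
-- by the union of its triples: 6 q² vertices and q³ hyperedges of size 6, without a Berge-C₄ as two points span one line.
-- For general n this needs primes q ~ √(n/6), that is, gaps of size o(q) between consecutive primes. If (x, (1 + δ) x]
-- carried too little mass of Λ, Selberg's symmetry formula would force density nearly 2 on (x/k, (1 + δ) x/k] for most k,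
-- and a chain of such intervals contradicts Chebyshev's bound. Everything is rational: log is replaced by a completely
-- additive function close to differences of harmonic numbers.
module Submission where

open import Defs
open import Data.Nat as ℕ using (ℕ; zero; suc; s≤s; z≤n; _^_; NonZero; _≥_)
import Data.Nat.Properties as ℕ using (*-assoc; *-cancelʳ-≡; *-cancelˡ-<; *-cancelˡ-≤; *-comm; *-distribʳ-+; *-distribˡ-+; *-identityʳ; *-identityˡ; *-mono-<; *-mono-≤; *-monoʳ-≤; *-monoˡ-<; *-monoˡ-≤; *-suc; *-zeroʳ; +-assoc; +-cancelˡ-≡; +-cancelˡ-≤; +-comm; +-identityʳ; +-mono-≤; +-monoʳ-<; +-monoʳ-≤; +-monoˡ-<; +-monoˡ-≤; +-suc; <-cmp; <-irrefl; <-trans; <-≤-trans; _<?_; <⇒≢; <⇒≤; <⇒≱; ^-distribˡ-+-*; ^-monoʳ-≤; anyUpTo?; m+[n∸m]≡n; m<m*n; m<n⇒m<1+n; m^n>0; m^n≢0; m∸n+n≡m; m≤m*n; m≤m+n; m≤n*m; m≤n+m; m≤n⇒m<n∨m≡n; m≤n⇒m≤1+n; n<1+n; n≤0⇒n≡0; n≤1+n; suc-injective; ∸-monoˡ-≤; _≟_; ≡ᵇ⇒≡; ≤-<-trans; ≤-antisym; ≤-refl; ≤-reflexive; ≤-total; ≤-trans; _≤?_; ≤∧≢⇒<; ≮⇒≥; ≰⇒>; ⊔-lub; ⊓-sel; m⊓n≤m; m⊓n≤n)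
open import Data.Integer as ℤ using (ℤ; -[1+_])
import Data.Integer.Properties as ℤ using (*-identityʳ; *-identityˡ; +-injective; abs-*; drop‿+≤+; i-j≡0⇒i≡j; i<j⇒suc[i]≤j; m-n≡m⊖n; pos-*; ∣i∣≡0⇒i≡0; ∣m⊝n∣≤m⊔n; ≰⇒>)
open import Data.Rational as ℚ using (ℚ; 1ℚ)
import Data.Rational.Properties as ℚ using (*-monoˡ-≤-nonNeg; *-zeroʳ; +-*-isCommutativeRing; +-mono-≤; <-irrefl; _≤?_; nonNegative⁻¹; normalize-nonNeg; toℚᵘ-cancel-≤; toℚᵘ-fromℚᵘ; toℚᵘ-homo-*; toℚᵘ-homo-+; toℚᵘ-injective; toℚᵘ-mono-≤; ≤-<-trans; ≤-antisym; ≤-refl; ≤-total; ≤-trans)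
import Data.Rational.Unnormalised as ℚᵘ using (mkℚᵘ; *≡*; *≤*; _+_; _*_; _≃_; 1ℚᵘ)
import Data.Rational.Unnormalised.Properties as ℚᵘ using (*-cong; +-cong; module ≃-Reasoning; ≃-sym; ≤-respʳ-≃; ≤-respˡ-≃)
open import Algebra.Bundles using (CommutativeRing)
open import Algebra.Structures using (IsCommutativeRing)
import Algebra.Properties.Ring as RingProperties
open import Data.Bool as Bool using (Bool; true; false; T; if_then_else_; _∧_; _∨_)
open import Data.List as List using (List; []; _∷_; _++_; map; foldr; concatMap; upTo)
open import Data.Maybe using (Maybe; just; nothing)
open import Data.Product using (_×_; _,_; proj₁; proj₂; ∃; Σ)
open import Data.Sum using (_⊎_; inj₁; inj₂; [_,_]′)
open import Data.Unit using (tt)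
open import Data.Empty using (⊥; ⊥-elim)
open import Relation.Nullary using (¬_; Dec; yes; no; does; _×-dec_; ¬?; _⊎-dec_)
open import Relation.Binary.PropositionalEquality using (_≡_; _≢_; refl; sym; trans; cong; cong₂; subst; subst₂; module ≡-Reasoning)
open import Function using (_∘_; id)
open import Data.Nat.Divisibility using (_∣_; divides; _∣?_; ∣⇒≤; ∣-trans; ∣-refl; ∣1⇒≡1; m∣m*n; n∣m*n; ∣n⇒∣m*n; *-monoʳ-∣; *-cancelˡ-∣; ∣m+n∣m⇒∣n; 1∣_)
open import Data.Nat.Primality using (Prime; prime?; euclidsLemma; prime⇒nonZero; prime⇒nonTrivial; prime⇒irreducible; prime[2])
open import Data.Nat.Primality.Factorisation using (factorise; PrimeFactorisation)
import Data.Nat.ListAction as ListAction using (product)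
open import Data.Nat.Induction using (<-rec)
open import Data.List.Relation.Unary.All as All using (All; []; _∷_)
open import Relation.Nullary.Decidable using (map′; dec-true; decidable-stable)
open import Relation.Binary.Definitions using (tri<; tri≈; tri>)
import Data.Nat.DivMod as ℕ using (+-distrib-/-∣ˡ; /-monoˡ-≤; _mod_; m%n<n; m*n/n≡m; m/n*n≤m; m<n⇒m/n≡0; m≡m%n+[m/n]*n)
import Data.Integer.Divisibility.Signed as ℤ∣ using (∣m∣n⇒∣m-n; ∣ᵤ⇒∣; ∣⇒∣ᵤ)
open import Data.Integer.Tactic.RingSolver using (solve-∀)
open import Data.Bool.Properties using (∨-zeroʳ)
open import Data.Fin using (Fin; zero; suc; toℕ; fromℕ<; cast; remQuot; combine)
import Data.Fin.Properties as Fin using (combine-remQuot; pigeonhole; toℕ-cast; toℕ-fromℕ<; toℕ-injective; toℕ<n)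
import Data.Fin as Fin using (_<_)
open import Data.Fin.Subset using (Subset; _∈_; ∣_∣)
open import Data.Vec as Vec using (Vec; []; _∷_)
import Data.Vec.Properties as Vec using ([]=⇒lookup; lookup⇒[]=; lookup∘tabulate)
import Data.List.Properties as List using (length-tabulate)
open import Data.List.Relation.Unary.Any using (here; there; any?)
import Data.List.Membership.Propositional as ∈ using (_∈_; _∉_)
open import Data.List.Relation.Unary.AllPairs using (AllPairs; []; _∷_)

-- The density of `Λ` is bootstrapped. Selberg's formula forces density nearly 2 on (x/n, x′/n] only
-- for most n in the sense of the weights `Λ n`, so finding such n near a given place already
-- presupposes positive density there. With Q = 3000 fixed, positive density on all intervals of
-- ratio 1 + Q/j yields it for ratio 1 + Q/(j + 1): consecutive multipliers n then differ by a
-- factor barely above x′/x, the gaps of the chain cost a factor of about 201/200, and a density of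
-- 39/20 survives against Chebyshev's 23/12. The start j = 200, of ratio 16, follows from central
-- binomial coefficients. All thresholds are uniform in the approximate logarithm, whose range X is
-- chosen only after the interval. In the upper bound, joining only positions at distance at most 8
-- keeps degrees at most 17, which makes every exceptional count linear in M; the distance 8
-- suffices because 9 positions less the vertex itself and on average two bad partners leave 6. A
-- pair in more than three hyperedges is called bad because three forbidden hyperedges can then
-- still be avoided when a cycle is built greedily.

infixl 6 _+_ _-_
infixl 7 _*_
infix  8 -_
infix  4 _≤_ _≤?_

-- The rationals as an abstract ordered field.

opaque
  F : Set
  F = ℚ

  0F 1F : F
  0F = ℚ.0ℚ
  1F = ℚ.1ℚ

  _+_ _*_ : F → F → F
  _+_ = ℚ._+_
  _*_ = ℚ._*_

  -_ : F → F
  -_ = ℚ.-_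

  _≤_ : F → F → Set
  _≤_ = ℚ._≤_

  inv : ℕ → F
  -- A default value, which keeps `0≤inv` free of side conditions.
  inv zero    = ℚ.0ℚ
  inv (suc n) = ℤ.+ 1 ℚ./ suc n

_-_ : F → F → F
a - b = a + - b

opaque
  unfolding F

  ≤-refl : ∀ {a} → a ≤ a
  ≤-refl = ℚ.≤-refl

  ≤-trans : ∀ {a b c} → a ≤ b → b ≤ c → a ≤ c
  ≤-trans = ℚ.≤-trans

  ≤-total : ∀ a b → a ≤ b ⊎ b ≤ a
  ≤-total = ℚ.≤-total

  _≤?_ : ∀ a b → Dec (a ≤ b)
  _≤?_ = ℚ._≤?_

  ≤-antisym : ∀ {a b} → a ≤ b → b ≤ a → a ≡ b
  ≤-antisym = ℚ.≤-antisym

  +-mono-≤ : ∀ {a b c d} → a ≤ b → c ≤ d → a + c ≤ b + d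
  +-mono-≤ = ℚ.+-mono-≤

  *-nonneg : ∀ {a b} → 0F ≤ a → 0F ≤ b → 0F ≤ a * b
  *-nonneg {a} {b} 0≤a 0≤b = subst (ℚ._≤ a ℚ.* b) (ℚ.*-zeroʳ a) (ℚ.*-monoˡ-≤-nonNeg a {{ℚ.nonNegative 0≤a}} 0≤b)

  ¬1≤0 : ¬ 1F ≤ 0F
  ¬1≤0 p = ℚ.<-irrefl refl (ℚ.≤-<-trans p (ℚ.*<* (ℤ.+<+ (ℕ.s≤s ℕ.z≤n))))

opaque
  unfolding F

  ζ : ℤ → F
  ζ z = z ℚ./ 1

  private
    via : ∀ {p q : ℚ.ℚ} → ℚ.toℚᵘ p ℚᵘ.≃ ℚ.toℚᵘ q → p ≡ q
    via = ℚ.toℚᵘ-injective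

    /1≃ : ∀ z → ℚ.toℚᵘ (z ℚ./ 1) ℚᵘ.≃ ℚᵘ.mkℚᵘ z 0
    /1≃ z = ℚ.toℚᵘ-fromℚᵘ (ℚᵘ.mkℚᵘ z 0)

  ζ-+ : ∀ a b → ζ (a ℤ.+ b) ≡ ζ a + ζ b
  ζ-+ a b = via (begin
    ℚ.toℚᵘ ((a ℤ.+ b) ℚ./ 1)                       ≈⟨ /1≃ (a ℤ.+ b) ⟩
    ℚᵘ.mkℚᵘ (a ℤ.+ b) 0                            ≈⟨ ℚᵘ.*≡* (cong (ℤ._* ℤ.+ 1) (sym (cong₂ ℤ._+_ (ℤ.*-identityʳ a) (ℤ.*-identityʳ b)))) ⟩
    ℚᵘ.mkℚᵘ a 0 ℚᵘ.+ ℚᵘ.mkℚᵘ b 0                   ≈⟨ ℚᵘ.+-cong (/1≃ a) (/1≃ b) ⟨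
    ℚ.toℚᵘ (a ℚ./ 1) ℚᵘ.+ ℚ.toℚᵘ (b ℚ./ 1)         ≈⟨ ℚ.toℚᵘ-homo-+ (a ℚ./ 1) (b ℚ./ 1) ⟨
    ℚ.toℚᵘ ((a ℚ./ 1) ℚ.+ (b ℚ./ 1))               ∎)
    where open ℚᵘ.≃-Reasoning

  ζ-* : ∀ a b → ζ (a ℤ.* b) ≡ ζ a * ζ b
  ζ-* a b = via (begin
    ℚ.toℚᵘ ((a ℤ.* b) ℚ./ 1)                       ≈⟨ /1≃ (a ℤ.* b) ⟩
    ℚᵘ.mkℚᵘ a 0 ℚᵘ.* ℚᵘ.mkℚᵘ b 0                   ≈⟨ ℚᵘ.*-cong (/1≃ a) (/1≃ b) ⟨
    ℚ.toℚᵘ (a ℚ./ 1) ℚᵘ.* ℚ.toℚᵘ (b ℚ./ 1)         ≈⟨ ℚ.toℚᵘ-homo-* (a ℚ./ 1) (b ℚ./ 1) ⟨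
    ℚ.toℚᵘ ((a ℚ./ 1) ℚ.* (b ℚ./ 1))               ∎)
    where open ℚᵘ.≃-Reasoning

  ζ-mono : ∀ {a b} → a ℤ.≤ b → ζ a ≤ ζ b
  ζ-mono {a} {b} p = ℚ.toℚᵘ-cancel-≤ (ℚᵘ.≤-respˡ-≃ (ℚᵘ.≃-sym (/1≃ a)) (ℚᵘ.≤-respʳ-≃ (ℚᵘ.≃-sym (/1≃ b))
    (ℚᵘ.*≤* (subst₂ ℤ._≤_ (sym (ℤ.*-identityʳ a)) (sym (ℤ.*-identityʳ b)) p))))

  ζ-cancel : ∀ {a b} → ζ a ≤ ζ b → a ℤ.≤ b
  ζ-cancel {a} {b} p with ℚᵘ.≤-respˡ-≃ (/1≃ a) (ℚᵘ.≤-respʳ-≃ (/1≃ b) (ℚ.toℚᵘ-mono-≤ p))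
  ... | ℚᵘ.*≤* q = subst₂ ℤ._≤_ (ℤ.*-identityʳ a) (ℤ.*-identityʳ b) q

  ζ0 : ζ (ℤ.+ 0) ≡ 0F
  ζ0 = refl

  ζ1 : ζ (ℤ.+ 1) ≡ 1F
  ζ1 = refl

  ι*inv : ∀ n → ζ (ℤ.+ suc n) * inv (suc n) ≡ 1F
  ι*inv n = via (begin
    ℚ.toℚᵘ ((ℤ.+ suc n ℚ./ 1) ℚ.* (ℤ.+ 1 ℚ./ suc n))            ≈⟨ ℚ.toℚᵘ-homo-* (ℤ.+ suc n ℚ./ 1) (ℤ.+ 1 ℚ./ suc n) ⟩
    ℚ.toℚᵘ (ℤ.+ suc n ℚ./ 1) ℚᵘ.* ℚ.toℚᵘ (ℤ.+ 1 ℚ./ suc n)      ≈⟨ ℚᵘ.*-cong (/1≃ (ℤ.+ suc n)) (ℚ.toℚᵘ-fromℚᵘ (ℚᵘ.mkℚᵘ (ℤ.+ 1) n)) ⟩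
    ℚᵘ.mkℚᵘ (ℤ.+ suc n) 0 ℚᵘ.* ℚᵘ.mkℚᵘ (ℤ.+ 1) n                ≈⟨ ℚᵘ.*≡* (trans (ℤ.*-identityʳ _) (trans (ℤ.*-identityʳ (ℤ.+ suc n)) (sym (trans (ℤ.*-identityˡ _) (cong (λ k → ℤ.+ k) (ℕ.*-identityˡ (suc n))))))) ⟩
    ℚᵘ.1ℚᵘ                                                  ∎)
    where open ℚᵘ.≃-Reasoning

  0≤inv : ∀ n → 0F ≤ inv n
  0≤inv zero    = ℚ.≤-refl
  0≤inv (suc n) = ℚ.nonNegative⁻¹ (ℤ.+ 1 ℚ./ suc n) {{ℚ.normalize-nonNeg 1 (suc n)}}

  isCommRing : IsCommutativeRing _≡_ _+_ _*_ -_ 0F 1F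
  isCommRing = ℚ.+-*-isCommutativeRing

commRing : CommutativeRing _ _
commRing = record { isCommutativeRing = isCommRing }

open CommutativeRing commRing public
  using (+-assoc; +-comm; +-identityˡ; +-identityʳ; *-assoc; *-comm; *-identityˡ; *-identityʳ; zeroˡ; zeroʳ; distribˡ; distribʳ; -‿inverseˡ; -‿inverseʳ; ring)
open RingProperties ring public
  using (-‿distribˡ-*; -‿distribʳ-*; -‿+-comm; -0#≈0#; -‿involutive; -1*x≈-x)

infix 9 #_
#_ : ℕ → F
# n = ζ (ℤ.+ n)

0≤# : ∀ n → 0F ≤ # n
0≤# n = subst (_≤ # n) ζ0 (ζ-mono (ℤ.+≤+ ℕ.z≤n))

opaque
  -- Opaque, unlike `#_`: linear arithmetic takes `ι n` as an unknown and `# n` as a literal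
  -- constant, and `ι-#` passes between the two.
  ι : ℕ → F
  ι n = ζ (ℤ.+ n)

  ι-# : ∀ n → ι n ≡ # n
  ι-# n = refl

  ι-+ : ∀ m n → ι (m ℕ.+ n) ≡ ι m + ι n
  ι-+ m n = ζ-+ (ℤ.+ m) (ℤ.+ n)

  ι-* : ∀ m n → ι (m ℕ.* n) ≡ ι m * ι n
  ι-* m n = trans (cong ζ (ℤ.pos-* m n)) (ζ-* (ℤ.+ m) (ℤ.+ n))

  ι-suc : ∀ n → ι (suc n) ≡ 1F + ι n
  ι-suc n = trans (ι-+ 1 n) (cong (_+ ι n) ζ1)

  ι-mono : ∀ {m n} → m ℕ.≤ n → ι m ≤ ι n
  ι-mono p = ζ-mono (ℤ.+≤+ p)

  ι-cancel : ∀ {m n} → ι m ≤ ι n → m ℕ.≤ n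
  ι-cancel p = ℤ.drop‿+≤+ (ζ-cancel p)

  0≤ι : ∀ n → 0F ≤ ι n
  0≤ι n = 0≤# n

  ι0 : ι 0 ≡ 0F
  ι0 = ζ0

-- Linear arithmetic with checked certificates.

module Linear where

  open ≡-Reasoning

  Mono : Set
  Mono = List ℕ

  Poly : Set
  Poly = List (ℤ × Mono)

  eqᵐ : Mono → Mono → Bool
  eqᵐ []      []      = true
  eqᵐ (i ∷ m) (j ∷ n) = (i ℕ.≡ᵇ j) ∧ eqᵐ m n
  eqᵐ _       _       = false

  ltᵐ : Mono → Mono → Bool
  ltᵐ []      []      = false
  ltᵐ []      (_ ∷ _) = true
  ltᵐ (_ ∷ _) []      = false
  ltᵐ (i ∷ m) (j ∷ n) = (i ℕ.<ᵇ j) ∨ ((i ℕ.≡ᵇ j) ∧ ltᵐ m n)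

  insᵐ : ℕ → Mono → Mono
  insᵐ i []      = i ∷ []
  insᵐ i (j ∷ m) = if i ℕ.≤ᵇ j then i ∷ j ∷ m else j ∷ insᵐ i m

  mulᵐ : Mono → Mono → Mono
  mulᵐ []      n = n
  mulᵐ (i ∷ m) n = insᵐ i (mulᵐ m n)

  -- Cancelled terms are dropped, so that a vanishing combination normalises to `[]`, the form
  -- tested by `certifies`.
  consᵖ : ℤ → Mono → Poly → Poly
  consᵖ (ℤ.+ 0) m p = p
  consᵖ c       m p = (c , m) ∷ p

  termᵖ : ℤ → Mono → Poly → Poly
  termᵖ c m []            = consᵖ c m []
  termᵖ c m ((d , n) ∷ p) =
    if eqᵐ m n then consᵖ (c ℤ.+ d) m p
    else if ltᵐ m n then (c , m) ∷ (d , n) ∷ p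
    else (d , n) ∷ termᵖ c m p

  addᵖ : Poly → Poly → Poly
  addᵖ []            q = q
  addᵖ ((c , m) ∷ p) q = termᵖ c m (addᵖ p q)

  scaleᵖ : ℤ → Mono → Poly → Poly
  scaleᵖ c m []            = []
  scaleᵖ c m ((d , n) ∷ q) = termᵖ (c ℤ.* d) (mulᵐ m n) (scaleᵖ c m q)

  mulᵖ : Poly → Poly → Poly
  mulᵖ []            q = []
  mulᵖ ((c , m) ∷ p) q = addᵖ (scaleᵖ c m q) (mulᵖ p q)

  look : List F → ℕ → F
  look []      _       = 0F
  look (a ∷ _) zero    = a
  look (_ ∷ ρ) (suc i) = look ρ i

  module _ (ρ : List F) where

    ⟦_⟧ᵐ : Mono → F
    ⟦ []    ⟧ᵐ = 1F
    ⟦ i ∷ m ⟧ᵐ = look ρ i * ⟦ m ⟧ᵐ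

    ⟦_⟧ : Poly → F
    ⟦ []          ⟧ = 0F
    ⟦ (c , m) ∷ p ⟧ = ζ c * ⟦ m ⟧ᵐ + ⟦ p ⟧

    left-swap : ∀ a b c → a * (b * c) ≡ b * (a * c)
    left-swap a b c = trans (sym (*-assoc a b c)) (trans (cong (_* c) (*-comm a b)) (*-assoc b a c))

    +-left-swap : ∀ a b c → a + (b + c) ≡ b + (a + c)
    +-left-swap a b c = trans (sym (+-assoc a b c)) (trans (cong (_+ c) (+-comm a b)) (+-assoc b a c))

    insᵐ-ok : ∀ i m → ⟦ insᵐ i m ⟧ᵐ ≡ look ρ i * ⟦ m ⟧ᵐ
    insᵐ-ok i []      = refl
    insᵐ-ok i (j ∷ m) with i ℕ.≤ᵇ j
    ... | true  = refl
    ... | false = trans (cong (look ρ j *_) (insᵐ-ok i m)) (left-swap (look ρ j) (look ρ i) ⟦ m ⟧ᵐ)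

    mulᵐ-ok : ∀ m n → ⟦ mulᵐ m n ⟧ᵐ ≡ ⟦ m ⟧ᵐ * ⟦ n ⟧ᵐ
    mulᵐ-ok []      n = sym (*-identityˡ _)
    mulᵐ-ok (i ∷ m) n = trans (insᵐ-ok i (mulᵐ m n)) (trans (cong (look ρ i *_) (mulᵐ-ok m n)) (sym (*-assoc _ _ _)))

    eqᵐ-ok : ∀ m n → T (eqᵐ m n) → m ≡ n
    eqᵐ-ok []      []      _ = refl
    eqᵐ-ok (i ∷ m) (j ∷ n) t with i ℕ.≡ᵇ j in e
    ... | true = cong₂ _∷_ (ℕ.≡ᵇ⇒≡ i j (subst T (sym e) tt)) (eqᵐ-ok m n t)

    consᵖ-ok : ∀ c m p → ⟦ consᵖ c m p ⟧ ≡ ζ c * ⟦ m ⟧ᵐ + ⟦ p ⟧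
    consᵖ-ok (ℤ.+ 0)     m p = sym (trans (cong (_+ ⟦ p ⟧) (trans (cong (_* ⟦ m ⟧ᵐ) ζ0) (zeroˡ _))) (+-identityˡ _))
    consᵖ-ok (ℤ.+ suc _) m p = refl
    consᵖ-ok -[1+ _ ]    m p = refl

    termᵖ-ok : ∀ c m p → ⟦ termᵖ c m p ⟧ ≡ ζ c * ⟦ m ⟧ᵐ + ⟦ p ⟧
    termᵖ-ok c m [] = consᵖ-ok c m []
    termᵖ-ok c m ((d , n) ∷ p) with eqᵐ m n in e
    ... | true rewrite sym (eqᵐ-ok m n (subst T (sym e) tt)) = begin
      ⟦ consᵖ (c ℤ.+ d) m p ⟧                    ≡⟨ consᵖ-ok (c ℤ.+ d) m p ⟩
      ζ (c ℤ.+ d) * ⟦ m ⟧ᵐ + ⟦ p ⟧               ≡⟨ cong (λ z → z * ⟦ m ⟧ᵐ + ⟦ p ⟧) (ζ-+ c d) ⟩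
      (ζ c + ζ d) * ⟦ m ⟧ᵐ + ⟦ p ⟧               ≡⟨ cong (_+ ⟦ p ⟧) (distribʳ _ _ _) ⟩
      (ζ c * ⟦ m ⟧ᵐ + ζ d * ⟦ m ⟧ᵐ) + ⟦ p ⟧      ≡⟨ +-assoc _ _ _ ⟩
      ζ c * ⟦ m ⟧ᵐ + (ζ d * ⟦ m ⟧ᵐ + ⟦ p ⟧)      ∎
    ... | false with ltᵐ m n
    ...   | true  = refl
    ...   | false = trans (cong (ζ d * ⟦ n ⟧ᵐ +_) (termᵖ-ok c m p)) (+-left-swap _ _ _)

    addᵖ-ok : ∀ p q → ⟦ addᵖ p q ⟧ ≡ ⟦ p ⟧ + ⟦ q ⟧
    addᵖ-ok []            q = sym (+-identityˡ _)
    addᵖ-ok ((c , m) ∷ p) q = trans (termᵖ-ok c m (addᵖ p q)) (trans (cong (ζ c * ⟦ m ⟧ᵐ +_) (addᵖ-ok p q)) (sym (+-assoc _ _ _)))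

    scaleᵖ-ok : ∀ c m q → ⟦ scaleᵖ c m q ⟧ ≡ (ζ c * ⟦ m ⟧ᵐ) * ⟦ q ⟧
    scaleᵖ-ok c m []            = sym (zeroʳ _)
    scaleᵖ-ok c m ((d , n) ∷ q) = begin
      ⟦ termᵖ (c ℤ.* d) (mulᵐ m n) (scaleᵖ c m q) ⟧                 ≡⟨ termᵖ-ok (c ℤ.* d) (mulᵐ m n) (scaleᵖ c m q) ⟩
      ζ (c ℤ.* d) * ⟦ mulᵐ m n ⟧ᵐ + ⟦ scaleᵖ c m q ⟧                ≡⟨ cong₂ _+_ (cong₂ _*_ (ζ-* c d) (mulᵐ-ok m n)) (scaleᵖ-ok c m q) ⟩
      (ζ c * ζ d) * (⟦ m ⟧ᵐ * ⟦ n ⟧ᵐ) + (ζ c * ⟦ m ⟧ᵐ) * ⟦ q ⟧      ≡⟨ cong (_+ (ζ c * ⟦ m ⟧ᵐ) * ⟦ q ⟧) (trans (*-assoc _ _ _) (trans (cong (ζ c *_) (left-swap _ _ _)) (sym (*-assoc _ _ _)))) ⟩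
      (ζ c * ⟦ m ⟧ᵐ) * (ζ d * ⟦ n ⟧ᵐ) + (ζ c * ⟦ m ⟧ᵐ) * ⟦ q ⟧      ≡⟨ distribˡ _ _ _ ⟨
      (ζ c * ⟦ m ⟧ᵐ) * (ζ d * ⟦ n ⟧ᵐ + ⟦ q ⟧)                       ∎

    mulᵖ-ok : ∀ p q → ⟦ mulᵖ p q ⟧ ≡ ⟦ p ⟧ * ⟦ q ⟧
    mulᵖ-ok []            q = sym (zeroˡ _)
    mulᵖ-ok ((c , m) ∷ p) q = begin
      ⟦ addᵖ (scaleᵖ c m q) (mulᵖ p q) ⟧           ≡⟨ addᵖ-ok (scaleᵖ c m q) (mulᵖ p q) ⟩
      ⟦ scaleᵖ c m q ⟧ + ⟦ mulᵖ p q ⟧              ≡⟨ cong₂ _+_ (scaleᵖ-ok c m q) (mulᵖ-ok p q) ⟩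
      (ζ c * ⟦ m ⟧ᵐ) * ⟦ q ⟧ + ⟦ p ⟧ * ⟦ q ⟧       ≡⟨ distribʳ _ _ _ ⟨
      (ζ c * ⟦ m ⟧ᵐ + ⟦ p ⟧) * ⟦ q ⟧               ∎

    conᵖ-ok : ∀ c → ⟦ consᵖ c [] [] ⟧ ≡ ζ c
    conᵖ-ok c = trans (consᵖ-ok c [] []) (trans (+-identityʳ _) (*-identityʳ _))

    record Reified (a : F) : Set where
      constructor reified
      field
        poly : Poly
        ok   : ⟦ poly ⟧ ≡ a

    open Reified

    constᴿ : ∀ c → Reified (ζ c)
    constᴿ c = reified (consᵖ c [] []) (conᵖ-ok c)

    varᴿ : ∀ i → Reified (look ρ i)
    varᴿ i = reified ((ℤ.+ 1 , i ∷ []) ∷ [])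
      (trans (+-identityʳ _) (trans (cong (_* (look ρ i * 1F)) ζ1) (trans (*-identityˡ _) (*-identityʳ _))))

    addᴿ : ∀ {a b} → Reified a → Reified b → Reified (a + b)
    addᴿ x y = reified (addᵖ (poly x) (poly y)) (trans (addᵖ-ok (poly x) (poly y)) (cong₂ _+_ (ok x) (ok y)))

    mulᴿ : ∀ {a b} → Reified a → Reified b → Reified (a * b)
    mulᴿ x y = reified (mulᵖ (poly x) (poly y)) (trans (mulᵖ-ok (poly x) (poly y)) (cong₂ _*_ (ok x) (ok y)))

    negᴿ : ∀ {a} → Reified a → Reified (- a)
    negᴿ {a} x = reified (scaleᵖ ℤ.-1ℤ [] (poly x))
      (trans (scaleᵖ-ok ℤ.-1ℤ [] (poly x)) (trans (cong₂ _*_ (trans (*-identityʳ _) ζ-1) (ok x)) (-1*x≈-x a)))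
      where
      ζ-1 : ζ ℤ.-1ℤ ≡ - 1F
      ζ-1 = begin
        ζ ℤ.-1ℤ                              ≡⟨ +-identityʳ _ ⟨
        ζ ℤ.-1ℤ + 0F                         ≡⟨ cong (ζ ℤ.-1ℤ +_) (-‿inverseʳ 1F) ⟨
        ζ ℤ.-1ℤ + (1F + - 1F)                ≡⟨ +-assoc _ _ _ ⟨
        (ζ ℤ.-1ℤ + 1F) + - 1F                ≡⟨ cong (λ z → (ζ ℤ.-1ℤ + z) + - 1F) ζ1 ⟨
        (ζ ℤ.-1ℤ + ζ (ℤ.+ 1)) + - 1F         ≡⟨ cong (_+ - 1F) (trans (sym (ζ-+ ℤ.-1ℤ (ℤ.+ 1))) ζ0) ⟩
        0F + - 1F                            ≡⟨ +-identityˡ _ ⟩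
        - 1F                                 ∎

  data Hyp (ρ : List F) : Set where
    nonneg : ∀ {a} → 0F ≤ a → Reified ρ a → Hyp ρ
    null   : ∀ {a} → a ≡ 0F → Reified ρ a → Hyp ρ

  hypᵖ : ∀ {ρ} → Hyp ρ → Poly
  hypᵖ (nonneg _ x) = Reified.poly x
  hypᵖ (null _ x)   = Reified.poly x

  isEq : ∀ {ρ} → Hyp ρ → Bool
  isEq (nonneg _ _) = false
  isEq (null _ _)   = true

  open Reified

  ≤⇒0≤ : ∀ {a b} → a ≤ b → 0F ≤ b - a
  ≤⇒0≤ {a} {b} p = subst (_≤ b - a) (-‿inverseʳ a) (+-mono-≤ p ≤-refl)

  0≤⇒≤ : ∀ {a b} → 0F ≤ b - a → a ≤ b
  0≤⇒≤ {a} {b} p = subst₂ _≤_ (+-identityˡ a) (trans (+-assoc b (- a) a) (trans (cong (b +_) (-‿inverseˡ a)) (+-identityʳ b))) (+-mono-≤ p ≤-refl)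

  -- A flag for equations, the coefficients of the monomials followed by the constant term, and the
  -- multipliers of the input rows that produced the row. The multipliers become the certificate.
  Row : Set
  Row = Bool × List ℤ × List ℤ

  resolve : ℤ → Row → ℤ → Row → List ℤ × List ℤ
  resolve x (_ , u , s) y (_ , v , t) = zip u v , zip s t
    where
    zip : List ℤ → List ℤ → List ℤ
    zip (a ∷ as) (b ∷ bs) = (x ℤ.* a ℤ.+ y ℤ.* b) ∷ zip as bs
    zip _        _        = []

  nth : ℕ → List ℤ → ℤ
  nth _       []      = ℤ.+ 0
  nth zero    (a ∷ _) = a
  nth (suc j) (_ ∷ u) = nth j u

  isZero : ℤ → Bool
  isZero (ℤ.+ 0) = true
  isZero _       = false

  -- The last coefficient is the constant term, which is never a pivot.
  leading : ℕ → List ℤ → Maybe ℕ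
  leading j []          = nothing
  leading j (_ ∷ [])    = nothing
  leading j (a ∷ u)     = if isZero a then leading (suc j) u else just j

  substitute : ℕ → Row → Row → Row
  substitute j p@(_ , u , _) r@(e , v , _) =
    -- The row `r` is scaled by an absolute value, so an inequality keeps its direction; the pivot
    -- is an equation and may be scaled by either sign.
    if isZero (nth j v) then r else e , resolve (ℤ.+ ℤ.∣ nth j u ∣) r (ℤ.- ((ℤ.sign (nth j u) ℤ.◃ 1) ℤ.* nth j v)) p

  nextEq : List Row → Maybe (ℕ × Row × List Row)
  nextEq [] = nothing
  nextEq (r@(e , u , _) ∷ rs) with (if e then leading 0 u else nothing) | nextEq rs
  ... | just j  | _                   = just (j , r , rs)
  ... | nothing | just (j , p , rs′)  = just (j , p , r ∷ rs′)
  ... | nothing | nothing             = nothing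

  solveEqs : ℕ → List Row → List Row
  solveEqs zero    rs = rs
  solveEqs (suc k) rs with nextEq rs
  ... | nothing            = rs
  ... | just (j , p , rs′) = solveEqs k (map (substitute j p) rs′)

  split : ℕ → List Row → List Row × List Row × List Row
  split j [] = [] , [] , []
  split j (r@(_ , u , _) ∷ rs) with nth j u | split j rs
  ... | ℤ.+ 0     | ps , ns , zs = ps , ns , r ∷ zs
  ... | ℤ.+ suc _ | ps , ns , zs = r ∷ ps , ns , zs
  ... | -[1+ _ ]  | ps , ns , zs = ps , r ∷ ns , zs

  cost : ℕ → List Row → ℕ × ℕ
  cost j [] = 0 , 0
  cost j ((_ , u , _) ∷ rs) with nth j u | cost j rs
  ... | ℤ.+ 0     | p , n = p , n
  ... | ℤ.+ suc _ | p , n = suc p , n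
  ... | -[1+ _ ]  | p , n = p , suc n

  best : List Row → List ℕ → ℕ × ℕ × List ℕ
  best rs []       = 0 , 0 , []
  best rs (j ∷ []) = 0 , j , []
  best rs (j ∷ js) with cost j rs | best rs js
  ... | p , n | c , i , is = if p ℕ.* n ℕ.≤ᵇ c then p ℕ.* n , j , js else c , i , j ∷ is

  eliminate : ℕ → List Row → List Row
  eliminate j rows with split j rows
  ... | ps , ns , zs = zs ++ concatMap (λ { p@(_ , u , _) → map (λ { n@(_ , v , _) → false , resolve (ℤ.- nth j v) p (nth j u) n }) ns }) ps

  iter : ℕ → List ℕ → List Row → List Row
  iter zero    js rs = rs
  iter (suc k) js rs with best rs js
  ... | _ , j , js′ = iter k js′ (eliminate j rs)

  -- Index `k` is the constant term. Three rows finish the search: a negative constant, an equation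
  -- with positive constant (after negation), or a zero constant with a positive multiplier on the
  -- first input row, which is the goal.
  pick : ℕ → List Row → List ℤ
  pick k [] = []
  pick k ((e , u , s) ∷ rs) with nth k u | e | s
  ... | -[1+ _ ]  | _     | _               = s
  ... | ℤ.+ suc _ | true  | _               = map ℤ.-_ s
  ... | ℤ.+ 0     | false | (ℤ.+ suc n) ∷ _ = s
  ... | _         | _     | _               = pick k rs

  coef : Mono → Poly → ℤ
  coef m []            = ℤ.+ 0
  coef m ((c , n) ∷ p) = if eqᵐ m n then c else coef m p

  addMono : Mono → List Mono → List Mono
  addMono []        ms = ms
  addMono m@(_ ∷ _) [] = m ∷ []
  addMono m@(_ ∷ _) (n ∷ ms) = if eqᵐ m n then n ∷ ms else n ∷ addMono m ms

  monos : List Poly → List Mono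
  monos = foldr (λ p ms → foldr (λ t → addMono (proj₂ t)) ms p) []

  units : ∀ {A : Set} → List A → List (List ℤ)
  units []       = []
  units (x ∷ xs) = ((ℤ.+ 1) ∷ map (λ _ → ℤ.+ 0) xs) ∷ map ((ℤ.+ 0) ∷_) (units xs)

  zipRows : List (Bool × Poly) → List (List ℤ) → List Mono → List Row
  zipRows ((e , p) ∷ ps) (s ∷ ss) ms = (e , (map (λ m → coef m p) ms ++ (coef [] p ∷ [])) , s) ∷ zipRows ps ss ms
  zipRows _ _ _ = []

  lengthᴸ : ∀ {A : Set} → List A → ℕ
  lengthᴸ []       = 0
  lengthᴸ (_ ∷ xs) = suc (lengthᴸ xs)

  -- Fourier–Motzkin elimination; its output is only trusted after the check below.
  search : List (Bool × Poly) → List ℤ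
  search ps = pick k (iter k (upTo k) (solveEqs (lengthᴸ ps) (zipRows ps (units ps) ms)))
    where
    ms = monos (map proj₂ ps)
    k  = lengthᴸ ms

  weighted : ∀ {ρ} → List ℤ → List (Hyp ρ) → Poly
  weighted (c ∷ cs) (h ∷ hs) = addᵖ (scaleᵖ c [] (hypᵖ h)) (weighted cs hs)
  weighted _        _        = []

  nonnegᵇ : ℤ → Bool
  nonnegᵇ (ℤ.+ _)  = true
  nonnegᵇ -[1+ _ ] = false

  signs : ∀ {ρ} → List ℤ → List (Hyp ρ) → Bool
  signs (c ∷ cs) (h ∷ hs) = (isEq h ∨ nonnegᵇ c) ∧ signs cs hs
  signs _        _        = true

  -- Here p = c g + w with w nonnegative and g the difference to be shown nonpositive. If p = 0 and
  -- c > 0 then g ≤ 0; if p is a negative constant then g < 0, or the hypotheses are contradictory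
  -- when c = 0.
  certifies : ℤ → Poly → Bool
  certifies (ℤ.+ suc _) []                        = true
  certifies (ℤ.+ _)     ((-[1+ _ ] , []) ∷ [])    = true
  certifies _           _                         = false

  check : ∀ {ρ} → Poly → List (Hyp ρ) → List ℤ → Bool
  check g hs []       = false
  check g hs (c ∷ cs) = signs cs hs ∧ certifies c (addᵖ (scaleᵖ c [] g) (weighted cs hs))

  decide : ∀ {ρ} → Poly → List (Hyp ρ) → Bool
  decide g hs = check g hs (search ((false , g) ∷ map (λ h → isEq h , hypᵖ h) hs))

  module _ {ρ : List F} where

    private
      scale-ok : ∀ c (p : Poly) → ⟦ ρ ⟧ (scaleᵖ c [] p) ≡ ζ c * ⟦ ρ ⟧ p
      scale-ok c p = trans (scaleᵖ-ok ρ c [] p) (cong (_* ⟦ ρ ⟧ p) (*-identityʳ _))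

      +-nonneg : ∀ {a b} → 0F ≤ a → 0F ≤ b → 0F ≤ a + b
      +-nonneg {a} {b} p q = subst (_≤ a + b) (+-identityʳ 0F) (+-mono-≤ p q)

      one : ∀ (h : Hyp ρ) c → isEq h ∨ nonnegᵇ c ≡ true → 0F ≤ ⟦ ρ ⟧ (scaleᵖ c [] (hypᵖ h))
      one (nonneg p x) (ℤ.+ n) e = subst (0F ≤_) (sym (trans (scale-ok (ℤ.+ n) (poly x)) (cong (ζ (ℤ.+ n) *_) (ok x)))) (*-nonneg (0≤# n) p)
      one (null p x) c e = subst (0F ≤_) (sym (trans (scale-ok c (poly x)) (trans (cong (ζ c *_) (trans (ok x) p)) (zeroʳ _)))) ≤-refl

      weighted-ok : ∀ cs (hs : List (Hyp ρ)) → T (signs cs hs) → 0F ≤ ⟦ ρ ⟧ (weighted cs hs)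
      weighted-ok []       hs       t = ≤-refl
      weighted-ok (c ∷ cs) []       t = ≤-refl
      weighted-ok (c ∷ cs) (h ∷ hs) t with isEq h ∨ nonnegᵇ c in e
      ... | true = subst (0F ≤_) (sym (addᵖ-ok ρ (scaleᵖ c [] (hypᵖ h)) (weighted cs hs))) (+-nonneg (one h c e) (weighted-ok cs hs t))

      #-cancel : ∀ n {y} → 0F ≤ # (suc n) * y → 0F ≤ y
      #-cancel n {y} p = subst (0F ≤_) eq (*-nonneg (0≤inv (suc n)) p)
        where
        eq : inv (suc n) * (# (suc n) * y) ≡ y
        eq = trans (sym (*-assoc _ _ _)) (trans (cong (_* y) (trans (*-comm _ _) (ι*inv n))) (*-identityˡ y))

      flip : ∀ {g w s} → g + w ≡ s → 0F ≤ w → s ≤ 0F → 0F ≤ - g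
      flip {g} {w} {s} e 0≤w s≤0 = subst (0F ≤_) eq (+-nonneg 0≤w (subst (_≤ - s) (-‿inverseʳ s) (subst (s + - s ≤_) (+-identityˡ (- s)) (+-mono-≤ s≤0 ≤-refl))))
        where
        eq : w + - s ≡ - g
        eq = begin
          w + - s               ≡⟨ cong (λ z → w + - z) e ⟨
          w + - (g + w)         ≡⟨ cong (w +_) (-‿+-comm g w) ⟨
          w + (- g + - w)       ≡⟨ +-comm _ _ ⟩
          (- g + - w) + w       ≡⟨ +-assoc _ _ _ ⟩
          - g + (- w + w)       ≡⟨ cong (- g +_) (-‿inverseˡ w) ⟩
          - g + 0F              ≡⟨ +-identityʳ _ ⟩
          - g                   ∎

      neg≤0 : ∀ k → ζ -[1+ k ] ≤ 0F
      neg≤0 k = subst (ζ -[1+ k ] ≤_) ζ0 (ζ-mono ℤ.-≤+)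

      certified : ∀ c (g : F) w (p : Poly) → ζ c * g + w ≡ ⟦ ρ ⟧ p → 0F ≤ w → T (certifies c p) → 0F ≤ - g
      certified (ℤ.+ suc n) g w []                       e 0≤w t = #-cancel n (subst (0F ≤_) (-‿distribʳ-* _ _) (flip e 0≤w ≤-refl))
      certified (ℤ.+ zero)  g w ((-[1+ k ] , []) ∷ [])   e 0≤w t with ζ-cancel (subst₂ _≤_ (sym ζ0) eq 0≤w)
        where
        eq : w ≡ ζ -[1+ k ]
        eq = trans (sym (trans (cong (_+ w) (trans (cong (_* g) ζ0) (zeroˡ g))) (+-identityˡ w))) (trans e (trans (+-identityʳ _) (*-identityʳ _)))
      ... | ()
      certified (ℤ.+ suc n) g w ((-[1+ k ] , []) ∷ [])   e 0≤w t =
        #-cancel n (subst (0F ≤_) (-‿distribʳ-* _ _) (flip (trans e (trans (+-identityʳ _) (*-identityʳ _))) 0≤w (neg≤0 k)))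
      certified (ℤ.+ zero)  g w [] e 0≤w ()
      certified (ℤ.+ zero)  g w ((ℤ.+ _ , _) ∷ _) e 0≤w ()
      certified (ℤ.+ suc n) g w ((ℤ.+ _ , _) ∷ _) e 0≤w ()
      certified -[1+ _ ]    g w _ e 0≤w ()

      ∧-T : ∀ {a b} → T (a ∧ b) → T a × T b
      ∧-T {true} t = tt , t

      check-ok : ∀ {g} (x : Reified ρ g) (hs : List (Hyp ρ)) cs → T (check (poly x) hs cs) → 0F ≤ - g
      check-ok {g} x hs (c ∷ cs) t with ∧-T {signs cs hs} t
      ... | t₁ , t₂ = certified c g (⟦ ρ ⟧ (weighted cs hs)) (addᵖ (scaleᵖ c [] (poly x)) (weighted cs hs))
        (sym (trans (addᵖ-ok ρ (scaleᵖ c [] (poly x)) (weighted cs hs)) (cong (_+ ⟦ ρ ⟧ (weighted cs hs)) (trans (scale-ok c (poly x)) (cong (ζ c *_) (ok x))))))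
        (weighted-ok cs hs t₁) t₂

    diffᴿ : ∀ {a b} → Reified ρ a → Reified ρ b → Reified ρ (a - b)
    diffᴿ x y = addᴿ ρ x (negᴿ ρ y)

    decide-ok : ∀ {a b} (x : Reified ρ a) (y : Reified ρ b) (hs : List (Hyp ρ)) → T (decide (poly (diffᴿ x y)) hs) → a ≤ b
    decide-ok {a} {b} x y hs t = 0≤⇒≤ (subst (0F ≤_) eq (check-ok (diffᴿ x y) hs (search ((false , poly (diffᴿ x y)) ∷ map (λ h → isEq h , hypᵖ h) hs)) t))
      where
      eq : - (a - b) ≡ b - a
      eq = trans (sym (-‿+-comm a (- b))) (trans (+-comm _ _) (cong (_+ - a) (-‿involutive b)))

  record IsHyp (ρ : List F) (A : Set) : Set where
    field hyp : A → Hyp ρ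

  record IsGoal (ρ : List F) (A : Set) : Set where
    field
      provable : List (Hyp ρ) → Bool
      proof    : ∀ hs → T (provable hs) → A

  open IsHyp
  open IsGoal

  instance
    reify-+ : ∀ {ρ a b} → ⦃ Reified ρ a ⦄ → ⦃ Reified ρ b ⦄ → Reified ρ (a + b)
    reify-+ {ρ} ⦃ x ⦄ ⦃ y ⦄ = addᴿ ρ x y

    reify-* : ∀ {ρ a b} → ⦃ Reified ρ a ⦄ → ⦃ Reified ρ b ⦄ → Reified ρ (a * b)
    reify-* {ρ} ⦃ x ⦄ ⦃ y ⦄ = mulᴿ ρ x y

    reify-neg : ∀ {ρ a} → ⦃ Reified ρ a ⦄ → Reified ρ (- a)
    reify-neg {ρ} ⦃ x ⦄ = negᴿ ρ x

    reify-ζ : ∀ {ρ c} → Reified ρ (ζ c)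
    reify-ζ {ρ} {c} = constᴿ ρ c

    reify-0 : ∀ {ρ} → Reified ρ 0F
    reify-0 = reified [] refl

    reify-1 : ∀ {ρ} → Reified ρ 1F
    reify-1 {ρ} = reified (consᵖ (ℤ.+ 1) [] []) (trans (conᵖ-ok ρ (ℤ.+ 1)) ζ1)

    hyp-≤ : ∀ {ρ a b} → ⦃ Reified ρ a ⦄ → ⦃ Reified ρ b ⦄ → IsHyp ρ (a ≤ b)
    hyp-≤ ⦃ x ⦄ ⦃ y ⦄ .hyp p = nonneg (≤⇒0≤ p) (diffᴿ y x)

    hyp-≡ : ∀ {ρ a b} → ⦃ Reified ρ a ⦄ → ⦃ Reified ρ b ⦄ → IsHyp ρ (a ≡ b)
    hyp-≡ {b = b} ⦃ x ⦄ ⦃ y ⦄ .hyp p = null (trans (cong (_- b) p) (-‿inverseʳ b)) (diffᴿ x y)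

    goal-≤ : ∀ {ρ a b} → ⦃ Reified ρ a ⦄ → ⦃ Reified ρ b ⦄ → IsGoal ρ (a ≤ b)
    goal-≤ ⦃ x ⦄ ⦃ y ⦄ .provable hs = decide (poly (diffᴿ x y)) hs
    goal-≤ ⦃ x ⦄ ⦃ y ⦄ .proof hs t  = decide-ok x y hs t

    goal-≡ : ∀ {ρ a b} → ⦃ Reified ρ a ⦄ → ⦃ Reified ρ b ⦄ → IsGoal ρ (a ≡ b)
    goal-≡ ⦃ x ⦄ ⦃ y ⦄ .provable hs = decide (poly (diffᴿ x y)) hs ∧ decide (poly (diffᴿ y x)) hs
    goal-≡ ⦃ x ⦄ ⦃ y ⦄ .proof hs t with decide (poly (diffᴿ x y)) hs in e
    ... | true = ≤-antisym (decide-ok x y hs (subst T (sym e) tt)) (decide-ok y x hs t)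

    goal-⊥ : ∀ {ρ} → IsGoal ρ ⊥
    goal-⊥ {ρ} .provable hs = decide (poly (diffᴿ (reify-1 {ρ}) reify-0)) hs
    goal-⊥     .proof hs t  = ¬1≤0 (decide-ok reify-1 reify-0 hs t)

  infixr 5 _&_
  _&_ : ∀ {ρ A} → A → ⦃ IsHyp ρ A ⦄ → List (Hyp ρ) → List (Hyp ρ)
  _&_ p ⦃ h ⦄ hs = hyp h p ∷ hs

  -- One instance argument per atom: instance search stops at the listed terms and takes every other
  -- term apart.
  Atoms : List F → List F → Set → Set
  Atoms ρ []       X = X
  Atoms ρ (a ∷ as) X = ⦃ Reified ρ a ⦄ → Atoms ρ as X

  supply : ∀ ρ as {X} (s : ℕ → ℕ) → (∀ i → look ρ (s i) ≡ look as i) → Atoms ρ as X → X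
  supply ρ []       s e x = x
  supply ρ (a ∷ as) s e f = supply ρ as (s ∘ suc) (e ∘ suc) (f ⦃ reified ((ℤ.+ 1 , s 0 ∷ []) ∷ []) (trans (ok (varᴿ ρ (s 0))) (e 0)) ⦄)

  record Problem (ρ : List F) (A : Set) : Set where
    constructor problem
    field
      goal : IsGoal ρ A
      hyps : List (Hyp ρ)

  from : ∀ {ρ A} → ⦃ IsGoal ρ A ⦄ → List (Hyp ρ) → Problem ρ A
  from ⦃ g ⦄ hs = problem g hs

  -- Proves a linear consequence of the hypotheses, treating all monomials in the listed terms as unknowns.
  lin : ∀ as {A} (P : ∀ {ρ} → Atoms ρ as (Problem ρ A)) →
        let open Problem (supply as as id (λ _ → refl) (P {as})) in
        {_ : T (provable goal hyps)} → A
  lin as P {t} = proof goal hyps t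
    where open Problem (supply as as id (λ _ → refl) (P {as}))

open Linear public using
  ( Reified; IsHyp; IsGoal; Problem; reify-+; reify-*; reify-neg; reify-ζ; reify-0; reify-1; hyp-≤; hyp-≡; goal-≤; goal-≡; goal-⊥
  ; _&_; from; lin; ≤⇒0≤; 0≤⇒≤)

-- Inequalities, indicators and finite sums.

≤-reflexive : ∀ {a b} → a ≡ b → a ≤ b
≤-reflexive refl = ≤-refl

+-nonneg : ∀ {a b} → 0F ≤ a → 0F ≤ b → 0F ≤ a + b
+-nonneg {a} {b} p q = subst (_≤ a + b) (+-identityʳ 0F) (+-mono-≤ p q)

*-monoˡ : ∀ {a b c} → 0F ≤ a → b ≤ c → a * b ≤ a * c
*-monoˡ {a} {b} {c} p q = lin (a ∷ b ∷ c ∷ []) (from (*-nonneg p (≤⇒0≤ q) & []))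

*-mono : ∀ {a b c d} → 0F ≤ a → 0F ≤ d → a ≤ b → c ≤ d → a * c ≤ b * d
*-mono {a} {b} {c} {d} p q r s = lin (a ∷ b ∷ c ∷ d ∷ []) (from (*-monoˡ p s & *-nonneg (≤⇒0≤ r) q & []))

*-cancel : ∀ {a b c} → # 1 ≤ a → a * b ≤ a * c → b ≤ c
*-cancel {a} {b} {c} p q with ≤-total b c
... | inj₁ r = r
... | inj₂ r = lin (a ∷ b ∷ c ∷ []) (from (*-nonneg (≤⇒0≤ r) (≤⇒0≤ p) & q & []))

0≤1 : 0F ≤ 1F
0≤1 = lin [] (from [])

1≤ι : ∀ {n} → 1 ℕ.≤ n → # 1 ≤ ι n
1≤ι {n} p = subst (_≤ ι n) (ι-# 1) (ι-mono p)

square-nonneg : ∀ a → 0F ≤ a * a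
square-nonneg a with ≤-total 0F a
... | inj₁ p = *-nonneg p p
... | inj₂ p = lin (a ∷ []) (from (*-nonneg {0F - a} {0F - a} (≤⇒0≤ p) (≤⇒0≤ p) & []))

𝟙 : ∀ {P : Set} → Dec P → F
𝟙 (yes _) = 1F
𝟙 (no _)  = 0F

𝟙-yes : ∀ {P : Set} (d : Dec P) → P → 𝟙 d ≡ 1F
𝟙-yes (yes _) p = refl
𝟙-yes (no ¬p) p = ⊥-elim (¬p p)

𝟙-no : ∀ {P : Set} (d : Dec P) → ¬ P → 𝟙 d ≡ 0F
𝟙-no (yes p) ¬p = ⊥-elim (¬p p)
𝟙-no (no _)  ¬p = refl

𝟙-cong : ∀ {P Q : Set} (d : Dec P) (e : Dec Q) → (P → Q) → (Q → P) → 𝟙 d ≡ 𝟙 e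
𝟙-cong (yes p) e f g = sym (𝟙-yes e (f p))
𝟙-cong (no ¬p) e f g = sym (𝟙-no e (¬p ∘ g))

𝟙-nonneg : ∀ {P : Set} (d : Dec P) → 0F ≤ 𝟙 d
𝟙-nonneg (yes _) = 0≤1
𝟙-nonneg (no _)  = ≤-refl

𝟙-mono : ∀ {P Q : Set} (d : Dec P) (e : Dec Q) → (P → Q) → 𝟙 d ≤ 𝟙 e
𝟙-mono (yes p) e f = ≤-reflexive (sym (𝟙-yes e (f p)))
𝟙-mono (no ¬p) e f = 𝟙-nonneg e

𝟙≤1 : ∀ {P : Set} (d : Dec P) → 𝟙 d ≤ 1F
𝟙≤1 (yes _) = ≤-refl
𝟙≤1 (no _)  = 0≤1

∑ : ℕ → (ℕ → F) → F
∑ zero    f = 0F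
∑ (suc n) f = ∑ n f + f n

∑-cong : ∀ n {f g} → (∀ i → i ℕ.< n → f i ≡ g i) → ∑ n f ≡ ∑ n g
∑-cong zero    e = refl
∑-cong (suc n) e = cong₂ _+_ (∑-cong n λ i p → e i (ℕ.m<n⇒m<1+n p)) (e n ℕ.≤-refl)

∑-ext : ∀ n {f g} → (∀ i → f i ≡ g i) → ∑ n f ≡ ∑ n g
∑-ext n e = ∑-cong n λ i _ → e i

∑-mono : ∀ n {f g} → (∀ i → i ℕ.< n → f i ≤ g i) → ∑ n f ≤ ∑ n g
∑-mono zero    e = ≤-refl
∑-mono (suc n) e = +-mono-≤ (∑-mono n λ i p → e i (ℕ.m<n⇒m<1+n p)) (e n ℕ.≤-refl)

∑-zero : ∀ n {f} → (∀ i → i ℕ.< n → f i ≡ 0F) → ∑ n f ≡ 0F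
∑-zero zero    e = refl
∑-zero (suc n) e = trans (cong₂ _+_ (∑-zero n λ i p → e i (ℕ.m<n⇒m<1+n p)) (e n ℕ.≤-refl)) (+-identityʳ 0F)

∑-nonneg : ∀ n {f} → (∀ i → i ℕ.< n → 0F ≤ f i) → 0F ≤ ∑ n f
∑-nonneg n {f} p = subst (_≤ ∑ n f) (∑-zero n λ _ _ → refl) (∑-mono n p)

∑-+ : ∀ n f g → ∑ n (λ i → f i + g i) ≡ ∑ n f + ∑ n g
∑-+ zero    f g = sym (+-identityʳ 0F)
∑-+ (suc n) f g = lin (∑ n (λ i → f i + g i) ∷ ∑ n f ∷ ∑ n g ∷ f n ∷ g n ∷ []) (from (∑-+ n f g & []))

∑-* : ∀ n c f → ∑ n (λ i → c * f i) ≡ c * ∑ n f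
∑-* zero    c f = sym (zeroʳ c)
∑-* (suc n) c f = trans (cong (_+ c * f n) (∑-* n c f)) (sym (distribˡ c (∑ n f) (f n)))

∑-*ʳ : ∀ n c f → ∑ n (λ i → f i * c) ≡ ∑ n f * c
∑-*ʳ n c f = trans (∑-ext n λ i → *-comm (f i) c) (trans (∑-* n c f) (*-comm c _))

∑-- : ∀ n f g → ∑ n (λ i → f i - g i) ≡ ∑ n f - ∑ n g
∑-- zero    f g = lin [] (from [])
∑-- (suc n) f g = lin (∑ n (λ i → f i - g i) ∷ ∑ n f ∷ ∑ n g ∷ f n ∷ g n ∷ []) (from (∑-- n f g & []))

∑-const : ∀ n c → ∑ n (λ _ → c) ≡ ι n * c
∑-const zero    c = lin (ι 0 ∷ c ∷ []) (from (cong (_* c) ι0 & []))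
∑-const (suc n) c = lin (ι (suc n) ∷ ι n ∷ c ∷ ∑ n (λ _ → c) ∷ []) (from (∑-const n c & cong (_* c) (ι-suc n) & []))

∑-swap : ∀ n m (f : ℕ → ℕ → F) → ∑ n (λ i → ∑ m (f i)) ≡ ∑ m (λ j → ∑ n (λ i → f i j))
∑-swap zero    m f = sym (∑-zero m λ _ _ → refl)
∑-swap (suc n) m f = trans (cong (_+ ∑ m (f n)) (∑-swap n m f)) (sym (∑-+ m (λ j → ∑ n (λ i → f i j)) (f n)))

∑-split : ∀ m n f → ∑ (m ℕ.+ n) f ≡ ∑ m f + ∑ n (λ i → f (m ℕ.+ i))
∑-split m zero    f = trans (cong (λ k → ∑ k f) (ℕ.+-identityʳ m)) (sym (+-identityʳ _))
∑-split m (suc n) f = trans (cong (λ k → ∑ k f) (ℕ.+-suc m n)) (trans (cong (_+ f (m ℕ.+ n)) (∑-split m n f)) (+-assoc _ _ _))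

∑-head : ∀ n f → ∑ (suc n) f ≡ f 0 + ∑ n (f ∘ suc)
∑-head n f = trans (∑-split 1 n f) (cong (_+ ∑ n (f ∘ suc)) (+-identityˡ (f 0)))

∑-extend : ∀ {m n} f → m ℕ.≤ n → (∀ i → m ℕ.≤ i → i ℕ.< n → f i ≡ 0F) → ∑ n f ≡ ∑ m f
∑-extend {m} {n} f p z = begin
  ∑ n f                                               ≡⟨ cong (λ k → ∑ k f) (ℕ.m+[n∸m]≡n p) ⟨
  ∑ (m ℕ.+ (n ℕ.∸ m)) f                               ≡⟨ ∑-split m (n ℕ.∸ m) f ⟩
  ∑ m f + ∑ (n ℕ.∸ m) (λ i → f (m ℕ.+ i))             ≡⟨ cong (∑ m f +_) (∑-zero (n ℕ.∸ m) λ i q → z (m ℕ.+ i) (ℕ.m≤m+n m i)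
                                                          (subst (m ℕ.+ i ℕ.<_) (ℕ.m+[n∸m]≡n p) (ℕ.+-monoʳ-< m q))) ⟩
  ∑ m f + 0F                                          ≡⟨ +-identityʳ _ ⟩
  ∑ m f                                               ∎
  where open ≡-Reasoning

∑-monoˡ : ∀ {m n} f → m ℕ.≤ n → (∀ i → 0F ≤ f i) → ∑ m f ≤ ∑ n f
∑-monoˡ {m} {n} f p z = subst (∑ m f ≤_) (trans (sym (∑-split m (n ℕ.∸ m) f)) (cong (λ k → ∑ k f) (ℕ.m+[n∸m]≡n p)))
  (lin (∑ m f ∷ ∑ (n ℕ.∸ m) (λ i → f (m ℕ.+ i)) ∷ []) (from (∑-nonneg (n ℕ.∸ m) {λ i → f (m ℕ.+ i)} (λ i _ → z (m ℕ.+ i)) & [])))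

∑-single : ∀ {n k} f → k ℕ.< n → (∀ i → i ℕ.< n → i ≢ k → f i ≡ 0F) → ∑ n f ≡ f k
∑-single {suc n} {k} f p z with k ℕ.≟ n
... | yes refl = trans (cong (_+ f n) (∑-zero n λ i q → z i (ℕ.m<n⇒m<1+n q) (ℕ.<⇒≢ q))) (+-identityˡ (f n))
... | no k≢n   = trans (cong₂ _+_ (∑-single f (ℕ.≤∧≢⇒< (ℕ.s≤s⁻¹ p) k≢n) λ i q → z i (ℕ.m<n⇒m<1+n q)) (z n ℕ.≤-refl (k≢n ∘ sym))) (+-identityʳ (f k))

∑-term : ∀ {n k} f → k ℕ.< n → (∀ i → i ℕ.< n → 0F ≤ f i) → f k ≤ ∑ n f
∑-term {suc n} {k} f p z with k ℕ.≟ n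
... | yes refl = lin (∑ n f ∷ f n ∷ []) (from (∑-nonneg n (λ i q → z i (ℕ.m<n⇒m<1+n q)) & []))
... | no k≢n   = lin (∑ n f ∷ f n ∷ f k ∷ []) (from (∑-term f (ℕ.≤∧≢⇒< (ℕ.s≤s⁻¹ p) k≢n) (λ i q → z i (ℕ.m<n⇒m<1+n q)) & z n ℕ.≤-refl & []))

∑-telescope : ∀ n (f : ℕ → F) → ∑ n (λ i → f (suc i) - f i) ≡ f n - f 0
∑-telescope zero    f = lin (f 0 ∷ []) (from [])
∑-telescope (suc n) f = lin (∑ n (λ i → f (suc i) - f i) ∷ f n ∷ f (suc n) ∷ f 0 ∷ []) (from (∑-telescope n f & []))

∑₁ : ℕ → (ℕ → F) → F
∑₁ n f = ∑ n (λ i → f (suc i))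

≢0 : ∀ {n} → 1 ℕ.≤ n → NonZero n
≢0 {suc n} _ = _

-- The range is cut into blocks of length `suc k`, each of which contains exactly one multiple, at
-- its end. The vanishing of `G` beyond `x` lets both sums run to the same bound.
∑-multiples : ∀ {x} k G → (∀ d → x ℕ.< d → G d ≡ 0F) →
              ∑₁ x (λ d → 𝟙 (suc k ∣? d) * G d) ≡ ∑₁ x (λ e → G (suc k ℕ.* e))
∑-multiples {x} k G z = trans (sym (∑-extend _ (ℕ.m≤n*m x (suc k)) λ i p _ → trans (cong (𝟙 (suc k ∣? suc i) *_) (z (suc i) (s≤s p))) (zeroʳ _))) (blocks x)
  where
  blocks : ∀ x → ∑₁ (suc k ℕ.* x) (λ d → 𝟙 (suc k ∣? d) * G d) ≡ ∑₁ x (λ e → G (suc k ℕ.* e))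
  blocks zero = cong (λ n → ∑₁ n (λ d → 𝟙 (suc k ∣? d) * G d)) (ℕ.*-zeroʳ k)
  blocks (suc x) = begin
    ∑ (suc k ℕ.* suc x) f                                                  ≡⟨ cong (λ n → ∑ n f) (trans (ℕ.*-suc (suc k) x) (ℕ.+-comm (suc k) (suc k ℕ.* x))) ⟩
    ∑ (suc k ℕ.* x ℕ.+ suc k) f                                            ≡⟨ ∑-split (suc k ℕ.* x) (suc k) f ⟩
    ∑ (suc k ℕ.* x) f + ∑ (suc k) (λ i → f (suc k ℕ.* x ℕ.+ i))            ≡⟨ cong₂ _+_ (blocks x) last ⟩
    ∑₁ x (λ e → G (suc k ℕ.* e)) + G (suc k ℕ.* suc x)                     ∎
    where
    open ≡-Reasoning
    f : ℕ → F
    f i = 𝟙 (suc k ∣? suc i) * G (suc i)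
    end : suc (suc k ℕ.* x ℕ.+ k) ≡ suc k ℕ.* suc x
    end = trans (sym (ℕ.+-suc (suc k ℕ.* x) k)) (trans (ℕ.+-comm (suc k ℕ.* x) (suc k)) (sym (ℕ.*-suc (suc k) x)))
    last : ∑ (suc k) (λ i → f (suc k ℕ.* x ℕ.+ i)) ≡ G (suc k ℕ.* suc x)
    last = trans (∑-single (λ i → f (suc k ℕ.* x ℕ.+ i)) ℕ.≤-refl λ i p i≢k →
             trans (cong (_* G (suc (suc k ℕ.* x ℕ.+ i))) (𝟙-no (suc k ∣? _) λ q →
               ℕ.<⇒≱ (s≤s (ℕ.≤∧≢⇒< (ℕ.s≤s⁻¹ p) i≢k)) (∣⇒≤ (∣m+n∣m⇒∣n (subst (suc k ∣_) (sym (ℕ.+-suc (suc k ℕ.* x) i)) q) (m∣m*n x))))) (zeroˡ _))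
           (trans (cong₂ _*_ (𝟙-yes (suc k ∣? _) (subst (suc k ∣_) (sym end) (m∣m*n (suc x)))) (cong G end)) (*-identityˡ _))

-- Substitute n = k m and collect the divisors k of n; products beyond `x` contribute nothing.
∑-dirichlet : ∀ {x} (a f : ℕ → F) → (∀ d → x ℕ.< d → f d ≡ 0F) →
              ∑₁ x (λ m → ∑₁ x (λ k → a k * f (k ℕ.* m))) ≡ ∑₁ x (λ n → ∑₁ x (λ k → 𝟙 (k ∣? n) * a k) * f n)
∑-dirichlet {x} a f z = begin
  ∑₁ x (λ m → ∑₁ x (λ k → a k * f (k ℕ.* m)))               ≡⟨ ∑-swap x x (λ m k → a (suc k) * f (suc k ℕ.* suc m)) ⟩
  ∑₁ x (λ k → ∑₁ x (λ m → a k * f (k ℕ.* m)))               ≡⟨ ∑-ext x (λ k → ∑-* x (a (suc k)) (λ m → f (suc k ℕ.* suc m))) ⟩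
  ∑₁ x (λ k → a k * ∑₁ x (λ m → f (k ℕ.* m)))               ≡⟨ ∑-ext x (λ k → cong (a (suc k) *_) (sym (∑-multiples k f z))) ⟩
  ∑₁ x (λ k → a k * ∑₁ x (λ n → 𝟙 (k ∣? n) * f n))          ≡⟨ ∑-ext x (λ k → sym (∑-* x (a (suc k)) (λ n → 𝟙 (suc k ∣? suc n) * f (suc n)))) ⟩
  ∑₁ x (λ k → ∑₁ x (λ n → a k * (𝟙 (k ∣? n) * f n)))        ≡⟨ ∑-swap x x (λ k n → a (suc k) * (𝟙 (suc k ∣? suc n) * f (suc n))) ⟩
  ∑₁ x (λ n → ∑₁ x (λ k → a k * (𝟙 (k ∣? n) * f n)))        ≡⟨ ∑-ext x (λ n → trans (∑-ext x λ k → trans (sym (*-assoc _ _ _)) (cong (_* f (suc n)) (*-comm _ _))) (∑-*ʳ x (f (suc n)) (λ k → 𝟙 (suc k ∣? suc n) * a (suc k)))) ⟩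
  ∑₁ x (λ n → ∑₁ x (λ k → 𝟙 (k ∣? n) * a k) * f n)          ∎
  where open ≡-Reasoning

-- Prime powers and completely additive functions.

1<prime : ∀ {p} → Prime p → 1 ℕ.< p
1<prime {p} pr = ℕ.nonTrivial⇒n>1 p {{prime⇒nonTrivial pr}}

prime-∣-prime : ∀ {p q} → Prime p → Prime q → p ∣ q → p ≡ q
prime-∣-prime pp pq d with prime⇒irreducible pq d
... | inj₁ refl = ⊥-elim (ℕ.<-irrefl refl (1<prime pp))
... | inj₂ e    = e

prime-∣-^ : ∀ {p m} k → Prime p → p ∣ m ^ k → p ∣ m
prime-∣-^ zero    pp d = ⊥-elim (ℕ.<-irrefl (sym (∣1⇒≡1 d)) (1<prime pp))
prime-∣-^ {m = m} (suc k) pp d with euclidsLemma m (m ^ k) pp d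
... | inj₁ e = e
... | inj₂ e = prime-∣-^ k pp e

prime-^-∣-* : ∀ {p q m} k → Prime p → Prime q → q ≢ p → q ^ k ∣ p ℕ.* m → q ^ k ∣ m
prime-^-∣-* zero pp pq ne d = 1∣ _
prime-^-∣-* {p} {q} {m} (suc k) pp pq ne (divides e eq) with euclidsLemma p m pq (divides (e ℕ.* q ^ k) (trans eq (trans (cong (e ℕ.*_) (ℕ.*-comm q (q ^ k))) (sym (ℕ.*-assoc e _ q)))))
... | inj₁ d = ⊥-elim (ne (prime-∣-prime pq pp d))
... | inj₂ (divides m′ refl) = subst (q ^ suc k ∣_) (ℕ.*-comm q m′) (*-monoʳ-∣ q (prime-^-∣-* {p} {q} {m′} k pp pq ne
      (*-cancelˡ-∣ q {{prime⇒nonZero pq}} (divides e (trans (trans (cong (q ℕ.*_) (ℕ.*-comm p m′)) (trans (sym (ℕ.*-assoc q m′ p)) (trans (cong (ℕ._* p) (ℕ.*-comm q m′)) (ℕ.*-comm (m′ ℕ.* q) p)))) eq)))))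

exponent : ∀ p → Prime p → ∀ m → 1 ℕ.≤ m → ∃ λ v → ∃ λ r → m ≡ p ^ v ℕ.* r × ¬ p ∣ r
exponent p pp = <-rec _ step
  where
  step : ∀ m → (∀ {m′} → m′ ℕ.< m → 1 ℕ.≤ m′ → ∃ λ v → ∃ λ r → m′ ≡ p ^ v ℕ.* r × ¬ p ∣ r) → 1 ℕ.≤ m → ∃ λ v → ∃ λ r → m ≡ p ^ v ℕ.* r × ¬ p ∣ r
  step m rec 1≤m with p ∣? m
  ... | no ¬d = 0 , m , sym (ℕ.*-identityˡ m) , ¬d
  ... | yes (divides zero refl) = ⊥-elim (ℕ.<-irrefl refl 1≤m)
  ... | yes (divides (suc q) refl) with rec (ℕ.m<m*n (suc q) p (1<prime pp)) (s≤s z≤n)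
  ...   | v , r , e , ¬d = suc v , r , trans (cong (ℕ._* p) e) (trans (ℕ.*-comm _ p) (sym (ℕ.*-assoc p (p ^ v) r))) , ¬d

record PrimePower (n : ℕ) : Set where
  constructor primePower
  field
    {base}  : ℕ
    prime   : Prime base
    exp     : ℕ
    isPower : n ≡ base ^ suc exp

n<p^n : ∀ {p} n → 1 ℕ.< p → n ℕ.< p ^ n
n<p^n zero    q = s≤s z≤n
n<p^n {p} (suc n) q = ℕ.<-≤-trans (s≤s (n<p^n n q)) (ℕ.≤-trans (ℕ.m<m*n (p ^ n) p {{≢0 (ℕ.≤-trans (s≤s z≤n) (n<p^n n q))}} q) (ℕ.≤-reflexive (ℕ.*-comm (p ^ n) p)))

base-≤ : ∀ {p} k → Prime p → p ℕ.≤ p ^ suc k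
base-≤ {p} k pp = ℕ.m≤m*n p (p ^ k) {{ℕ.m^n≢0 p k {{prime⇒nonZero pp}}}}

-- The search is finite because the base is at most `n` and, by `n<p^n`, so is the exponent.
primePower? : ∀ n → Dec (PrimePower n)
primePower? n = map′ to fro
  (ℕ.anyUpTo? (λ p → prime? p ×-dec ℕ.anyUpTo? (λ k → n ℕ.≟ p ^ suc k) n) (suc n))
  where
  to : (∃ λ p → p ℕ.< suc n × (Prime p × ∃ λ k → k ℕ.< n × n ≡ p ^ suc k)) → PrimePower n
  to (p , _ , pp , k , _ , e) = primePower pp k e
  fro : PrimePower n → ∃ λ p → p ℕ.< suc n × (Prime p × ∃ λ k → k ℕ.< n × n ≡ p ^ suc k)
  fro (primePower {p} pp k refl) = p , s≤s (base-≤ k pp) , pp , k , ℕ.<-trans (ℕ.n<1+n k) (n<p^n (suc k) (1<prime pp)) , refl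

primePower-base : ∀ {p q} j k → Prime p → Prime q → p ^ suc j ≡ q ^ suc k → p ≡ q
primePower-base {p} j k pp pq e = prime-∣-prime pp pq (prime-∣-^ (suc k) pp (subst (p ∣_) e (m∣m*n (p ^ j))))

-- The von Mangoldt function of an arbitrary weight on the primes, and its completely additive divisor sum.
module Additive (a : ℕ → F) where
  open PrimePower

  Λ : ℕ → F
  Λ n with primePower? n
  ... | yes pp = a (base pp)
  ... | no _   = 0F

  Λ-power : ∀ {p} k → Prime p → Λ (p ^ suc k) ≡ a p
  Λ-power {p} k pp with primePower? (p ^ suc k)
  ... | yes (primePower pq j e) = cong a (primePower-base j k pq pp (sym e))
  ... | no ¬pp = ⊥-elim (¬pp (primePower pp k refl))

  Λ-else : ∀ {n} → ¬ PrimePower n → Λ n ≡ 0F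
  Λ-else {n} ¬pp with primePower? n
  ... | yes pp = ⊥-elim (¬pp pp)
  ... | no _   = refl

  Λ-nonneg : (∀ p → Prime p → 0F ≤ a p) → ∀ n → 0F ≤ Λ n
  Λ-nonneg a≥0 n with primePower? n
  ... | yes pp = a≥0 (base pp) (prime pp)
  ... | no _   = ≤-refl

  L : ℕ → F
  L n = ∑₁ n (λ d → 𝟙 (d ∣? n) * Λ d)

  L-extend : ∀ {n x} → 1 ℕ.≤ n → n ℕ.≤ x → ∑₁ x (λ d → 𝟙 (d ∣? n) * Λ d) ≡ L n
  L-extend {n} 1≤n n≤x = ∑-extend _ n≤x λ i p _ →
    trans (cong (_* Λ (suc i)) (𝟙-no (suc i ∣? n) λ d → ℕ.<⇒≱ (s≤s p) (∣⇒≤ {{≢0 1≤n}} d))) (zeroˡ _)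

  ¬primePower-1 : ¬ PrimePower 1
  ¬primePower-1 (primePower {p} pp k e) = ℕ.<⇒≱ (1<prime pp) (subst (p ℕ.≤_) (sym e) (base-≤ k pp))

  L-1 : L 1 ≡ 0F
  L-1 = trans (+-identityˡ _) (trans (cong (𝟙 (1 ∣? 1) *_) (Λ-else ¬primePower-1)) (zeroʳ _))

  -- If p divides m exactly v times, the only prime power that divides p m but not m is p ^ (v + 1),
  -- and `Λ` takes the value `a p` there.
  L-prime-* : ∀ {p m} → Prime p → 1 ℕ.≤ m → L (p ℕ.* m) ≡ a p + L m
  L-prime-* {p} {m} pp 1≤m with exponent p pp m 1≤m
  ... | v , r , e , ¬p∣r = lin (L (p ℕ.* m) ∷ L m ∷ a p ∷ ∑₁ x (λ d → g d - h d) ∷ ∑₁ x h ∷ [])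
        (from (difference & ∑-- x (g ∘ suc) (h ∘ suc) & L-extend 1≤m m≤x & []))
    where
    x = p ℕ.* m
    m≤x : m ℕ.≤ x
    m≤x = ℕ.m≤n*m m p {{prime⇒nonZero pp}}
    1≤x : 1 ℕ.≤ x
    1≤x = ℕ.≤-trans 1≤m m≤x
    g h : ℕ → F
    g d = 𝟙 (d ∣? x) * Λ d
    h d = 𝟙 (d ∣? m) * Λ d
    w = p ^ suc v
    1≤w : 1 ℕ.≤ w
    1≤w = ℕ.≤-trans (s≤s z≤n) (n<p^n (suc v) (1<prime pp))
    x≡ : x ≡ w ℕ.* r
    x≡ = trans (cong (p ℕ.*_) e) (sym (ℕ.*-assoc p (p ^ v) r))
    w∣x : w ∣ x
    w∣x = subst (w ∣_) (sym x≡) (m∣m*n r)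
    w∤m : ¬ w ∣ m
    w∤m d = ¬p∣r (*-cancelˡ-∣ (p ^ v) {{ℕ.m^n≢0 p v {{prime⇒nonZero pp}}}} (subst₂ _∣_ (ℕ.*-comm p (p ^ v)) e d))
    unique : ∀ d → d ≢ w → d ∣ x → ¬ d ∣ m → PrimePower d → ⊥
    unique d d≢w d∣x d∤m (primePower {q} pq k refl) with q ℕ.≟ p
    ... | no q≢p   = d∤m (prime-^-∣-* (suc k) pp pq q≢p d∣x)
    ... | yes refl with ℕ.<-cmp k v
    ...   | tri< k<v _ _ = d∤m (subst (p ^ suc k ∣_) (sym e) (∣-trans (m^k∣m^l k<v) (m∣m*n r)))
      where
      m^k∣m^l : ∀ {k l} → k ℕ.≤ l → p ^ k ∣ p ^ l
      m^k∣m^l {k} {l} q = subst (p ^ k ∣_) (trans (sym (ℕ.^-distribˡ-+-* p k (l ℕ.∸ k))) (cong (p ^_) (ℕ.m+[n∸m]≡n q))) (m∣m*n (p ^ (l ℕ.∸ k)))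
    ...   | tri≈ _ refl _ = d≢w refl
    ...   | tri> _ _ v<k = ¬p∣r (∣-trans (m∣m*n (p ^ (k ℕ.∸ suc v))) (*-cancelˡ-∣ w {{≢0 1≤w}} (subst₂ _∣_ eq x≡ d∣x)))
      where
      eq : p ^ suc k ≡ w ℕ.* (p ^ suc (k ℕ.∸ suc v))
      eq = trans (cong (p ^_) (trans (cong suc (sym (ℕ.m+[n∸m]≡n v<k))) (sym (ℕ.+-suc (suc v) (k ℕ.∸ suc v))))) (ℕ.^-distribˡ-+-* p (suc v) (suc (k ℕ.∸ suc v)))
    term : ∀ d → d ≢ w → g d - h d ≡ 0F
    term d d≢w with d ∣? x | d ∣? m
    ... | yes _ | yes _ = lin (Λ d ∷ []) (from [])
    ... | no _  | no _  = lin (Λ d ∷ []) (from [])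
    ... | no n  | yes y = ⊥-elim (n (∣n⇒∣m*n p y))
    ... | yes y | no n  = lin (Λ d ∷ []) (from (Λ-else (unique d d≢w y n) & []))
    difference : ∑₁ x (λ d → g d - h d) ≡ a p
    difference = at w 1≤w (∣⇒≤ {{≢0 1≤x}} w∣x) (λ d → term d) refl
      where
      at : ∀ w′ → 1 ℕ.≤ w′ → w′ ℕ.≤ x → (∀ d → d ≢ w′ → g d - h d ≡ 0F) → w′ ≡ w → ∑₁ x (λ d → g d - h d) ≡ a p
      at (suc u) _ q t e′ = trans (∑-single (λ i → g (suc i) - h (suc i)) q (λ i _ i≢u → t (suc i) (i≢u ∘ ℕ.suc-injective)))
        (lin (𝟙 (suc u ∣? x) ∷ 𝟙 (suc u ∣? m) ∷ Λ (suc u) ∷ a p ∷ [])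
          (from (cong (_* Λ (suc u)) (𝟙-yes (suc u ∣? x) (subst (_∣ x) (sym e′) w∣x)) & cong (_* Λ (suc u)) (𝟙-no (suc u ∣? m) (subst (λ z → ¬ z ∣ m) (sym e′) w∤m))
               & trans (cong Λ e′) (Λ-power v pp) & [])))

  private
    product≥1 : ∀ ps → All Prime ps → 1 ℕ.≤ ListAction.product ps
    product≥1 []       []         = ℕ.≤-refl
    product≥1 (p ∷ ps) (pp ∷ pps) = ℕ.*-mono-≤ (ℕ.<⇒≤ (1<prime pp)) (product≥1 ps pps)

    L-product-* : ∀ ps n → All Prime ps → 1 ℕ.≤ n → L (ListAction.product ps ℕ.* n) ≡ L (ListAction.product ps) + L n
    L-product-* []       n []         1≤n = trans (cong L (ℕ.*-identityˡ n)) (sym (trans (cong (_+ L n) L-1) (+-identityˡ _)))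
    L-product-* (p ∷ ps) n (pp ∷ pps) 1≤n = begin
      L (p ℕ.* P ℕ.* n)          ≡⟨ cong L (ℕ.*-assoc p P n) ⟩
      L (p ℕ.* (P ℕ.* n))        ≡⟨ L-prime-* pp (ℕ.*-mono-≤ (product≥1 ps pps) 1≤n) ⟩
      a p + L (P ℕ.* n)          ≡⟨ cong (a p +_) (L-product-* ps n pps 1≤n) ⟩
      a p + (L P + L n)          ≡⟨ +-assoc _ _ _ ⟨
      (a p + L P) + L n          ≡⟨ cong (_+ L n) (L-prime-* pp (product≥1 ps pps)) ⟨
      L (p ℕ.* P) + L n          ∎
      where
      open ≡-Reasoning
      P = ListAction.product ps

  L-* : ∀ {m n} → 1 ℕ.≤ m → 1 ℕ.≤ n → L (m ℕ.* n) ≡ L m + L n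
  L-* {m} {n} 1≤m 1≤n = subst (λ m → L (m ℕ.* n) ≡ L m + L n) (sym isFactorisation) (L-product-* factors n factorsPrime 1≤n)
    where open PrimeFactorisation (factorise m {{≢0 1≤m}})

  L-prime : ∀ {p} → Prime p → L p ≡ a p
  L-prime {p} pp = trans (cong L (sym (ℕ.*-identityʳ p))) (trans (L-prime-* pp ℕ.≤-refl) (trans (cong (a p +_) L-1) (+-identityʳ _)))

-- Möbius inversion.

-- μ k is the Möbius function restricted to integers all of whose prime factors are at most k.
μ : ℕ → ℕ → F
μ zero    d = 𝟙 (d ℕ.≟ 1)
μ (suc k) d with prime? (suc k) | suc k ∣? d
... | yes _ | yes (divides e _) = - μ k e
... | yes _ | no _              = μ k d
... | no _  | _                 = μ k d

μ-bounds : ∀ k d → - 1F ≤ μ k d × μ k d ≤ 1F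
μ-bounds zero d with d ℕ.≟ 1
... | yes _ = lin [] (from []) , ≤-refl
... | no _  = lin [] (from []) , 0≤1
μ-bounds (suc k) d with prime? (suc k) | suc k ∣? d
... | yes _ | no _              = μ-bounds k d
... | no _  | _                 = μ-bounds k d
... | yes _ | yes (divides e _) with μ-bounds k e
...   | p , q = lin (μ k e ∷ []) (from (q & [])) , lin (μ k e ∷ []) (from (p & []))

-- This is what makes `μ` vanish on multiples of squares: if d is divisible by p * p with p = k + 1,
-- the recursive call is made at d / p, which still has the prime factor p > k.
μ-support : ∀ k d {q} → Prime q → k ℕ.< q → q ∣ d → μ k d ≡ 0F
μ-support zero d pq k<q q∣d = 𝟙-no (d ℕ.≟ 1) λ { refl → ℕ.<-irrefl (sym (∣1⇒≡1 q∣d)) (1<prime pq) }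
μ-support (suc k) d {q} pq k<q q∣d with prime? (suc k) | suc k ∣? d
... | yes _  | no _ = μ-support k d pq (ℕ.<-trans (ℕ.n<1+n k) k<q) q∣d
... | no _   | _    = μ-support k d pq (ℕ.<-trans (ℕ.n<1+n k) k<q) q∣d
... | yes pk | yes (divides e refl) with euclidsLemma e (suc k) pq q∣d
...   | inj₁ q∣e = trans (cong -_ (μ-support k e pq (ℕ.<-trans (ℕ.n<1+n k) k<q) q∣e)) -0#≈0#
...   | inj₂ q∣k = ⊥-elim (ℕ.<-irrefl (sym (prime-∣-prime pq pk q∣k)) k<q)

∑μ : ℕ → ℕ → ℕ → F
∑μ x k n = ∑₁ x (λ d → 𝟙 (d ∣? n) * μ k d)

∑μ-skip : ∀ x k n → (Prime (suc k) → ¬ suc k ∣ n) → ∑μ x (suc k) n ≡ ∑μ x k n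
∑μ-skip x k n h = ∑-ext x λ i → term (suc i)
  where
  term : ∀ d → 𝟙 (d ∣? n) * μ (suc k) d ≡ 𝟙 (d ∣? n) * μ k d
  term d with d ∣? n
  ... | no _ = trans (zeroˡ _) (sym (zeroˡ _))
  ... | yes d∣n with prime? (suc k) | suc k ∣? d
  ...   | yes pk | yes k∣d = ⊥-elim (h pk (∣-trans k∣d d∣n))
  ...   | yes _  | no _    = refl
  ...   | no _   | _       = refl

-- Put p = k + 1. Divisors d of m p not divisible by p divide m and contribute `μ k d`; those
-- divisible by p contribute `- μ k (d / p)` with d / p dividing m. The two sums agree.
∑μ-cancel : ∀ x k m → Prime (suc k) → 1 ℕ.≤ m → m ℕ.* suc k ℕ.≤ x → ∑μ x (suc k) (m ℕ.* suc k) ≡ 0F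
∑μ-cancel x k m pk 1≤m n≤x = begin
  ∑μ x (suc k) n                                                    ≡⟨ ∑-ext x (λ i → term (suc i)) ⟩
  ∑₁ x (λ d → 𝟙 (d ∣? m) * μ k d - 𝟙 (suc k ∣? d) * g d)             ≡⟨ ∑-- x (λ i → 𝟙 (suc i ∣? m) * μ k (suc i)) (λ i → 𝟙 (suc k ∣? suc i) * g (suc i)) ⟩
  ∑μ x k m - ∑₁ x (λ d → 𝟙 (suc k ∣? d) * g d)                       ≡⟨ cong (λ z → ∑μ x k m - z) (trans (∑-multiples k g vanish) (∑-ext x λ i → g-* (suc i))) ⟩
  ∑μ x k m - ∑μ x k m                                                ≡⟨ -‿inverseʳ _ ⟩
  0F                                                                 ∎
  where
  open ≡-Reasoning
  n = m ℕ.* suc k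
  g : ℕ → F
  g d with suc k ∣? d
  ... | yes (divides e _) = 𝟙 (e ∣? m) * μ k e
  ... | no _              = 0F
  vanish : ∀ d → x ℕ.< d → g d ≡ 0F
  vanish d x<d with suc k ∣? d
  ... | no _ = refl
  ... | yes (divides e refl) = trans (cong (_* μ k e) (𝟙-no (e ∣? m) λ e∣m → ℕ.<⇒≱ x<d (ℕ.≤-trans (ℕ.*-monoˡ-≤ (suc k) (∣⇒≤ {{≢0 1≤m}} e∣m)) n≤x))) (zeroˡ _)
  g-* : ∀ e → g (suc k ℕ.* e) ≡ 𝟙 (e ∣? m) * μ k e
  g-* e with suc k ∣? (suc k ℕ.* e)
  ... | no ¬d = ⊥-elim (¬d (m∣m*n e))
  ... | yes (divides e′ eq) rewrite ℕ.*-cancelʳ-≡ e′ e (suc k) (trans (sym eq) (ℕ.*-comm (suc k) e)) = refl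
  term : ∀ d → 𝟙 (d ∣? n) * μ (suc k) d ≡ 𝟙 (d ∣? m) * μ k d - 𝟙 (suc k ∣? d) * g d
  term d with prime? (suc k) | suc k ∣? d
  ... | no ¬pk | _ = ⊥-elim (¬pk pk)
  ... | yes _ | yes (divides e refl) = lin (𝟙 (e ℕ.* suc k ∣? n) ∷ μ k e ∷ 𝟙 (e ∣? m) ∷ 𝟙 (e ℕ.* suc k ∣? m) ∷ μ k (e ℕ.* suc k) ∷ [])
        (from (cong (_* μ k e) (𝟙-cong (e ℕ.* suc k ∣? n) (e ∣? m) (λ d → *-cancelˡ-∣ (suc k) (subst₂ _∣_ (ℕ.*-comm e (suc k)) (ℕ.*-comm m (suc k)) d)) (λ d → subst₂ _∣_ (ℕ.*-comm (suc k) e) (ℕ.*-comm (suc k) m) (*-monoʳ-∣ (suc k) d)))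
              & cong (𝟙 (e ℕ.* suc k ∣? m) *_) (μ-support k (e ℕ.* suc k) pk ℕ.≤-refl (n∣m*n e)) & []))
  ... | yes _ | no ¬k∣d = lin (𝟙 (d ∣? n) ∷ 𝟙 (d ∣? m) ∷ μ k d ∷ [])
        (from (cong (_* μ k d) (𝟙-cong (d ∣? n) (d ∣? m) fwd λ q → ∣-trans q (m∣m*n (suc k))) & []))
    where
    fwd : d ∣ n → d ∣ m
    fwd (divides e eq) with euclidsLemma e d pk (subst (suc k ∣_) eq (n∣m*n m))
    ... | inj₂ q = ⊥-elim (¬k∣d q)
    ... | inj₁ (divides e′ refl) = divides e′ (ℕ.*-cancelʳ-≡ m (e′ ℕ.* d) (suc k) (trans eq (trans (ℕ.*-assoc e′ (suc k) d) (trans (cong (e′ ℕ.*_) (ℕ.*-comm (suc k) d)) (sym (ℕ.*-assoc e′ d (suc k)))))))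

∑μ-smooth : ∀ x k n {q} → 1 ℕ.≤ n → n ℕ.≤ x → Prime q → q ℕ.≤ k → q ∣ n → ∑μ x k n ≡ 0F
∑μ-smooth x zero n 1≤n n≤x pq q≤k q∣n = ⊥-elim (ℕ.<⇒≱ (1<prime pq) (ℕ.≤-trans q≤k z≤n))
∑μ-smooth x (suc k) n {q} 1≤n n≤x pq q≤k q∣n = cases (prime? (suc k)) (suc k ∣? n)
  where
  skip : (Prime (suc k) → ¬ suc k ∣ n) → q ≢ suc k → ∑μ x (suc k) n ≡ 0F
  skip h q≢k = trans (∑μ-skip x k n h) (∑μ-smooth x k n 1≤n n≤x pq (ℕ.s≤s⁻¹ (ℕ.≤∧≢⇒< q≤k q≢k)) q∣n)
  cases : Dec (Prime (suc k)) → Dec (suc k ∣ n) → ∑μ x (suc k) n ≡ 0F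
  cases (yes pk) (yes (divides zero refl))    = ⊥-elim (ℕ.<-irrefl refl 1≤n)
  cases (yes pk) (yes (divides (suc m) refl)) = ∑μ-cancel x k (suc m) pk (s≤s z≤n) n≤x
  cases (yes pk) (no ¬k∣n)                    = skip (λ _ → ¬k∣n) λ { refl → ¬k∣n q∣n }
  cases (no ¬pk) _                            = skip (λ pk → ⊥-elim (¬pk pk)) λ { refl → ¬pk pq }

∑μ-one : ∀ x k → ∑μ (suc x) k 1 ≡ 1F
∑μ-one x (suc k) = trans (∑μ-skip (suc x) k 1 λ pk k∣1 → ℕ.<-irrefl (sym (∣1⇒≡1 k∣1)) (1<prime pk)) (∑μ-one x k)
∑μ-one x zero = trans (∑-single {suc x} {0} (λ i → 𝟙 (suc i ∣? 1) * 𝟙 (suc i ℕ.≟ 1)) (s≤s z≤n) (λ i _ i≢0 → trans (cong (_* 𝟙 (suc i ℕ.≟ 1)) (𝟙-no (suc i ∣? 1) λ q → i≢0 (ℕ.suc-injective (∣1⇒≡1 q)))) (zeroˡ _))) (trans (cong₂ _*_ (𝟙-yes (1 ∣? 1) ∣-refl) refl) (*-identityˡ 1F))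

has-prime : ∀ n → 2 ℕ.≤ n → ∃ λ q → Prime q × q ∣ n
has-prime n 2≤n = go factors factorsPrime isFactorisation
  where
  open PrimeFactorisation (factorise n {{≢0 (ℕ.<⇒≤ 2≤n)}})
  go : ∀ ps → All Prime ps → n ≡ ListAction.product ps → ∃ λ q → Prime q × q ∣ n
  go [] [] e = ⊥-elim (ℕ.<-irrefl (sym e) 2≤n)
  go (p ∷ ps) (pp ∷ _) refl = p , pp , m∣m*n _

∑μ≡δ : ∀ x n → 1 ℕ.≤ n → n ℕ.≤ x → ∑μ x x n ≡ 𝟙 (n ℕ.≟ 1)
∑μ≡δ zero n 1≤n n≤x = ⊥-elim (ℕ.<⇒≱ 1≤n n≤x)
∑μ≡δ (suc x) n 1≤n n≤x with n ℕ.≟ 1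
... | yes refl = ∑μ-one x (suc x)
... | no n≢1 with has-prime n (ℕ.≤∧≢⇒< 1≤n (n≢1 ∘ sym))
...   | q , pq , q∣n = ∑μ-smooth (suc x) (suc x) n 1≤n n≤x pq (ℕ.≤-trans (∣⇒≤ {{≢0 1≤n}} q∣n) n≤x) q∣n

möbius : ∀ x (w : ℕ → F) → w 1 ≡ ∑₁ (suc x) (λ d → μ (suc x) d * ∑₁ (suc x) (λ n → 𝟙 (d ∣? n) * w n))
möbius x w = sym (begin
  ∑₁ y (λ d → μ y d * ∑₁ y (λ n → 𝟙 (d ∣? n) * w n))          ≡⟨ ∑-ext y (λ i → sym (∑-* y (μ y (suc i)) (λ n → 𝟙 (suc i ∣? suc n) * w (suc n)))) ⟩
  ∑₁ y (λ d → ∑₁ y (λ n → μ y d * (𝟙 (d ∣? n) * w n)))        ≡⟨ ∑-swap y y (λ d n → μ y (suc d) * (𝟙 (suc d ∣? suc n) * w (suc n))) ⟩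
  ∑₁ y (λ n → ∑₁ y (λ d → μ y d * (𝟙 (d ∣? n) * w n)))        ≡⟨ ∑-ext y (λ n → trans (∑-ext y λ d → trans (sym (*-assoc _ _ _)) (cong (_* w (suc n)) (*-comm _ _))) (∑-*ʳ y (w (suc n)) (λ d → 𝟙 (suc d ∣? suc n) * μ y (suc d)))) ⟩
  ∑₁ y (λ n → ∑μ y y n * w n)                                 ≡⟨ ∑-cong y (λ n p → cong (_* w (suc n)) (∑μ≡δ y (suc n) (s≤s z≤n) p)) ⟩
  ∑₁ y (λ n → 𝟙 (n ℕ.≟ 1) * w n)                              ≡⟨ ∑-single {y} {0} (λ i → 𝟙 (suc i ℕ.≟ 1) * w (suc i)) (s≤s z≤n) (λ i _ i≢0 → trans (cong (_* w (suc i)) (𝟙-no (suc i ℕ.≟ 1) (i≢0 ∘ ℕ.suc-injective))) (zeroˡ _)) ⟩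
  𝟙 (1 ℕ.≟ 1) * w 1                                           ≡⟨ *-identityˡ (w 1) ⟩
  w 1                                                         ∎)
  where
  open ≡-Reasoning
  y = suc x

product-bound : ∀ {m w b} → - 1F ≤ m → m ≤ 1F → - b ≤ w → w ≤ b → - b ≤ m * w × m * w ≤ b
product-bound {m} {w} {b} m₁ m₂ w₁ w₂ =
    lin (m ∷ w ∷ b ∷ []) (from (*-nonneg (≤⇒0≤ m₁) (≤⇒0≤ w₁) & *-nonneg (≤⇒0≤ m₂) (≤⇒0≤ w₂) & []))
  , lin (m ∷ w ∷ b ∷ []) (from (*-nonneg (≤⇒0≤ m₁) (≤⇒0≤ w₂) & *-nonneg (≤⇒0≤ m₂) (≤⇒0≤ w₁) & []))

-- Möbius inversion with the trivial bound 1 on the absolute value of `μ`.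
möbius-bound : ∀ x (w b : ℕ → F) → (∀ d → 1 ℕ.≤ d → d ℕ.≤ suc x →
                 - b d ≤ ∑₁ (suc x) (λ n → 𝟙 (d ∣? n) * w n) × ∑₁ (suc x) (λ n → 𝟙 (d ∣? n) * w n) ≤ b d) →
               - ∑₁ (suc x) b ≤ w 1 × w 1 ≤ ∑₁ (suc x) b
möbius-bound x w b h = lower , upper
  where
  W : ℕ → F
  W d = ∑₁ (suc x) (λ n → 𝟙 (d ∣? n) * w n)
  m : ℕ → F
  m = μ (suc x)
  bound : ∀ d → 1 ℕ.≤ d → d ℕ.≤ suc x → - b d ≤ m d * W d × m d * W d ≤ b d
  bound d p q = product-bound (proj₁ (μ-bounds (suc x) d)) (proj₂ (μ-bounds (suc x) d)) (proj₁ (h d p q)) (proj₂ (h d p q))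
  upper : w 1 ≤ ∑₁ (suc x) b
  upper = subst (_≤ ∑₁ (suc x) b) (sym (möbius x w)) (∑-mono (suc x) λ i p → proj₂ (bound (suc i) (s≤s z≤n) p))
  lower : - ∑₁ (suc x) b ≤ w 1
  lower = subst₂ _≤_ neg (sym (möbius x w)) (∑-mono (suc x) λ i p → proj₁ (bound (suc i) (s≤s z≤n) p))
    where
    neg : ∑₁ (suc x) (λ d → - b d) ≡ - ∑₁ (suc x) b
    neg = trans (∑-ext (suc x) λ i → sym (-1*x≈-x (b (suc i)))) (trans (∑-* (suc x) (- 1F) (λ i → b (suc i))) (-1*x≈-x _))

-- Integer quotients, partial sums and reciprocals.

fl : ℕ → ℕ → ℕ
fl x zero    = 0
fl x (suc k) = x ℕ./ suc k

fl-lower : ∀ x k → k ℕ.* fl x k ℕ.≤ x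
fl-lower x zero    = z≤n
fl-lower x (suc k) = subst (ℕ._≤ x) (ℕ.*-comm (fl x (suc k)) (suc k)) (ℕ.m/n*n≤m x (suc k))

fl-upper : ∀ x k → 1 ℕ.≤ k → x ℕ.< k ℕ.* suc (fl x k)
fl-upper x (suc k) _ = subst₂ ℕ._<_ (sym (ℕ.m≡m%n+[m/n]*n x (suc k)))
  (trans (cong (suc k ℕ.+_) (ℕ.*-comm (x ℕ./ suc k) (suc k))) (sym (ℕ.*-suc (suc k) (x ℕ./ suc k))))
  (ℕ.+-monoˡ-< (x ℕ./ suc k ℕ.* suc k) (ℕ.m%n<n x (suc k)))

fl-≤ : ∀ {x k m} → 1 ℕ.≤ k → k ℕ.* m ℕ.≤ x → m ℕ.≤ fl x k
fl-≤ {x} {k} {m} 1≤k p = ℕ.s≤s⁻¹ (ℕ.*-cancelˡ-< k m (suc (fl x k)) (ℕ.≤-<-trans p (fl-upper x k 1≤k)))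

≤-fl : ∀ {x k m} → m ℕ.≤ fl x k → k ℕ.* m ℕ.≤ x
≤-fl {x} {k} p = ℕ.≤-trans (ℕ.*-monoʳ-≤ k p) (fl-lower x k)

fl≤ : ∀ x k → fl x k ℕ.≤ x
fl≤ x zero    = z≤n
fl≤ x (suc k) = ℕ.≤-trans (ℕ.m≤n*m (fl x (suc k)) (suc k)) (fl-lower x (suc k))

fl-mono : ∀ {x y} k → x ℕ.≤ y → fl x k ℕ.≤ fl y k
fl-mono zero    p = z≤n
fl-mono (suc k) p = ℕ./-monoˡ-≤ (suc k) p

fl-≡ : ∀ {x k m} → 1 ℕ.≤ k → k ℕ.* m ℕ.≤ x → x ℕ.< k ℕ.* suc m → fl x k ≡ m
fl-≡ {x} {k} {m} 1≤k p q = ℕ.≤-antisym (ℕ.s≤s⁻¹ (ℕ.*-cancelˡ-< k (fl x k) (suc m) (ℕ.≤-<-trans (fl-lower x k) q))) (fl-≤ 1≤k p)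

fl-fl : ∀ x d m → 1 ℕ.≤ d → 1 ℕ.≤ m → fl x (d ℕ.* m) ≡ fl (fl x d) m
fl-fl x d m 1≤d 1≤m = ℕ.≤-antisym
  (fl-≤ 1≤m (fl-≤ 1≤d (ℕ.≤-trans (ℕ.≤-reflexive (sym (ℕ.*-assoc d m _))) (fl-lower x (d ℕ.* m)))))
  (fl-≤ (ℕ.*-mono-≤ 1≤d 1≤m) (ℕ.≤-trans (ℕ.≤-reflexive (ℕ.*-assoc d m _)) (≤-fl {k = d} (fl-lower (fl x d) m))))

∑-floor : ∀ x k f → 1 ℕ.≤ k → ∑₁ x (λ m → 𝟙 (k ℕ.* m ℕ.≤? x) * f m) ≡ ∑₁ (fl x k) f
∑-floor x k f 1≤k = trans
  (∑-extend (λ i → 𝟙 (k ℕ.* suc i ℕ.≤? x) * f (suc i)) (fl≤ x k) λ i p _ → trans (cong (_* f (suc i)) (𝟙-no (k ℕ.* suc i ℕ.≤? x) λ q → ℕ.<⇒≱ (s≤s p) (fl-≤ 1≤k q))) (zeroˡ _))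
  (∑-cong (fl x k) λ i p → trans (cong (_* f (suc i)) (𝟙-yes (k ℕ.* suc i ℕ.≤? x) (≤-fl {k = k} p))) (*-identityˡ _))

opaque
  summatory : (ℕ → F) → ℕ → F
  summatory f n = ∑₁ n f

  summatory-def : ∀ f n → summatory f n ≡ ∑₁ n f
  summatory-def f n = refl

  summatory-0 : ∀ f → summatory f 0 ≡ 0F
  summatory-0 f = refl

  summatory-suc : ∀ f n → summatory f (suc n) ≡ summatory f n + f (suc n)
  summatory-suc f n = refl

summatory-mono : ∀ {f m n} → (∀ i → 0F ≤ f i) → m ℕ.≤ n → summatory f m ≤ summatory f n
summatory-mono {f} {m} {n} z p = subst₂ _≤_ (sym (summatory-def f m)) (sym (summatory-def f n)) (∑-monoˡ (λ i → f (suc i)) p λ i → z (suc i))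

increasing : ∀ (f : ℕ → F) {m} n → m ℕ.≤ n → (∀ i → m ℕ.≤ i → i ℕ.< n → f i ≤ f (suc i)) → f m ≤ f n
increasing f {m} n m≤n s with m ℕ.≟ n
... | yes refl = ≤-refl
increasing f {m} zero    m≤n s | no m≢n = ⊥-elim (m≢n (ℕ.n≤0⇒n≡0 m≤n))
increasing f {m} (suc n) m≤n s | no m≢n = ≤-trans (increasing f n m≤n′ λ i p q → s i p (ℕ.m<n⇒m<1+n q)) (s n m≤n′ ℕ.≤-refl)
  where m≤n′ = ℕ.s≤s⁻¹ (ℕ.≤∧≢⇒< m≤n m≢n)

ι-inv : ∀ {n} → 1 ℕ.≤ n → ι n * inv n ≡ 1F
ι-inv {suc n} _ = trans (cong (_* inv (suc n)) (ι-# (suc n))) (ι*inv n)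

inv-diff : ∀ {n} → 1 ℕ.≤ n → inv n - inv (suc n) ≡ inv n * inv (suc n)
inv-diff {n} p = lin (inv n ∷ inv (suc n) ∷ ι n ∷ ι (suc n) ∷ [])
  (from (cong (_* inv (suc n)) (ι-inv p) & cong (_* inv n) (ι-inv {suc n} (s≤s z≤n)) & cong (λ z → z * (inv n * inv (suc n))) (ι-suc n) & []))

inv-antitone-suc : ∀ {n} → 1 ℕ.≤ n → inv (suc n) ≤ inv n
inv-antitone-suc {n} p = lin (inv n ∷ inv (suc n) ∷ []) (from (inv-diff p & *-nonneg (0≤inv n) (0≤inv (suc n)) & []))

inv-antitone : ∀ {m n} → 1 ℕ.≤ m → m ℕ.≤ n → inv n ≤ inv m
inv-antitone {m} {n} 1≤m m≤n = lin (inv m ∷ inv n ∷ [])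
  (from (increasing (λ i → - inv i) n m≤n (λ i p _ → lin (inv i ∷ inv (suc i) ∷ []) (from (inv-antitone-suc (ℕ.≤-trans 1≤m p) & []))) & []))

inv-double : ∀ {n} → 1 ℕ.≤ n → inv n ≤ # 2 * inv (suc n)
inv-double {n} p = lin (inv n ∷ inv (suc n) ∷ ι n ∷ [])
  (from (inv-diff p & cong (_* inv (suc n)) (ι-inv p) & *-nonneg (≤⇒0≤ (1≤ι p)) (*-nonneg (0≤inv n) (0≤inv (suc n))) & []))

inv-1 : inv 1 ≡ 1F
inv-1 = lin (ι 1 ∷ inv 1 ∷ []) (from (ι-inv {1} ℕ.≤-refl & cong (_* inv 1) (ι-# 1) & []))

inv≤1 : ∀ {n} → 1 ℕ.≤ n → inv n ≤ 1F
inv≤1 {n} p = subst (inv n ≤_) inv-1 (inv-antitone ℕ.≤-refl p)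

inv-unique : ∀ {n a} → 1 ℕ.≤ n → ι n * a ≡ 1F → a ≡ inv n
inv-unique {n} {a} p e = lin (inv n ∷ a ∷ ι n ∷ []) (from (cong (_* a) (ι-inv p) & cong (_* inv n) e & []))

inv-* : ∀ {m n} → 1 ℕ.≤ m → 1 ℕ.≤ n → inv (m ℕ.* n) ≡ inv m * inv n
inv-* {m} {n} p q = sym (inv-unique (ℕ.*-mono-≤ p q) (trans (cong (_* (inv m * inv n)) (ι-* m n))
  (lin (inv m ∷ inv n ∷ ι m ∷ ι n ∷ []) (from (cong (_* (ι n * inv n)) (ι-inv p) & ι-inv q & [])))))

-- A logarithm up to X: completely additive, with Λ its von Mangoldt function,
-- and with growth controlled by the reciprocals only below X, so that rational values suffice.
record Log (X : ℕ) : Set where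
  field
    Λ L        : ℕ → F
    Λ-nonneg   : ∀ n → 0F ≤ Λ n
    Λ-else     : ∀ {n} → ¬ PrimePower n → Λ n ≡ 0F
    L-divisors : ∀ {n x} → 1 ℕ.≤ n → n ℕ.≤ x → ∑₁ x (λ d → 𝟙 (d ∣? n) * Λ d) ≡ L n
    L-1        : L 1 ≡ 0F
    L-*        : ∀ {m n} → 1 ℕ.≤ m → 1 ℕ.≤ n → L (m ℕ.* n) ≡ L m + L n
    -- The increments of the true logarithm lie between 1/(n + 1) and 1/n. Both bounds are widened
    -- by 1/n - 1/(n + 1), which leaves room for a rational construction and still telescopes.
    L-step≤    : ∀ {n} → 1 ℕ.≤ n → n ℕ.< X → L (suc n) - L n ≤ # 2 * inv n - inv (suc n)
    L-step≥    : ∀ {n} → 1 ℕ.≤ n → n ℕ.< X → # 2 * inv (suc n) - inv n ≤ L (suc n) - L n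
    1≤2L2      : # 1 ≤ # 2 * L 2
    6L2≤5      : # 6 * L 2 ≤ # 5

halve : ∀ n → ∃ λ m → n ≡ m ℕ.* 2 ⊎ n ≡ suc (m ℕ.* 2)
halve zero = 0 , inj₁ refl
halve (suc n) with halve n
... | m , inj₁ e = m , inj₂ (cong suc e)
... | m , inj₂ e = suc m , inj₁ (cong suc e)

ι-double : ∀ m → ι (m ℕ.* 2) ≡ # 2 * ι m
ι-double m = trans (ι-* m 2) (trans (*-comm _ _) (cong (_* ι m) (ι-# 2)))

fl-double-bounds : ∀ m k → 1 ℕ.≤ k → # 2 * ι (fl m k) ≤ ι (fl (m ℕ.* 2) k) × ι (fl (m ℕ.* 2) k) ≤ # 2 * ι (fl m k) + # 1
fl-double-bounds m k 1≤k = subst (_≤ ι b) (ι-double a) (ι-mono (fl-≤ 1≤k low)) ,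
    lin (ι b ∷ ι (suc (a ℕ.* 2)) ∷ ι (a ℕ.* 2) ∷ ι a ∷ []) (from (ι-mono (ℕ.s≤s⁻¹ (ℕ.*-cancelˡ-< k b (suc (suc (a ℕ.* 2))) high)) & ι-suc (a ℕ.* 2) & ι-double a & []))
  where
  a = fl m k
  b = fl (m ℕ.* 2) k
  low : k ℕ.* (a ℕ.* 2) ℕ.≤ m ℕ.* 2
  low = subst (ℕ._≤ m ℕ.* 2) (ℕ.*-assoc k a 2) (ℕ.*-monoˡ-≤ 2 (fl-lower m k))
  high : k ℕ.* b ℕ.< k ℕ.* suc (suc (a ℕ.* 2))
  high = ℕ.≤-<-trans (fl-lower (m ℕ.* 2) k) (subst (m ℕ.* 2 ℕ.<_) (ℕ.*-assoc k (suc a) 2) (ℕ.*-monoˡ-< 2 (fl-upper m k 1≤k)))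

argmin : ∀ (f : ℕ → F) n → ∃ λ i → i ℕ.≤ n × (∀ j → j ℕ.≤ n → f i ≤ f j)
argmin f zero = 0 , z≤n , λ { zero z≤n → ≤-refl }
argmin f (suc n) with argmin f n
... | i , i≤n , m with ≤-total (f i) (f (suc n))
...   | inj₁ p = i , ℕ.m≤n⇒m≤1+n i≤n , λ j q → [ (λ { (s≤s r) → m j r }) , (λ { refl → p }) ]′ (ℕ.m≤n⇒m<n∨m≡n q)
...   | inj₂ p = suc n , ℕ.≤-refl , λ j q → [ (λ { (s≤s r) → ≤-trans p (m j r) }) , (λ { refl → ≤-refl }) ]′ (ℕ.m≤n⇒m<n∨m≡n q)

≤-average : ∀ n (f : ℕ → F) → ∃ λ i → i ℕ.< suc n × ι (suc n) * f i ≤ ∑ (suc n) f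
≤-average n f with argmin f n
... | i , i≤n , m = i , s≤s i≤n , subst (_≤ ∑ (suc n) f) (∑-const (suc n) (f i)) (∑-mono (suc n) λ j p → m j (ℕ.s≤s⁻¹ p))

-- The witness minimises `f` on (y, z].
≤-weighted-average : ∀ (f g : ℕ → F) y z → y ℕ.< z → (∀ i → 0F ≤ g i) →
                     ∃ λ n → y ℕ.< n × n ℕ.≤ z × f n * (summatory g z - summatory g y) ≤ summatory (λ k → g k * f k) z - summatory (λ k → g k * f k) y
≤-weighted-average f g y (suc z) (s≤s y≤z) g≥0 with argmin (λ i → f (suc (y ℕ.+ i))) (z ℕ.∸ y)
... | i , i≤ , m = suc (y ℕ.+ i) , s≤s (ℕ.m≤m+n y i) , s≤s (subst (y ℕ.+ i ℕ.≤_) (ℕ.m+[n∸m]≡n y≤z) (ℕ.+-monoʳ-≤ y i≤)) , final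
  where
  n = suc (y ℕ.+ i)
  G P : ℕ → F
  G = summatory g
  P = summatory (λ k → g k * f k)
  final : f n * (G (suc z) - G y) ≤ P (suc z) - P y
  final = lin (f n ∷ G (suc z) ∷ G y ∷ P (suc z) ∷ P y ∷ [])
    (from (increasing (λ k → P k - f n * G k) (suc z) (ℕ.m≤n⇒m≤1+n y≤z) (λ k p q →
      lin (f n ∷ f (suc k) ∷ g (suc k) ∷ G k ∷ G (suc k) ∷ P k ∷ P (suc k) ∷ [])
        (from (*-monoˡ (g≥0 (suc k)) (subst (λ z → f n ≤ f (suc z)) (ℕ.m+[n∸m]≡n p) (m (k ℕ.∸ y) (ℕ.∸-monoˡ-≤ y (ℕ.s≤s⁻¹ q)))) & cong (f n *_) (summatory-suc g k) & summatory-suc (λ k → g k * f k) k & []))) & []))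

power-floor : ∀ w y → 2 ℕ.≤ w → 1 ℕ.≤ y → ∃ λ J → w ^ J ℕ.≤ y × y ℕ.< w ^ suc J
power-floor w (suc zero) 2≤w _ = 0 , s≤s z≤n , subst (1 ℕ.<_) (sym (ℕ.*-identityʳ w)) 2≤w
power-floor w (suc y@(suc _)) 2≤w _ with power-floor w y 2≤w (s≤s z≤n)
... | J , p , q with ℕ.m≤n⇒m<n∨m≡n q
...   | inj₁ r = J , ℕ.m≤n⇒m≤1+n p , r
...   | inj₂ e = suc J , ℕ.≤-reflexive (sym e) , subst (ℕ._< w ^ suc (suc J)) (sym e)
      (ℕ.<-≤-trans (ℕ.m<m*n (w ^ suc J) w {{≢0 (ℕ.m^n>0 w {{≢0 (ℕ.<⇒≤ 2≤w)}} (suc J))}} 2≤w) (ℕ.≤-reflexive (ℕ.*-comm (w ^ suc J) w)))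

-- The numerical heart of the non-overlapping case: if e is only slightly larger than s, an interval of
-- relative length at least s with density nearly 2 still has density 39/20 on the relative length e.
dense-enough : ∀ {u x l r s a e} → 0F ≤ x → 0F ≤ s → s * x ≤ l → # 200 * r ≤ # 201 * s → # 4000 * a ≤ s → r ≤ # 15 → 0F ≤ r → 0F ≤ a → a ≤ # 1 → 0F ≤ u → # 4000 ≤ u * s →
               e ≡ r + # 33 * a → # 39 * (u * ((x + l) * e)) ≤ # 20 * ((# 2 * u * l - x) * (# 1 + e))
dense-enough {u} {x} {l} {r} {s} {a} {e} 0≤x 0≤s sx≤l rs as r≤15 0≤r 0≤a a≤1 0≤u us e≡ =
  lin (u ∷ x ∷ e ∷ l ∷ s ∷ [])
    (from (h₁ & h₂ & h₃ & h₄ & h₅ & 0≤x & []))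
  where
  0≤e : 0F ≤ e
  0≤e = lin (e ∷ r ∷ a ∷ []) (from (e≡ & 0≤r & 0≤a & []))
  e≤48 : e ≤ # 48
  e≤48 = lin (e ∷ r ∷ a ∷ []) (from (e≡ & r≤15 & a≤1 & []))
  es : # 4000 * e ≤ # 4053 * s
  es = lin (e ∷ r ∷ a ∷ s ∷ []) (from (e≡ & rs & as & []))
  h₁ : # 4000 * (u * x * e) ≤ # 4053 * (u * x * s)
  h₁ = lin (u ∷ x ∷ e ∷ s ∷ []) (from (*-monoˡ (*-nonneg 0≤u 0≤x) es & []))
  h₂ : u * x * s ≤ u * l
  h₂ = lin (u ∷ x ∷ s ∷ l ∷ []) (from (*-monoˡ 0≤u sx≤l & []))
  h₃ : # 4000 * x ≤ u * x * s
  h₃ = lin (u ∷ x ∷ s ∷ []) (from (*-monoˡ 0≤x us & []))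
  h₄ : x * e ≤ # 48 * x
  h₄ = lin (x ∷ e ∷ []) (from (*-monoˡ 0≤x e≤48 & []))
  h₅ : 0F ≤ u * l * e
  h₅ = *-nonneg (*-nonneg 0≤u (≤-trans (*-nonneg 0≤s 0≤x) sx≤l)) 0≤e

-- Chebyshev, Mertens and Selberg estimates for an approximate logarithm.

module Logarithmic {X : ℕ} (log : Log X) where
  open Log log

  -- Chebyshev's function, log n! and the harmonic numbers.
  ψ Θ H : ℕ → F
  ψ = summatory Λ
  Θ = summatory L
  H = summatory inv

  ψ-0 : ψ 0 ≡ 0F
  ψ-0 = summatory-0 Λ

  ψ-suc : ∀ n → ψ (suc n) ≡ ψ n + Λ (suc n)
  ψ-suc = summatory-suc Λ

  ψ-mono : ∀ {m n} → m ℕ.≤ n → ψ m ≤ ψ n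
  ψ-mono = summatory-mono Λ-nonneg

  0≤ψ : ∀ n → 0F ≤ ψ n
  0≤ψ n = subst (_≤ ψ n) ψ-0 (ψ-mono {0} {n} z≤n)

  0≤H : ∀ n → 0F ≤ H n
  0≤H n = subst (_≤ H n) (summatory-0 inv) (summatory-mono {inv} {0} {n} 0≤inv z≤n)

  L-suc : ∀ {n} → 1 ℕ.≤ n → n ℕ.< X → L n ≤ L (suc n)
  L-suc {n} p q = lin (L n ∷ L (suc n) ∷ inv n ∷ inv (suc n) ∷ []) (from (L-step≥ p q & inv-double p & []))

  L-mono : ∀ {m n} → 1 ℕ.≤ m → m ℕ.≤ n → n ℕ.≤ X → L m ≤ L n
  L-mono {m} {n} 1≤m m≤n n≤X = increasing L n m≤n λ i p q → L-suc (ℕ.≤-trans 1≤m p) (ℕ.<-≤-trans q n≤X)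

  0≤L : ∀ {n} → 1 ℕ.≤ n → n ℕ.≤ X → 0F ≤ L n
  0≤L {n} p q = subst (_≤ L n) L-1 (L-mono ℕ.≤-refl p q)

  L-diff : ∀ {m n} → 1 ℕ.≤ m → m ℕ.≤ n → n ℕ.≤ X → L n - L m ≤ # 2 * (ι n - ι m) * inv m
  L-diff {m} {n} 1≤m m≤n n≤X = lin (L n ∷ L m ∷ ι n ∷ ι m ∷ inv m ∷ [])
    (from (increasing (λ i → # 2 * ι i * inv m - L i) n m≤n (λ i p q →
      lin (L i ∷ L (suc i) ∷ ι i ∷ ι (suc i) ∷ inv i ∷ inv (suc i) ∷ inv m ∷ [])
        (from (L-step≤ (ℕ.≤-trans 1≤m p) (ℕ.<-≤-trans q n≤X) & inv-antitone 1≤m p & 0≤inv (suc i) & cong (_* inv m) (ι-suc i) & []))) & []))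

  L≤2n : ∀ {n} → 1 ℕ.≤ n → n ℕ.≤ X → L n ≤ # 2 * ι n
  L≤2n {n} 1≤n n≤X = lin (L n ∷ L 1 ∷ ι n ∷ ι 1 ∷ inv 1 ∷ [])
    (from (L-diff ℕ.≤-refl 1≤n n≤X & L-1 & cong (λ z → (ι n - ι 1) * z) inv-1 & ι-# 1 & []))

  L-double : ∀ {n} → 1 ℕ.≤ n → L (n ℕ.* 2) ≡ L n + L 2
  L-double 1≤n = L-* 1≤n (s≤s z≤n)

  Λ≤L : ∀ {n} → 1 ℕ.≤ n → Λ n ≤ L n
  Λ≤L {n@(suc i)} 1≤n = subst₂ _≤_ (trans (cong (_* Λ n) (𝟙-yes (n ∣? n) ∣-refl)) (*-identityˡ _)) (L-divisors 1≤n ℕ.≤-refl)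
    (∑-term (λ j → 𝟙 (suc j ∣? n) * Λ (suc j)) ℕ.≤-refl λ j _ → *-nonneg (𝟙-nonneg (suc j ∣? n)) (Λ-nonneg (suc j)))

  C : ℕ → F
  C n = H n - L n

  -- Stands in for Euler's constant: up to `X`, the differences `C n` agree with it to within
  -- O(1/n).
  γ : F
  γ = C X

  -- By `L-step≤` the sequence `C i - 2 * inv i` increases; dually, `C i + inv i` decreases by
  -- `L-step≥`.
  C-lower : ∀ {n} → 1 ℕ.≤ n → n ℕ.≤ X → C n - # 2 * inv n ≤ γ
  C-lower {n} 1≤n n≤X = lin (H n ∷ L n ∷ inv n ∷ H X ∷ L X ∷ inv X ∷ [])
    (from (increasing (λ i → H i - L i - # 2 * inv i) X n≤X (λ i p q →
      lin (H i ∷ H (suc i) ∷ L i ∷ L (suc i) ∷ inv i ∷ inv (suc i) ∷ []) (from (summatory-suc inv i & L-step≤ (ℕ.≤-trans 1≤n p) q & []))) & 0≤inv X & []))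

  C-upper : ∀ {n} → 1 ℕ.≤ n → n ℕ.≤ X → γ ≤ C n + inv n
  C-upper {n} 1≤n n≤X = lin (H n ∷ L n ∷ inv n ∷ H X ∷ L X ∷ inv X ∷ [])
    (from (increasing (λ i → L i - H i - inv i) X n≤X (λ i p q →
      lin (H i ∷ H (suc i) ∷ L i ∷ L (suc i) ∷ inv i ∷ inv (suc i) ∷ []) (from (summatory-suc inv i & L-step≥ (ℕ.≤-trans 1≤n p) q & []))) & 0≤inv X & []))

  H-1 : H 1 ≡ 1F
  H-1 = trans (summatory-suc inv 0) (trans (cong₂ _+_ (summatory-0 inv) inv-1) (+-identityˡ 1F))

  γ-bounds : 1 ℕ.≤ X → - 1F ≤ γ × γ ≤ # 2
  γ-bounds 1≤X = lin (H 1 ∷ L 1 ∷ inv 1 ∷ H X ∷ L X ∷ []) (from (C-lower ℕ.≤-refl 1≤X & H-1 & L-1 & inv-1 & []))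
               , lin (H 1 ∷ L 1 ∷ inv 1 ∷ H X ∷ L X ∷ []) (from (C-upper ℕ.≤-refl 1≤X & H-1 & L-1 & inv-1 & []))

  H≤2+L : ∀ {n} → 1 ℕ.≤ n → n ℕ.≤ X → H n ≤ # 2 + L n
  H≤2+L {n} 1≤n n≤X = lin (H n ∷ L n ∷ inv n ∷ H 1 ∷ L 1 ∷ inv 1 ∷ [])
    (from (increasing (λ i → L i - H i - inv i) n 1≤n (λ i p q →
      lin (H i ∷ H (suc i) ∷ L i ∷ L (suc i) ∷ inv i ∷ inv (suc i) ∷ []) (from (summatory-suc inv i & L-step≥ p (ℕ.<-≤-trans q n≤X) & []))) & H-1 & L-1 & inv-1 & 0≤inv n & []))

  -- The error in Stirling's formula log n! = n H(n) - (γ + 1) n. Its increments are O(1/n), which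
  -- bounds it by a multiple of `H n`.
  Θ-error : ℕ → F
  Θ-error n = Θ n - ι n * H n + (γ + # 1) * ι n

  Θ-error-suc : ∀ n → Θ-error (suc n) ≡ Θ-error n + γ - C (suc n) + inv (suc n)
  Θ-error-suc n = lin (Θ n ∷ Θ (suc n) ∷ H n ∷ H (suc n) ∷ ι n ∷ ι (suc n) ∷ H X ∷ L X ∷ L (suc n) ∷ inv (suc n) ∷ [])
    (from (summatory-suc L n & cong (ι (suc n) *_) (summatory-suc inv n) & summatory-suc inv n & ι-inv {suc n} (s≤s z≤n) & cong (_* H n) (ι-suc n) & cong (_* γ) (ι-suc n) & ι-suc n & []))

  Θ-error-0 : Θ-error 0 ≡ 0F
  Θ-error-0 = lin (Θ 0 ∷ ι 0 ∷ H 0 ∷ H X ∷ L X ∷ []) (from (summatory-0 L & cong (_* H 0) ι0 & cong (_* γ) ι0 & ι0 & []))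

  Θ-error-bounds : ∀ n → n ℕ.≤ X → - (# 2 * H n) ≤ Θ-error n × Θ-error n ≤ # 2 * H n
  Θ-error-bounds zero n≤X = lin (Θ 0 ∷ ι 0 ∷ H 0 ∷ H X ∷ L X ∷ []) (from (Θ-error-0 & summatory-0 inv & []))
                          , lin (Θ 0 ∷ ι 0 ∷ H 0 ∷ H X ∷ L X ∷ []) (from (Θ-error-0 & summatory-0 inv & []))
  Θ-error-bounds (suc n) n≤X = step (Θ-error n) (Θ-error (suc n)) (C (suc n)) (proj₁ ih) (proj₂ ih) (Θ-error-suc n) (C-lower (s≤s z≤n) n≤X) (C-upper (s≤s z≤n) n≤X)
    where
    ih = Θ-error-bounds n (ℕ.<⇒≤ n≤X)
    step : ∀ e e′ c → - (# 2 * H n) ≤ e → e ≤ # 2 * H n → e′ ≡ e + γ - c + inv (suc n) → c - # 2 * inv (suc n) ≤ γ → γ ≤ c + inv (suc n) →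
           - (# 2 * H (suc n)) ≤ e′ × e′ ≤ # 2 * H (suc n)
    step e e′ c p q r s t = lin (e ∷ e′ ∷ c ∷ H X ∷ L X ∷ H n ∷ H (suc n) ∷ inv (suc n) ∷ []) (from (p & r & s & summatory-suc inv n & 0≤inv (suc n) & []))
                          , lin (e ∷ e′ ∷ c ∷ H X ∷ L X ∷ H n ∷ H (suc n) ∷ inv (suc n) ∷ []) (from (q & r & t & summatory-suc inv n & 0≤inv (suc n) & []))

  -- Legendre's formula for log x!: exactly ⌊x/k⌋ of the integers up to x are divisible by k.
  ∑Λ-floor : ∀ x → Θ x ≡ ∑₁ x (λ k → Λ k * ι (fl x k))
  ∑Λ-floor x = sym (begin
    ∑₁ x (λ k → Λ k * ι (fl x k))                                    ≡⟨ ∑-ext x (λ i → cong (Λ (suc i) *_) (sym (count (suc i) (s≤s z≤n)))) ⟩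
    ∑₁ x (λ k → Λ k * ∑₁ x (λ m → 𝟙 (k ℕ.* m ℕ.≤? x)))               ≡⟨ ∑-ext x (λ i → sym (∑-* x (Λ (suc i)) (λ m → 𝟙 (suc i ℕ.* suc m ℕ.≤? x)))) ⟩
    ∑₁ x (λ k → ∑₁ x (λ m → Λ k * 𝟙 (k ℕ.* m ℕ.≤? x)))               ≡⟨ ∑-swap x x (λ k m → Λ (suc k) * 𝟙 (suc k ℕ.* suc m ℕ.≤? x)) ⟩
    ∑₁ x (λ m → ∑₁ x (λ k → Λ k * 𝟙 (k ℕ.* m ℕ.≤? x)))               ≡⟨ ∑-dirichlet Λ (λ n → 𝟙 (n ℕ.≤? x)) (λ d p → 𝟙-no (d ℕ.≤? x) (ℕ.<⇒≱ p)) ⟩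
    ∑₁ x (λ n → ∑₁ x (λ k → 𝟙 (k ∣? n) * Λ k) * 𝟙 (n ℕ.≤? x))        ≡⟨ ∑-cong x (λ i p → trans (cong₂ _*_ (L-divisors (s≤s z≤n) p) (𝟙-yes (suc i ℕ.≤? x) p)) (*-identityʳ _)) ⟩
    ∑₁ x L                                                           ≡⟨ summatory-def L x ⟨
    Θ x                                                              ∎)
    where
    open ≡-Reasoning
    count : ∀ k → 1 ℕ.≤ k → ∑₁ x (λ m → 𝟙 (k ℕ.* m ℕ.≤? x)) ≡ ι (fl x k)
    count k p = trans (∑-ext x λ i → sym (*-identityʳ _)) (trans (∑-floor x k (λ _ → 1F) p) (trans (∑-const (fl x k) 1F) (*-identityʳ _)))

  -- The same sum over pairs with k m ≤ y as in Legendre's formula, grouped by the cofactor m.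
  ∑ψ-floor : ∀ y → ∑₁ y (λ m → ψ (fl y m)) ≡ Θ y
  ∑ψ-floor y = begin
    ∑₁ y (λ m → ψ (fl y m))                                          ≡⟨ ∑-ext y (λ i → trans (summatory-def Λ (fl y (suc i))) (sym (∑-floor y (suc i) Λ (s≤s z≤n)))) ⟩
    ∑₁ y (λ m → ∑₁ y (λ k → 𝟙 (m ℕ.* k ℕ.≤? y) * Λ k))               ≡⟨ ∑-ext y (λ i → ∑-ext y λ j → trans (*-comm _ _) (cong (λ n → Λ (suc j) * 𝟙 (n ℕ.≤? y)) (ℕ.*-comm (suc i) (suc j)))) ⟩
    ∑₁ y (λ m → ∑₁ y (λ k → Λ k * 𝟙 (k ℕ.* m ℕ.≤? y)))               ≡⟨ ∑-dirichlet Λ (λ n → 𝟙 (n ℕ.≤? y)) (λ d p → 𝟙-no (d ℕ.≤? y) (ℕ.<⇒≱ p)) ⟩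
    ∑₁ y (λ n → ∑₁ y (λ k → 𝟙 (k ∣? n) * Λ k) * 𝟙 (n ℕ.≤? y))        ≡⟨ ∑-cong y (λ i p → trans (cong₂ _*_ (L-divisors (s≤s z≤n) p) (𝟙-yes (suc i ℕ.≤? y) p)) (*-identityʳ _)) ⟩
    ∑₁ y L                                                           ≡⟨ summatory-def L y ⟨
    Θ y                                                              ∎
    where open ≡-Reasoning

  -- Moments of log (y/d). Both are O(y): the first gives the lower bound for log y!, and together
  -- they control the Möbius sum behind Selberg's formula.
  S₁ S₂ : ℕ → F
  S₁ y = ∑₁ y (λ d → L y - L d)
  S₂ y = ∑₁ y (λ d → (L y - L d) * (L y - L d))

  S₁-suc : ∀ y → S₁ (suc y) ≡ S₁ y + ι y * (L (suc y) - L y)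
  S₁-suc y = trans (cong₂ _+_ (trans (∑-ext y λ i → regroup (L (suc y)) (L y) (L (suc i))) (trans (∑-+ y _ _) (cong (S₁ y +_) (∑-const y _)))) (-‿inverseʳ (L (suc y)))) (+-identityʳ _)
    where
    regroup : ∀ a b c → a - c ≡ (b - c) + (a - b)
    regroup a b c = lin (a ∷ b ∷ c ∷ []) (from [])

  S₂-suc : ∀ y → S₂ (suc y) ≡ S₂ y + # 2 * (L (suc y) - L y) * S₁ y + ι y * ((L (suc y) - L y) * (L (suc y) - L y))
  S₂-suc y = trans (cong₂ _+_ (trans (∑-ext y λ i → regroup (L (suc y)) (L y) (L (suc i)))
      (trans (∑-+ y _ _) (cong₂ _+_ (trans (∑-+ y _ _) (cong (S₂ y +_) (∑-* y (# 2 * δ) (λ i → L y - L (suc i))))) (∑-const y _)))) (trans (cong (_* (L (suc y) - L (suc y))) (-‿inverseʳ (L (suc y)))) (zeroˡ _))) (+-identityʳ _)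
    where
    δ = L (suc y) - L y
    regroup : ∀ a b c → (a - c) * (a - c) ≡ ((b - c) * (b - c) + # 2 * (a - b) * (b - c)) + (a - b) * (a - b)
    regroup a b c = lin (a ∷ b ∷ c ∷ []) (from [])

  δ-bounds : ∀ {y} → 1 ℕ.≤ y → y ℕ.< X → 0F ≤ L (suc y) - L y × ι y * (L (suc y) - L y) ≤ # 2
  δ-bounds {y} 1≤y y<X = ≤⇒0≤ (L-suc 1≤y y<X)
    , lin (ι y ∷ L (suc y) ∷ L y ∷ inv y ∷ inv (suc y) ∷ [])
        (from (*-monoˡ (0≤ι y) (L-step≤ 1≤y y<X) & ι-inv 1≤y & *-nonneg (0≤ι y) (0≤inv (suc y)) & []))

  S₁-bound : ∀ y → y ℕ.≤ X → S₁ y ≤ # 2 * ι y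
  S₁-bound zero _ = lin (ι 0 ∷ []) (from (ι0 & []))
  S₁-bound (suc zero) _ = lin (ι 1 ∷ ι 0 ∷ L 1 ∷ L 0 ∷ []) (from (cong (_* (L 1 - L 0)) ι0 & ι-# 1 & []))
  S₁-bound (suc y@(suc _)) p = step (S₁ y) (S₁ (suc y)) (L (suc y) - L y) (S₁-bound y (ℕ.<⇒≤ p)) (S₁-suc y) (proj₂ (δ-bounds (s≤s z≤n) p))
    where
    step : ∀ s s′ δ → s ≤ # 2 * ι y → s′ ≡ s + ι y * δ → ι y * δ ≤ # 2 → s′ ≤ # 2 * ι (suc y)
    step s s′ δ a b c = lin (s ∷ s′ ∷ δ ∷ ι y ∷ ι (suc y) ∷ []) (from (a & b & c & ι-suc y & []))

  S₂-bound : ∀ y → y ℕ.≤ X → S₂ y ≤ # 12 * ι y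
  S₂-bound zero _ = lin (ι 0 ∷ []) (from (ι0 & []))
  S₂-bound (suc zero) _ = lin (ι 1 ∷ L 1 ∷ []) (from (ι-# 1 & []))
  S₂-bound (suc y@(suc _)) p = step (S₁ y) (S₂ y) (S₂ (suc y)) (L (suc y) - L y) (S₂-bound y (ℕ.<⇒≤ p)) (S₂-suc y) (S₁-bound y (ℕ.<⇒≤ p)) (proj₁ (δ-bounds (s≤s z≤n) p)) (proj₂ (δ-bounds (s≤s z≤n) p))
    where
    step : ∀ s₁ s s′ δ → s ≤ # 12 * ι y → s′ ≡ s + # 2 * δ * s₁ + ι y * (δ * δ) → s₁ ≤ # 2 * ι y → 0F ≤ δ → ι y * δ ≤ # 2 → s′ ≤ # 12 * ι (suc y)
    step s₁ s s′ δ a b c d e = lin (s₁ ∷ s ∷ s′ ∷ δ ∷ ι y ∷ ι (suc y) ∷ [])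
      (from (a & b & *-monoˡ d c & e & *-monoˡ d e & ι-suc y & *-nonneg d (≤⇒0≤ (1≤ι {y} (s≤s z≤n))) & []))

  S₁≡ : ∀ y → S₁ y ≡ ι y * L y - Θ y
  S₁≡ y = trans (∑-- y (λ _ → L y) (λ i → L (suc i))) (cong₂ _-_ (∑-const y (L y)) (sym (summatory-def L y)))

  Θ-lower : ∀ y → y ℕ.≤ X → ι y * L y - # 2 * ι y ≤ Θ y
  Θ-lower y p = step (S₁ y) (S₁≡ y) (S₁-bound y p)
    where
    step : ∀ s → s ≡ ι y * L y - Θ y → s ≤ # 2 * ι y → ι y * L y - # 2 * ι y ≤ Θ y
    step s a b = lin (s ∷ ι y ∷ L y ∷ Θ y ∷ []) (from (a & b & []))

  Θ-upper : ∀ y → y ℕ.≤ X → Θ y ≤ ι y * L y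
  Θ-upper y p = step (S₁ y) (S₁≡ y) (∑-nonneg y λ i q → ≤⇒0≤ (L-mono (s≤s z≤n) q p))
    where
    step : ∀ s → s ≡ ι y * L y - Θ y → 0F ≤ s → Θ y ≤ ι y * L y
    step s a b = lin (s ∷ ι y ∷ L y ∷ Θ y ∷ []) (from (a & b & []))

  -- The logarithm of the central binomial coefficient of order 2m. The bounds below place it
  -- between 4^m / (2m) and 4^m.
  D : ℕ → F
  D m = Θ (m ℕ.* 2) - # 2 * Θ m

  D-suc : ∀ m → D (suc m) ≡ D m + L (suc (m ℕ.* 2)) + L (suc (suc (m ℕ.* 2))) - # 2 * L (suc m)
  D-suc m = lin (Θ (suc (suc (m ℕ.* 2))) ∷ Θ (suc (m ℕ.* 2)) ∷ Θ (m ℕ.* 2) ∷ Θ (suc m) ∷ Θ m ∷ L (suc (m ℕ.* 2)) ∷ L (suc (suc (m ℕ.* 2))) ∷ L (suc m) ∷ [])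
    (from (summatory-suc L (suc (m ℕ.* 2)) & summatory-suc L (m ℕ.* 2) & summatory-suc L m & []))

  D-0 : D 0 ≡ 0F
  D-0 = lin (Θ 0 ∷ []) (from (summatory-0 L & []))

  D-upper : ∀ m → m ℕ.* 2 ℕ.≤ X → D m ≤ # 2 * ι m * L 2
  D-upper zero p = lin (ι 0 ∷ L 2 ∷ Θ 0 ∷ []) (from (summatory-0 L & cong (_* L 2) ι0 & []))
  D-upper (suc m) p = step (D m) (D (suc m)) (D-upper m (ℕ.≤-trans (ℕ.m≤n+m (m ℕ.* 2) 2) p)) (D-suc m)
    where
    step : ∀ d d′ → d ≤ # 2 * ι m * L 2 → d′ ≡ d + L (suc (m ℕ.* 2)) + L (suc (suc (m ℕ.* 2))) - # 2 * L (suc m) → d′ ≤ # 2 * ι (suc m) * L 2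
    step d d′ a b = lin (d ∷ d′ ∷ ι m ∷ ι (suc m) ∷ L 2 ∷ L (suc (m ℕ.* 2)) ∷ L (suc (suc (m ℕ.* 2))) ∷ L (suc m) ∷ [])
      (from (a & b & L-suc {suc (m ℕ.* 2)} (s≤s z≤n) p & L-double {suc m} (s≤s z≤n) & cong (_* L 2) (ι-suc m) & []))

  D-lower : ∀ m → 1 ℕ.≤ m → m ℕ.* 2 ℕ.≤ X → # 2 * ι m * L 2 - L (m ℕ.* 2) ≤ D m
  D-lower (suc zero) _ p = step (D 0) (D 1) D-0 (D-suc 0)
    where
    step : ∀ d d′ → d ≡ 0F → d′ ≡ d + L 1 + L 2 - # 2 * L 1 → # 2 * ι 1 * L 2 - L 2 ≤ d′
    step d d′ a b = lin (d ∷ d′ ∷ ι 1 ∷ L 1 ∷ L 2 ∷ []) (from (a & b & L-1 & cong (_* L 2) (ι-# 1) & []))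
  D-lower (suc m@(suc _)) _ p = step (D m) (D (suc m)) (D-lower m (s≤s z≤n) (ℕ.≤-trans (ℕ.m≤n+m (m ℕ.* 2) 2) p)) (D-suc m)
    where
    step : ∀ d d′ → # 2 * ι m * L 2 - L (m ℕ.* 2) ≤ d → d′ ≡ d + L (suc (m ℕ.* 2)) + L (suc (suc (m ℕ.* 2))) - # 2 * L (suc m) →
           # 2 * ι (suc m) * L 2 - L (suc m ℕ.* 2) ≤ d′
    step d d′ a b = lin (d ∷ d′ ∷ ι m ∷ ι (suc m) ∷ L 2 ∷ L (m ℕ.* 2) ∷ L (suc (m ℕ.* 2)) ∷ L (suc (suc (m ℕ.* 2))) ∷ L (suc m) ∷ [])
      (from (a & b & L-suc {m ℕ.* 2} (s≤s z≤n) (ℕ.<-trans (ℕ.n<1+n _) p) & L-double {suc m} (s≤s z≤n) & cong (_* L 2) (ι-suc m) & []))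

  D-∑ : ∀ m → D m ≡ ∑₁ (m ℕ.* 2) (λ k → Λ k * (ι (fl (m ℕ.* 2) k) - # 2 * ι (fl m k)))
  D-∑ m = sym (begin
    ∑₁ x (λ k → Λ k * (ι (fl x k) - # 2 * ι (fl m k)))                              ≡⟨ ∑-ext x (λ i → expand (Λ (suc i)) (ι (fl x (suc i))) (ι (fl m (suc i)))) ⟩
    ∑₁ x (λ k → Λ k * ι (fl x k) - # 2 * (Λ k * ι (fl m k)))                        ≡⟨ ∑-- x (λ i → Λ (suc i) * ι (fl x (suc i))) (λ i → # 2 * (Λ (suc i) * ι (fl m (suc i)))) ⟩
    ∑₁ x (λ k → Λ k * ι (fl x k)) - ∑₁ x (λ k → # 2 * (Λ k * ι (fl m k)))           ≡⟨ cong₂ _-_ (sym (∑Λ-floor x)) (trans (∑-* x (# 2) (λ i → Λ (suc i) * ι (fl m (suc i)))) (cong (# 2 *_) short)) ⟩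
    D m                                                                             ∎)
    where
    open ≡-Reasoning
    x = m ℕ.* 2
    expand : ∀ a b c → a * (b - # 2 * c) ≡ a * b - # 2 * (a * c)
    expand a b c = lin (a ∷ b ∷ c ∷ []) (from [])
    short : ∑₁ x (λ k → Λ k * ι (fl m k)) ≡ Θ m
    short = trans (∑-extend (λ i → Λ (suc i) * ι (fl m (suc i))) (ℕ.m≤m*n m 2) λ i p _ →
      trans (cong (λ n → Λ (suc i) * ι n) (ℕ.m<n⇒m/n≡0 {m} {suc i} (s≤s p))) (trans (cong (Λ (suc i) *_) ι0) (zeroʳ _))) (sym (∑Λ-floor m))

  ψ-half : ∀ m → ∑₁ (m ℕ.* 2) (λ k → Λ k * 𝟙 (m ℕ.<? k)) ≡ ψ (m ℕ.* 2) - ψ m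
  ψ-half m = begin
    ∑₁ x (λ k → Λ k * 𝟙 (m ℕ.<? k))                          ≡⟨ ∑-ext x (λ i → flip (suc i)) ⟩
    ∑₁ x (λ k → Λ k - Λ k * 𝟙 (k ℕ.≤? m))                    ≡⟨ ∑-- x (λ i → Λ (suc i)) (λ i → Λ (suc i) * 𝟙 (suc i ℕ.≤? m)) ⟩
    ∑₁ x Λ - ∑₁ x (λ k → Λ k * 𝟙 (k ℕ.≤? m))                 ≡⟨ cong₂ _-_ (sym (summatory-def Λ x)) (trans (∑-extend (λ i → Λ (suc i) * 𝟙 (suc i ℕ.≤? m)) (ℕ.m≤m*n m 2) (λ i p _ → trans (cong (Λ (suc i) *_) (𝟙-no (suc i ℕ.≤? m) (ℕ.<⇒≱ (s≤s p)))) (zeroʳ _)))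
                                                                 (trans (∑-cong m (λ i p → trans (cong (Λ (suc i) *_) (𝟙-yes (suc i ℕ.≤? m) p)) (*-identityʳ _))) (sym (summatory-def Λ m)))) ⟩
    ψ x - ψ m                                                ∎
    where
    open ≡-Reasoning
    x = m ℕ.* 2
    flip : ∀ k → Λ k * 𝟙 (m ℕ.<? k) ≡ Λ k - Λ k * 𝟙 (k ℕ.≤? m)
    flip k with m ℕ.<? k
    ... | yes p = lin (Λ k ∷ 𝟙 (k ℕ.≤? m) ∷ []) (from (cong (Λ k *_) (𝟙-no (k ℕ.≤? m) (ℕ.<⇒≱ p)) & []))
    ... | no p  = lin (Λ k ∷ 𝟙 (k ℕ.≤? m) ∷ []) (from (cong (Λ k *_) (𝟙-yes (k ℕ.≤? m) (ℕ.≮⇒≥ p)) & []))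

  -- In `D-∑` the coefficient of `Λ k` is nonnegative, and at least 1 for m < k ≤ 2m.
  ψ-half-≤ : ∀ m → ψ (m ℕ.* 2) - ψ m ≤ D m
  ψ-half-≤ m = subst₂ _≤_ (ψ-half m) (sym (D-∑ m)) (∑-mono (m ℕ.* 2) λ i p → *-monoˡ (Λ-nonneg (suc i)) (term (suc i) (s≤s z≤n) p))
    where
    term : ∀ k → 1 ℕ.≤ k → k ℕ.≤ m ℕ.* 2 → 𝟙 (m ℕ.<? k) ≤ ι (fl (m ℕ.* 2) k) - # 2 * ι (fl m k)
    term k 1≤k k≤x with m ℕ.<? k
    ... | yes m<k = lin (ι (fl (m ℕ.* 2) k) ∷ ι (fl m k) ∷ [])
      (from (1≤ι (fl-≤ {m ℕ.* 2} {k} 1≤k (subst (ℕ._≤ m ℕ.* 2) (sym (ℕ.*-identityʳ k)) k≤x)) & trans (cong ι (fl-≡ {m} {k} {0} 1≤k (subst (ℕ._≤ m) (sym (ℕ.*-zeroʳ k)) z≤n) (subst (m ℕ.<_) (sym (ℕ.*-identityʳ k)) m<k))) ι0 & []))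
    ... | no m≮k  = ≤⇒0≤ (proj₁ (fl-double-bounds m k 1≤k))

  -- The coefficients in `D-∑` are at most 1.
  D≤ψ : ∀ m → D m ≤ ψ (m ℕ.* 2)
  D≤ψ m = subst₂ _≤_ (sym (D-∑ m)) (sym (summatory-def Λ (m ℕ.* 2))) (∑-mono (m ℕ.* 2) λ i p → term (suc i) (s≤s z≤n))
    where
    term : ∀ k → 1 ℕ.≤ k → Λ k * (ι (fl (m ℕ.* 2) k) - # 2 * ι (fl m k)) ≤ Λ k
    term k 1≤k = lin (Λ k ∷ ι (fl (m ℕ.* 2) k) ∷ ι (fl m k) ∷ []) (from (*-monoˡ (Λ-nonneg k) (proj₂ (fl-double-bounds m k 1≤k)) & []))

  ψ-double-≤ : ∀ m → m ℕ.* 2 ℕ.≤ X → # 3 * ψ (m ℕ.* 2) ≤ # 3 * ψ m + # 5 * ι m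
  ψ-double-≤ m p = step (D m) (ψ-half-≤ m) (D-upper m p)
    where
    step : ∀ d → ψ (m ℕ.* 2) - ψ m ≤ d → d ≤ # 2 * ι m * L 2 → # 3 * ψ (m ℕ.* 2) ≤ # 3 * ψ m + # 5 * ι m
    step d a b = lin (ψ (m ℕ.* 2) ∷ ψ m ∷ d ∷ ι m ∷ L 2 ∷ []) (from (a & b & *-monoˡ (0≤ι m) 6L2≤5 & []))

  -- An explicit form of log n = o(n): beyond `B` the slope of `L` is at most 2/B, and below it
  -- `L≤2n` is enough.
  L-sublinear : ∀ B {n} → 1 ℕ.≤ B → 1 ℕ.≤ n → n ℕ.≤ X → ι B * L n ≤ # 2 * ι n + # 2 * ι B * ι B
  L-sublinear B {n} 1≤B 1≤n n≤X with ℕ.≤-total n B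
  ... | inj₁ n≤B = lin (ι B ∷ L n ∷ ι n ∷ [])
    (from (*-monoˡ (0≤ι B) (L≤2n 1≤n n≤X) & *-monoˡ (0≤ι B) (ι-mono n≤B) & 0≤ι n & []))
  ... | inj₂ B≤n = lin (ι B ∷ L n ∷ L B ∷ ι n ∷ inv B ∷ [])
    (from (*-monoˡ (0≤ι B) (L-diff 1≤B B≤n n≤X) & cong (_* (ι n - ι B)) (ι-inv 1≤B) & *-monoˡ (0≤ι B) (L≤2n 1≤B (ℕ.≤-trans B≤n n≤X)) & 0≤ι B & []))

  ψ≤6x : ∀ x → x ℕ.≤ X → ψ x ≤ # 6 * ι x
  ψ≤6x = <-rec _ go
    where
    go : ∀ x → (∀ {y} → y ℕ.< x → y ℕ.≤ X → ψ y ≤ # 6 * ι y) → x ℕ.≤ X → ψ x ≤ # 6 * ι x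
    go x rec p with halve x
    ... | zero , inj₁ refl = lin (ψ 0 ∷ ι 0 ∷ []) (from (ψ-0 & ι0 & []))
    ... | suc m₁ , inj₁ refl = step (suc m₁) (ℕ.m<m*n (suc m₁) 2 (s≤s (s≤s z≤n))) p
      where
      step : ∀ m → m ℕ.< suc m₁ ℕ.* 2 → m ℕ.* 2 ℕ.≤ X → ψ (m ℕ.* 2) ≤ # 6 * ι (m ℕ.* 2)
      step m q p = lin (ψ (m ℕ.* 2) ∷ ψ m ∷ ι m ∷ ι (m ℕ.* 2) ∷ []) (from (ψ-double-≤ m p & rec q (ℕ.≤-trans (ℕ.m≤m*n m 2) p) & ι-double m & 0≤ι m & []))
    ... | m , inj₂ refl = lin (ψ (suc (m ℕ.* 2)) ∷ ψ (m ℕ.* 2) ∷ Λ (suc (m ℕ.* 2)) ∷ L (suc (m ℕ.* 2)) ∷ ψ m ∷ ι m ∷ ι (m ℕ.* 2) ∷ ι (suc (m ℕ.* 2)) ∷ [])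
      (from (ψ-suc (m ℕ.* 2) & Λ≤L {suc (m ℕ.* 2)} (s≤s z≤n) & L≤2n {suc (m ℕ.* 2)} (s≤s z≤n) p & ψ-double-≤ m (ℕ.<⇒≤ p) & rec (s≤s (ℕ.m≤m*n m 2)) (ℕ.≤-trans (ℕ.m≤m*n m 2) (ℕ.<⇒≤ p)) & ι-double m & 0≤ι m & ι-suc (m ℕ.* 2) & []))

  -- Doubling m adds at most 10 m to 6 ψ, while the main term of the bound grows by 11 m. The spare
  -- m and the growth 600 `L 2` ≥ 300 of the second term absorb the last summand of an odd argument.
  6ψ≤ : ∀ x → 1 ℕ.≤ x → x ℕ.≤ X → # 6 * ψ x ≤ # 11 * ι x + # 600 * (L x + # 1)
  6ψ≤ = <-rec _ go
    where
    go : ∀ x → (∀ {y} → y ℕ.< x → 1 ℕ.≤ y → y ℕ.≤ X → # 6 * ψ y ≤ # 11 * ι y + # 600 * (L y + # 1)) → 1 ℕ.≤ x → x ℕ.≤ X → # 6 * ψ x ≤ # 11 * ι x + # 600 * (L x + # 1)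
    go x rec 1≤x p with halve x
    ... | zero , inj₁ refl = ⊥-elim (ℕ.<⇒≱ 1≤x z≤n)
    ... | zero , inj₂ refl = lin (ψ 1 ∷ ψ 0 ∷ Λ 1 ∷ L 1 ∷ ι 1 ∷ []) (from (ψ-suc 0 & ψ-0 & Λ≤L {1} ℕ.≤-refl & L-1 & ι-# 1 & []))
    ... | suc m₁ , inj₁ refl = step (suc m₁) (s≤s z≤n) (ℕ.m<m*n (suc m₁) 2 (s≤s (s≤s z≤n))) p
      where
      step : ∀ m → 1 ℕ.≤ m → m ℕ.< suc m₁ ℕ.* 2 → m ℕ.* 2 ℕ.≤ X → # 6 * ψ (m ℕ.* 2) ≤ # 11 * ι (m ℕ.* 2) + # 600 * (L (m ℕ.* 2) + # 1)
      step m r q p = lin (ψ (m ℕ.* 2) ∷ ψ m ∷ ι m ∷ ι (m ℕ.* 2) ∷ L (m ℕ.* 2) ∷ L m ∷ L 2 ∷ [])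
        (from (ψ-double-≤ m p & rec q r (ℕ.≤-trans (ℕ.m≤m*n m 2) p) & ι-double m & 0≤ι m & L-double r & 1≤2L2 & []))
    ... | suc m₁ , inj₂ refl = step (suc m₁) (s≤s z≤n) (s≤s (ℕ.m≤m*n (suc m₁) 2)) p
      where
      step : ∀ m → 1 ℕ.≤ m → m ℕ.< suc (suc m₁ ℕ.* 2) → suc (m ℕ.* 2) ℕ.≤ X → # 6 * ψ (suc (m ℕ.* 2)) ≤ # 11 * ι (suc (m ℕ.* 2)) + # 600 * (L (suc (m ℕ.* 2)) + # 1)
      step m r q p = lin (ψ (suc (m ℕ.* 2)) ∷ ψ (m ℕ.* 2) ∷ Λ (suc (m ℕ.* 2)) ∷ L (suc (m ℕ.* 2)) ∷ ψ m ∷ ι m ∷ ι (m ℕ.* 2) ∷ ι (suc (m ℕ.* 2)) ∷ L (m ℕ.* 2) ∷ L m ∷ L 2 ∷ ι 24 ∷ [])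
        (from (ψ-suc (m ℕ.* 2) & Λ≤L {suc (m ℕ.* 2)} (s≤s z≤n) & ψ-double-≤ m (ℕ.<⇒≤ p) & rec q r (ℕ.≤-trans (ℕ.m≤m*n m 2) (ℕ.<⇒≤ p)) & ι-double m & 0≤ι m
             & L-double r & 1≤2L2 & L-mono (ℕ.*-mono-≤ r (s≤s (z≤n {1}))) (ℕ.n≤1+n (m ℕ.* 2)) p & ι-suc (m ℕ.* 2)
             & L-sublinear 24 {suc (m ℕ.* 2)} (s≤s z≤n) (s≤s z≤n) p & cong (_* L (suc (m ℕ.* 2))) (ι-# 24) & ι-# 24 & cong (_* ι 24) (ι-# 24) & []))

  -- What matters is 23/12 < 39/20, the density obtained along a chain. The slope parameter 4800
  -- makes 1200 `L x` at most x/2 plus a constant, which the size of x absorbs.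
  12ψ≤23x : ∀ {x} → 1 ℕ.≤ x → x ℕ.≤ X → # 24000000 ≤ ι x → # 12 * ψ x ≤ # 23 * ι x
  12ψ≤23x {x} 1≤x x≤X big = lin (ψ x ∷ ι x ∷ L x ∷ ι 4800 ∷ [])
    (from (6ψ≤ x 1≤x x≤X & L-sublinear 4800 1≤4800 1≤x x≤X & cong (_* L x) (ι-# 4800) & ι-# 4800 & cong (_* ι 4800) (ι-# 4800) & big & []))
    where
    1≤4800 : 1 ℕ.≤ 4800
    1≤4800 = s≤s z≤n

  ψ-double-≥ : ∀ m → 1 ℕ.≤ m → m ℕ.* 2 ℕ.≤ X → ι m - L (m ℕ.* 2) ≤ ψ (m ℕ.* 2)
  ψ-double-≥ m 1≤m p = step (D m) (D-lower m 1≤m p) (D≤ψ m)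
    where
    step : ∀ d → # 2 * ι m * L 2 - L (m ℕ.* 2) ≤ d → d ≤ ψ (m ℕ.* 2) → ι m - L (m ℕ.* 2) ≤ ψ (m ℕ.* 2)
    step d a b = lin (ψ (m ℕ.* 2) ∷ L (m ℕ.* 2) ∷ d ∷ ι m ∷ L 2 ∷ []) (from (a & b & *-monoˡ (0≤ι m) 1≤2L2 & []))

  M : ℕ → F
  M = summatory (λ k → Λ k * inv k)

  fl-inv : ∀ x k → 1 ℕ.≤ k → ι (fl x k) ≤ ι x * inv k × ι x * inv k ≤ ι (fl x k) + # 1
  fl-inv x k 1≤k =
      lin (ι (fl x k) ∷ ι x ∷ ι k ∷ inv k ∷ ι (k ℕ.* fl x k) ∷ [])
        (from (*-monoˡ (0≤inv k) (ι-mono (fl-lower x k)) & cong (inv k *_) (ι-* k (fl x k)) & cong (_* ι (fl x k)) (ι-inv 1≤k) & []))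
    , lin (ι (fl x k) ∷ ι (suc (fl x k)) ∷ ι x ∷ ι k ∷ inv k ∷ ι (k ℕ.* suc (fl x k)) ∷ [])
        (from (*-monoˡ (0≤inv k) (ι-mono (ℕ.<⇒≤ (fl-upper x k 1≤k))) & cong (inv k *_) (ι-* k (suc (fl x k))) & cong (_* ι (suc (fl x k))) (ι-inv 1≤k) & ι-suc (fl x k) & []))

  xM : ∀ x → ι x * M x ≡ ∑₁ x (λ k → Λ k * (ι x * inv k))
  xM x = trans (cong (ι x *_) (summatory-def (λ k → Λ k * inv k) x)) (trans (sym (∑-* x (ι x) (λ i → Λ (suc i) * inv (suc i)))) (∑-ext x λ i → swap (ι x) (Λ (suc i)) (inv (suc i))))
    where
    swap : ∀ a b c → a * (b * c) ≡ b * (a * c)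
    swap a b c = lin (a ∷ b ∷ c ∷ []) (from [])

  -- Towards Mertens' estimate `M x` = log x + O(1): replacing ⌊x/k⌋ by x/k in Legendre's formula
  -- costs at most `ψ x`, which is O(x).
  Θ≤xM : ∀ x → Θ x ≤ ι x * M x
  Θ≤xM x = subst₂ _≤_ (sym (∑Λ-floor x)) (sym (xM x)) (∑-mono x λ i _ → *-monoˡ (Λ-nonneg (suc i)) (proj₁ (fl-inv x (suc i) (s≤s z≤n))))

  xM≤Θ+ψ : ∀ x → ι x * M x ≤ Θ x + ψ x
  xM≤Θ+ψ x = subst₂ _≤_ (sym (xM x)) (trans (∑-+ x (λ i → Λ (suc i) * ι (fl x (suc i))) (λ i → Λ (suc i))) (cong₂ _+_ (sym (∑Λ-floor x)) (sym (summatory-def Λ x))))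
    (∑-mono x λ i _ → step (Λ (suc i)) (ι x * inv (suc i)) (ι (fl x (suc i))) (Λ-nonneg (suc i)) (proj₂ (fl-inv x (suc i) (s≤s z≤n))))
    where
    step : ∀ a b c → 0F ≤ a → b ≤ c + # 1 → a * b ≤ a * c + a
    step a b c p q = lin (a ∷ b ∷ c ∷ []) (from (*-monoˡ p q & []))

  M-upper : ∀ {x} → 1 ℕ.≤ x → x ℕ.≤ X → M x ≤ L x + # 6
  M-upper {x} 1≤x p = *-cancel (1≤ι 1≤x) (lin (ι x ∷ M x ∷ Θ x ∷ ψ x ∷ L x ∷ []) (from (xM≤Θ+ψ x & Θ-upper x p & ψ≤6x x p & [])))

  M-lower : ∀ {x} → 1 ℕ.≤ x → x ℕ.≤ X → L x - # 2 ≤ M x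
  M-lower {x} 1≤x p = *-cancel (1≤ι 1≤x) (lin (ι x ∷ M x ∷ Θ x ∷ L x ∷ []) (from (Θ≤xM x & Θ-lower x p & [])))

  -- Selberg's sum, to be shown equal to 2 x log x + O(x).
  S : ℕ → F
  S x = L x * ψ x + ∑₁ x (λ k → Λ k * ψ (fl x k))

  module TatuzawaIseki (x′ : ℕ) (x≤X : suc x′ ℕ.≤ X) where
    private
      x = suc x′
      1≤x : 1 ℕ.≤ x
      1≤x = s≤s z≤n
      1≤X : 1 ℕ.≤ X
      1≤X = ℕ.≤-trans 1≤x x≤X

    c : F
    c = γ + # 1

    v u ℓ w : ℕ → F
    -- The remainder ψ(y) - y at y = x/n, shifted by c = γ + 1. With this shift, Stirling's formula
    -- makes the sums of `v` over the multiples of d only logarithmic in x/d.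
    v n = ψ (fl x n) - ι x * inv n + c
    u n = 𝟙 (n ℕ.≤? x) * v n
    ℓ n = L x - L n
    w n = ℓ n * u n + ∑₁ x (λ k → Λ k * u (k ℕ.* n))

    u-vanish : ∀ n → x ℕ.< n → u n ≡ 0F
    u-vanish n p = trans (cong (_* v n) (𝟙-no (n ℕ.≤? x) (ℕ.<⇒≱ p))) (zeroˡ _)

    w-vanish : ∀ n → x ℕ.< n → w n ≡ 0F
    w-vanish n p = trans (cong₂ _+_ (trans (cong (ℓ n *_) (u-vanish n p)) (zeroʳ _))
      (∑-zero x λ i _ → trans (cong (Λ (suc i) *_) (u-vanish (suc i ℕ.* n) (ℕ.<-≤-trans p (ℕ.m≤n*m n (suc i))))) (zeroʳ _))) (+-identityʳ 0F)

    U : ℕ → F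
    U d = ∑₁ x (λ m → u (d ℕ.* m))

    -- The convolution with `Λ` turns into the factor `L n` at d n, and complete additivity gives
    -- ℓ(d n) + L(n) = ℓ(d), which no longer depends on n. This is the Tatuzawa-Iseki identity in
    -- summed form.
    w-∑ : ∀ d → 1 ℕ.≤ d → ∑₁ x (λ n → 𝟙 (d ∣? n) * w n) ≡ ℓ d * U d
    w-∑ d@(suc d′) 1≤d = begin
      ∑₁ x (λ n → 𝟙 (d ∣? n) * w n)                                                   ≡⟨ ∑-multiples d′ w w-vanish ⟩
      ∑₁ x (λ m → w (d ℕ.* m))                                                        ≡⟨ ∑-+ x (λ i → ℓ (d ℕ.* suc i) * u (d ℕ.* suc i)) (λ i → ∑₁ x (λ k → Λ k * u (k ℕ.* (d ℕ.* suc i)))) ⟩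
      A + ∑₁ x (λ m → ∑₁ x (λ k → Λ k * u (k ℕ.* (d ℕ.* m))))                         ≡⟨ cong (A +_) (∑-ext x λ i → ∑-ext x λ j → cong (λ n → Λ (suc j) * u n) (exchange (suc j) (suc i))) ⟩
      A + ∑₁ x (λ m → ∑₁ x (λ k → Λ k * u (d ℕ.* (k ℕ.* m))))                         ≡⟨ cong (A +_) (∑-dirichlet Λ (λ n → u (d ℕ.* n)) (λ n p → u-vanish (d ℕ.* n) (ℕ.<-≤-trans p (ℕ.m≤n*m n d)))) ⟩
      A + ∑₁ x (λ n → ∑₁ x (λ k → 𝟙 (k ∣? n) * Λ k) * u (d ℕ.* n))                    ≡⟨ cong (A +_) (∑-cong x λ i p → cong (_* u (d ℕ.* suc i)) (L-divisors (s≤s z≤n) p)) ⟩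
      A + ∑₁ x (λ n → L n * u (d ℕ.* n))                                              ≡⟨ ∑-+ x (λ i → ℓ (d ℕ.* suc i) * u (d ℕ.* suc i)) (λ i → L (suc i) * u (d ℕ.* suc i)) ⟨
      ∑₁ x (λ m → ℓ (d ℕ.* m) * u (d ℕ.* m) + L m * u (d ℕ.* m))                      ≡⟨ ∑-ext x (λ i → merge (L x) (L (d ℕ.* suc i)) (L d) (L (suc i)) (u (d ℕ.* suc i)) (L-* 1≤d (s≤s z≤n))) ⟩
      ∑₁ x (λ m → ℓ d * u (d ℕ.* m))                                                  ≡⟨ ∑-* x (ℓ d) (λ i → u (d ℕ.* suc i)) ⟩
      ℓ d * U d                                                                       ∎
      where
      open ≡-Reasoning
      A = ∑₁ x (λ m → ℓ (d ℕ.* m) * u (d ℕ.* m))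
      exchange : ∀ k m → k ℕ.* (d ℕ.* m) ≡ d ℕ.* (k ℕ.* m)
      exchange k m = trans (sym (ℕ.*-assoc k d m)) (trans (cong (ℕ._* m) (ℕ.*-comm k d)) (ℕ.*-assoc d k m))
      merge : ∀ a b e f g → b ≡ e + f → (a - b) * g + f * g ≡ (a - e) * g
      merge a b e f g refl = lin (a ∷ e ∷ f ∷ g ∷ []) (from [])

    U≡ : ∀ d → 1 ℕ.≤ d → U d ≡ Θ (fl x d) - ι x * inv d * H (fl x d) + ι (fl x d) * c
    U≡ d 1≤d = begin
      U d                                                                        ≡⟨ ∑-floor x d (λ m → v (d ℕ.* m)) 1≤d ⟩
      ∑₁ y (λ m → v (d ℕ.* m))                                                   ≡⟨ ∑-ext y (λ i → cong₂ (λ a b → ψ a - b + c) (fl-fl x d (suc i) 1≤d (s≤s z≤n)) (trans (cong (ι x *_) (inv-* 1≤d (s≤s z≤n))) (sym (*-assoc _ _ _)))) ⟩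
      ∑₁ y (λ m → ψ (fl y m) - ι x * inv d * inv m + c)                          ≡⟨ ∑-+ y (λ i → ψ (fl y (suc i)) - ι x * inv d * inv (suc i)) (λ _ → c) ⟩
      ∑₁ y (λ m → ψ (fl y m) - ι x * inv d * inv m) + ∑₁ y (λ _ → c)             ≡⟨ cong₂ _+_ (∑-- y (λ i → ψ (fl y (suc i))) (λ i → ι x * inv d * inv (suc i))) (∑-const y c) ⟩
      ∑₁ y (λ m → ψ (fl y m)) - ∑₁ y (λ m → ι x * inv d * inv m) + ι y * c       ≡⟨ cong₂ (λ a b → a - b + ι y * c) (∑ψ-floor y) (trans (∑-* y (ι x * inv d) (λ i → inv (suc i))) (cong (ι x * inv d *_) (sym (summatory-def inv y)))) ⟩
      Θ y - ι x * inv d * H y + ι y * c                                          ∎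
      where
      open ≡-Reasoning
      y = fl x d

    ℓ-nonneg : ∀ {d} → 1 ℕ.≤ d → d ℕ.≤ x → 0F ≤ ℓ d
    ℓ-nonneg 1≤d d≤x = ≤⇒0≤ (L-mono 1≤d d≤x x≤X)

    -- With y = ⌊x/d⌋ the main terms of `U≡` are those of Stirling's formula at y; what remains is
    -- `Θ-error` and the rounding of x/d, each of size O(H y).
    U-bounds : ∀ d → 1 ℕ.≤ d → d ℕ.≤ x → - (# 6 + # 3 * ℓ d) ≤ U d × U d ≤ # 6 + # 3 * ℓ d
    U-bounds d 1≤d d≤x = step (U d) (Θ-error y) (ι x * inv d) (U≡ d 1≤d) refl (proj₁ (Θ-error-bounds y y≤X)) (proj₂ (Θ-error-bounds y y≤X)) (proj₁ (fl-inv x d 1≤d)) (proj₂ (fl-inv x d 1≤d))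
      where
      y = fl x d
      1≤y : 1 ℕ.≤ y
      1≤y = fl-≤ 1≤d (subst (ℕ._≤ x) (sym (ℕ.*-identityʳ d)) d≤x)
      y≤X : y ℕ.≤ X
      y≤X = ℕ.≤-trans (fl≤ x d) x≤X
      Ly : L y ≤ ℓ d
      Ly = lin (L y ∷ L x ∷ L d ∷ L (d ℕ.* y) ∷ []) (from (L-* 1≤d 1≤y & L-mono (ℕ.*-mono-≤ 1≤d 1≤y) (fl-lower x d) x≤X & []))
      step : ∀ U e r → U ≡ Θ y - r * H y + ι y * c → e ≡ Θ-error y → - (# 2 * H y) ≤ e → e ≤ # 2 * H y → ι y ≤ r → r ≤ ι y + # 1 →
             - (# 6 + # 3 * ℓ d) ≤ U × U ≤ # 6 + # 3 * ℓ d
      step U e r p q a b s t =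
          lin (U ∷ e ∷ r ∷ Θ y ∷ H y ∷ ι y ∷ H X ∷ L X ∷ L x ∷ L d ∷ L y ∷ []) (from (p & q & a & *-monoˡ (0≤H y) t & H≤2+L 1≤y y≤X & Ly & []))
        , lin (U ∷ e ∷ r ∷ Θ y ∷ H y ∷ ι y ∷ H X ∷ L X ∷ L x ∷ L d ∷ L y ∷ []) (from (p & q & b & *-monoˡ (0≤H y) s & H≤2+L 1≤y y≤X & Ly & 0≤H y & []))

    b : ℕ → F
    b d = # 6 * ℓ d + # 3 * (ℓ d * ℓ d)

    -- 48 = 6 · 2 + 3 · 12, from the first and the second moment.
    ∑b : ∑₁ x b ≤ # 48 * ι x
    ∑b = subst (_≤ # 48 * ι x) (sym (trans (∑-+ x (λ i → # 6 * ℓ (suc i)) (λ i → # 3 * (ℓ (suc i) * ℓ (suc i)))) (cong₂ _+_ (∑-* x (# 6) (λ i → ℓ (suc i))) (∑-* x (# 3) (λ i → ℓ (suc i) * ℓ (suc i))))))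
           (step (S₁ x) (S₂ x) (S₁-bound x x≤X) (S₂-bound x x≤X))
      where
      step : ∀ s t → s ≤ # 2 * ι x → t ≤ # 12 * ι x → # 6 * s + # 3 * t ≤ # 48 * ι x
      step s t p q = lin (s ∷ t ∷ ι x ∷ []) (from (p & q & []))

    w-bounds : - (# 48 * ι x) ≤ w 1 × w 1 ≤ # 48 * ι x
    w-bounds = step (∑₁ x b) (w 1) ∑b (möbius-bound x′ w b bound)
      where
      step : ∀ s w → s ≤ # 48 * ι x → - s ≤ w × w ≤ s → - (# 48 * ι x) ≤ w × w ≤ # 48 * ι x
      step s w p (q , r) = lin (s ∷ w ∷ ι x ∷ []) (from (p & q & [])) , lin (s ∷ w ∷ ι x ∷ []) (from (p & r & []))
      product : ∀ l U → 0F ≤ l → - (# 6 + # 3 * l) ≤ U × U ≤ # 6 + # 3 * l → - (# 6 * l + # 3 * (l * l)) ≤ l * U × l * U ≤ # 6 * l + # 3 * (l * l)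
      product l U p (q , r) = lin (l ∷ U ∷ []) (from (*-monoˡ p q & [])) , lin (l ∷ U ∷ []) (from (*-monoˡ p r & []))
      bound : ∀ d → 1 ℕ.≤ d → d ℕ.≤ x → - b d ≤ ∑₁ x (λ n → 𝟙 (d ∣? n) * w n) × ∑₁ x (λ n → 𝟙 (d ∣? n) * w n) ≤ b d
      bound d p q = subst (λ z → - b d ≤ z × z ≤ b d) (sym (w-∑ d p)) (product (ℓ d) (U d) (ℓ-nonneg p q) (U-bounds d p q))

    w-1 : w 1 ≡ S x - ι x * L x + c * L x - ι x * M x + c * ψ x
    w-1 = trans (cong₂ _+_ (cong (ℓ 1 *_) (trans (cong (_* v 1) (𝟙-yes (1 ℕ.≤? x) 1≤x)) (*-identityˡ _))) tail)
                (step (∑₁ x (λ k → Λ k * ψ (fl x k))) (ψ (fl x 1)) (cong ψ (fl-≡ {x} {1} {x} ℕ.≤-refl (ℕ.≤-reflexive (ℕ.*-identityˡ x)) (ℕ.≤-reflexive (sym (ℕ.*-identityˡ (suc x)))))))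
      where
      open ≡-Reasoning
      expand : ∀ a b c d → a * (b - d + c) ≡ a * b - a * d + a * c
      expand a b c d = lin (a ∷ b ∷ c ∷ d ∷ []) (from [])
      tail : ∑₁ x (λ k → Λ k * u (k ℕ.* 1)) ≡ ∑₁ x (λ k → Λ k * ψ (fl x k)) - ι x * M x + ψ x * c
      tail = begin
        ∑₁ x (λ k → Λ k * u (k ℕ.* 1))                                                 ≡⟨ ∑-cong x (λ i p → trans (cong (λ n → Λ (suc i) * u n) (ℕ.*-identityʳ (suc i)))
                                                                                           (trans (cong (Λ (suc i) *_) (trans (cong (_* v (suc i)) (𝟙-yes (suc i ℕ.≤? x) p)) (*-identityˡ _))) (expand (Λ (suc i)) (ψ (fl x (suc i))) c (ι x * inv (suc i))))) ⟩
        ∑₁ x (λ k → Λ k * ψ (fl x k) - Λ k * (ι x * inv k) + Λ k * c)                  ≡⟨ ∑-+ x (λ i → Λ (suc i) * ψ (fl x (suc i)) - Λ (suc i) * (ι x * inv (suc i))) (λ i → Λ (suc i) * c) ⟩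
        ∑₁ x (λ k → Λ k * ψ (fl x k) - Λ k * (ι x * inv k)) + ∑₁ x (λ k → Λ k * c)     ≡⟨ cong₂ _+_ (trans (∑-- x (λ i → Λ (suc i) * ψ (fl x (suc i))) (λ i → Λ (suc i) * (ι x * inv (suc i)))) (cong (λ z → ∑₁ x (λ k → Λ k * ψ (fl x k)) - z) (sym (xM x))))
                                                                                           (trans (∑-*ʳ x c (λ i → Λ (suc i))) (cong (_* c) (sym (summatory-def Λ x)))) ⟩
        ∑₁ x (λ k → Λ k * ψ (fl x k)) - ι x * M x + ψ x * c                            ∎
      step : ∀ s p → p ≡ ψ x → ℓ 1 * (p - ι x * inv 1 + c) + (s - ι x * M x + ψ x * c) ≡ (L x * ψ x + s) - ι x * L x + c * L x - ι x * M x + c * ψ x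
      step s p refl = lin (s ∷ ψ x ∷ L x ∷ L 1 ∷ ι x ∷ inv 1 ∷ H X ∷ L X ∷ M x ∷ [])
        (from (cong (_* (ψ x - ι x * inv 1 + c)) L-1 & cong (λ z → L x * ι x * z) inv-1 & []))

    -- By `w-1`, the bounded quantity `w 1` is S x - x L x - x M x up to O(x), and Mertens' estimate
    -- replaces x M x by x L x.
    selberg′ : - (# 80 * ι x) ≤ S x - # 2 * (ι x * L x) × S x - # 2 * (ι x * L x) ≤ # 80 * ι x
    selberg′ = step (S x) (w 1) c w-1 (proj₁ w-bounds) (proj₂ w-bounds) (lin (H X ∷ L X ∷ []) (from (proj₁ (γ-bounds 1≤X) & []))) (lin (H X ∷ L X ∷ []) (from (proj₂ (γ-bounds 1≤X) & [])))
      where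
      step : ∀ s w c → w ≡ s - ι x * L x + c * L x - ι x * M x + c * ψ x → - (# 48 * ι x) ≤ w → w ≤ # 48 * ι x → 0F ≤ c → c ≤ # 3 →
             - (# 80 * ι x) ≤ s - # 2 * (ι x * L x) × s - # 2 * (ι x * L x) ≤ # 80 * ι x
      step s w c a p q r t =
          lin (s ∷ w ∷ c ∷ ι x ∷ L x ∷ M x ∷ ψ x ∷ Θ x ∷ []) (from (a & p & *-monoˡ (0≤L 1≤x x≤X) t & *-monoˡ (0≤ψ x) t & L≤2n 1≤x x≤X & Θ≤xM x & Θ-lower x x≤X & ψ≤6x x x≤X & 0≤ι x & []))
        , lin (s ∷ w ∷ c ∷ ι x ∷ L x ∷ M x ∷ ψ x ∷ Θ x ∷ []) (from (a & q & *-nonneg r (0≤L 1≤x x≤X) & *-nonneg r (0≤ψ x) & xM≤Θ+ψ x & Θ-upper x x≤X & ψ≤6x x x≤X & 0≤ι x & []))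

  selberg : ∀ {x} → 1 ℕ.≤ x → x ℕ.≤ X → - (# 80 * ι x) ≤ S x - # 2 * (ι x * L x) × S x - # 2 * (ι x * L x) ≤ # 80 * ι x
  selberg {suc x′} _ p = TatuzawaIseki.selberg′ x′ p

  R : ℕ → F
  R x = ∑₁ x (λ k → Λ k * ψ (fl x k))

  R-mono : ∀ {y z} → y ℕ.≤ z → R y ≤ R z
  R-mono {y} {z} p = ≤-trans (∑-mono y λ i _ → *-monoˡ (Λ-nonneg (suc i)) (ψ-mono (fl-mono (suc i) p)))
                             (∑-monoˡ (λ i → Λ (suc i) * ψ (fl z (suc i))) p λ i → *-nonneg (Λ-nonneg (suc i)) (0≤ψ (fl z (suc i))))

  -- Subtract Selberg's formula at y from that at z. The double sum only grows, so the increase of ψ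
  -- is bounded alone: a Brun-Titchmarsh inequality with constant 2.
  ψ-interval : ∀ {y z} → 1 ℕ.≤ y → y ℕ.≤ z → z ℕ.≤ X →
               L y * (ψ z - ψ y) ≤ # 2 * (ι z - ι y) * L y + # 4 * ι z * ((ι z - ι y) * inv y) + # 160 * ι z
  ψ-interval {y} {z} 1≤y y≤z z≤X = step (R y) (R z) (R-mono y≤z) (proj₁ (selberg 1≤y (ℕ.≤-trans y≤z z≤X))) (proj₂ (selberg (ℕ.≤-trans 1≤y y≤z) z≤X))
    where
    step : ∀ r r′ → r ≤ r′ → - (# 80 * ι y) ≤ (L y * ψ y + r) - # 2 * (ι y * L y) → (L z * ψ z + r′) - # 2 * (ι z * L z) ≤ # 80 * ι z →
           L y * (ψ z - ψ y) ≤ # 2 * (ι z - ι y) * L y + # 4 * ι z * ((ι z - ι y) * inv y) + # 160 * ι z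
    step r r′ p q s = lin (r ∷ r′ ∷ L y ∷ L z ∷ ψ y ∷ ψ z ∷ ι y ∷ ι z ∷ inv y ∷ [])
      (from (p & q & s & *-monoˡ (0≤ι z) (L-diff 1≤y y≤z z≤X) & *-monoˡ (0≤ψ z) (L-mono 1≤y y≤z z≤X) & ι-mono y≤z & []))

  -- If ψ grows by more than twice the length, the excess is nonnegative and its factor `L y` may be
  -- lowered to `ι B`; otherwise the claim is immediate. 10500 = 4 · 35 · 35 + 160 · 35.
  ψ-interval-scaled : ∀ {y z B} → 1 ℕ.≤ y → y ℕ.≤ z → z ℕ.≤ X → ι z ≤ # 35 * ι y → ι B ≤ L y →
                      ι B * (ψ z - ψ y) ≤ # 2 * ι B * (ι z - ι y) + # 10500 * ι y
  ψ-interval-scaled {y} {z} {B} 1≤y y≤z z≤X z≤35y B≤Ly = step (ψ z - ψ y) (ι z - ι y) refl refl main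
    where
    w : (ι z - ι y) * inv y ≤ # 35
    w = lin (ι z ∷ ι y ∷ inv y ∷ []) (from (*-monoˡ (0≤inv y) z≤35y & ι-inv 1≤y & []))
    main : L y * (ψ z - ψ y) ≤ # 2 * (ι z - ι y) * L y + # 10500 * ι y
    main = lin (L y ∷ ψ z ∷ ψ y ∷ ι z ∷ ι y ∷ inv y ∷ []) (from (ψ-interval 1≤y y≤z z≤X & *-monoˡ (0≤ι z) w & z≤35y & []))
    step : ∀ p d → p ≡ ψ z - ψ y → d ≡ ι z - ι y → L y * (ψ z - ψ y) ≤ # 2 * (ι z - ι y) * L y + # 10500 * ι y → ι B * p ≤ # 2 * ι B * d + # 10500 * ι y
    step p d refl refl m with ≤-total (ψ z - ψ y) (# 2 * (ι z - ι y))
    ... | inj₁ q = lin (ψ z ∷ ψ y ∷ ι z ∷ ι y ∷ ι B ∷ []) (from (*-monoˡ (0≤ι B) q & 0≤ι y & []))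
    ... | inj₂ q = lin (ψ z ∷ ψ y ∷ ι z ∷ ι y ∷ ι B ∷ L y ∷ []) (from (*-nonneg (≤⇒0≤ B≤Ly) (≤⇒0≤ q) & m & []))

  L-^ : ∀ {w} k → 1 ℕ.≤ w → L (w ^ k) ≡ ι k * L w
  L-^ {w} zero    1≤w = lin (L 1 ∷ ι 0 ∷ L w ∷ []) (from (L-1 & cong (_* L w) ι0 & []))
  L-^ {w} (suc k) 1≤w = lin (L (w ℕ.* w ^ k) ∷ L w ∷ L (w ^ k) ∷ ι k ∷ ι (suc k) ∷ [])
    (from (L-* {w} {w ^ k} 1≤w (ℕ.m^n>0 w {{≢0 1≤w}} k) & L-^ {w} k 1≤w & cong (_* L w) (ι-suc k) & []))

  L-large : ∀ {x} k → 2 ^ (k ℕ.* 2) ℕ.≤ x → x ℕ.≤ X → ι k ≤ L x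
  L-large {x} k p q = step (L (2 ^ (k ℕ.* 2))) (L-^ (k ℕ.* 2) (s≤s z≤n)) (L-mono (ℕ.m^n>0 2 (k ℕ.* 2)) p q)
    where
    step : ∀ l → l ≡ ι (k ℕ.* 2) * L 2 → l ≤ L x → ι k ≤ L x
    step l e r = lin (l ∷ ι k ∷ ι (k ℕ.* 2) ∷ L 2 ∷ L x ∷ []) (from (e & r & cong (_* L 2) (ι-double k) & *-monoˡ (0≤ι k) 1≤2L2 & []))

  -- The consequences of an interval with little mass.

  -- If (x, x′] carries little mass, Selberg's formula forces the intervals (x/k, x′/k] to carry
  -- nearly twice their length, for most k with respect to the weights Λ k.
  module Deficit (x x′ B K : ℕ)
    (1≤x : 1 ℕ.≤ x) (x≤x′ : x ℕ.≤ x′) (x′≤X : x′ ℕ.≤ X) (x′≤17x : ι x′ ≤ # 17 * ι x)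
    (few : ι B * (ψ x′ - ψ x) ≤ ι x)
    (1≤B : 1 ℕ.≤ B) (B≤K : B ℕ.≤ K) (K≤x : K ℕ.≤ x) (B≤LK : ι B ≤ L K)
    where

    y₀ : ℕ
    y₀ = fl x K

    1≤K : 1 ℕ.≤ K
    1≤K = ℕ.≤-trans 1≤B B≤K

    x≤X : x ℕ.≤ X
    x≤X = ℕ.≤-trans x≤x′ x′≤X

    1≤y₀ : 1 ℕ.≤ y₀
    1≤y₀ = fl-≤ 1≤K (subst (ℕ._≤ x) (sym (ℕ.*-identityʳ K)) K≤x)

    y₀≤x : y₀ ℕ.≤ x
    y₀≤x = fl≤ x K

    I : ℕ → F
    I k = ψ (fl x′ k) - ψ (fl x k)

    -- For n up to x/K the interval starts at or above K, where the logarithm is at least B. The 2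
    -- beyond 10500 pays for rounding x/n, since B ≤ K ≤ x/n.
    interval-upper : ∀ {m n} → 1 ℕ.≤ n → n ℕ.≤ m → n ℕ.≤ y₀ → fl x n ℕ.≤ fl x′ m →
                     ι B * (ψ (fl x′ m) - ψ (fl x n)) ≤ # 2 * ι B * (ι x′ * inv m - ι x * inv n) + # 10502 * (ι x * inv n)
    interval-upper {m} {n} 1≤n n≤m n≤y₀ y≤z =
      lin (ψ z ∷ ψ y ∷ ι y ∷ ι z ∷ ι B ∷ ι x′ ∷ inv m ∷ ι x ∷ inv n ∷ [])
        (from (ψ-interval-scaled 1≤y y≤z z≤X z≤35y (≤-trans B≤LK (L-mono 1≤K K≤y (ℕ.≤-trans y≤z z≤X)))
             & *-monoˡ (0≤ι B) (proj₁ (fl-inv x′ m 1≤m)) & *-monoˡ (0≤ι B) (proj₂ (fl-inv x n 1≤n)) & proj₁ (fl-inv x n 1≤n) & ι-mono (ℕ.≤-trans B≤K K≤y) & []))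
      where
      y = fl x n
      z = fl x′ m
      1≤m : 1 ℕ.≤ m
      1≤m = ℕ.≤-trans 1≤n n≤m
      K≤y : K ℕ.≤ y
      K≤y = fl-≤ 1≤n (subst (ℕ._≤ x) (ℕ.*-comm K n) (≤-fl {x} {K} n≤y₀))
      1≤y : 1 ℕ.≤ y
      1≤y = ℕ.≤-trans 1≤K K≤y
      z≤X : z ℕ.≤ X
      z≤X = ℕ.≤-trans (fl≤ x′ m) x′≤X
      z≤35y : ι z ≤ # 35 * ι y
      z≤35y = lin (ι z ∷ ι y ∷ ι x′ ∷ ι x ∷ inv m ∷ inv n ∷ [])
        (from (proj₁ (fl-inv x′ m 1≤m) & *-monoˡ (0≤ι x′) (inv-antitone 1≤n n≤m) & *-monoˡ (0≤inv n) x′≤17x & proj₂ (fl-inv x n 1≤n) & 1≤ι 1≤y & []))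

    cap : F
    cap = # 2 * ι B * (ι x′ - ι x) + # 10502 * ι x

    -- The amount, scaled by B, by which (x/k, x′/k] falls short of its upper bound. Being
    -- nonnegative, it is small for most k as soon as its weighted sum is.
    Δ : ℕ → F
    Δ k = cap * inv k - ι B * I k

    Δ-nonneg : ∀ {k} → 1 ℕ.≤ k → k ℕ.≤ y₀ → 0F ≤ Δ k
    Δ-nonneg {k} 1≤k k≤y₀ = lin (ι x′ ∷ ι x ∷ ι B ∷ inv k ∷ ψ (fl x′ k) ∷ ψ (fl x k) ∷ [])
      (from (interval-upper 1≤k ℕ.≤-refl k≤y₀ (fl-mono k x≤x′) & []))

    SI SΔ : ℕ → F
    SI = summatory (λ k → Λ k * I k)
    SΔ = summatory (λ k → Λ k * Δ k)

    SΔ≡ : ∀ n → SΔ n ≡ cap * M n - ι B * SI n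
    SΔ≡ zero = step (SΔ 0) (M 0) (SI 0) cap (summatory-0 _) (summatory-0 _) (summatory-0 _)
      where
      step : ∀ s m i c → s ≡ 0F → m ≡ 0F → i ≡ 0F → s ≡ c * m - ι B * i
      step _ _ _ c refl refl refl = lin (ι B ∷ c ∷ []) (from [])
    SΔ≡ (suc n) = step (SΔ n) (SΔ (suc n)) (M n) (M (suc n)) (SI n) (SI (suc n)) cap (I (suc n)) (SΔ≡ n)
        (summatory-suc (λ k → Λ k * Δ k) n) (summatory-suc (λ k → Λ k * inv k) n) (summatory-suc (λ k → Λ k * I k) n)
      where
      step : ∀ s s′ m m′ i i′ c I → s ≡ c * m - ι B * i → s′ ≡ s + Λ (suc n) * (c * inv (suc n) - ι B * I) → m′ ≡ m + Λ (suc n) * inv (suc n) → i′ ≡ i + Λ (suc n) * I → s′ ≡ c * m′ - ι B * i′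
      step s s′ m m′ i i′ c I refl refl refl refl = lin (m ∷ i ∷ c ∷ I ∷ ι B ∷ Λ (suc n) ∷ inv (suc n) ∷ []) (from [])

    SI≡R : SI x′ ≡ R x′ - R x
    SI≡R = trans (summatory-def _ x′) (trans (∑-ext x′ λ i → expand (Λ (suc i)) (ψ (fl x′ (suc i))) (ψ (fl x (suc i))))
        (trans (∑-- x′ (λ i → Λ (suc i) * ψ (fl x′ (suc i))) (λ i → Λ (suc i) * ψ (fl x (suc i)))) (cong (λ z → R x′ - z) short)))
      where
      expand : ∀ a b c → a * (b - c) ≡ a * b - a * c
      expand a b c = lin (a ∷ b ∷ c ∷ []) (from [])
      short : ∑₁ x′ (λ k → Λ k * ψ (fl x k)) ≡ R x
      short = ∑-extend (λ i → Λ (suc i) * ψ (fl x (suc i))) x≤x′ λ i p _ →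
        trans (cong (λ n → Λ (suc i) * ψ n) (ℕ.m<n⇒m/n≡0 {x} {suc i} (s≤s p))) (trans (cong (Λ (suc i) *_) ψ-0) (zeroʳ _))

    λx : ∀ {a} → a ≤ # 2 * (ι x′ - ι x) * inv x → a ≤ # 32
    λx {a} p = lin (a ∷ ι x′ ∷ ι x ∷ inv x ∷ []) (from (p & *-monoˡ (0≤inv x) x′≤17x & ι-inv 1≤x & []))

    L-ratio : L x′ - L x ≤ # 32
    L-ratio = λx (L-diff 1≤x x≤x′ x′≤X)

    L-y₀ : L x - L y₀ ≤ # 4 * ι K
    L-y₀ = lin (L x ∷ L y₀ ∷ ι K ∷ ι x ∷ ι y₀ ∷ inv y₀ ∷ ι (K ℕ.* suc y₀) ∷ ι (suc y₀) ∷ [])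
      (from (L-diff 1≤y₀ y₀≤x x≤X & *-monoˡ (0≤inv y₀) (ι-mono (ℕ.<⇒≤ (fl-upper x K 1≤K))) & cong (inv y₀ *_) (ι-* K (suc y₀)) & cong (λ z → inv y₀ * ι K * z) (ι-suc y₀)
            & cong (ι K *_) (ι-inv 1≤y₀) & ι-inv 1≤y₀ & *-monoˡ (0≤ι K) (inv≤1 1≤y₀) & []))

    -- Selberg's formula at x and at x′: as ψ hardly grows in between, the growth of 2 x log x must
    -- come from the double sum.
    total-lower : # 2 * (ι x′ - ι x) * L x - # 1632 * ι x - L x′ * (ψ x′ - ψ x) ≤ SI x′
    total-lower = step (R x) (R x′) (SI x′) SI≡R (proj₂ (selberg 1≤x x≤X)) (proj₁ (selberg (ℕ.≤-trans 1≤x x≤x′) x′≤X))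
      where
      step : ∀ r r′ s → s ≡ r′ - r → (L x * ψ x + r) - # 2 * (ι x * L x) ≤ # 80 * ι x → - (# 80 * ι x′) ≤ (L x′ * ψ x′ + r′) - # 2 * (ι x′ * L x′) →
             # 2 * (ι x′ - ι x) * L x - # 1632 * ι x - L x′ * (ψ x′ - ψ x) ≤ s
      step r r′ s e p q = lin (r ∷ r′ ∷ s ∷ L x ∷ L x′ ∷ ψ x ∷ ψ x′ ∷ ι x ∷ ι x′ ∷ [])
        (from (e & p & q & x′≤17x & *-monoˡ (0≤ι x′) (L-mono 1≤x x≤x′ x′≤X) & *-monoˡ (0≤ψ x) L-ratio & ψ≤6x x x≤X & []))

    -- The indices beyond `y₀` are out of reach of `interval-upper`, but Chebyshev's bound suffices:
    -- they span only a bounded ratio, so their Mertens sum is O(K).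
    tail-upper : SI x′ - SI y₀ ≤ # 6 * ι x′ * (M x′ - M y₀)
    tail-upper = lin (SI x′ ∷ SI y₀ ∷ ι x′ ∷ M x′ ∷ M y₀ ∷ [])
      (from (increasing (λ k → # 6 * ι x′ * M k - SI k) x′ (ℕ.≤-trans y₀≤x x≤x′) (λ k _ _ →
        step k (suc k) (s≤s z≤n) (SI k) (SI (suc k)) (M k) (M (suc k)) (summatory-suc (λ k → Λ k * I k) k) (summatory-suc (λ k → Λ k * inv k) k)) & []))
      where
      step : ∀ k k′ → 1 ℕ.≤ k′ → ∀ s s′ m m′ → s′ ≡ s + Λ k′ * (ψ (fl x′ k′) - ψ (fl x k′)) → m′ ≡ m + Λ k′ * inv k′ → # 6 * ι x′ * m - s ≤ # 6 * ι x′ * m′ - s′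
      step k k′ p s s′ m m′ refl refl = lin (s ∷ m ∷ ι x′ ∷ Λ k′ ∷ ψ (fl x′ k′) ∷ ψ (fl x k′) ∷ inv k′ ∷ ι (fl x′ k′) ∷ [])
        (from (*-nonneg (Λ-nonneg k′) (0≤ψ (fl x k′)) & *-monoˡ (Λ-nonneg k′) (ψ≤6x (fl x′ k′) (ℕ.≤-trans (fl≤ x′ k′) x′≤X)) & *-monoˡ (Λ-nonneg k′) (proj₁ (fl-inv x′ k′ p)) & []))

    M-range : M x′ - M y₀ ≤ # 40 + # 4 * ι K
    M-range = lin (M x′ ∷ M y₀ ∷ L x′ ∷ L x ∷ L y₀ ∷ ι K ∷ [])
      (from (M-upper (ℕ.≤-trans 1≤x x≤x′) x′≤X & M-lower 1≤y₀ (ℕ.≤-trans y₀≤x x≤X) & L-ratio & L-y₀ & []))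

    SI-lower : # 2 * ι B * (ι x′ - ι x) * L x - # 5712 * (ι B * ι x) - # 408 * (ι B * ι K * ι x) - ι x * L x - # 32 * ι x ≤ ι B * SI y₀
    SI-lower = lin (SI x′ ∷ SI y₀ ∷ ι x′ ∷ ι x ∷ M x′ ∷ M y₀ ∷ L x ∷ L x′ ∷ ψ x ∷ ψ x′ ∷ ι B ∷ ι K ∷ [])
      (from (*-monoˡ (0≤ι B) total-lower & *-monoˡ (0≤ι B) tail′ & *-monoˡ (0≤L (ℕ.≤-trans 1≤x x≤x′) x′≤X) few & *-monoˡ (0≤ι x) L-ratio & []))
      where
      tail′ : SI x′ - SI y₀ ≤ # 102 * ι x * (# 40 + # 4 * ι K)
      tail′ = lin (SI x′ ∷ SI y₀ ∷ ι x′ ∷ ι x ∷ M x′ ∷ M y₀ ∷ ι K ∷ [])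
        (from (tail-upper & *-monoˡ (0≤ι x′) M-range & x′≤17x & *-monoˡ (0≤ι K) x′≤17x & []))

    -- The terms 2 B (x′ - x) `L x` of `cap * M y₀` and of `ι B * SI y₀` cancel. The remaining
    -- constant does not depend on B, so a large B makes the deficit a small fraction of the total.
    SΔ-upper : # 5904 * ι B + # 408 * (ι B * ι K) + # 63044 ≤ L x → SΔ y₀ ≤ # 10504 * (ι x * L x)
    SΔ-upper big = step (SΔ y₀) (M y₀) (SI y₀) (SΔ≡ y₀) SI-lower My₀
      where
      My₀ : M y₀ ≤ L x + # 6
      My₀ = lin (M y₀ ∷ L y₀ ∷ L x ∷ []) (from (M-upper 1≤y₀ (ℕ.≤-trans y₀≤x x≤X) & L-mono 1≤y₀ y₀≤x x≤X & []))
      0≤cap : 0F ≤ # 2 * ι B * (ι x′ - ι x) + # 10502 * ι x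
      0≤cap = lin (ι B ∷ ι x ∷ ι x′ ∷ []) (from (*-nonneg (0≤ι B) (≤⇒0≤ (ι-mono x≤x′)) & 0≤ι x & []))
      step : ∀ s m i → s ≡ (# 2 * ι B * (ι x′ - ι x) + # 10502 * ι x) * m - ι B * i →
             # 2 * ι B * (ι x′ - ι x) * L x - # 5712 * (ι B * ι x) - # 408 * (ι B * ι K * ι x) - ι x * L x - # 32 * ι x ≤ ι B * i →
             m ≤ L x + # 6 → s ≤ # 10504 * (ι x * L x)
      step s m i e p q = lin (s ∷ m ∷ i ∷ ι B ∷ ι K ∷ ι x ∷ ι x′ ∷ L x ∷ [])
        (from (e & p & *-monoˡ 0≤cap q & *-monoˡ (0≤ι B) x′≤17x & *-monoˡ (0≤ι x) big & []))

    module Window (big : # 5904 * ι B + # 408 * (ι B * ι K) + # 63044 ≤ L x)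
      (W : ℕ) (2≤W : 2 ℕ.≤ W) (W≤x : W ℕ.≤ x) (big′ : # 2 * (L W + # 2 * ι W + # 4 * ι K) ≤ L x)
      where

      SΔ-mono : ∀ {m n} → m ℕ.≤ n → n ℕ.≤ y₀ → SΔ m ≤ SΔ n
      SΔ-mono {m} {n} m≤n n≤y₀ = increasing SΔ n m≤n λ k _ q → step (SΔ k) (SΔ (suc k)) (Λ (suc k) * Δ (suc k)) (summatory-suc (λ k → Λ k * Δ k) k)
          (*-nonneg (Λ-nonneg (suc k)) (Δ-nonneg (s≤s z≤n) (ℕ.≤-trans q n≤y₀)))
        where
        step : ∀ s s′ t → s′ ≡ s + t → 0F ≤ t → s ≤ s′
        step s s′ t e p = lin (s ∷ s′ ∷ t ∷ []) (from (e & p & []))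

      1≤W : 1 ℕ.≤ W
      1≤W = ℕ.<⇒≤ 2≤W

      1≤W^ : ∀ k → 1 ℕ.≤ W ^ k
      1≤W^ k = ℕ.m^n>0 W {{≢0 1≤W}} k

      W≤X : W ℕ.≤ X
      W≤X = ℕ.≤-trans W≤x x≤X

      levels : ∀ J → W ^ J ℕ.≤ y₀ → y₀ ℕ.< W ^ suc J → L x ≤ ι J * L W + # 2 * ι W + # 4 * ι K
      levels J p q = step (L v) (L-^ J 1≤W) (L-diff (1≤W^ J) p (ℕ.≤-trans y₀≤x x≤X)) (ι-mono (ℕ.<⇒≤ q)) (ι-* W v) (ι-inv (1≤W^ J))
        where
        v = W ^ J
        step : ∀ l → l ≡ ι J * L W → L y₀ - l ≤ # 2 * (ι y₀ - ι v) * inv v → ι y₀ ≤ ι (W ℕ.* v) → ι (W ℕ.* v) ≡ ι W * ι v → ι v * inv v ≡ 1F → L x ≤ ι J * L W + # 2 * ι W + # 4 * ι K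
        step l e r s u t = lin (l ∷ ι v ∷ inv v ∷ L x ∷ L y₀ ∷ L W ∷ ι J ∷ ι W ∷ ι K ∷ ι y₀ ∷ ι (W ℕ.* v) ∷ [])
          (from (e & r & *-monoˡ (0≤inv v) s & cong (inv v *_) u & cong (ι W *_) t & t & L-y₀ & []))

      0≤LW : 0F ≤ L W
      0≤LW = 0≤L 1≤W W≤X

      few-levels : ∀ J → ι J ≤ # 1 → L x ≤ ι J * L W + # 2 * ι W + # 4 * ι K → ⊥
      few-levels J r s = lin (ι J ∷ L x ∷ L W ∷ ι W ∷ ι K ∷ ι B ∷ []) (from (*-monoˡ 0≤LW r & s & big′ & big & 0≤ι B & *-nonneg (0≤ι B) (0≤ι K) & []))

      slice : ℕ → F
      slice t = SΔ (W ^ suc (suc t)) - SΔ (W ^ suc t)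

      slice-upper : ∀ J {s e b f} → ι (suc J) * f ≤ s → s ≡ e - b → e ≤ SΔ y₀ → 0F ≤ b → L x ≤ ι (suc (suc J)) * L W + # 2 * ι W + # 4 * ι K → f ≤ # 42016 * (ι W * ι x)
      slice-upper J {s} {e} {b} {f} a₁ a₂ a₃ a₄ a₅ = *-cancel (1≤ι {suc J} (s≤s z≤n)) (finish (SΔ y₀) a₃ (SΔ-upper big))
        where
        half : L x ≤ # 2 * (ι (suc J) * L W)
        half = lin (L x ∷ L W ∷ ι (suc J) ∷ ι (suc (suc J)) ∷ ι W ∷ ι K ∷ []) (from (a₅ & big′ & cong (_* L W) (ι-suc (suc J)) & []))
        half′ : L x ≤ # 4 * (ι (suc J) * ι W)
        half′ = lin (L x ∷ L W ∷ ι (suc J) ∷ ι W ∷ []) (from (half & *-monoˡ (0≤ι (suc J)) (L≤2n 1≤W W≤X) & []))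
        finish : ∀ S → e ≤ S → S ≤ # 10504 * (ι x * L x) → ι (suc J) * f ≤ ι (suc J) * (# 42016 * (ι W * ι x))
        finish S r r′ = lin (f ∷ s ∷ e ∷ b ∷ S ∷ ι (suc J) ∷ ι W ∷ ι x ∷ L x ∷ []) (from (a₁ & a₂ & a₄ & r & r′ & *-monoˡ (0≤ι x) half′ & []))

      -- The powers of W cut the range up to `y₀` into about log x / log W slices, and one of them
      -- carries at most the average deficit, from which log x has disappeared. The slices start at
      -- W rather than 1, so that every index in the chosen one is large.
      window : ∃ λ i → W ℕ.* W ^ suc i ℕ.≤ y₀ × SΔ (W ℕ.* W ^ suc i) - SΔ (W ^ suc i) ≤ # 42016 * (ι W * ι x)
      window = cases (power-floor W y₀ 2≤W 1≤y₀)
        where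
        cases : (∃ λ J → W ^ J ℕ.≤ y₀ × y₀ ℕ.< W ^ suc J) → ∃ λ i → W ℕ.* W ^ suc i ℕ.≤ y₀ × SΔ (W ℕ.* W ^ suc i) - SΔ (W ^ suc i) ≤ # 42016 * (ι W * ι x)
        cases (zero , p , q)        = ⊥-elim (few-levels 0 (lin (ι 0 ∷ []) (from (ι0 & []))) (levels 0 p q))
        cases (suc zero , p , q)    = ⊥-elim (few-levels 1 (lin (ι 1 ∷ []) (from (ι-# 1 & []))) (levels 1 p q))
        cases (suc (suc J) , p , q) = choose (≤-average J slice)
          where
          choose : (∃ λ t → t ℕ.< suc J × ι (suc J) * slice t ≤ ∑ (suc J) slice) → _
          choose (t , t≤J , avg) = t , ℕ.≤-trans (ℕ.^-monoʳ-≤ W {{≢0 1≤W}} (s≤s t≤J)) p ,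
            slice-upper J avg (∑-telescope (suc J) (λ t → SΔ (W ^ suc t))) (SΔ-mono p ℕ.≤-refl)
              (subst (_≤ SΔ (W ^ 1)) (summatory-0 (λ k → Λ k * Δ k)) (SΔ-mono z≤n (ℕ.≤-trans (ℕ.^-monoʳ-≤ W {{≢0 1≤W}} (s≤s (z≤n {suc J}))) p))) (levels (suc (suc J)) p q)

  -- The interval (x/n, x′/n] carries twice its length, up to a loss of x/(U n).
  Heavy : ℕ → ℕ → ℕ → ℕ → Set
  Heavy U x x′ n = (# 2 * ι U * (ι x′ - ι x) - ι x) * inv n ≤ ι U * (ψ (fl x′ n) - ψ (fl x n))

  -- Successive heavy n differ by a factor of at most 1 + `e`, so the intervals (x/n, x′/n] overlap
  -- or leave only short gaps. From x′/n₀ down to x′/(100 n₀) they would give ψ the density 39/20.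
  module Chain (x x′ Q j A U P hi : ℕ)
    (1≤x : 1 ℕ.≤ x) (x≤x′ : x ℕ.≤ x′) (x′≤X : x′ ℕ.≤ X)
    (long : ι Q * ι x ≤ (ι j + # 1) * (ι x′ - ι x))
    (1≤j : 1 ℕ.≤ j) (200≤j : # 200 ≤ ι j) (1≤Q : 1 ℕ.≤ Q) (Q≤15j : ι Q ≤ # 15 * ι j)
    (A≡ : ι A ≡ # 4000 * (ι j + # 1)) (U≡ : ι U ≡ # 80 * ι A) (A≤P : A ℕ.≤ P) (P≤hi : # 34000 * ι P ≤ ι hi)
    (hi-small : ∀ {n} → 1 ℕ.≤ n → n ℕ.≤ hi → # 24000000 ≤ ι (fl x n))
    (upper : ∀ {m n} → 1 ℕ.≤ n → n ℕ.≤ m → n ℕ.≤ hi → fl x n ℕ.≤ fl x′ m →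
             ι U * (ψ (fl x′ m) - ψ (fl x n)) ≤ # 2 * ι U * (ι x′ * inv m - ι x * inv n) + ι x * inv n)
    (find : ∀ {y z} → P ℕ.≤ y → y ℕ.< z → (j ℕ.+ Q) ℕ.* y ℕ.≤ j ℕ.* z → z ℕ.≤ hi → ∃ λ n → y ℕ.< n × n ℕ.≤ z × Heavy U x x′ n)
    where

    good : ℕ → Set
    good = Heavy U x x′

    a : F
    a = inv A

    opaque
      r s e : F
      r = ι Q * inv j
      s = ι Q * inv (suc j)
      -- A step multiplies n by at most (1 + 2a)(1 + r) + a, and r ≤ 15 gives 33 = 2 (1 + 15) + 1.
      e = r + # 33 * a

      r≡ : r ≡ ι Q * inv j
      r≡ = refl

      s≡ : s ≡ ι Q * inv (suc j)
      s≡ = refl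

      e≡ : e ≡ r + # 33 * a
      e≡ = refl

    1≤A : 1 ℕ.≤ A
    1≤A = ι-cancel (lin (ι A ∷ ι 1 ∷ ι j ∷ []) (from (A≡ & ι-# 1 & 0≤ι j & [])))

    1≤P : 1 ℕ.≤ P
    1≤P = ℕ.≤-trans 1≤A A≤P

    aA : ι A * a ≡ 1F
    aA = ι-inv 1≤A

    0≤a : 0F ≤ a
    0≤a = 0≤inv A

    0≤r : 0F ≤ r
    0≤r = subst (0F ≤_) (sym r≡) (*-nonneg (0≤ι Q) (0≤inv j))

    0≤s : 0F ≤ s
    0≤s = subst (0F ≤_) (sym s≡) (*-nonneg (0≤ι Q) (0≤inv (suc j)))

    r≤15 : r ≤ # 15
    r≤15 = lin (r ∷ ι Q ∷ inv j ∷ ι j ∷ []) (from (r≡ & *-monoˡ (0≤inv j) Q≤15j & ι-inv 1≤j & []))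

    j+1 : (ι j + # 1) * inv (suc j) ≡ 1F
    j+1 = trans (cong (_* inv (suc j)) (lin (ι j ∷ ι (suc j) ∷ []) (from (ι-suc j & [])))) (ι-inv (s≤s z≤n))

    r≤s : # 200 * r ≤ # 201 * s
    r≤s = lin (r ∷ s ∷ ι Q ∷ inv j ∷ inv (suc j) ∷ [])
      (from (r≡ & s≡ & cong (ι Q *_) (inv-diff 1≤j) & h & []))
      where
      h : # 200 * (ι Q * (inv j * inv (suc j))) ≤ ι Q * inv (suc j)
      h = lin (ι Q ∷ inv j ∷ inv (suc j) ∷ ι j ∷ [])
        (from (*-monoˡ (*-nonneg (0≤ι Q) (*-nonneg (0≤inv j) (0≤inv (suc j)))) 200≤j & cong (_* (ι Q * inv (suc j))) (ι-inv 1≤j) & []))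

    a≤s : # 4000 * a ≤ s
    a≤s = lin (a ∷ s ∷ ι Q ∷ inv (suc j) ∷ ι A ∷ ι j ∷ [])
      (from (s≡ & cong (_* inv (suc j)) aA & cong (_* (a * inv (suc j))) A≡ & cong (_* (# 4000 * a)) j+1 & *-monoˡ (0≤inv (suc j)) (1≤ι 1≤Q) & []))

    a≤1 : a ≤ # 1
    a≤1 = lin (a ∷ []) (from (inv≤1 1≤A & []))

    Ua : ι U * a ≡ # 80
    Ua = lin (ι U ∷ a ∷ ι A ∷ []) (from (cong (_* a) U≡ & aA & []))

    Us : # 4000 ≤ ι U * s
    Us = lin (ι U ∷ a ∷ s ∷ []) (from (*-monoˡ (0≤ι U) a≤s & Ua & []))

    s≤length : s * ι x ≤ ι x′ - ι x
    s≤length = lin (s ∷ ι Q ∷ inv (suc j) ∷ ι x ∷ ι x′ ∷ ι j ∷ []) (from (cong (_* ι x) s≡ & *-monoˡ (0≤inv (suc j)) long & cong (_* (ι x′ - ι x)) j+1 & []))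

    1≤U : # 1 ≤ ι U
    1≤U = lin (ι U ∷ ι A ∷ []) (from (U≡ & 1≤ι 1≤A & []))

    dense : # 39 * (ι U * (ι x′ * e)) ≤ # 20 * ((# 2 * ι U * (ι x′ - ι x) - ι x) * (# 1 + e))
    dense = subst (λ z → # 39 * (ι U * (z * e)) ≤ # 20 * ((# 2 * ι U * (ι x′ - ι x) - ι x) * (# 1 + e))) (lin (ι x ∷ ι x′ ∷ []) (from []))
      (dense-enough {r = r} {s = s} {a = a} (0≤ι x) 0≤s s≤length r≤s a≤s r≤15 0≤r 0≤a a≤1 (0≤ι U) Us e≡)

    below : ℕ → ℕ
    below y = suc (fl ((j ℕ.+ Q) ℕ.* y) j)

    below-long : ∀ y → (j ℕ.+ Q) ℕ.* y ℕ.≤ j ℕ.* below y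
    below-long y = ℕ.<⇒≤ (fl-upper ((j ℕ.+ Q) ℕ.* y) j 1≤j)

    y<below : ∀ y → y ℕ.< below y
    y<below y = ℕ.*-cancelˡ-< j y (below y) (ℕ.≤-<-trans (ℕ.*-monoˡ-≤ y (ℕ.m≤m+n j Q)) (fl-upper ((j ℕ.+ Q) ℕ.* y) j 1≤j))

    below-upper : ∀ y → ι (below y) ≤ (# 1 + r) * ι y + # 1
    below-upper y = lin (ι (below y) ∷ ι (fl v j) ∷ ι v ∷ ι j ∷ ι Q ∷ ι (j ℕ.+ Q) ∷ ι y ∷ inv j ∷ r ∷ [])
      (from (cong (_* ι y) r≡ & ι-suc (fl v j) & proj₁ (fl-inv v j 1≤j) & cong (_* inv j) (ι-* (j ℕ.+ Q) y) & cong (λ z → z * ι y * inv j) (ι-+ j Q) & cong (_* ι y) (ι-inv 1≤j) & []))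
      where v = (j ℕ.+ Q) ℕ.* y

    -- It does not increase from n to n′ exactly if ψ(x′/n) - ψ(x′/n′) is at least 39/20 of x′/n -
    -- x′/n′.
    potential : ℕ → F
    potential n = # 20 * ψ (fl x′ n) - # 39 * (ι x′ * inv n)

    step : ∀ {n} → P ℕ.≤ n → good n → # 20 * ι n ≤ ι hi → ∃ λ n′ → n ℕ.< n′ × good n′ × potential n′ ≤ potential n
    step {n} P≤n g 20n≤hi = n′ , ℕ.<-trans n<y y<n′ , g′ , conclude (ℕ.≤-total (fl x n) (fl x′ n′))
      where
      1≤n : 1 ℕ.≤ n
      1≤n = ℕ.≤-trans 1≤P P≤n
      y : ℕ
      -- The search for the next index starts a relative 1/A beyond n. Every step then covers a
      -- definite proportion, which pays for the error terms when the intervals overlap.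
      y = suc (n ℕ.+ fl n A)
      n<y : n ℕ.< y
      n<y = s≤s (ℕ.m≤m+n n (fl n A))
      1≤na : # 1 ≤ ι n * a
      1≤na = lin (ι n ∷ a ∷ ι A ∷ []) (from (*-monoˡ 0≤a (ι-mono (ℕ.≤-trans A≤P P≤n)) & aA & []))
      ι-y : ι y ≡ # 1 + (ι n + ι (fl n A))
      ι-y = trans (ι-suc (n ℕ.+ fl n A)) (trans (cong (1F +_) (ι-+ n (fl n A))) (lin (ι n ∷ ι (fl n A) ∷ []) (from [])))
      y-upper : ι y ≤ ι n + # 2 * (ι n * a)
      y-upper = lin (ι y ∷ ι n ∷ a ∷ ι (fl n A) ∷ []) (from (ι-y & proj₁ (fl-inv n A 1≤A) & 1≤na & []))
      y-lower : ι n + ι n * a ≤ ι y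
      y-lower = lin (ι y ∷ ι n ∷ a ∷ ι (fl n A) ∷ []) (from (ι-y & proj₂ (fl-inv n A 1≤A) & []))
      z : ℕ
      z = below y
      z-upper : ι z ≤ ι n + ι n * e
      z-upper = lin (ι z ∷ ι y ∷ ι n ∷ r ∷ a ∷ e ∷ [])
        (from (cong (ι n *_) e≡ & below-upper y & y-upper & *-monoˡ 0≤r y-upper & 1≤na & *-monoˡ (*-nonneg (0≤ι n) 0≤a) r≤15 & []))
      e≤19 : e ≤ # 19
      e≤19 = lin (r ∷ a ∷ s ∷ e ∷ []) (from (e≡ & r≤15 & a≤s & r≤s & s≤r & []))
        where
        s≤r : s ≤ r
        s≤r = subst₂ _≤_ (sym s≡) (sym r≡) (*-monoˡ (0≤ι Q) (inv-antitone-suc 1≤j))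
      z≤hi : z ℕ.≤ hi
      z≤hi = ι-cancel (lin (ι z ∷ ι n ∷ e ∷ ι hi ∷ []) (from (z-upper & *-monoˡ (0≤ι n) e≤19 & 20n≤hi & [])))
      found = find (ℕ.≤-trans P≤n (ℕ.<⇒≤ n<y)) (y<below y) (below-long y) z≤hi
      n′ : ℕ
      n′ = proj₁ found
      y<n′ : y ℕ.< n′
      y<n′ = proj₁ (proj₂ found)
      n′≤z : n′ ℕ.≤ z
      n′≤z = proj₁ (proj₂ (proj₂ found))
      g′ : good n′
      g′ = proj₂ (proj₂ (proj₂ found))
      n≤n′ : n ℕ.≤ n′
      n≤n′ = ℕ.<⇒≤ (ℕ.<-trans n<y y<n′)
      1≤n′ : 1 ℕ.≤ n′
      1≤n′ = ℕ.≤-trans 1≤n n≤n′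
      h h′ : F
      h  = inv n
      h′ = inv n′
      0≤h : 0F ≤ h
      0≤h = 0≤inv n
      0≤h′ : 0F ≤ h′
      0≤h′ = 0≤inv n′
      gap-lower : h′ + a * h′ ≤ h
      gap-lower = lin (h′ ∷ h ∷ a ∷ ι n ∷ ι n′ ∷ ι y ∷ [])
        (from (*-monoˡ (*-nonneg 0≤h 0≤h′) (≤-trans y-lower (ι-mono (ℕ.<⇒≤ y<n′))) & cong (_* h) (ι-inv 1≤n′) & cong (_* (h′ + a * h′)) (ι-inv 1≤n) & []))
      gap-upper : h ≤ h′ + e * h′
      gap-upper = lin (h′ ∷ h ∷ e ∷ ι n ∷ ι n′ ∷ [])
        (from (*-monoˡ (*-nonneg 0≤h 0≤h′) (≤-trans (ι-mono n′≤z) z-upper) & cong (_* h) (ι-inv 1≤n′) & cong (_* (h′ + e * h′)) (ι-inv 1≤n) & []))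
      0≤x′ = 0≤ι x′
      u : F
      u = ι U
      conclude : fl x n ℕ.≤ fl x′ n′ ⊎ fl x′ n′ ℕ.≤ fl x n → potential n′ ≤ potential n
      -- Overlap: from the mass of the heavy interval, subtract the upper bound for the part (x/n,
      -- x′/n′] that belongs to the next one.
      conclude (inj₁ meets) = finish (ψ (fl x′ n)) (ψ (fl x n)) (ψ (fl x′ n′)) g (upper 1≤n n≤n′ (ι-cancel (lin (ι n ∷ ι hi ∷ []) (from (20n≤hi & 0≤ι n & [])))) meets)
        where
        q₁ : # 80 * h ≤ # 2 * (u * (h - h′))
        q₁ = lin (u ∷ h ∷ h′ ∷ a ∷ [])
          (from (*-monoˡ (0≤ι U) gap-lower & cong (_* h′) Ua & cong (_* h) Ua & *-monoˡ (0≤ι U) (*-monoˡ (≤⇒0≤ a≤1) (inv-antitone 1≤n n≤n′)) & []))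
        q₂ : # 40 * (ι x * h) ≤ ι x′ * (u * (h - h′))
        q₂ = lin (u ∷ h ∷ h′ ∷ ι x ∷ ι x′ ∷ []) (from (*-monoˡ 0≤x′ q₁ & *-monoˡ 0≤h (ι-mono x≤x′) & []))
        finish : ∀ p₁ p₂ p₃ → (# 2 * u * (ι x′ - ι x) - ι x) * h ≤ u * (p₁ - p₂) → u * (p₃ - p₂) ≤ # 2 * u * (ι x′ * h′ - ι x * h) + ι x * h →
                 # 20 * p₃ - # 39 * (ι x′ * h′) ≤ # 20 * p₁ - # 39 * (ι x′ * h)
        finish p₁ p₂ p₃ b c = *-cancel 1≤U (lin (p₁ ∷ p₂ ∷ p₃ ∷ u ∷ ι x ∷ ι x′ ∷ h ∷ h′ ∷ []) (from (b & c & q₂ & [])))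
      -- Gap: the heavy interval alone must have density 39/20 relative to the whole step. It does,
      -- because `s` is at least 200/201 of `r`.
      conclude (inj₂ apart) = finish (ψ (fl x′ n)) (ψ (fl x n)) (ψ (fl x′ n′)) g (ψ-mono apart)
        where
        c : F
        c = # 2 * u * (ι x′ - ι x) - ι x
        1≤1+e : # 1 ≤ # 1 + e
        1≤1+e = lin (r ∷ a ∷ e ∷ []) (from (e≡ & 0≤r & 0≤a & []))
        q : # 39 * (u * (ι x′ * (h - h′))) ≤ # 20 * (c * h)
        q = *-cancel 1≤1+e (lin (u ∷ ι x ∷ ι x′ ∷ h ∷ h′ ∷ e ∷ [])
          (from (*-monoˡ (*-nonneg (0≤ι U) 0≤x′) gap-upper & *-monoˡ 0≤h dense & [])))
        finish : ∀ p₁ p₂ p₃ → (# 2 * u * (ι x′ - ι x) - ι x) * h ≤ u * (p₁ - p₂) → p₃ ≤ p₂ →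
                 # 20 * p₃ - # 39 * (ι x′ * h′) ≤ # 20 * p₁ - # 39 * (ι x′ * h)
        finish p₁ p₂ p₃ b d = *-cancel 1≤U (lin (p₁ ∷ p₂ ∷ p₃ ∷ u ∷ ι x ∷ ι x′ ∷ h ∷ h′ ∷ []) (from (b & *-monoˡ (0≤ι U) d & q & [])))

    start : ∃ λ n → P ℕ.≤ n × good n × ι n ≤ # 17 * ι P
    start = conclude (find ℕ.≤-refl (y<below P) (below-long P) (ι-cancel (lin (ι (below P) ∷ ι P ∷ ι hi ∷ []) (from (z≤17P & P≤hi & 0≤ι P & [])))))
      where
      z≤17P : ι (below P) ≤ # 17 * ι P
      z≤17P = lin (ι (below P) ∷ ι P ∷ r ∷ []) (from (below-upper P & *-monoˡ (0≤ι P) r≤15 & 1≤ι 1≤P & []))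
      conclude : (∃ λ n → P ℕ.< n × n ℕ.≤ below P × good n) → ∃ λ n → P ℕ.≤ n × good n × ι n ≤ # 17 * ι P
      conclude (n , P<n , n≤z , g) = n , ℕ.<⇒≤ P<n , g , ≤-trans (ι-mono n≤z) z≤17P

    chain : ∀ {n₀ end} → ι n₀ ≤ # 17 * ι P → 1 ℕ.≤ end → ι end ≡ # 100 * ι n₀ →
            ∀ fuel {n} → P ℕ.≤ n → good n → end ℕ.≤ fuel ℕ.+ n → - (# 39 * (ι x′ * inv end)) ≤ potential n
    chain {n₀} {end} n₀≤17P 1≤end ι-end = go
      where
      at-end : ∀ n → end ℕ.≤ n → - (# 39 * (ι x′ * inv end)) ≤ potential n
      at-end n end≤n = lin (ι x′ ∷ inv end ∷ inv n ∷ ψ (fl x′ n) ∷ []) (from (*-monoˡ (0≤ι x′) (inv-antitone 1≤end end≤n) & 0≤ψ (fl x′ n) & []))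
      inside : ∀ n → n ℕ.≤ end → # 20 * ι n ≤ ι hi
      inside n n≤end = lin (ι n ∷ ι end ∷ ι n₀ ∷ ι P ∷ ι hi ∷ []) (from (ι-mono n≤end & ι-end & n₀≤17P & P≤hi & []))
      Goal : ℕ → Set
      Goal n = - (# 39 * (ι x′ * inv end)) ≤ potential n
      go : ∀ fuel {n} → P ℕ.≤ n → good n → end ℕ.≤ fuel ℕ.+ n → Goal n
      continue : ∀ fuel {n} → P ℕ.≤ n → end ℕ.≤ suc fuel ℕ.+ n → (∃ λ n′ → n ℕ.< n′ × good n′ × potential n′ ≤ potential n) → Goal n
      go fuel {n} P≤n g b = cases fuel b (ℕ.≤-total end n)
        where
        cases : ∀ fuel → end ℕ.≤ fuel ℕ.+ n → end ℕ.≤ n ⊎ n ℕ.≤ end → Goal n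
        cases fuel       b (inj₁ end≤n) = at-end n end≤n
        cases zero       b (inj₂ n≤end) = at-end n b
        cases (suc fuel) b (inj₂ n≤end) = continue fuel P≤n b (step P≤n g (inside n n≤end))
      continue fuel {n} P≤n b (n′ , n<n′ , g′ , p) =
        ≤-trans (go fuel (ℕ.≤-trans P≤n (ℕ.<⇒≤ n<n′)) g′ (ℕ.≤-trans b (ℕ.≤-trans (ℕ.≤-reflexive (sym (ℕ.+-suc fuel n))) (ℕ.+-monoʳ-≤ fuel n<n′)))) p

    absurd : ⊥
    absurd = from-start start
      where
      from-start : (∃ λ n → P ℕ.≤ n × good n × ι n ≤ # 17 * ι P) → ⊥
      from-start (n₀ , P≤n₀ , g , n₀≤17P) = final (n₀ ℕ.* 100) (ℕ.*-mono-≤ 1≤n₀ (s≤s (z≤n {99}))) (trans (ι-* n₀ 100) (trans (cong (ι n₀ *_) (ι-# 100)) (*-comm _ _)))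
        where
        1≤n₀ : 1 ℕ.≤ n₀
        1≤n₀ = ℕ.≤-trans 1≤P P≤n₀
        n₀≤hi : n₀ ℕ.≤ hi
        n₀≤hi = ι-cancel (lin (ι n₀ ∷ ι P ∷ ι hi ∷ []) (from (n₀≤17P & P≤hi & 0≤ι P & [])))
        Y : ℕ
        Y = fl x′ n₀
        bigY : # 24000000 ≤ ι Y
        bigY = ≤-trans (hi-small 1≤n₀ n₀≤hi) (ι-mono (fl-mono n₀ x≤x′))
        1≤Y : 1 ℕ.≤ Y
        1≤Y = ι-cancel (lin (ι 1 ∷ ι Y ∷ []) (from (bigY & ι-# 1 & [])))
        Y≤X : Y ℕ.≤ X
        Y≤X = ℕ.≤-trans (fl≤ x′ n₀) x′≤X
        final : ∀ end → 1 ℕ.≤ end → ι end ≡ # 100 * ι n₀ → ⊥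
        final end 1≤end ι-end = contra (ψ Y) (ι x′ * inv n₀) (ι x′ * inv end) scaled
            (chain n₀≤17P 1≤end ι-end end P≤n₀ g (ℕ.m≤m+n end n₀)) (12ψ≤23x 1≤Y Y≤X bigY) bigY (proj₁ (fl-inv x′ n₀ 1≤n₀))
          where
          scaled : # 100 * (ι x′ * inv end) ≡ ι x′ * inv n₀
          scaled = lin (ι x′ ∷ inv end ∷ inv n₀ ∷ ι n₀ ∷ ι end ∷ [])
            (from (cong (_* (ι x′ * inv n₀)) (ι-inv 1≤end) & cong (_* (inv end * (ι x′ * inv n₀))) ι-end & cong (_* (ι x′ * inv end)) (ι-inv 1≤n₀) & []))
          -- 39/20 · 99/100 = 1.9305 still exceeds 23/12, which is why the chain is followed up to
          -- 100 n₀.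
          contra : ∀ p h h′ → # 100 * h′ ≡ h → - (# 39 * h′) ≤ # 20 * p - # 39 * h → # 12 * p ≤ # 23 * ι Y → # 24000000 ≤ ι Y → ι Y ≤ h → ⊥
          contra p h h′ a b c d f = lin (p ∷ h ∷ h′ ∷ ι Y ∷ []) (from (a & b & c & d & f & []))

-- A rational logarithm from harmonic numbers.

harmonic : ℕ → F
harmonic = summatory inv

harmonic-block : ∀ y n → 1 ℕ.≤ y → ι n * inv (y ℕ.+ n) ≤ harmonic (y ℕ.+ n) - harmonic y × harmonic (y ℕ.+ n) - harmonic y ≤ ι n * inv y
harmonic-block y zero 1≤y rewrite ℕ.+-identityʳ y =
    lin (ι 0 ∷ inv y ∷ harmonic y ∷ []) (from (cong (_* inv y) ι0 & []))
  , lin (ι 0 ∷ inv y ∷ harmonic y ∷ []) (from (cong (_* inv y) ι0 & []))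
harmonic-block y (suc n) 1≤y rewrite ℕ.+-suc y n with harmonic-block y n 1≤y
... | p , q =
    lin (ι n ∷ ι (suc n) ∷ inv (y ℕ.+ n) ∷ inv (suc (y ℕ.+ n)) ∷ harmonic y ∷ harmonic (y ℕ.+ n) ∷ harmonic (suc (y ℕ.+ n)) ∷ [])
      (from (p & summatory-suc inv (y ℕ.+ n) & *-monoˡ (0≤ι n) (inv-antitone-suc (ℕ.≤-trans 1≤y (ℕ.m≤m+n y n))) & cong (_* inv (suc (y ℕ.+ n))) (ι-suc n) & []))
  , lin (ι n ∷ ι (suc n) ∷ inv y ∷ inv (suc (y ℕ.+ n)) ∷ harmonic y ∷ harmonic (y ℕ.+ n) ∷ harmonic (suc (y ℕ.+ n)) ∷ [])
      (from (q & summatory-suc inv (y ℕ.+ n) & inv-antitone 1≤y (ℕ.≤-trans (ℕ.m≤m+n y n) (ℕ.n≤1+n _)) & cong (_* inv y) (ι-suc n) & []))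

ι-inv-* : ∀ {m n} → 1 ℕ.≤ m → 1 ℕ.≤ n → ι m * inv (n ℕ.* m) ≡ inv n
ι-inv-* {m} {n} p q = trans (cong (ι m *_) (inv-* q p)) (lin (ι m ∷ inv m ∷ inv n ∷ []) (from (cong (inv n *_) (ι-inv p) & [])))

harmonic-scale : ∀ k n → 1 ℕ.≤ k → 1 ℕ.≤ n → inv (suc k) ≤ harmonic (suc k ℕ.* n) - harmonic (k ℕ.* n) × harmonic (suc k ℕ.* n) - harmonic (k ℕ.* n) ≤ inv k
harmonic-scale k n 1≤k 1≤n = subst (λ z → inv (suc k) ≤ harmonic z - harmonic (k ℕ.* n) × harmonic z - harmonic (k ℕ.* n) ≤ inv k) (ℕ.+-comm (k ℕ.* n) n)
  ( subst (_≤ h′ - h) (trans (cong (λ z → ι n * inv z) (ℕ.+-comm (k ℕ.* n) n)) (ι-inv-* {n} {suc k} 1≤n (s≤s z≤n))) (proj₁ block)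
  , subst (h′ - h ≤_) (ι-inv-* 1≤n 1≤k) (proj₂ block))
  where
  h h′ : F
  h  = harmonic (k ℕ.* n)
  h′ = harmonic (k ℕ.* n ℕ.+ n)
  block : ι n * inv (k ℕ.* n ℕ.+ n) ≤ h′ - h × h′ - h ≤ ι n * inv (k ℕ.* n)
  block = harmonic-block (k ℕ.* n) n (ℕ.*-mono-≤ 1≤k 1≤n)

-- log n is approximated by 1/(M+1) + … + 1/(n M); forcing additivity on the primes only perturbs this by n/M.
module Construction (M : ℕ) (1≤M : 1 ℕ.≤ M) where

  a : ℕ → F
  a n = harmonic (n ℕ.* M) - harmonic M

  open Additive a public

  a-nonneg : ∀ {n} → 1 ℕ.≤ n → 0F ≤ a n
  a-nonneg {n} p = ≤⇒0≤ (summatory-mono 0≤inv (ℕ.m≤n*m M n {{≢0 p}}))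

  a-1 : a 1 ≡ 0F
  a-1 = trans (cong (λ z → harmonic z - harmonic M) (ℕ.*-identityˡ M)) (-‿inverseʳ _)

  a-suc : ∀ {n} → 1 ℕ.≤ n → inv (suc n) ≤ a (suc n) - a n × a (suc n) - a n ≤ inv n
  a-suc {n} 1≤n = step (harmonic (n ℕ.* M)) (harmonic (suc n ℕ.* M)) (harmonic M) (harmonic-scale n M 1≤n 1≤M)
    where
    step : ∀ h h′ m → inv (suc n) ≤ h′ - h × h′ - h ≤ inv n → inv (suc n) ≤ (h′ - m) - (h - m) × (h′ - m) - (h - m) ≤ inv n
    step h h′ m (p , q) = lin (inv (suc n) ∷ h′ ∷ h ∷ m ∷ []) (from (p & [])) , lin (inv n ∷ h′ ∷ h ∷ m ∷ []) (from (q & []))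

  -- The difference H(k n) - H(k) increases with k, and becomes decreasing when 1/k is added. At k =
  -- M it equals `a n`, at k = m M it equals `a (m n) - a m`.
  a-* : ∀ {m n} → 1 ℕ.≤ m → 1 ℕ.≤ n → a m + a n ≤ a (m ℕ.* n) × a (m ℕ.* n) ≤ a m + a n + inv M
  a-* {m} {n} 1≤m 1≤n = result
    where
    g : ℕ → F
    g k = harmonic (k ℕ.* n) - harmonic k
    M≤mM : M ℕ.≤ m ℕ.* M
    M≤mM = ℕ.m≤n*m M m {{≢0 1≤m}}
    up : g M ≤ g (m ℕ.* M)
    up = increasing g (m ℕ.* M) M≤mM λ i p _ →
      lin (harmonic (i ℕ.* n) ∷ harmonic (suc i ℕ.* n) ∷ harmonic i ∷ harmonic (suc i) ∷ inv (suc i) ∷ [])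
        (from (summatory-suc inv i & proj₁ (harmonic-scale i n (ℕ.≤-trans 1≤M p) 1≤n) & []))
    down : inv (m ℕ.* M) + g (m ℕ.* M) ≤ inv M + g M
    down = lin (inv (m ℕ.* M) ∷ inv M ∷ harmonic (m ℕ.* M ℕ.* n) ∷ harmonic (m ℕ.* M) ∷ harmonic (M ℕ.* n) ∷ harmonic M ∷ [])
      (from (increasing (λ k → - (inv k + g k)) (m ℕ.* M) M≤mM (λ i p _ →
        lin (harmonic (i ℕ.* n) ∷ harmonic (suc i ℕ.* n) ∷ harmonic i ∷ harmonic (suc i) ∷ inv (suc i) ∷ inv i ∷ [])
          (from (summatory-suc inv i & proj₂ (harmonic-scale i n (ℕ.≤-trans 1≤M p) 1≤n) & []))) & []))
    e₁ : m ℕ.* M ℕ.* n ≡ m ℕ.* n ℕ.* M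
    e₁ = trans (ℕ.*-assoc m M n) (trans (cong (m ℕ.*_) (ℕ.*-comm M n)) (sym (ℕ.*-assoc m n M)))
    result : a m + a n ≤ a (m ℕ.* n) × a (m ℕ.* n) ≤ a m + a n + inv M
    result =
        lin (harmonic (m ℕ.* n ℕ.* M) ∷ harmonic (m ℕ.* M ℕ.* n) ∷ harmonic (m ℕ.* M) ∷ harmonic (M ℕ.* n) ∷ harmonic (n ℕ.* M) ∷ harmonic M ∷ [])
          (from (up & cong harmonic e₁ & cong harmonic (ℕ.*-comm M n) & []))
      , lin (inv (m ℕ.* M) ∷ inv M ∷ harmonic (m ℕ.* n ℕ.* M) ∷ harmonic (m ℕ.* M ℕ.* n) ∷ harmonic (m ℕ.* M) ∷ harmonic (M ℕ.* n) ∷ harmonic (n ℕ.* M) ∷ harmonic M ∷ [])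
          (from (down & 0≤inv (m ℕ.* M) & cong harmonic e₁ & cong harmonic (ℕ.*-comm M n) & []))

  error : ℕ → Set
  error n = L n ≤ a n × a n ≤ L n + ι n * inv M

  private
    -- Each further prime factor costs at most 1/M by `a-*`. The total stays below n/M because m + 1
    -- ≤ p m.
    product-error : ∀ ps → All Prime ps → 1 ℕ.≤ ListAction.product ps × error (ListAction.product ps)
    product-error [] [] = ℕ.≤-refl
      , base (L 1) (a 1) L-1 a-1
      where
      base : ∀ l a → l ≡ 0F → a ≡ 0F → l ≤ a × a ≤ l + ι 1 * inv M
      base l a e f = lin (l ∷ a ∷ []) (from (e & f & [])) , lin (l ∷ a ∷ ι 1 ∷ inv M ∷ []) (from (e & f & *-nonneg (0≤ι 1) (0≤inv M) & []))
    product-error (p ∷ ps) (pp ∷ pps) with product-error ps pps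
    ... | 1≤m , lo , hi = ℕ.*-mono-≤ 1≤p 1≤m
        , step₁ (a p) (a m) (L m) (a (p ℕ.* m)) (L (p ℕ.* m)) (L-prime-* pp 1≤m) (proj₁ (a-* 1≤p 1≤m)) lo
        , step₂ (a p) (a m) (L m) (a (p ℕ.* m)) (L (p ℕ.* m)) (L-prime-* pp 1≤m) (proj₂ (a-* 1≤p 1≤m)) hi
      where
      m = ListAction.product ps
      1≤p : 1 ℕ.≤ p
      1≤p = ℕ.<⇒≤ (1<prime pp)
      m<pm : suc m ℕ.≤ p ℕ.* m
      m<pm = ℕ.≤-trans (ℕ.m<m*n m p {{≢0 1≤m}} (1<prime pp)) (ℕ.≤-reflexive (ℕ.*-comm m p))
      step₁ : ∀ ap am lm apm lpm → lpm ≡ ap + lm → ap + am ≤ apm → lm ≤ am → lpm ≤ apm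
      step₁ ap am lm apm lpm e p q = lin (ap ∷ am ∷ lm ∷ apm ∷ lpm ∷ []) (from (e & p & q & []))
      step₂ : ∀ ap am lm apm lpm → lpm ≡ ap + lm → apm ≤ ap + am + inv M → am ≤ lm + ι m * inv M → apm ≤ lpm + ι (p ℕ.* m) * inv M
      step₂ ap am lm apm lpm e r q = lin (ap ∷ am ∷ lm ∷ apm ∷ lpm ∷ ι m ∷ ι (suc m) ∷ ι (p ℕ.* m) ∷ inv M ∷ [])
        (from (e & r & q & *-nonneg (≤⇒0≤ (ι-mono m<pm)) (0≤inv M) & cong (_* inv M) (ι-suc m) & []))

  error-bounds : ∀ {n} → 1 ℕ.≤ n → error n
  error-bounds {n} 1≤n = subst error (sym isFactorisation) (proj₂ (product-error factors factorsPrime))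
    where open PrimeFactorisation (factorise n {{≢0 1≤n}})

module LogConstruction (X K : ℕ) (1≤K : 1 ℕ.≤ K) (cubes : ∀ {n} → n ℕ.< X → suc n ℕ.* (n ℕ.* suc n) ℕ.≤ K) where

  opaque
    M : ℕ
    -- An even M allows `a 2` = H(4K) - H(2K) to be split at 3K, which puts it between 7/12 and 5/6.
    M = K ℕ.* 2

    M≡ : M ≡ 2 ℕ.* K
    M≡ = ℕ.*-comm K 2

    K≤M : K ℕ.≤ M
    K≤M = ℕ.m≤m*n K 2

  1≤M : 1 ℕ.≤ M
  1≤M = ℕ.≤-trans 1≤K K≤M

  open Construction M 1≤M

  -- The defect of additivity fits into the slack 1/n - 1/(n + 1) of `Log`, since M is at least n (n
  -- + 1)².
  small : ∀ n → 1 ℕ.≤ n → n ℕ.< X → ι (suc n) * inv M ≤ inv n - inv (suc n)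
  small n 1≤n n<X = lin (ι n ∷ ι (suc n) ∷ inv n ∷ inv (suc n) ∷ inv M ∷ [])
    (from (inv-diff 1≤n & bound & []))
    where
    n′ = suc n
    prod : ι n′ * (ι n * ι n′) ≤ ι M
    prod = subst (_≤ ι M) (trans (ι-* n′ (n ℕ.* n′)) (cong (ι n′ *_) (ι-* n n′))) (ι-mono (ℕ.≤-trans (cubes n<X) K≤M))
    p : 0F ≤ inv n * inv n′ * inv M
    p = *-nonneg (*-nonneg (0≤inv n) (0≤inv n′)) (0≤inv M)
    bound : ι n′ * inv M ≤ inv n * inv n′
    bound = lin (ι n ∷ ι n′ ∷ inv n ∷ inv n′ ∷ inv M ∷ ι M ∷ [])
      (from (*-monoˡ p prod & cong (_* (inv n * inv n′)) (ι-inv 1≤M) & cong (_* (ι n′ * inv M * (ι n′ * inv n′))) (ι-inv 1≤n) & cong (_* (ι n′ * inv M)) (ι-inv {n′} (s≤s z≤n)) & []))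

  step≤ : ∀ n → 1 ℕ.≤ n → ∀ l l′ a a′ → l′ ≤ a′ → a ≤ l + ι n * inv M → a′ - a ≤ inv n → ι (suc n) * inv M ≤ inv n - inv (suc n) → l′ - l ≤ # 2 * inv n - inv (suc n)
  step≤ n _ l l′ a a′ p q r s = lin (l ∷ l′ ∷ a ∷ a′ ∷ ι n ∷ ι (suc n) ∷ inv n ∷ inv (suc n) ∷ inv M ∷ []) (from (p & q & r & s & cong (_* inv M) (ι-suc n) & 0≤inv M & []))

  step≥ : ∀ n → 1 ℕ.≤ n → ∀ l l′ a a′ → a′ ≤ l′ + ι (suc n) * inv M → l ≤ a → inv (suc n) ≤ a′ - a → ι (suc n) * inv M ≤ inv n - inv (suc n) → # 2 * inv (suc n) - inv n ≤ l′ - l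
  step≥ n _ l l′ a a′ p q r s = lin (l ∷ l′ ∷ a ∷ a′ ∷ ι (suc n) ∷ inv n ∷ inv (suc n) ∷ inv M ∷ []) (from (p & q & r & s & []))

  h2 h3 h4 : F
  h2 = harmonic (2 ℕ.* K)
  h3 = harmonic (3 ℕ.* K)
  h4 = harmonic (4 ℕ.* K)

  a-2 : a 2 ≡ h4 - h2
  a-2 = cong₂ (λ m n → harmonic m - harmonic n) (trans (cong (2 ℕ.*_) M≡) (sym (ℕ.*-assoc 2 2 K))) M≡

  inv-# : ∀ n → # (suc n) * inv (suc n) ≡ 1F
  inv-# = ι*inv

  halves : ∀ l h₂ h₃ h₄ → l ≡ h₄ - h₂ → inv 3 ≤ h₃ - h₂ × h₃ - h₂ ≤ inv 2 → inv 4 ≤ h₄ - h₃ × h₄ - h₃ ≤ inv 3 → # 1 ≤ # 2 * l × # 6 * l ≤ # 5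
  halves l h₂ h₃ h₄ e (p , q) (r , s) =
      lin (l ∷ h₂ ∷ h₃ ∷ h₄ ∷ inv 3 ∷ inv 4 ∷ []) (from (e & p & r & inv-# 2 & inv-# 3 & []))
    , lin (l ∷ h₂ ∷ h₃ ∷ h₄ ∷ inv 2 ∷ inv 3 ∷ []) (from (e & q & s & inv-# 1 & inv-# 2 & []))

  L2-bounds : # 1 ≤ # 2 * L 2 × # 6 * L 2 ≤ # 5
  L2-bounds = halves (L 2) h2 h3 h4 (trans (L-prime prime[2]) a-2) (harmonic-scale 2 K (s≤s z≤n) 1≤K) (harmonic-scale 3 K (s≤s z≤n) 1≤K)

  logarithm : Log X
  logarithm = record
    { Λ          = Λ
    ; L          = L
    ; Λ-nonneg   = Λ-nonneg λ p pp → a-nonneg (ℕ.<⇒≤ (1<prime pp))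
    ; Λ-else     = Λ-else
    ; L-divisors = L-extend
    ; L-1        = L-1
    ; L-*        = L-*
    ; L-step≤    = λ {n} 1≤n n<X → step≤ n 1≤n (L n) (L (suc n)) (a n) (a (suc n)) (proj₁ (error-bounds {suc n} (s≤s z≤n))) (proj₂ (error-bounds 1≤n)) (proj₂ (a-suc 1≤n)) (small n 1≤n n<X)
    ; L-step≥    = λ {n} 1≤n n<X → step≥ n 1≤n (L n) (L (suc n)) (a n) (a (suc n)) (proj₂ (error-bounds {suc n} (s≤s z≤n))) (proj₁ (error-bounds 1≤n)) (proj₁ (a-suc 1≤n)) (small n 1≤n n<X)
    ; 1≤2L2      = proj₁ L2-bounds
    ; 6L2≤5      = proj₂ L2-bounds
    }

log : ∀ X → Log X
log X = LogConstruction.logarithm X (X ℕ.* (X ℕ.* X) ℕ.+ 1) (ℕ.m≤n+m 1 _)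
  (λ {n} p → ℕ.≤-trans (ℕ.*-mono-≤ p (ℕ.*-mono-≤ (ℕ.<⇒≤ p) p)) (ℕ.m≤m+n _ 1))

-- Positive density at shrinking ratios, and prime gaps.

record Dense (Q j : ℕ) : Set where
  field
    ρ N   : ℕ
    1≤ρ   : 1 ℕ.≤ ρ
    -- Quantified over the logarithm after `ρ` and `N`: these must be uniform, as X is chosen later
    -- according to the interval.
    dense : ∀ {X} (log : Log X) {y z} → N ℕ.≤ y → (j ℕ.+ Q) ℕ.* y ℕ.≤ j ℕ.* z → z ℕ.≤ X →
            ι y ≤ ι ρ * (summatory (Log.Λ log) z - summatory (Log.Λ log) y)

-- At ratio 16, ψ(16 y) ≥ 8 y - log (16 y) and ψ(y) ≤ 6 y leave 2 y - log (16 y), which is at least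
-- y once y ≥ 256.
dense-base : ∀ {Q j} → 1 ℕ.≤ j → ι Q ≡ # 15 * ι j → Dense Q j
dense-base {Q} {j} 1≤j Q≡ = record { ρ = 1 ; N = 256 ; 1≤ρ = ℕ.≤-refl ; dense = λ log p q r → base log p q r }
  where
  base : ∀ {X} (log : Log X) {y z} → 256 ℕ.≤ y → (j ℕ.+ Q) ℕ.* y ℕ.≤ j ℕ.* z → z ℕ.≤ X →
         ι y ≤ ι 1 * (summatory (Log.Λ log) z - summatory (Log.Λ log) y)
  base {X} log {y} {z} 256≤y h z≤X = lin (ι y ∷ ι 1 ∷ ψ z ∷ ψ y ∷ ψ (m ℕ.* 2) ∷ L (m ℕ.* 2) ∷ ι m ∷ ι (m ℕ.* 2) ∷ ι 64 ∷ ι 256 ∷ [])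
    (from (cong (_* (ψ z - ψ y)) (ι-# 1) & ψ-mono m2≤z & ψ-double-≥ m 1≤m m2≤X & ψ≤6x y y≤X & ι-m & ι-double m & ι-mono 256≤y & ι-# 256
          & L-sublinear 64 (s≤s z≤n) (ℕ.*-mono-≤ 1≤m (s≤s (z≤n {1}))) m2≤X & cong (_* L (m ℕ.* 2)) (ι-# 64) & ι-# 64 & cong (_* ι 64) (ι-# 64) & []))
    where
    open Log log
    open Logarithmic log
    m : ℕ
    m = y ℕ.* 8
    1≤y : 1 ℕ.≤ y
    1≤y = ℕ.≤-trans (s≤s z≤n) 256≤y
    1≤m : 1 ℕ.≤ m
    1≤m = ℕ.*-mono-≤ 1≤y (s≤s (z≤n {7}))
    ι-m : ι m ≡ # 8 * ι y
    ι-m = trans (ι-* y 8) (trans (*-comm _ _) (cong (_* ι y) (ι-# 8)))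
    m2≤z : m ℕ.* 2 ℕ.≤ z
    m2≤z = ι-cancel (*-cancel (1≤ι 1≤j) (lin (ι j ∷ ι Q ∷ ι (m ℕ.* 2) ∷ ι m ∷ ι y ∷ ι z ∷ ι ((j ℕ.+ Q) ℕ.* y) ∷ ι (j ℕ.* z) ∷ ι (j ℕ.+ Q) ∷ [])
      (from (ι-mono h & ι-* (j ℕ.+ Q) y & ι-* j z & cong (_* ι y) (ι-+ j Q) & cong (_* ι y) Q≡ & cong (ι j *_) (ι-double m) & cong (ι j *_) ι-m & []))))
    m2≤X : m ℕ.* 2 ℕ.≤ X
    m2≤X = ℕ.≤-trans m2≤z z≤X
    y≤X : y ℕ.≤ X
    y≤X = ℕ.≤-trans (ℕ.m≤m*n y 8) (ℕ.≤-trans (ℕ.m≤m*n m 2) m2≤X)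

-- Density at ratio 1 + Q/j supplies a heavy index wherever the chain looks for one; the chain then
-- refutes a nearly empty interval of ratio 1 + Q/(j + 1). For j ≥ 200 the two ratios are close
-- enough.
module DenseStep (Q j : ℕ) (1≤j : 1 ℕ.≤ j) (200≤j : # 200 ≤ ι j) (1≤Q : 1 ℕ.≤ Q) (Q≤15j : ι Q ≤ # 15 * ι j) (given : Dense Q j) where
  open Dense given

  private
    scale : ∀ m c → ι (m ℕ.* c) ≡ # c * ι m
    scale m c = trans (ι-* m c) (trans (*-comm _ _) (cong (_* ι m) (ι-# c)))

  opaque
    A U W V B K G N′ : ℕ
    -- A and U set the precision of the chain and W the width of the window. V is the loss in
    -- passing from the slice to a single n, and V U fixes B. K ensures `L K` ≥ B, G collects the
    -- conditions on `L x`, and N′ ensures `L x` ≥ G.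
    A  = (j ℕ.+ 1) ℕ.* 4000
    U  = A ℕ.* 80
    W  = N ℕ.+ A ℕ.+ 40000
    V  = ρ ℕ.* (W ℕ.* W) ℕ.* 42016
    B  = V ℕ.* U
    K  = 2 ^ (B ℕ.* 2)
    G  = B ℕ.* 5904 ℕ.+ B ℕ.* K ℕ.* 408 ℕ.+ W ℕ.* 8 ℕ.+ K ℕ.* 8 ℕ.+ 63044
    N′ = 2 ^ (G ℕ.* 2)

    A≡ : ι A ≡ # 4000 * (ι j + # 1)
    A≡ = trans (scale (j ℕ.+ 1) 4000) (cong (# 4000 *_) (trans (ι-+ j 1) (cong (ι j +_) (ι-# 1))))

    U≡ : ι U ≡ # 80 * ι A
    U≡ = scale A 80

    W≡ : ι W ≡ ι N + ι A + # 40000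
    W≡ = trans (ι-+ (N ℕ.+ A) 40000) (cong₂ _+_ (ι-+ N A) (ι-# 40000))

    V≡ : ι V ≡ # 42016 * (ι ρ * (ι W * ι W))
    V≡ = trans (scale (ρ ℕ.* (W ℕ.* W)) 42016) (cong (# 42016 *_) (trans (ι-* ρ (W ℕ.* W)) (cong (ι ρ *_) (ι-* W W))))

    B≡ : ι B ≡ ι V * ι U
    B≡ = ι-* V U

    G≡ : ι G ≡ # 5904 * ι B + # 408 * (ι B * ι K) + # 8 * ι W + # 8 * ι K + # 63044
    G≡ = trans (ι-+ _ 63044) (cong₂ _+_ (trans (ι-+ (B ℕ.* 5904 ℕ.+ B ℕ.* K ℕ.* 408 ℕ.+ W ℕ.* 8) (K ℕ.* 8)) (cong₂ _+_ (trans (ι-+ (B ℕ.* 5904 ℕ.+ B ℕ.* K ℕ.* 408) (W ℕ.* 8)) (cong₂ _+_ (trans (ι-+ (B ℕ.* 5904) (B ℕ.* K ℕ.* 408)) (cong₂ _+_ (scale B 5904) (trans (scale (B ℕ.* K) 408) (cong (# 408 *_) (ι-* B K))))) (scale W 8))) (scale K 8))) (ι-# 63044))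

    N≤W : N ℕ.≤ W
    N≤W = ℕ.≤-trans (ℕ.m≤m+n N A) (ℕ.m≤m+n (N ℕ.+ A) 40000)

    A≤W : A ℕ.≤ W
    A≤W = ℕ.≤-trans (ℕ.m≤n+m A N) (ℕ.m≤m+n (N ℕ.+ A) 40000)

    B≤K : B ℕ.≤ K
    B≤K = ℕ.≤-trans (ℕ.m≤m*n B 2) (ℕ.<⇒≤ (n<p^n (B ℕ.* 2) (s≤s (s≤s z≤n))))

    G≤N′ : G ℕ.≤ N′
    G≤N′ = ℕ.≤-trans (ℕ.m≤m*n G 2) (ℕ.<⇒≤ (n<p^n (G ℕ.* 2) (s≤s (s≤s z≤n))))

    1≤N′ : 1 ℕ.≤ N′
    1≤N′ = ℕ.m^n>0 2 (G ℕ.* 2)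

    L-N′ : ∀ {X} (log : Log X) {x} → N′ ℕ.≤ x → x ℕ.≤ X → ι G ≤ Log.L log x
    L-N′ log = Logarithmic.L-large log G

    L-K : ∀ {X} (log : Log X) → K ℕ.≤ X → ι B ≤ Log.L log K
    L-K log = Logarithmic.L-large log B ℕ.≤-refl

  40000≤W : # 40000 ≤ ι W
  40000≤W = lin (ι W ∷ ι N ∷ ι A ∷ []) (from (W≡ & 0≤ι N & 0≤ι A & []))

  2≤W : 2 ℕ.≤ W
  2≤W = ι-cancel (lin (ι 2 ∷ ι W ∷ []) (from (ι-# 2 & 40000≤W & [])))

  42016≤V : # 42016 ≤ ι V
  42016≤V = lin (ι V ∷ ι ρ ∷ ι W ∷ [])
    (from (V≡ & *-monoˡ (*-nonneg (0≤ι W) (0≤ι W)) (1≤ι 1≤ρ) & *-mono 0≤#1 (0≤ι W) 1≤W 1≤W & []))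
    where
    0≤#1 : 0F ≤ # 1
    0≤#1 = 0≤# 1
    1≤W : # 1 ≤ ι W
    1≤W = lin (ι W ∷ []) (from (40000≤W & []))

  320000≤U : # 320000 ≤ ι U
  320000≤U = lin (ι U ∷ ι A ∷ ι j ∷ []) (from (U≡ & A≡ & 0≤ι j & []))

  big-B : # 24000000 ≤ ι B
  big-B = lin (ι B ∷ ι V ∷ ι U ∷ []) (from (B≡ & *-monoˡ (0≤ι V) 320000≤U & 42016≤V & []))

  1≤B : 1 ℕ.≤ B
  1≤B = ι-cancel (lin (ι 1 ∷ ι B ∷ []) (from (ι-# 1 & big-B & [])))

  module Contradiction {X} (log : Log X) (x x′ : ℕ)
    (large : N′ ℕ.≤ x) (x≤x′ : x ℕ.≤ x′) (x′≤X : x′ ℕ.≤ X) (x′≤17x : ι x′ ≤ # 17 * ι x)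
    (long : (suc j ℕ.+ Q) ℕ.* x ℕ.≤ suc j ℕ.* x′)
    (few : ι B * (summatory (Log.Λ log) x′ - summatory (Log.Λ log) x) ≤ ι x)
    where

    open Log log
    open Logarithmic log

    G≤x : G ℕ.≤ x
    G≤x = ℕ.≤-trans G≤N′ large

    1≤x : 1 ℕ.≤ x
    1≤x = ℕ.≤-trans 1≤N′ large

    x≤X : x ℕ.≤ X
    x≤X = ℕ.≤-trans x≤x′ x′≤X

    G≤Lx : ι G ≤ L x
    G≤Lx = L-N′ log large x≤X

    0≤BK : 0F ≤ ι B * ι K
    0≤BK = *-nonneg (0≤ι B) (0≤ι K)

    K≤x : K ℕ.≤ x
    K≤x = ι-cancel (lin (ι K ∷ ι x ∷ ι G ∷ ι B ∷ ι W ∷ []) (from (ι-mono G≤x & G≡ & 0≤ι B & 0≤ι W & 0≤ι K & 0≤BK & [])))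

    W≤x : W ℕ.≤ x
    W≤x = ι-cancel (lin (ι K ∷ ι x ∷ ι G ∷ ι B ∷ ι W ∷ []) (from (ι-mono G≤x & G≡ & 0≤ι B & 0≤ι W & 0≤ι K & 0≤BK & [])))

    B≤LK : ι B ≤ L K
    B≤LK = L-K log (ℕ.≤-trans K≤x x≤X)

    big : # 5904 * ι B + # 408 * (ι B * ι K) + # 63044 ≤ L x
    big = lin (ι K ∷ L x ∷ ι G ∷ ι B ∷ ι W ∷ []) (from (G≤Lx & G≡ & 0≤ι W & 0≤ι K & []))

    big′ : # 2 * (L W + # 2 * ι W + # 4 * ι K) ≤ L x
    big′ = lin (ι K ∷ L x ∷ ι G ∷ ι B ∷ ι W ∷ L W ∷ []) (from (G≤Lx & G≡ & 0≤ι B & 0≤BK & L≤2n (ℕ.<⇒≤ 2≤W) (ℕ.≤-trans W≤x x≤X) & []))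

    open Deficit x x′ B K 1≤x x≤x′ x′≤X x′≤17x few 1≤B B≤K K≤x B≤LK hiding (x≤X)
    open Window big W 2≤W W≤x big′

    P hi : ℕ
    P  = W ^ suc (proj₁ window)
    hi = W ℕ.* P

    hi≤y₀ : hi ℕ.≤ y₀
    hi≤y₀ = proj₁ (proj₂ window)

    W≤P : W ℕ.≤ P
    W≤P = ℕ.m≤m*n W (W ^ proj₁ window) {{≢0 (1≤W^ (proj₁ window))}}

    P≤hi : # 34000 * ι P ≤ ι hi
    P≤hi = lin (ι P ∷ ι hi ∷ ι W ∷ []) (from (ι-* W P & *-monoˡ (0≤ι P) 40000≤W & 0≤ι P & []))

    hi-small : ∀ {n} → 1 ℕ.≤ n → n ℕ.≤ hi → # 24000000 ≤ ι (fl x n)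
    hi-small {n} 1≤n n≤hi = ≤-trans big-B (ι-mono (ℕ.≤-trans B≤K (fl-≤ 1≤n (subst (ℕ._≤ x) (ℕ.*-comm K n) (≤-fl {x} {K} (ℕ.≤-trans n≤hi hi≤y₀))))))

    1≤V : # 1 ≤ ι V
    1≤V = lin (ι V ∷ []) (from (42016≤V & []))

    upper : ∀ {m n} → 1 ℕ.≤ n → n ℕ.≤ m → n ℕ.≤ hi → fl x n ℕ.≤ fl x′ m →
            ι U * (ψ (fl x′ m) - ψ (fl x n)) ≤ # 2 * ι U * (ι x′ * inv m - ι x * inv n) + ι x * inv n
    upper {m} {n} 1≤n n≤m n≤hi p = step (ψ (fl x′ m) - ψ (fl x n)) (ι x′ * inv m - ι x * inv n) (ι x * inv n) (*-nonneg (0≤ι x) (0≤inv n)) (interval-upper 1≤n n≤m (ℕ.≤-trans n≤hi hi≤y₀) p)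
      where
      step : ∀ d l t → 0F ≤ t → ι B * d ≤ # 2 * ι B * l + # 10502 * t → ι U * d ≤ # 2 * ι U * l + t
      step d l t 0≤t q = *-cancel 1≤V (lin (ι V ∷ ι U ∷ ι B ∷ d ∷ l ∷ t ∷ [])
        (from (q & cong (_* d) B≡ & cong (_* l) B≡ & *-monoˡ 0≤t 42016≤V & 0≤t & [])))

    -- Here `Δ n` is at most a mean: the deficit 42016 W x of the slice over a mass of at least P/ρ.
    -- As n ≤ W P, this is at most V x / n, and division by V leaves the loss allowed by `Heavy`.
    find-good : ∀ {n y m sz sy} → P ℕ.≤ y → 1 ℕ.≤ n → n ℕ.≤ hi → 0F ≤ Δ n → Δ n * m ≤ sz - sy → sz ≤ SΔ hi → SΔ P ≤ sy → ι y ≤ ι ρ * m →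
                (# 2 * ι U * (ι x′ - ι x) - ι x) * inv n ≤ ι U * I n
    find-good {n} {y} {m} {sz} {sy} P≤y 1≤n n≤hi 0≤Δ a b c f = step (Δ n) (I n) (SΔ hi) (SΔ P) refl 0≤Δ a b c (proj₂ (proj₂ window))
      where
      n≤WP : # 1 ≤ ι W * ι P * inv n
      n≤WP = lin (ι n ∷ inv n ∷ ι hi ∷ ι W ∷ ι P ∷ []) (from (*-monoˡ (0≤inv n) (ι-mono n≤hi) & cong (inv n *_) (ι-* W P) & ι-inv 1≤n & []))
      step : ∀ δ i sh sp → δ ≡ (# 2 * ι B * (ι x′ - ι x) + # 10502 * ι x) * inv n - ι B * i → 0F ≤ δ → δ * m ≤ sz - sy → sz ≤ sh → sp ≤ sy →
             sh - sp ≤ # 42016 * (ι W * ι x) → (# 2 * ι U * (ι x′ - ι x) - ι x) * inv n ≤ ι U * i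
      step δ i sh sp e 0≤δ a b c d = *-cancel 1≤V (lin (δ ∷ i ∷ ι V ∷ ι U ∷ ι B ∷ ι x ∷ ι x′ ∷ inv n ∷ [])
          (from (e & δ≤ & cong (λ z → z * (ι x′ - ι x) * inv n) B≡ & cong (_* i) B≡ & *-nonneg (0≤ι x) (0≤inv n) & [])))
        where
        δP : δ * ι P ≤ # 42016 * (ι ρ * (ι W * ι x))
        δP = lin (δ ∷ m ∷ ι P ∷ ι ρ ∷ ι W ∷ ι x ∷ sz ∷ sy ∷ sh ∷ sp ∷ [])
          (from (*-monoˡ 0≤δ (≤-trans (ι-mono P≤y) f) & *-monoˡ (0≤ι ρ) a & *-monoˡ (0≤ι ρ) b & *-monoˡ (0≤ι ρ) c & *-monoˡ (0≤ι ρ) d & []))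
        δ≤ : δ ≤ ι V * (ι x * inv n)
        δ≤ = lin (δ ∷ ι P ∷ ι ρ ∷ ι W ∷ ι x ∷ ι V ∷ inv n ∷ [])
          (from (*-monoˡ 0≤δ n≤WP & *-monoˡ (*-nonneg (0≤ι W) (0≤inv n)) δP & cong (_* (ι x * inv n)) V≡ & []))

    find : ∀ {y z} → P ℕ.≤ y → y ℕ.< z → (j ℕ.+ Q) ℕ.* y ℕ.≤ j ℕ.* z → z ℕ.≤ hi →
           ∃ λ n → y ℕ.< n × n ℕ.≤ z × (# 2 * ι U * (ι x′ - ι x) - ι x) * inv n ≤ ι U * (ψ (fl x′ n) - ψ (fl x n))
    find {y} {z} P≤y y<z far z≤hi = conclude (≤-weighted-average Δ Λ y z y<z Λ-nonneg)
      where
      conclude : (∃ λ n → y ℕ.< n × n ℕ.≤ z × Δ n * (ψ z - ψ y) ≤ SΔ z - SΔ y) →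
                 ∃ λ n → y ℕ.< n × n ℕ.≤ z × (# 2 * ι U * (ι x′ - ι x) - ι x) * inv n ≤ ι U * (ψ (fl x′ n) - ψ (fl x n))
      conclude (n , y<n , n≤z , avg) = n , y<n , n≤z , find-good P≤y 1≤n n≤hi (Δ-nonneg 1≤n (ℕ.≤-trans n≤hi hi≤y₀)) avg (SΔ-mono z≤hi hi≤y₀) (SΔ-mono P≤y (ℕ.≤-trans (ℕ.<⇒≤ y<z) (ℕ.≤-trans z≤hi hi≤y₀)))
          (dense log (ℕ.≤-trans N≤W (ℕ.≤-trans W≤P P≤y)) far (ℕ.≤-trans z≤hi (ℕ.≤-trans hi≤y₀ (ℕ.≤-trans y₀≤x x≤X))))
        where
        1≤n : 1 ℕ.≤ n
        1≤n = ℕ.≤-trans (s≤s z≤n) y<n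
        n≤hi : n ℕ.≤ hi
        n≤hi = ℕ.≤-trans n≤z z≤hi

    long′ : ι Q * ι x ≤ (ι j + # 1) * (ι x′ - ι x)
    long′ = lin (ι Q ∷ ι x ∷ ι x′ ∷ ι j ∷ ι (suc j) ∷ ι (suc j ℕ.+ Q) ∷ ι ((suc j ℕ.+ Q) ℕ.* x) ∷ ι (suc j ℕ.* x′) ∷ [])
      (from (ι-mono long & ι-* (suc j ℕ.+ Q) x & ι-* (suc j) x′ & cong (_* ι x) (ι-+ (suc j) Q) & cong (_* ι x) (ι-suc j) & cong (_* ι x′) (ι-suc j) & []))

    contradiction : ⊥
    contradiction = Chain.absurd x x′ Q j A U P hi 1≤x x≤x′ x′≤X long′ 1≤j 200≤j 1≤Q Q≤15j A≡ U≡ (ℕ.≤-trans A≤W W≤P) P≤hi hi-small upper find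

  dense-step : Dense Q (suc j)
  dense-step = record { ρ = B ; N = N′ ; 1≤ρ = 1≤B ; dense = λ log p q r → conclude log p q r }
    where
    conclude : ∀ {X} (log : Log X) {x z} → N′ ℕ.≤ x → (suc j ℕ.+ Q) ℕ.* x ℕ.≤ suc j ℕ.* z → z ℕ.≤ X →
               ι x ≤ ι B * (summatory (Log.Λ log) z - summatory (Log.Λ log) x)
    conclude {X} log {x} {z} large far z≤X = cases (ℕ.≤-total z (suc f))
      where
      open Logarithmic log
      v f : ℕ
      v = (suc j ℕ.+ Q) ℕ.* x
      f = fl v (suc j)
      1≤x : 1 ℕ.≤ x
      1≤x = ℕ.≤-trans 1≤N′ large
      f≤16x : ι (suc f) ≤ # 17 * ι x
      f≤16x = *-cancel (1≤ι {suc j} (s≤s z≤n)) (lin (ι (suc f) ∷ ι f ∷ ι x ∷ ι j ∷ ι (suc j) ∷ ι Q ∷ ι v ∷ ι (suc j ℕ.+ Q) ∷ ι (suc j ℕ.* f) ∷ [])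
        (from (ι-mono (fl-lower v (suc j)) & ι-* (suc j) f & ι-* (suc j ℕ.+ Q) x & cong (_* ι x) (ι-+ (suc j) Q) & cong (ι (suc j) *_) (ι-suc f)
              & cong (_* ι x) (ι-suc j) & *-monoˡ (0≤ι x) Q≤15j & *-monoˡ (0≤ι (suc j)) (1≤ι 1≤x) & 0≤ι x & []))) 
      try : ∀ x′ → (suc j ℕ.+ Q) ℕ.* x ℕ.≤ suc j ℕ.* x′ → x′ ℕ.≤ z → x′ ℕ.≤ suc f → ι x ≤ ι B * (ψ z - ψ x)
      try x′ long x′≤z x′≤f with ≤-total (ι x) (ι B * (ψ x′ - ψ x))
      ... | inj₁ p = lin (ι x ∷ ι B ∷ ψ z ∷ ψ x ∷ ψ x′ ∷ []) (from (p & *-monoˡ (0≤ι B) (ψ-mono x′≤z) & []))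
      ... | inj₂ p = ⊥-elim (Contradiction.contradiction log x x′ large x≤x′ (ℕ.≤-trans x′≤z z≤X) (≤-trans (ι-mono x′≤f) f≤16x) long p)
        where
        x≤x′ : x ℕ.≤ x′
        x≤x′ = ℕ.*-cancelˡ-≤ (suc j) (ℕ.≤-trans (ℕ.*-monoˡ-≤ x (ℕ.m≤m+n (suc j) Q)) long)
      -- A distant z is replaced by the least integer above (1 + Q/(j + 1)) x, which keeps x′ ≤ 17
      -- x.
      cases : z ℕ.≤ suc f ⊎ suc f ℕ.≤ z → ι x ≤ ι B * (ψ z - ψ x)
      cases (inj₁ z≤f) = try z far ℕ.≤-refl z≤f
      cases (inj₂ f≤z) = try (suc f) (ℕ.<⇒≤ (fl-upper v (suc j) (s≤s z≤n))) f≤z ℕ.≤-refl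

-- 3000 = 15 · 200, so the induction starts at ratio 16 with j already as large as the step
-- requires.
dense-all : ∀ k → Dense 3000 (k ℕ.+ 200)
dense-all zero    = dense-base (s≤s z≤n) (lin (ι 3000 ∷ ι 200 ∷ []) (from (ι-# 3000 & ι-# 200 & [])))
dense-all (suc k) = DenseStep.dense-step 3000 (k ℕ.+ 200) (ℕ.≤-trans (s≤s z≤n) (ℕ.m≤n+m 200 k))
  (lin (ι (k ℕ.+ 200) ∷ ι k ∷ ι 200 ∷ []) (from (ι-+ k 200 & ι-# 200 & 0≤ι k & []))) (s≤s z≤n)
  (lin (ι 3000 ∷ ι (k ℕ.+ 200) ∷ ι k ∷ ι 200 ∷ []) (from (ι-+ k 200 & ι-# 200 & ι-# 3000 & 0≤ι k & []))) (dense-all k)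

∑-hits : ∀ n a c → ∑ n (λ i → 𝟙 (a ℕ.+ i ℕ.≟ c)) ≤ 1F
∑-hits zero    a c = 0≤1
∑-hits (suc n) a c = cases (a ℕ.+ n ℕ.≟ c)
  where
  cases : (d : Dec (a ℕ.+ n ≡ c)) → ∑ n (λ i → 𝟙 (a ℕ.+ i ℕ.≟ c)) + 𝟙 d ≤ 1F
  cases (yes refl) = ≤-reflexive (trans (cong (_+ 1F) (∑-zero n λ i p → 𝟙-no (a ℕ.+ i ℕ.≟ a ℕ.+ n) (λ e → ℕ.<⇒≢ p (ℕ.+-cancelˡ-≡ a i n e)))) (+-identityˡ 1F))
  cases (no _)     = subst (_≤ 1F) (sym (+-identityʳ _)) (∑-hits n a c)

isqrt : ∀ z → ∃ λ s → s ℕ.* s ℕ.≤ z × z ℕ.< suc s ℕ.* suc s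
isqrt zero = 0 , z≤n , s≤s z≤n
isqrt (suc z) with isqrt z
... | s , p , q with ℕ.m≤n⇒m<n∨m≡n q
...   | inj₁ r = s , ℕ.m≤n⇒m≤1+n p , r
...   | inj₂ e = suc s , ℕ.≤-reflexive (sym e) , subst (ℕ._< suc (suc s) ℕ.* suc (suc s)) (sym e) (ℕ.*-mono-< (ℕ.n<1+n (suc s)) (ℕ.n<1+n (suc s)))

-- It makes the odd power r * r * root r a function of r, so that each r accounts for two integers.
-- The value 1 off prime powers is a default.
root : ℕ → ℕ
root q with primePower? q
... | yes pp = PrimePower.base pp
... | no _   = 1

root-^ : ∀ {p} m → Prime p → root (p ^ suc m) ≡ p
root-^ {p} m pp with primePower? (p ^ suc m)
... | yes (primePower pq k e) = primePower-base k m pq pp (sym e)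
... | no ¬pp = ⊥-elim (¬pp (primePower pp m refl))

module _ {X : ℕ} (log : Log X) where

  open Log log
  open Logarithmic log

  -- Every prime power q ^ k with k ≥ 2 is r * r or r * r * root r for some power r of q.
  Λ-nonprime : ∀ {n z s} → 1 ℕ.≤ n → n ℕ.≤ z → z ℕ.≤ X → z ℕ.< suc s ℕ.* suc s → ¬ Prime n →
               Λ n ≤ ∑ (suc s) (λ r → (𝟙 (n ℕ.≟ r ℕ.* r) + 𝟙 (n ℕ.≟ r ℕ.* r ℕ.* root r)) * L z)
  Λ-nonprime {n} {z} {s} 1≤n n≤z z≤X z<t² ¬prime = cases (primePower? n)
    where
    0≤Lz : 0F ≤ L z
    0≤Lz = 0≤L (ℕ.≤-trans 1≤n n≤z) z≤X
    term : ℕ → F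
    term r = (𝟙 (n ℕ.≟ r ℕ.* r) + 𝟙 (n ℕ.≟ r ℕ.* r ℕ.* root r)) * L z
    0≤term : ∀ r → 0F ≤ term r
    0≤term r = *-nonneg (+-nonneg (𝟙-nonneg (n ℕ.≟ r ℕ.* r)) (𝟙-nonneg (n ℕ.≟ r ℕ.* r ℕ.* root r))) 0≤Lz
    hit : ∀ r → n ≡ r ℕ.* r ⊎ n ≡ r ℕ.* r ℕ.* root r → # 1 ≤ 𝟙 (n ℕ.≟ r ℕ.* r) + 𝟙 (n ℕ.≟ r ℕ.* r ℕ.* root r)
    hit r (inj₁ e) = lin (𝟙 (n ℕ.≟ r ℕ.* r) ∷ 𝟙 (n ℕ.≟ r ℕ.* r ℕ.* root r) ∷ []) (from (𝟙-yes (n ℕ.≟ r ℕ.* r) e & 𝟙-nonneg (n ℕ.≟ r ℕ.* r ℕ.* root r) & []))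
    hit r (inj₂ e) = lin (𝟙 (n ℕ.≟ r ℕ.* r) ∷ 𝟙 (n ℕ.≟ r ℕ.* r ℕ.* root r) ∷ []) (from (𝟙-yes (n ℕ.≟ r ℕ.* r ℕ.* root r) e & 𝟙-nonneg (n ℕ.≟ r ℕ.* r) & []))
    bound : ∀ r → r ℕ.≤ s → n ≡ r ℕ.* r ⊎ n ≡ r ℕ.* r ℕ.* root r → Λ n ≤ ∑ (suc s) term
    bound r r≤s e = ≤-trans (step (Λ n) (L n) (L z) (𝟙 (n ℕ.≟ r ℕ.* r) + 𝟙 (n ℕ.≟ r ℕ.* r ℕ.* root r)) (Λ≤L 1≤n) (L-mono 1≤n n≤z z≤X) 0≤Lz (hit r e))
                            (∑-term term (s≤s r≤s) λ i _ → 0≤term i)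
      where
      step : ∀ a b c d → a ≤ b → b ≤ c → 0F ≤ c → # 1 ≤ d → a ≤ d * c
      step a b c d p q r s = lin (a ∷ b ∷ c ∷ d ∷ []) (from (p & q & *-monoˡ r s & []))
    square : ∀ p m → p ^ (m ℕ.* 2) ≡ p ^ m ℕ.* p ^ m
    square p m = trans (cong (p ^_) (trans (ℕ.*-comm m 2) (cong (m ℕ.+_) (ℕ.+-identityʳ m)))) (ℕ.^-distribˡ-+-* p m m)
    small : ∀ r → r ℕ.* r ℕ.≤ n → r ℕ.≤ s
    small r p = ℕ.≮⇒≥ λ s<r → ℕ.<⇒≱ z<t² (ℕ.≤-trans (ℕ.*-mono-≤ s<r s<r) (ℕ.≤-trans p n≤z))
    powers : ∀ {p} k → Prime p → n ≡ p ^ suc (suc k) → (∃ λ m → suc (suc k) ≡ m ℕ.* 2 ⊎ suc (suc k) ≡ suc (m ℕ.* 2)) → Λ n ≤ ∑ (suc s) term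
    powers {p} k pp e (zero , inj₁ ())
    powers {p} k pp e (zero , inj₂ ())
    powers {p} k pp e (suc m , inj₁ f) = bound r (small r (ℕ.≤-reflexive (sym e′))) (inj₁ e′)
      where
      r = p ^ suc m
      e′ : n ≡ r ℕ.* r
      e′ = trans e (trans (cong (p ^_) f) (square p (suc m)))
    powers {p} k pp e (suc m , inj₂ f) = bound r (small r (ℕ.≤-trans (ℕ.m≤m*n (r ℕ.* r) p {{prime⇒nonZero pp}}) (ℕ.≤-reflexive (sym e′)))) (inj₂ (trans e′ (cong (r ℕ.* r ℕ.*_) (sym (root-^ m pp)))))
      where
      r = p ^ suc m
      e′ : n ≡ r ℕ.* r ℕ.* p
      e′ = trans e (trans (cong (p ^_) f) (trans (ℕ.*-comm p _) (cong (ℕ._* p) (square p (suc m)))))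
    cases : Dec (PrimePower n) → Λ n ≤ ∑ (suc s) term
    cases (no ¬pp) = subst (_≤ ∑ (suc s) term) (sym (Λ-else ¬pp)) (∑-nonneg (suc s) λ i _ → 0≤term i)
    cases (yes (primePower {p} pp zero e))    = ⊥-elim (¬prime (subst Prime (sym (trans e (ℕ.*-identityʳ p))) pp))
    cases (yes (primePower {p} pp (suc k) e)) = powers k pp e (halve (suc (suc k)))

  -- The proper prime powers up to z are indexed by r ≤ s, two for each r, and each weighs at most
  -- `L z`.
  ψ-without-primes : ∀ {y z s} → 1 ℕ.≤ z → y ℕ.≤ z → z ℕ.≤ X → z ℕ.< suc s ℕ.* suc s → (∀ n → y ℕ.< n → n ℕ.≤ z → ¬ Prime n) →
                     ψ z - ψ y ≤ ι (suc s) * (# 2 * L z)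
  ψ-without-primes {y} {z} {s} 1≤z y≤z z≤X z<t² none = begin-≤
    where
    l = z ℕ.∸ y
    n : ℕ → ℕ
    n i = suc y ℕ.+ i
    n≤z : ∀ i → i ℕ.< l → n i ℕ.≤ z
    n≤z i p = subst (n i ℕ.≤_) (ℕ.m+[n∸m]≡n y≤z) (subst (ℕ._≤ y ℕ.+ l) (ℕ.+-suc y i) (ℕ.+-monoʳ-≤ y p))
    diff : ψ z - ψ y ≡ ∑ l (λ i → Λ (n i))
    diff = step (∑ l (λ i → Λ (n i))) (trans (summatory-def Λ z) (trans (cong (λ k → ∑₁ k Λ) (sym (ℕ.m+[n∸m]≡n y≤z))) (trans (∑-split y l (λ i → Λ (suc i))) (cong (_+ ∑ l (λ i → Λ (n i))) (sym (summatory-def Λ y))))))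
      where
      step : ∀ t → ψ z ≡ ψ y + t → ψ z - ψ y ≡ t
      step t e = lin (ψ z ∷ ψ y ∷ t ∷ []) (from (e & []))
    column : ∀ r → ∑ l (λ i → (𝟙 (n i ℕ.≟ r ℕ.* r) + 𝟙 (n i ℕ.≟ r ℕ.* r ℕ.* root r)) * L z) ≤ # 2 * L z
    column r = subst (_≤ # 2 * L z) (sym (trans (∑-*ʳ l (L z) (λ i → 𝟙 (n i ℕ.≟ r ℕ.* r) + 𝟙 (n i ℕ.≟ r ℕ.* r ℕ.* root r))) (cong (_* L z) (∑-+ l (λ i → 𝟙 (n i ℕ.≟ r ℕ.* r)) (λ i → 𝟙 (n i ℕ.≟ r ℕ.* r ℕ.* root r))))))
      (step (∑ l (λ i → 𝟙 (n i ℕ.≟ r ℕ.* r))) (∑ l (λ i → 𝟙 (n i ℕ.≟ r ℕ.* r ℕ.* root r))) (∑-hits l (suc y) (r ℕ.* r)) (∑-hits l (suc y) (r ℕ.* r ℕ.* root r)))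
      where
      step : ∀ a b → a ≤ 1F → b ≤ 1F → (a + b) * L z ≤ # 2 * L z
      step a b p q = lin (a ∷ b ∷ L z ∷ []) (from (*-monoˡ (0≤L 1≤z z≤X) p & *-monoˡ (0≤L 1≤z z≤X) q & []))
    begin-≤ : ψ z - ψ y ≤ ι (suc s) * (# 2 * L z)
    begin-≤ = subst₂ _≤_ (sym diff) (∑-const (suc s) (# 2 * L z))
      (≤-trans (∑-mono l λ i p → Λ-nonprime {n i} {z} {s} (s≤s z≤n) (n≤z i p) z≤X z<t² (none (n i) (s≤s (ℕ.m≤m+n y i)) (n≤z i p)))
      (≤-trans (≤-reflexive (∑-swap l (suc s) (λ i r → (𝟙 (n i ℕ.≟ r ℕ.* r) + 𝟙 (n i ℕ.≟ r ℕ.* r ℕ.* root r)) * L z))) (∑-mono (suc s) λ r _ → column r)))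

-- A mass of y/ρ exceeds the O(√z log z) of proper prime powers. With t about √z the comparison
-- reads t ≤ 32 ρ `L t`, and `L-sublinear` at 128 ρ turns it into t ≤ 128² ρ².
prime-between : ∀ {Q j} (d : Dense Q j) {y z} → Dense.N d ℕ.≤ y → 1 ℕ.≤ y → (j ℕ.+ Q) ℕ.* y ℕ.≤ j ℕ.* z → y ℕ.≤ z → ι z ≤ # 2 * ι y →
                (∀ {t} → z ℕ.≤ t ℕ.* t → # 16384 * (ι (Dense.ρ d) * ι (Dense.ρ d)) + # 2 ≤ ι t) → ∃ λ q → Prime q × y ℕ.< q × q ℕ.≤ z
prime-between {Q} {j} d {y} {z} N≤y 1≤y far y≤z z≤2y big = cases (ℕ.anyUpTo? (λ q → prime? q ×-dec (y ℕ.<? q)) (suc z))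
  where
  open Dense d
  cases : Dec (∃ λ q → q ℕ.< suc z × (Prime q × y ℕ.< q)) → ∃ λ q → Prime q × y ℕ.< q × q ℕ.≤ z
  cases (yes (q , q≤z , pq , y<q)) = q , pq , y<q , ℕ.s≤s⁻¹ q≤z
  cases (no none) = ⊥-elim (contra (isqrt z))
    where
    contra : (∃ λ s → s ℕ.* s ℕ.≤ z × z ℕ.< suc s ℕ.* suc s) → ⊥
    contra (s , s²≤z , z<t²) = using-log s s²≤z z<t² (log (suc s ℕ.* suc s))
     where
     using-log : ∀ s → s ℕ.* s ℕ.≤ z → z ℕ.< suc s ℕ.* suc s → Log (suc s ℕ.* suc s) → ⊥
     using-log s s²≤z z<t² lg = final (ψ z - ψ y) (L z) (dense lg N≤y far z≤X) (ψ-without-primes lg {y} {z} {s} 1≤z y≤z z≤X z<t² λ n y<n n≤z pn → none (n , s≤s n≤z , pn , y<n)) Lz (L-sublinear B {t} 1≤B 1≤t t≤X)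
      where
      t = suc s
      1≤t : 1 ℕ.≤ t
      1≤t = s≤s z≤n
      open Log lg
      open Logarithmic lg
      z≤X : z ℕ.≤ t ℕ.* t
      z≤X = ℕ.<⇒≤ z<t²
      t≤X : t ℕ.≤ t ℕ.* t
      t≤X = ℕ.m≤m*n t t
      1≤z : 1 ℕ.≤ z
      1≤z = ℕ.≤-trans 1≤y y≤z
      B : ℕ
      B = ρ ℕ.* 128
      1≤B : 1 ℕ.≤ B
      1≤B = ℕ.*-mono-≤ 1≤ρ (s≤s (z≤n {127}))
      B≡ : ι B ≡ # 128 * ι ρ
      B≡ = trans (ι-* ρ 128) (trans (*-comm _ _) (cong (_* ι ρ) (ι-# 128)))
      Lz : L z ≤ # 2 * L t
      Lz = lin (L z ∷ L t ∷ L (t ℕ.* t) ∷ []) (from (L-mono 1≤z z≤X ℕ.≤-refl & L-* 1≤t 1≤t & []))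
      t²≤8y : ι t * ι t ≤ # 8 * ι y
      t²≤8y = lin (ι t ∷ ι s ∷ ι (s ℕ.* s) ∷ ι z ∷ ι y ∷ ι ρ ∷ [])
        (from (ι-mono s²≤z & ι-* s s & z≤2y & cong (λ u → u * u) (ι-suc s) & *-nonneg (≤⇒0≤ two≤s) (≤⇒0≤ two≤s) & two≤s & *-nonneg (0≤ι s) (≤⇒0≤ two≤s) & []))
        where
        two≤s : # 1 ≤ ι s
        two≤s = lin (ι s ∷ ι t ∷ ι ρ ∷ []) (from (big z≤X & ι-suc s & square-nonneg (ι ρ) & []))
      final : ∀ m l → ι y ≤ ι ρ * m → m ≤ ι t * (# 2 * l) → l ≤ # 2 * L t → ι B * L t ≤ # 2 * ι t + # 2 * ι B * ι B → ⊥
      final m l a b c e = lin (ι t ∷ ι ρ ∷ L t ∷ ι B ∷ [])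
        (from (cancelled & e & cong (_* L t) B≡ & cong (λ u → u * u) B≡ & big z≤X & square-nonneg (ι ρ) & []))
        where
        cancelled : ι t ≤ # 32 * (ι ρ * L t)
        cancelled = *-cancel (1≤ι 1≤t) (lin (ι t ∷ ι ρ ∷ L t ∷ m ∷ l ∷ ι y ∷ [])
          (from (t²≤8y & a & *-monoˡ (0≤ι ρ) b & *-monoˡ (*-nonneg (0≤ι ρ) (0≤ι t)) c & [])))

prime-gaps : ∀ k → 1 ℕ.≤ k → ∃ λ N → ∀ z → N ℕ.≤ z → ∃ λ q → Prime q × q ℕ.≤ z × k ℕ.* suc z ℕ.≤ suc k ℕ.* q
prime-gaps k 1≤k = threshold , λ z p → conclude z p
  where
  j : ℕ
  -- Then 3000/j < 1/(2k), half of the permitted relative gap; the other half absorbs rounding and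
  -- the passage from z to z + 1.
  j = k ℕ.* 6000 ℕ.+ 200
  d : Dense 3000 j
  d = dense-all (k ℕ.* 6000)
  open Dense d
  R threshold : ℕ
  R = ρ ℕ.* ρ ℕ.* 16384 ℕ.+ 2
  threshold = R ℕ.* R ℕ.+ N ℕ.* 2 ℕ.+ k ℕ.* 6 ℕ.+ 10
  j≡ : ι j ≡ # 6000 * ι k + # 200
  j≡ = trans (ι-+ (k ℕ.* 6000) 200) (cong₂ _+_ (trans (ι-* k 6000) (trans (*-comm _ _) (cong (_* ι k) (ι-# 6000)))) (ι-# 200))
  R≡ : ι R ≡ # 16384 * (ι ρ * ι ρ) + # 2
  R≡ = trans (ι-+ (ρ ℕ.* ρ ℕ.* 16384) 2) (cong₂ _+_ (trans (ι-* (ρ ℕ.* ρ) 16384) (trans (*-comm _ _) (cong₂ _*_ (ι-# 16384) (ι-* ρ ρ)))) (ι-# 2))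
  threshold≡ : ι threshold ≡ ι (R ℕ.* R) + # 2 * ι N + # 6 * ι k + # 10
  threshold≡ = trans (ι-+ (R ℕ.* R ℕ.+ N ℕ.* 2 ℕ.+ k ℕ.* 6) 10) (cong₂ _+_ (trans (ι-+ (R ℕ.* R ℕ.+ N ℕ.* 2) (k ℕ.* 6)) (cong₂ _+_ (trans (ι-+ (R ℕ.* R) (N ℕ.* 2)) (cong (ι (R ℕ.* R) +_) (ι-double N)))
                 (trans (ι-* k 6) (trans (*-comm _ _) (cong (_* ι k) (ι-# 6)))))) (ι-# 10))
  conclude : ∀ z → threshold ℕ.≤ z → ∃ λ q → Prime q × q ℕ.≤ z × k ℕ.* suc z ℕ.≤ suc k ℕ.* q
  conclude z th≤z = finish (prime-between d N≤y 1≤y far y≤z z≤2y big)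
    where
    j+Q : ℕ
    j+Q = j ℕ.+ 3000
    y : ℕ
    y = fl (j ℕ.* z) j+Q
    ι-j+Q : ι j+Q ≡ # 6000 * ι k + # 3200
    ι-j+Q = trans (ι-+ j 3000) (lin (ι j ∷ ι k ∷ ι 3000 ∷ []) (from (j≡ & ι-# 3000 & [])))
    1≤j+Q : 1 ℕ.≤ j+Q
    1≤j+Q = ι-cancel (lin (ι 1 ∷ ι k ∷ ι j+Q ∷ []) (from (ι-# 1 & ι-j+Q & 0≤ι k & [])))
    far : j+Q ℕ.* y ℕ.≤ j ℕ.* z
    far = fl-lower (j ℕ.* z) j+Q
    y≤z : y ℕ.≤ z
    y≤z = ℕ.*-cancelˡ-≤ j+Q {{≢0 1≤j+Q}} (ℕ.≤-trans far (ℕ.*-monoˡ-≤ z (ℕ.m≤m+n j 3000)))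
    above : ∀ q → y ℕ.< q → ι j * ι z ≤ ι j+Q * ι q
    above q y<q = lin (ι (j ℕ.* z) ∷ ι (j+Q ℕ.* suc y) ∷ ι j ∷ ι z ∷ ι j+Q ∷ ι q ∷ ι (suc y) ∷ [])
      (from (ι-mono (ℕ.<⇒≤ (fl-upper (j ℕ.* z) j+Q 1≤j+Q)) & ι-* j z & ι-* j+Q (suc y) & *-monoˡ (0≤ι j+Q) (ι-mono y<q) & []))
    th : ι (R ℕ.* R) + # 2 * ι N + # 6 * ι k + # 10 ≤ ι z
    th = subst (_≤ ι z) threshold≡ (ι-mono th≤z)
    half : ∀ q → y ℕ.< q → # 3 * ι z ≤ # 5 * ι q
    half q y<q = *-cancel 1≤k′ (lin (ι j ∷ ι k ∷ ι z ∷ ι j+Q ∷ ι q ∷ [])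
      (from (above q y<q & cong (_* ι z) j≡ & cong (_* ι q) ι-j+Q & *-monoˡ (0≤ι q) (1≤ι 1≤k) & 0≤ι z & 0≤ι q & [])))
      where
      1≤k′ : # 1 ≤ ι k
      1≤k′ = 1≤ι 1≤k
    half-y : # 3 * ι z ≤ # 5 * (ι y + # 1)
    half-y = lin (ι z ∷ ι y ∷ ι (suc y) ∷ []) (from (half (suc y) ℕ.≤-refl & ι-suc y & []))
    0≤R² : 0F ≤ ι (R ℕ.* R)
    0≤R² = 0≤ι (R ℕ.* R)
    N≤y : N ℕ.≤ y
    N≤y = ι-cancel (lin (ι N ∷ ι y ∷ ι z ∷ ι k ∷ ι (R ℕ.* R) ∷ []) (from (half-y & th & 0≤R² & 0≤ι k & 0≤ι N & [])))
    1≤y : 1 ℕ.≤ y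
    1≤y = ι-cancel (lin (ι 1 ∷ ι N ∷ ι y ∷ ι z ∷ ι k ∷ ι (R ℕ.* R) ∷ []) (from (ι-# 1 & half-y & th & 0≤R² & 0≤ι k & 0≤ι N & [])))
    z≤2y : ι z ≤ # 2 * ι y
    z≤2y = lin (ι N ∷ ι y ∷ ι z ∷ ι k ∷ ι (R ℕ.* R) ∷ []) (from (half-y & th & 0≤R² & 0≤ι k & 0≤ι N & []))
    big : ∀ {t} → z ℕ.≤ t ℕ.* t → # 16384 * (ι ρ * ι ρ) + # 2 ≤ ι t
    big {t} z≤t² = subst (_≤ ι t) R≡ (ι-mono (ℕ.≮⇒≥ λ t<R → ℕ.<⇒≱ (ℕ.*-mono-< t<R t<R) (ℕ.≤-trans R²≤z z≤t²)))
      where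
      R²≤z : R ℕ.* R ℕ.≤ z
      R²≤z = ι-cancel (lin (ι (R ℕ.* R) ∷ ι N ∷ ι z ∷ ι k ∷ []) (from (th & 0≤ι k & 0≤ι N & [])))
    finish : (∃ λ q → Prime q × y ℕ.< q × q ℕ.≤ z) → ∃ λ q → Prime q × q ℕ.≤ z × k ℕ.* suc z ℕ.≤ suc k ℕ.* q
    finish (q , pq , y<q , q≤z) = q , pq , q≤z , ι-cancel (subst₂ _≤_ (sym (ι-* k (suc z))) (sym (ι-* (suc k) q))
      (lin (ι j ∷ ι k ∷ ι (suc k) ∷ ι z ∷ ι (suc z) ∷ ι j+Q ∷ ι q ∷ ι (R ℕ.* R) ∷ ι N ∷ [])
        (from (above q y<q & cong (_* ι z) j≡ & cong (_* ι q) ι-j+Q & cong (_* ι q) (ι-suc k) & cong (ι k *_) (ι-suc z) & half q y<q & th & 0≤R² & 0≤ι N & 0≤ι k & 0≤ι z & []))))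

-- The hypergraph of an affine plane.

mem : ∀ {n} → Subset n → ℕ → Bool
mem []      _       = false
mem (b ∷ h) zero    = b
mem (b ∷ h) (suc v) = mem h v

𝟙ᵇ : Bool → F
𝟙ᵇ true  = 1F
𝟙ᵇ false = 0F

mem-toℕ : ∀ {n} (h : Subset n) v → mem h (toℕ v) ≡ Vec.lookup h v
mem-toℕ (b ∷ h) zero    = refl
mem-toℕ (b ∷ h) (suc v) = mem-toℕ h v

card : ∀ {n} (h : Subset n) → ι ∣ h ∣ ≡ ∑ n (λ v → 𝟙ᵇ (mem h v))
card []                  = ι0
card {suc n} (true  ∷ h) = trans (ι-suc ∣ h ∣) (trans (cong (1F +_) (card h)) (sym (∑-head n (λ v → 𝟙ᵇ (mem (true ∷ h) v)))))
card {suc n} (false ∷ h) = trans (card h) (sym (trans (∑-head n (λ v → 𝟙ᵇ (mem (false ∷ h) v))) (+-identityˡ _)))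

lookup-tabulate : ∀ {A : Set} {n} (f : Fin n → A) (i : Fin (List.length (List.tabulate f))) →
                  List.lookup (List.tabulate f) i ≡ f (cast (List.length-tabulate f) i)
lookup-tabulate {n = suc n} f zero    = refl
lookup-tabulate {n = suc n} f (suc i) = lookup-tabulate (f ∘ suc) i

cast-injective : ∀ {m n} .(e : m ≡ n) {i j : Fin m} → cast e i ≡ cast e j → i ≡ j
cast-injective e {i} {j} p = Fin.toℕ-injective (trans (sym (Fin.toℕ-cast e i)) (trans (cong toℕ p) (Fin.toℕ-cast e j)))

weight-≥ : ∀ {n} (H : Hypergraph n) → (∀ i → 6 ℕ.≤ ∣ edge H i ∣) → ι (List.length H ℕ.* 3) ≤ ζ (weight H)
weight-≥ []      big = subst₂ _≤_ (sym ι0) (sym ζ0) ≤-refl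
weight-≥ (h ∷ H) big = step (ζ (weight H)) (ζ (weight (h ∷ H))) (ζ (ℤ.- (ℤ.+ 3))) (weight-≥ H (big ∘ suc))
    (trans (ζ-+ (ℤ.+ ∣ h ∣ ℤ.- ℤ.+ 3) (weight H)) (cong (_+ ζ (weight H)) (ζ-+ (ℤ.+ ∣ h ∣) (ℤ.- (ℤ.+ 3)))))
    (subst (_≤ ζ (ℤ.+ ∣ h ∣)) refl (ζ-mono (ℤ.+≤+ (big zero))))
  where
  step : ∀ w w′ c → ι (List.length H ℕ.* 3) ≤ w → w′ ≡ (ζ (ℤ.+ ∣ h ∣) + ζ (ℤ.- (ℤ.+ 3))) + w → # 6 ≤ ζ (ℤ.+ ∣ h ∣) → ι (3 ℕ.+ List.length H ℕ.* 3) ≤ w′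
  step w w′ c p q r = go (ζ (ℤ.+ ∣ h ∣)) q r
    where
    go : ∀ s → w′ ≡ (s + ζ (ℤ.- (ℤ.+ 3))) + w → # 6 ≤ s → ι (3 ℕ.+ List.length H ℕ.* 3) ≤ w′
    go s q r = lin (w ∷ w′ ∷ s ∷ ι (List.length H ℕ.* 3) ∷ ι (3 ℕ.+ List.length H ℕ.* 3) ∷ ι 3 ∷ [])
      (from (p & q & r & ι-+ 3 (List.length H ℕ.* 3) & ι-# 3 & []))

-- Incidences between points and lines of the affine plane of prime order q; every point and every
-- line is replaced by three vertices, and an incidence becomes the union of its two triples.
-- The vertex v belongs to class v / 3; classes below q² are points, the next q² classes are lines.
module Plane (q : ℕ) (pq : Prime q) (n : ℕ) (room : q ℕ.* q ℕ.* 6 ℕ.≤ n) where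

  instance
    q≢0 : NonZero q
    q≢0 = prime⇒nonZero pq

  Flag : Set
  Flag = Fin (q ℕ.* (q ℕ.* q))

  opaque
    slope intercept abscissa : Flag → ℕ
    slope     i = toℕ (proj₁ (remQuot {q} (q ℕ.* q) i))
    intercept i = toℕ (proj₁ (remQuot {q} q (proj₂ (remQuot {q} (q ℕ.* q) i))))
    abscissa  i = toℕ (proj₂ (remQuot {q} q (proj₂ (remQuot {q} (q ℕ.* q) i))))

    slope< : ∀ i → slope i ℕ.< q
    slope< i = Fin.toℕ<n (proj₁ (remQuot {q} (q ℕ.* q) i))

    intercept< : ∀ i → intercept i ℕ.< q
    intercept< i = Fin.toℕ<n (proj₁ (remQuot {q} q (proj₂ (remQuot {q} (q ℕ.* q) i))))

    abscissa< : ∀ i → abscissa i ℕ.< q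
    abscissa< i = Fin.toℕ<n (proj₂ (remQuot {q} q (proj₂ (remQuot {q} (q ℕ.* q) i))))

    flag-injective : ∀ {i j} → slope i ≡ slope j → intercept i ≡ intercept j → abscissa i ≡ abscissa j → i ≡ j
    flag-injective {i} {j} a b c = trans (sym (Fin.combine-remQuot {q} (q ℕ.* q) i)) (trans (cong₂ combine (Fin.toℕ-injective a)
        (trans (sym (Fin.combine-remQuot {q} q _)) (trans (cong₂ combine (Fin.toℕ-injective b) (Fin.toℕ-injective c)) (Fin.combine-remQuot {q} q _))))
        (Fin.combine-remQuot {q} (q ℕ.* q) j))

  ordinate : Flag → ℕ
  ordinate i = (slope i ℕ.* abscissa i ℕ.+ intercept i) ℕ.% q

  ordinate< : ∀ i → ordinate i ℕ.< q
  ordinate< i = ℕ.m%n<n (slope i ℕ.* abscissa i ℕ.+ intercept i) q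

  pair-injective : ∀ {a b c d} → b ℕ.< q → d ℕ.< q → a ℕ.* q ℕ.+ b ≡ c ℕ.* q ℕ.+ d → a ≡ c × b ≡ d
  pair-injective {a} {b} {c} {d} b<q d<q e = a≡c , ℕ.+-cancelˡ-≡ (a ℕ.* q) b d (trans e (cong (λ z → z ℕ.* q ℕ.+ d) (sym a≡c)))
    where
    quotient : ∀ {a b} → b ℕ.< q → (a ℕ.* q ℕ.+ b) ℕ./ q ≡ a
    quotient {a} {b} b<q = trans (ℕ.+-distrib-/-∣ˡ b (divides a refl)) (trans (cong₂ ℕ._+_ (ℕ.m*n/n≡m a q) (ℕ.m<n⇒m/n≡0 b<q)) (ℕ.+-identityʳ a))
    a≡c : a ≡ c
    a≡c = trans (sym (quotient b<q)) (trans (cong (ℕ._/ q) e) (quotient d<q))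

  pair< : ∀ {a b} → a ℕ.< q → b ℕ.< q → a ℕ.* q ℕ.+ b ℕ.< q ℕ.* q
  pair< {a} {b} a<q b<q = ℕ.<-≤-trans (ℕ.+-monoʳ-< (a ℕ.* q) b<q) (ℕ.≤-trans (ℕ.≤-reflexive (ℕ.+-comm (a ℕ.* q) q)) (ℕ.*-monoˡ-≤ q a<q))

  data Side : Set where
    point line : Side

  class : Side → Flag → ℕ
  class point i = abscissa i ℕ.* q ℕ.+ ordinate i
  class line  i = q ℕ.* q ℕ.+ (slope i ℕ.* q ℕ.+ intercept i)

  class-sides : ∀ i j → class point i ≢ class line j
  class-sides i j e = ℕ.<⇒≱ (pair< (abscissa< i) (ordinate< i)) (subst (q ℕ.* q ℕ.≤_) (sym e) (ℕ.m≤m+n (q ℕ.* q) _))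

  point-coordinates : ∀ {i j} → class point i ≡ class point j → abscissa i ≡ abscissa j × ordinate i ≡ ordinate j
  point-coordinates {i} {j} = pair-injective {abscissa i} {ordinate i} {abscissa j} {ordinate j} (ordinate< i) (ordinate< j)

  line-coordinates : ∀ {i j} → class line i ≡ class line j → slope i ≡ slope j × intercept i ≡ intercept j
  line-coordinates {i} {j} e = pair-injective {slope i} {intercept i} {slope j} {intercept j} (intercept< i) (intercept< j) (ℕ.+-cancelˡ-≡ (q ℕ.* q) _ _ e)

  class-injective : ∀ {i j} → class point i ≡ class point j → class line i ≡ class line j → i ≡ j
  class-injective p l = flag-injective (proj₁ (line-coordinates l)) (proj₂ (line-coordinates l)) (proj₁ (point-coordinates p))

  small-multiple : ∀ {a b} → a ℕ.< q → b ℕ.< q → q ∣ ℤ.∣ ℤ.+ a ℤ.- ℤ.+ b ∣ → a ≡ b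
  small-multiple {a} {b} a<q b<q d = ℤ.+-injective (ℤ.i-j≡0⇒i≡j (ℤ.+ a) (ℤ.+ b) (ℤ.∣i∣≡0⇒i≡0 (zero-if-small (ℤ.∣ ℤ.+ a ℤ.- ℤ.+ b ∣) size d)))
    where
    zero-if-small : ∀ m → m ℕ.< q → q ∣ m → m ≡ 0
    zero-if-small zero    _ _ = refl
    zero-if-small (suc m) p d = ⊥-elim (ℕ.<⇒≱ p (∣⇒≤ d))
    size : ℤ.∣ ℤ.+ a ℤ.- ℤ.+ b ∣ ℕ.< q
    size = subst (ℕ._< q) (cong ℤ.∣_∣ (sym (ℤ.m-n≡m⊖n a b))) (ℕ.≤-<-trans (ℤ.∣m⊝n∣≤m⊔n a b) (ℕ.⊔-lub a<q b<q))

  congruent : ∀ u v → u ℕ.% q ≡ v ℕ.% q → q ∣ ℤ.∣ ℤ.+ u ℤ.- ℤ.+ v ∣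
  congruent u v e = divides ℤ.∣ ℤ.+ (u ℕ./ q) ℤ.- ℤ.+ (v ℕ./ q) ∣ (trans (cong ℤ.∣_∣ eq) (ℤ.abs-* (ℤ.+ (u ℕ./ q) ℤ.- ℤ.+ (v ℕ./ q)) (ℤ.+ q)))
    where
    expand : ∀ u → ℤ.+ u ≡ ℤ.+ (u ℕ.% q) ℤ.+ ℤ.+ (u ℕ./ q) ℤ.* ℤ.+ q
    expand u = trans (cong (λ z → ℤ.+ z) (ℕ.m≡m%n+[m/n]*n u q)) (cong (λ z → ℤ.+ (u ℕ.% q) ℤ.+ z) (ℤ.pos-* (u ℕ./ q) q))
    cancel : ∀ r a b c → (r ℤ.+ a ℤ.* c) ℤ.- (r ℤ.+ b ℤ.* c) ≡ (a ℤ.- b) ℤ.* c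
    cancel = solve-∀
    eq : ℤ.+ u ℤ.- ℤ.+ v ≡ (ℤ.+ (u ℕ./ q) ℤ.- ℤ.+ (v ℕ./ q)) ℤ.* ℤ.+ q
    eq = trans (cong₂ ℤ._-_ (expand u) (trans (expand v) (cong (λ r → ℤ.+ r ℤ.+ ℤ.+ (v ℕ./ q) ℤ.* ℤ.+ q) (sym e)))) (cancel (ℤ.+ (u ℕ.% q)) (ℤ.+ (u ℕ./ q)) (ℤ.+ (v ℕ./ q)) (ℤ.+ q))

  -- Two points on two common lines: (a - a′)(x - x′) vanishes modulo q.
  no-digon : ∀ {a b a′ b′ x x′} → a ℕ.< q → a′ ℕ.< q → x ℕ.< q → x′ ℕ.< q →
             (a ℕ.* x ℕ.+ b) ℕ.% q ≡ (a′ ℕ.* x ℕ.+ b′) ℕ.% q → (a ℕ.* x′ ℕ.+ b) ℕ.% q ≡ (a′ ℕ.* x′ ℕ.+ b′) ℕ.% q → a ≡ a′ ⊎ x ≡ x′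
  no-digon {a} {b} {a′} {b′} {x} {x′} a<q a′<q x<q x′<q e e′ =
    [ inj₁ ∘ small-multiple a<q a′<q , inj₂ ∘ small-multiple x<q x′<q ]′ (euclidsLemma ℤ.∣ ℤ.+ a ℤ.- ℤ.+ a′ ∣ ℤ.∣ ℤ.+ x ℤ.- ℤ.+ x′ ∣ pq product-∣)
    where
    pos : ∀ a x b → ℤ.+ (a ℕ.* x ℕ.+ b) ≡ ℤ.+ a ℤ.* ℤ.+ x ℤ.+ ℤ.+ b
    pos a x b = cong (λ z → z ℤ.+ ℤ.+ b) (ℤ.pos-* a x)
    identity : ∀ a a′ x x′ b b′ → ((a ℤ.* x ℤ.+ b) ℤ.- (a′ ℤ.* x ℤ.+ b′)) ℤ.- ((a ℤ.* x′ ℤ.+ b) ℤ.- (a′ ℤ.* x′ ℤ.+ b′)) ≡ (a ℤ.- a′) ℤ.* (x ℤ.- x′)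
    identity = solve-∀
    u v : ℤ
    u = ℤ.+ (a ℕ.* x ℕ.+ b) ℤ.- ℤ.+ (a′ ℕ.* x ℕ.+ b′)
    v = ℤ.+ (a ℕ.* x′ ℕ.+ b) ℤ.- ℤ.+ (a′ ℕ.* x′ ℕ.+ b′)
    uv : u ℤ.- v ≡ (ℤ.+ a ℤ.- ℤ.+ a′) ℤ.* (ℤ.+ x ℤ.- ℤ.+ x′)
    uv = trans (cong₂ ℤ._-_ (cong₂ ℤ._-_ (pos a x b) (pos a′ x b′)) (cong₂ ℤ._-_ (pos a x′ b) (pos a′ x′ b′))) (identity (ℤ.+ a) (ℤ.+ a′) (ℤ.+ x) (ℤ.+ x′) (ℤ.+ b) (ℤ.+ b′))
    product-∣ : q ∣ ℤ.∣ ℤ.+ a ℤ.- ℤ.+ a′ ∣ ℕ.* ℤ.∣ ℤ.+ x ℤ.- ℤ.+ x′ ∣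
    product-∣ = subst (q ∣_) (trans (cong ℤ.∣_∣ uv) (ℤ.abs-* (ℤ.+ a ℤ.- ℤ.+ a′) (ℤ.+ x ℤ.- ℤ.+ x′)))
      (ℤ∣.∣⇒∣ᵤ {ℤ.+ q} {u ℤ.- v} (ℤ∣.∣m∣n⇒∣m-n {ℤ.+ q} {u} {v} (ℤ∣.∣ᵤ⇒∣ {ℤ.+ q} {u} (congruent _ _ e)) (ℤ∣.∣ᵤ⇒∣ {ℤ.+ q} {v} (congruent _ _ e′))))

  -- The points of the flags i and j lie on the lines of both i and l. By `no-digon` the slopes or
  -- the abscissae agree, and then two flags coincide.
  no-quad : ∀ {i j k l} → class point i ≡ class point l → class line i ≡ class line j → class point j ≡ class point k → class line k ≡ class line l → i ≡ j ⊎ i ≡ l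
  no-quad {i} {j} {k} {l} pil lij pjk lkl = conclude (no-digon {slope i} {intercept i} {slope l} {intercept l} {abscissa i} {abscissa j} (slope< i) (slope< l) (abscissa< i) (abscissa< j) on-i on-j)
    where
    il = point-coordinates {i} {l} pil
    jk = point-coordinates {j} {k} pjk
    ij = line-coordinates {i} {j} lij
    kl = line-coordinates {k} {l} lkl
    at : ℕ → ℕ → ℕ → ℕ
    at a x b = (a ℕ.* x ℕ.+ b) ℕ.% q
    on-i : at (slope i) (abscissa i) (intercept i) ≡ at (slope l) (abscissa i) (intercept l)
    on-i = trans (proj₂ il) (cong (λ x → at (slope l) x (intercept l)) (sym (proj₁ il)))
    on-j : at (slope i) (abscissa j) (intercept i) ≡ at (slope l) (abscissa j) (intercept l)
    on-j = trans (cong₂ (λ a b → at a (abscissa j) b) (proj₁ ij) (proj₂ ij)) (trans (proj₂ jk)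
      (trans (cong (λ x → at (slope k) x (intercept k)) (sym (proj₁ jk))) (cong₂ (λ a b → at a (abscissa j) b) (proj₁ kl) (proj₂ kl))))
    conclude : slope i ≡ slope l ⊎ abscissa i ≡ abscissa j → i ≡ j ⊎ i ≡ l
    conclude (inj₂ e) = inj₁ (flag-injective (proj₁ ij) (proj₂ ij) e)
    conclude (inj₁ e) = inj₂ (flag-injective e same-intercept (proj₁ il))
      where
      same-intercept : intercept i ≡ intercept l
      same-intercept = small-multiple (intercept< i) (intercept< l) (subst (q ∣_) (cong ℤ.∣_∣ (shift (ℤ.+ (slope i ℕ.* abscissa i)) (ℤ.+ intercept i) (ℤ.+ intercept l)))
        (congruent (slope i ℕ.* abscissa i ℕ.+ intercept i) (slope i ℕ.* abscissa i ℕ.+ intercept l) (trans on-i (cong (λ a → at a (abscissa i) (intercept l)) (sym e)))))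
        where
        shift : ∀ s a b → (s ℤ.+ a) ℤ.- (s ℤ.+ b) ≡ a ℤ.- b
        shift = solve-∀

  class< : ∀ s i → class s i ℕ.< q ℕ.* q ℕ.+ q ℕ.* q
  class< point i = ℕ.<-≤-trans (pair< (abscissa< i) (ordinate< i)) (ℕ.m≤m+n (q ℕ.* q) (q ℕ.* q))
  class< line  i = ℕ.+-monoʳ-< (q ℕ.* q) (pair< (slope< i) (intercept< i))

  side-unique : ∀ {s t i j} → class s i ≡ class t j → s ≡ t
  side-unique {point} {point} e = refl
  side-unique {point} {line} {i} {j} e = ⊥-elim (class-sides i j e)
  side-unique {line} {point} {i} {j} e = ⊥-elim (class-sides j i (sym e))
  side-unique {line} {line}  e = refl

  other : Side → Side
  other point = line
  other line  = point

  class-injective′ : ∀ s {i j} → class s i ≡ class s j → class (other s) i ≡ class (other s) j → i ≡ j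
  class-injective′ point p l = class-injective p l
  class-injective′ line  l p = class-injective p l

  -- Consecutive classes on one side coincide, both being that class of the common hyperedge. If the
  -- sides form two runs, two hyperedges agree in both classes (`one`, `two`); alternating sides
  -- contradict `no-quad`. Only walks within one class remain.
  closed-walk : ∀ {c₁ c₂ c₃ c₄ e₁ e₂ e₃ e₄} s₁ s₂ s₃ s₄ →
    c₁ ≡ class s₁ e₁ → c₂ ≡ class s₂ e₁ → c₂ ≡ class s₂ e₂ → c₃ ≡ class s₃ e₂ →
    c₃ ≡ class s₃ e₃ → c₄ ≡ class s₄ e₃ → c₄ ≡ class s₄ e₄ → c₁ ≡ class s₁ e₄ →
    e₁ ≢ e₂ → e₁ ≢ e₃ → e₁ ≢ e₄ → e₂ ≢ e₃ → e₂ ≢ e₄ → e₃ ≢ e₄ → c₂ ≡ c₁ × c₃ ≡ c₁ × c₄ ≡ c₁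
  closed-walk {e₁ = e₁} {e₂} {e₃} {e₄} s₁ s₂ s₃ s₄ a₁ b₂ a₂ b₃ a₃ b₄ a₄ b₁ n₁₂ n₁₃ n₁₄ n₂₃ n₂₄ n₃₄ = go s₁ s₂ s₃ s₄ a₁ b₂ a₂ b₃ a₃ b₄ a₄ b₁
    where
    constant : ∀ s {c₁ c₂ c₃ c₄} → c₁ ≡ class s e₁ → c₂ ≡ class s e₁ → c₂ ≡ class s e₂ → c₃ ≡ class s e₂ → c₄ ≡ class s e₄ → c₁ ≡ class s e₄ → c₂ ≡ c₁ × c₃ ≡ c₁ × c₄ ≡ c₁
    constant s a₁ b₂ a₂ b₃ a₄ b₁ = trans b₂ (sym a₁) , trans b₃ (trans (sym a₂) (trans b₂ (sym a₁))) , trans a₄ (sym b₁)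
    one : ∀ s {c₁ c₂ c₃ c₄ e₁ e₂ e₃ e₄} → c₁ ≡ class s e₁ → c₂ ≡ class s e₁ → c₂ ≡ class s e₂ → c₃ ≡ class s e₂ →
          c₃ ≡ class s e₃ → c₄ ≡ class (other s) e₃ → c₄ ≡ class (other s) e₄ → c₁ ≡ class s e₄ → e₃ ≡ e₄
    one s a₁ b₂ a₂ b₃ a₃ b₄ a₄ b₁ = class-injective′ s (trans (sym a₃) (trans b₃ (trans (sym a₂) (trans b₂ (trans (sym a₁) b₁))))) (trans (sym b₄) a₄)
    two : ∀ s {c₁ c₂ c₃ c₄ e₁ e₂ e₃ e₄} → c₁ ≡ class s e₁ → c₂ ≡ class s e₁ → c₂ ≡ class s e₂ → c₃ ≡ class (other s) e₂ →
          c₃ ≡ class (other s) e₃ → c₄ ≡ class (other s) e₃ → c₄ ≡ class (other s) e₄ → c₁ ≡ class s e₄ → e₂ ≡ e₄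
    two s a₁ b₂ a₂ b₃ a₃ b₄ a₄ b₁ = class-injective′ s (trans (sym a₂) (trans b₂ (trans (sym a₁) b₁))) (trans (sym b₃) (trans a₃ (trans (sym b₄) a₄)))
    go : ∀ {c₁ c₂ c₃ c₄} s₁ s₂ s₃ s₄ → c₁ ≡ class s₁ e₁ → c₂ ≡ class s₂ e₁ → c₂ ≡ class s₂ e₂ → c₃ ≡ class s₃ e₂ →
         c₃ ≡ class s₃ e₃ → c₄ ≡ class s₄ e₃ → c₄ ≡ class s₄ e₄ → c₁ ≡ class s₁ e₄ → c₂ ≡ c₁ × c₃ ≡ c₁ × c₄ ≡ c₁
    go point point point point a₁ b₂ a₂ b₃ a₃ b₄ a₄ b₁ = constant point a₁ b₂ a₂ b₃ a₄ b₁
    go line  line  line  line  a₁ b₂ a₂ b₃ a₃ b₄ a₄ b₁ = constant line a₁ b₂ a₂ b₃ a₄ b₁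
    go point point point line  a₁ b₂ a₂ b₃ a₃ b₄ a₄ b₁ = ⊥-elim (n₃₄ (one point a₁ b₂ a₂ b₃ a₃ b₄ a₄ b₁))
    go line  line  line  point a₁ b₂ a₂ b₃ a₃ b₄ a₄ b₁ = ⊥-elim (n₃₄ (one line a₁ b₂ a₂ b₃ a₃ b₄ a₄ b₁))
    go point point line  point a₁ b₂ a₂ b₃ a₃ b₄ a₄ b₁ = ⊥-elim (n₂₃ (one point a₄ b₁ a₁ b₂ a₂ b₃ a₃ b₄))
    go line  line  point line  a₁ b₂ a₂ b₃ a₃ b₄ a₄ b₁ = ⊥-elim (n₂₃ (one line a₄ b₁ a₁ b₂ a₂ b₃ a₃ b₄))
    go point line  point point a₁ b₂ a₂ b₃ a₃ b₄ a₄ b₁ = ⊥-elim (n₁₂ (one point a₃ b₄ a₄ b₁ a₁ b₂ a₂ b₃))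
    go line  point line  line  a₁ b₂ a₂ b₃ a₃ b₄ a₄ b₁ = ⊥-elim (n₁₂ (one line a₃ b₄ a₄ b₁ a₁ b₂ a₂ b₃))
    go line  point point point a₁ b₂ a₂ b₃ a₃ b₄ a₄ b₁ = ⊥-elim (n₁₄ (sym (one point a₂ b₃ a₃ b₄ a₄ b₁ a₁ b₂)))
    go point line  line  line  a₁ b₂ a₂ b₃ a₃ b₄ a₄ b₁ = ⊥-elim (n₁₄ (sym (one line a₂ b₃ a₃ b₄ a₄ b₁ a₁ b₂)))
    go point point line  line  a₁ b₂ a₂ b₃ a₃ b₄ a₄ b₁ = ⊥-elim (n₂₄ (two point a₁ b₂ a₂ b₃ a₃ b₄ a₄ b₁))
    go line  line  point point a₁ b₂ a₂ b₃ a₃ b₄ a₄ b₁ = ⊥-elim (n₂₄ (two line a₁ b₂ a₂ b₃ a₃ b₄ a₄ b₁))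
    go point line  line  point a₁ b₂ a₂ b₃ a₃ b₄ a₄ b₁ = ⊥-elim (n₁₃ (two point a₄ b₁ a₁ b₂ a₂ b₃ a₃ b₄))
    go line  point point line  a₁ b₂ a₂ b₃ a₃ b₄ a₄ b₁ = ⊥-elim (n₁₃ (two line a₄ b₁ a₁ b₂ a₂ b₃ a₃ b₄))
    go point line  point line  a₁ b₂ a₂ b₃ a₃ b₄ a₄ b₁ = ⊥-elim ([ n₁₂ , n₁₄ ]′ (no-quad {e₁} {e₂} {e₃} {e₄} (trans (sym a₁) b₁) (trans (sym b₂) a₂) (trans (sym b₃) a₃) (trans (sym b₄) a₄)))
    go line  point line  point a₁ b₂ a₂ b₃ a₃ b₄ a₄ b₁ = ⊥-elim ([ n₂₃ , n₁₂ ∘ sym ]′ (no-quad {e₂} {e₃} {e₄} {e₁} (trans (sym a₂) b₂) (trans (sym b₃) a₃) (trans (sym b₄) a₄) (trans (sym b₁) a₁)))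

  opaque
    hyperedge : Flag → Subset n
    hyperedge i = Vec.tabulate (λ v → does (fl (toℕ v) 3 ℕ.≟ class point i) ∨ does (fl (toℕ v) 3 ℕ.≟ class line i))

    ∈⇒class : ∀ {v i} → v ∈ hyperedge i → ∃ λ s → fl (toℕ v) 3 ≡ class s i
    ∈⇒class {v} {i} m = cases (fl (toℕ v) 3 ℕ.≟ class point i) (fl (toℕ v) 3 ℕ.≟ class line i) (trans (sym (Vec.lookup∘tabulate _ v)) (Vec.[]=⇒lookup m))
      where
      cases : (d : Dec (fl (toℕ v) 3 ≡ class point i)) (e : Dec (fl (toℕ v) 3 ≡ class line i)) → does d ∨ does e ≡ true → ∃ λ s → fl (toℕ v) 3 ≡ class s i
      cases (yes e) _       _  = point , e
      cases (no _)  (yes e) _  = line , e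
      cases (no _)  (no _)  ()

    class⇒mem : ∀ {v i} s → v ℕ.< n → fl v 3 ≡ class s i → mem (hyperedge i) v ≡ true
    class⇒mem {v} {i} s v<n e = trans (cong (mem (hyperedge i)) (sym v≡)) (trans (mem-toℕ (hyperedge i) (fromℕ< v<n)) (trans (Vec.lookup∘tabulate _ (fromℕ< v<n)) (holds s (trans (cong (λ u → fl u 3) v≡) e))))
      where
      v≡ : toℕ (fromℕ< v<n) ≡ v
      v≡ = Fin.toℕ-fromℕ< v<n
      holds : ∀ s {p} → p ≡ class s i → does (p ℕ.≟ class point i) ∨ does (p ℕ.≟ class line i) ≡ true
      holds point {p} e = cong (_∨ does (p ℕ.≟ class line i)) (dec-true (p ℕ.≟ class point i) e)
      holds line  {p} e = trans (cong (does (p ℕ.≟ class point i) ∨_) (dec-true (p ℕ.≟ class line i) e)) (∨-zeroʳ _)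

  room₃ : ∀ c → c ℕ.< q ℕ.* q ℕ.+ q ℕ.* q → c ℕ.* 3 ℕ.+ 3 ℕ.≤ n
  room₃ c p = ℕ.≤-trans (ℕ.≤-trans (ℕ.≤-reflexive (ℕ.+-comm (c ℕ.* 3) 3)) (ℕ.*-monoˡ-≤ 3 p)) (ℕ.≤-trans (ℕ.≤-reflexive (six (q ℕ.* q))) room)
    where
    six : ∀ m → (m ℕ.+ m) ℕ.* 3 ≡ m ℕ.* 6
    six m = trans (ℕ.*-distribʳ-+ 3 m m) (sym (ℕ.*-distribˡ-+ m 3 3))

  class-size : ∀ c → c ℕ.< q ℕ.* q ℕ.+ q ℕ.* q → # 3 ≤ ∑ n (λ v → 𝟙 (fl v 3 ℕ.≟ c))
  class-size c p = ≤-trans (subst (# 3 ≤_) (sym (∑-split (c ℕ.* 3) 3 f)) (step (∑ (c ℕ.* 3) f) (∑-nonneg (c ℕ.* 3) λ i _ → 𝟙-nonneg (fl i 3 ℕ.≟ c)) block)) (∑-monoˡ f (room₃ c p) λ i → 𝟙-nonneg (fl i 3 ℕ.≟ c))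
    where
    f : ℕ → F
    f v = 𝟙 (fl v 3 ℕ.≟ c)
    block : ∑ 3 (λ i → f (c ℕ.* 3 ℕ.+ i)) ≡ ι 3 * 1F
    block = trans (∑-cong 3 λ i i<3 → 𝟙-yes (fl (c ℕ.* 3 ℕ.+ i) 3 ℕ.≟ c) (fl-≡ (s≤s z≤n) (ℕ.≤-trans (ℕ.≤-reflexive (ℕ.*-comm 3 c)) (ℕ.m≤m+n (c ℕ.* 3) i))
              (subst (c ℕ.* 3 ℕ.+ i ℕ.<_) (trans (ℕ.+-comm (c ℕ.* 3) 3) (ℕ.*-comm (suc c) 3)) (ℕ.+-monoʳ-< (c ℕ.* 3) i<3)))) (∑-const 3 1F)
    step : ∀ a {b} → 0F ≤ a → b ≡ ι 3 * 1F → # 3 ≤ a + b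
    step a p refl = lin (a ∷ ι 3 ∷ []) (from (p & ι-# 3 & []))

  hyperedge-size : ∀ i → 6 ℕ.≤ ∣ hyperedge i ∣
  hyperedge-size i = ι-cancel (≤-trans (subst₂ _≤_ (sym (ι-# 6)) refl (six (class-size (class point i) (class< point i)) (class-size (class line i) (class< line i))))
      (subst₂ _≤_ (∑-+ n (λ v → 𝟙 (fl v 3 ℕ.≟ class point i)) (λ v → 𝟙 (fl v 3 ℕ.≟ class line i))) (sym (card (hyperedge i))) (∑-mono n λ v v<n → pointwise v v<n (fl v 3 ℕ.≟ class point i) (fl v 3 ℕ.≟ class line i))))
    where
    six : ∀ {a b} → # 3 ≤ a → # 3 ≤ b → # 6 ≤ a + b
    six {a} {b} p q = lin (a ∷ b ∷ []) (from (p & q & []))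
    pointwise : ∀ v → v ℕ.< n → (d : Dec (fl v 3 ≡ class point i)) (e : Dec (fl v 3 ≡ class line i)) → 𝟙 d + 𝟙 e ≤ 𝟙ᵇ (mem (hyperedge i) v)
    pointwise v v<n (yes d) (yes e) = ⊥-elim (class-sides i i (trans (sym d) e))
    pointwise v v<n (yes d) (no _)  = subst (λ b → 1F + 0F ≤ 𝟙ᵇ b) (sym (class⇒mem point v<n d)) (≤-reflexive (+-identityʳ 1F))
    pointwise v v<n (no _)  (yes e) = subst (λ b → 0F + 1F ≤ 𝟙ᵇ b) (sym (class⇒mem line v<n e)) (≤-reflexive (+-identityˡ 1F))
    pointwise v v<n (no _)  (no _)  = ≤-trans (≤-reflexive (+-identityʳ 0F)) (0≤𝟙ᵇ (mem (hyperedge i) v))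
      where
      0≤𝟙ᵇ : ∀ b → 0F ≤ 𝟙ᵇ b
      0≤𝟙ᵇ true  = 0≤1
      0≤𝟙ᵇ false = ≤-refl

  hypergraph : Hypergraph n
  hypergraph = List.tabulate hyperedge

  flag : Fin (List.length hypergraph) → Flag
  flag = cast (List.length-tabulate hyperedge)

  edge≡ : ∀ h → edge hypergraph h ≡ hyperedge (flag h)
  edge≡ = lookup-tabulate hyperedge

  weight-lower : ι (q ℕ.* (q ℕ.* q) ℕ.* 3) ≤ ζ (weight hypergraph)
  weight-lower = subst (λ m → ι (m ℕ.* 3) ≤ ζ (weight hypergraph)) (List.length-tabulate hyperedge)
    (weight-≥ hypergraph λ h → subst (λ e → 6 ℕ.≤ ∣ e ∣) (sym (edge≡ h)) (hyperedge-size (flag h)))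

  class-pigeonhole : ∀ (v : Fin 4 → Fin n) c → (∀ i → fl (toℕ (v i)) 3 ≡ c) → ∃ λ i → ∃ λ j → i Fin.< j × v i ≡ v j
  class-pigeonhole v c same = conclude (Fin.pigeonhole (ℕ.n<1+n 3) (λ i → ℕ._mod_ (toℕ (v i)) 3))
    where
    conclude : (∃ λ i → ∃ λ j → i Fin.< j × ℕ._mod_ (toℕ (v i)) 3 ≡ ℕ._mod_ (toℕ (v j)) 3) → ∃ λ i → ∃ λ j → i Fin.< j × v i ≡ v j
    conclude (i , j , i<j , e) = i , j , i<j , Fin.toℕ-injective (trans (ℕ.m≡m%n+[m/n]*n (toℕ (v i)) 3)
        (trans (cong₂ (λ a b → a ℕ.+ b ℕ.* 3) (trans (sym (Fin.toℕ-fromℕ< _)) (trans (cong toℕ e) (Fin.toℕ-fromℕ< _))) (trans (same i) (sym (same j)))) (sym (ℕ.m≡m%n+[m/n]*n (toℕ (v j)) 3))))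

  -- By `closed-walk` the four vertices of a cycle lie in one class, which has only three vertices.
  C4-free : BergeC4Free hypergraph
  C4-free cycle = distinct (class-pigeonhole v (at v₁) same)
    where
    open BergeC4 cycle
    at : Fin n → ℕ
    at v = fl (toℕ v) 3
    located : ∀ {v} h → v ∈ edge hypergraph h → ∃ λ s → at v ≡ class s (flag h)
    located h m = ∈⇒class (subst (_ ∈_) (edge≡ h) m)
    agree : ∀ {v h h′} (p : ∃ λ s → at v ≡ class s (flag h)) (p′ : ∃ λ s → at v ≡ class s (flag h′)) → at v ≡ class (proj₁ p) (flag h′)
    agree {v} {h} {h′} (s , e) (s′ , e′) = subst (λ t → at v ≡ class t (flag h′)) (sym (side-unique {s} {s′} {flag h} {flag h′} (trans (sym e) e′))) e′
    differ : ∀ {h h′} → h ≢ h′ → flag h ≢ flag h′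
    differ ne e = ne (cast-injective _ e)
    w₁ = located h₁ (proj₁ in₁)
    w₂ = located h₂ (proj₁ in₂)
    w₃ = located h₃ (proj₁ in₃)
    w₄ = located h₄ (proj₁ in₄)
    constant : at v₂ ≡ at v₁ × at v₃ ≡ at v₁ × at v₄ ≡ at v₁
    constant = closed-walk (proj₁ w₁) (proj₁ w₂) (proj₁ w₃) (proj₁ w₄)
      (proj₂ w₁) (agree {v₂} {h₂} {h₁} w₂ (located h₁ (proj₂ in₁))) (proj₂ w₂) (agree {v₃} {h₃} {h₂} w₃ (located h₂ (proj₂ in₂)))
      (proj₂ w₃) (agree {v₄} {h₄} {h₃} w₄ (located h₃ (proj₂ in₃))) (proj₂ w₄) (agree {v₁} {h₁} {h₄} w₁ (located h₄ (proj₂ in₄)))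
      (differ (proj₁ h-distinct)) (differ (proj₁ (proj₂ h-distinct))) (differ (proj₁ (proj₂ (proj₂ h-distinct)))) (differ (proj₁ (proj₂ (proj₂ (proj₂ h-distinct)))))
      (differ (proj₁ (proj₂ (proj₂ (proj₂ (proj₂ h-distinct)))))) (differ (proj₂ (proj₂ (proj₂ (proj₂ (proj₂ h-distinct))))))
    v : Fin 4 → Fin n
    v zero                   = v₁
    v (suc zero)             = v₂
    v (suc (suc zero))       = v₃
    v (suc (suc (suc zero))) = v₄
    same : ∀ i → at (v i) ≡ at v₁
    same zero                   = refl
    same (suc zero)             = proj₁ constant
    same (suc (suc zero))       = proj₁ (proj₂ constant)
    same (suc (suc (suc zero))) = proj₂ (proj₂ constant)
    distinct : ¬ ∃ λ i → ∃ λ j → i Fin.< j × v i ≡ v j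
    distinct (zero , suc zero , _ , e)                               = proj₁ v-distinct e
    distinct (zero , suc (suc zero) , _ , e)                         = proj₁ (proj₂ v-distinct) e
    distinct (zero , suc (suc (suc zero)) , _ , e)                   = proj₁ (proj₂ (proj₂ v-distinct)) e
    distinct (suc zero , suc (suc zero) , _ , e)                     = proj₁ (proj₂ (proj₂ (proj₂ v-distinct))) e
    distinct (suc zero , suc (suc (suc zero)) , _ , e)               = proj₁ (proj₂ (proj₂ (proj₂ (proj₂ v-distinct)))) e
    distinct (suc (suc zero) , suc (suc (suc zero)) , _ , e)         = proj₂ (proj₂ (proj₂ (proj₂ (proj₂ v-distinct)))) e
    distinct (zero , zero , () , _)
    distinct (suc zero , suc zero , s≤s () , _)
    distinct (suc (suc zero) , suc zero , s≤s () , _)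
    distinct (suc (suc zero) , suc (suc zero) , s≤s (s≤s ()) , _)
    distinct (suc (suc (suc zero)) , suc zero , s≤s () , _)
    distinct (suc (suc (suc zero)) , suc (suc zero) , s≤s (s≤s ()) , _)
    distinct (suc (suc (suc zero)) , suc (suc (suc zero)) , s≤s (s≤s (s≤s ())) , _)

-- Lower bound: choice of the prime and comparison of cubes.

opaque
  unfolding F ζ

  at-least : ∀ w k m → 0F ≤ ζ w → (1F - inv (suc k)) * (1F - inv (suc k)) * (ζ (ℤ.+ m) * inv 24) ≤ ζ w * ζ w →
             AtLeastSqrt (ℤ→ℚ w) (ℚ.1ℚ ℚ.- ε k) (ℕ→ℚ m ℚ.* (ℤ.+ 1 ℚ./ 24))
  at-least w k m p q = p , q

  at-most : ∀ w k m → ζ w ≤ 0F ⊎ ζ w * ζ w ≤ ((1F + inv (suc k)) * inv 2) * ((1F + inv (suc k)) * inv 2) * ζ (ℤ.+ m) →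
            AtMostSqrt (ℤ→ℚ w) ((ℚ.1ℚ ℚ.+ ε k) ℚ.* (ℤ.+ 1 ℚ./ 2)) (ℕ→ℚ m)
  at-most w k m p = p

ι-cube : ∀ n → ζ (ℤ.+ (n ^ 3)) ≡ ι n * ι n * ι n
ι-cube n = trans (sym (ι-# (n ^ 3))) (trans (ι-* n (n ℕ.* (n ℕ.* 1))) (trans (cong (ι n *_) (trans (ι-* n (n ℕ.* 1)) (cong (ι n *_) (cong ι (ℕ.*-identityʳ n)))))
  (sym (*-assoc (ι n) (ι n) (ι n)))))

-- With t = 7 u, (1 + u)³ ≤ 1 + t and (1 - t)(1 + t) ≤ 1.
cube-comparison : ∀ {t u Z q} → 0F ≤ t → t ≤ # 1 → 0F ≤ u → u ≤ # 1 → t ≡ # 7 * u → 0F ≤ Z → 0F ≤ q → Z ≤ (# 1 + u) * q →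
                  (# 1 - t) * (Z * Z * Z) ≤ q * q * q
cube-comparison {t} {u} {Z} {q} 0≤t t≤1 0≤u u≤1 t≡ 0≤Z 0≤q Z≤ =
  ≤-trans (*-monoˡ (≤⇒0≤ t≤1) Z³) (lin (t ∷ q ∷ []) (from (*-nonneg (*-nonneg 0≤t 0≤t) 0≤q³ & [])))
  where
  v : F
  v = (# 1 + u) * q
  0≤v : 0F ≤ v
  0≤v = ≤-trans 0≤Z Z≤
  0≤q³ : 0F ≤ q * q * q
  0≤q³ = *-nonneg (*-nonneg 0≤q 0≤q) 0≤q
  Z³ : Z * Z * Z ≤ (# 1 + t) * (q * q * q)
  Z³ = ≤-trans (*-mono (*-nonneg 0≤Z 0≤Z) 0≤v (*-mono 0≤Z 0≤v Z≤ Z≤) Z≤)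
        (lin (t ∷ u ∷ q ∷ []) (from (cong (_* (q * q * q)) t≡ & *-monoˡ 0≤q³ (*-monoˡ 0≤u u≤1) & *-monoˡ 0≤q³ (*-monoˡ (*-nonneg 0≤u 0≤u) u≤1) & [])))

lower-bound : (k : ℕ) → ∃ λ N → (n : ℕ) → n ℕ.≥ N → Σ (Hypergraph n) λ H → BergeC4Free H ×
              AtLeastSqrt (ℤ→ℚ (weight H)) (ℚ.1ℚ ℚ.- ε k) (ℕ→ℚ (n ^ 3) ℚ.* (ℤ.+ 1 ℚ./ 24))
lower-bound k = N ℕ.* N ℕ.* 6 , λ n big → construct n big (isqrt (fl n 6))
  where
  k′ : ℕ
  -- The factor 7 matches `cube-comparison`, which turns the relative gap 1/k′ of the prime into
  -- 1/(k + 1) for its cube.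
  k′ = (k ℕ.+ 1) ℕ.* 7
  1≤k′ : 1 ℕ.≤ k′
  1≤k′ = ℕ.*-mono-≤ (ℕ.m≤n+m 1 k) (s≤s (z≤n {6}))
  gaps = prime-gaps k′ 1≤k′
  N = proj₁ gaps
  construct : ∀ n → n ℕ.≥ N ℕ.* N ℕ.* 6 → (∃ λ z → z ℕ.* z ℕ.≤ fl n 6 × fl n 6 ℕ.< suc z ℕ.* suc z) →
              Σ (Hypergraph n) λ H → BergeC4Free H × AtLeastSqrt (ℤ→ℚ (weight H)) (ℚ.1ℚ ℚ.- ε k) (ℕ→ℚ (n ^ 3) ℚ.* (ℤ.+ 1 ℚ./ 24))
  construct n big (z , z²≤ , <z²) = build (proj₂ gaps z N≤z)
    where
    6z²≤n : z ℕ.* z ℕ.* 6 ℕ.≤ n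
    6z²≤n = ℕ.≤-trans (ℕ.≤-reflexive (ℕ.*-comm (z ℕ.* z) 6)) (≤-fl {n} {6} z²≤)
    n<6z² : n ℕ.< suc z ℕ.* suc z ℕ.* 6
    n<6z² = ℕ.<-≤-trans (fl-upper n 6 (s≤s z≤n)) (ℕ.≤-trans (ℕ.*-monoʳ-≤ 6 <z²) (ℕ.≤-reflexive (ℕ.*-comm 6 (suc z ℕ.* suc z))))
    N≤z : N ℕ.≤ z
    N≤z = ℕ.≮⇒≥ λ z<N → ℕ.<⇒≱ n<6z² (ℕ.≤-trans (ℕ.*-monoˡ-≤ 6 (ℕ.*-mono-≤ z<N z<N)) big)
    build : (∃ λ q → Prime q × q ℕ.≤ z × k′ ℕ.* suc z ℕ.≤ suc k′ ℕ.* q) → Σ (Hypergraph n) λ H → BergeC4Free H ×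
            AtLeastSqrt (ℤ→ℚ (weight H)) (ℚ.1ℚ ℚ.- ε k) (ℕ→ℚ (n ^ 3) ℚ.* (ℤ.+ 1 ℚ./ 24))
    build (q , pq , q≤z , close) = hypergraph , C4-free , at-least (weight hypergraph) k (n ^ 3) (proj₁ bounds) (proj₂ bounds)
      where
      open Plane q pq n (ℕ.≤-trans (ℕ.*-monoˡ-≤ 6 (ℕ.*-mono-≤ q≤z q≤z)) 6z²≤n)
      t u Z c : F
      t = inv (suc k)
      u = inv k′
      Z = ι (suc z)
      c = ι q
      ι-k′ : ι k′ ≡ # 7 * ι (suc k)
      ι-k′ = trans (ι-* (k ℕ.+ 1) 7) (trans (*-comm _ _) (cong₂ _*_ (ι-# 7) (cong ι (ℕ.+-comm k 1))))
      t≡ : t ≡ # 7 * u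
      t≡ = lin (t ∷ u ∷ ι k′ ∷ ι (suc k) ∷ []) (from (cong (_* (u * t)) ι-k′ & cong (_* t) (ι-inv 1≤k′) & cong (_* (# 7 * u)) (ι-inv {suc k} (s≤s z≤n)) & []))
      t≤1 : t ≤ # 1
      t≤1 = lin (t ∷ []) (from (inv≤1 {suc k} (s≤s z≤n) & []))
      u≤1 : u ≤ # 1
      u≤1 = lin (u ∷ []) (from (inv≤1 1≤k′ & []))
      Z≤ : Z ≤ (# 1 + u) * c
      Z≤ = lin (Z ∷ c ∷ u ∷ ι k′ ∷ ι (suc k′) ∷ ι (k′ ℕ.* suc z) ∷ ι (suc k′ ℕ.* q) ∷ [])
        (from (*-monoˡ (0≤inv k′) (ι-mono close) & cong (u *_) (ι-* k′ (suc z)) & cong (u *_) (ι-* (suc k′) q) & cong (λ s → u * (s * c)) (ι-suc k′) & cong (_* Z) (ι-inv 1≤k′) & cong (_* c) (ι-inv 1≤k′) & []))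
      cubes : (# 1 - t) * (Z * Z * Z) ≤ c * c * c
      cubes = cube-comparison (0≤inv (suc k)) t≤1 (0≤inv k′) u≤1 t≡ (0≤ι (suc z)) (0≤ι q) Z≤
      W≥ : # 3 * (c * c * c) ≤ ζ (weight hypergraph)
      W≥ = subst (_≤ ζ (weight hypergraph)) (trans (ι-* (q ℕ.* (q ℕ.* q)) 3) (trans (cong₂ _*_ (trans (ι-* q (q ℕ.* q)) (cong (c *_) (ι-* q q))) (ι-# 3)) (lin (c ∷ []) (from [])))) weight-lower
      n≤ : ι n ≤ # 6 * (Z * Z)
      n≤ = subst (ι n ≤_) (trans (ι-* (suc z ℕ.* suc z) 6) (trans (*-comm _ _) (cong₂ _*_ (ι-# 6) (ι-* (suc z) (suc z))))) (ι-mono (ℕ.<⇒≤ n<6z²))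
      inv-24 : # 24 * inv 24 ≡ 1F
      inv-24 = ι*inv 23
      0≤Z² : 0F ≤ Z * Z
      0≤Z² = square-nonneg Z
      -- 216/24 = 9, so the bound is the square of 3 Z³, to be compared with the weight 3 q³.
      n³ : ζ (ℤ.+ (n ^ 3)) * inv 24 ≤ # 9 * ((Z * Z * Z) * (Z * Z * Z))
      n³ = subst (λ m → m * inv 24 ≤ # 9 * ((Z * Z * Z) * (Z * Z * Z))) (sym (ι-cube n)) (lin (ι n ∷ Z ∷ inv 24 ∷ [])
        (from (*-monoˡ (0≤inv 24) (*-mono (*-nonneg (0≤ι n) (0≤ι n)) 0≤6Z² (*-mono (0≤ι n) 0≤6Z² n≤ n≤) n≤) & cong (_* ((Z * Z * Z) * (Z * Z * Z))) inv-24 & [])))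
        where
        0≤6Z² : 0F ≤ # 6 * (Z * Z)
        0≤6Z² = *-nonneg (0≤# 6) 0≤Z²
      finish : ∀ w y m d → # 3 * d ≤ w → 0F ≤ d → 0F ≤ (# 1 - t) * y → (# 1 - t) * y ≤ d → m ≤ # 9 * (y * y) → 0F ≤ w × (1F - t) * (1F - t) * m ≤ w * w
      finish w y m d a 0≤d 0≤ty b e = ≤-trans 0≤3d a ,
          lin (t ∷ w ∷ y ∷ m ∷ d ∷ []) (from (*-monoˡ (square-nonneg (1F - t)) e & *-mono 0≤ty 0≤d b b & *-mono 0≤3d (≤-trans 0≤3d a) a a & []))
        where
        0≤3d : 0F ≤ # 3 * d
        0≤3d = *-nonneg (0≤# 3) 0≤d
      bounds : 0F ≤ ζ (weight hypergraph) × (1F - t) * (1F - t) * (ζ (ℤ.+ (n ^ 3)) * inv 24) ≤ ζ (weight hypergraph) * ζ (weight hypergraph)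
      bounds = finish (ζ (weight hypergraph)) (Z * Z * Z) (ζ (ℤ.+ (n ^ 3)) * inv 24) (c * c * c) W≥
        (*-nonneg (*-nonneg (0≤ι q) (0≤ι q)) (0≤ι q)) (*-nonneg (≤⇒0≤ t≤1) (*-nonneg (*-nonneg (0≤ι (suc z)) (0≤ι (suc z))) (0≤ι (suc z)))) cubes n³

-- Counting outside a list, and near positions in a hyperedge.

occurrences : List ℕ → ℕ → F
occurrences []       v = 0F
occurrences (x ∷ xs) v = 𝟙 (v ℕ.≟ x) + occurrences xs v

occurrences-nonneg : ∀ xs v → 0F ≤ occurrences xs v
occurrences-nonneg []       v = ≤-refl
occurrences-nonneg (x ∷ xs) v = +-nonneg (𝟙-nonneg (v ℕ.≟ x)) (occurrences-nonneg xs v)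

∑-occurrences-≤ : ∀ n xs → ∑ n (occurrences xs) ≤ # (List.length xs)
∑-occurrences-≤ n []       = ≤-reflexive (trans (∑-zero n λ _ _ → refl) (sym ζ0))
∑-occurrences-≤ n (x ∷ xs) = subst₂ _≤_ (sym (∑-+ n (λ v → 𝟙 (v ℕ.≟ x)) (occurrences xs))) (trans (cong (_+ # List.length xs) (sym ζ1)) (sym (ζ-+ (ℤ.+ 1) (ℤ.+ List.length xs))))
  (+-mono-≤ (∑-hits n 0 x) (∑-occurrences-≤ n xs))

∑-occurrences-≥ : ∀ {n} xs → All (ℕ._< n) xs → # (List.length xs) ≤ ∑ n (occurrences xs)
∑-occurrences-≥ {n} []       []       = ≤-reflexive (trans ζ0 (sym (∑-zero n λ _ _ → refl)))
∑-occurrences-≥ {n} (x ∷ xs) (p ∷ ps) = subst₂ _≤_ (trans (cong (_+ # List.length xs) (sym ζ1)) (sym (ζ-+ (ℤ.+ 1) (ℤ.+ List.length xs)))) (sym (∑-+ n (λ v → 𝟙 (v ℕ.≟ x)) (occurrences xs)))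
  (+-mono-≤ (subst (_≤ ∑ n (λ v → 𝟙 (v ℕ.≟ x))) (𝟙-yes (x ℕ.≟ x) refl) (∑-term (λ v → 𝟙 (v ℕ.≟ x)) p λ i _ → 𝟙-nonneg (i ℕ.≟ x))) (∑-occurrences-≥ xs ps))

occurrences-∉ : ∀ xs {v} → v ∈.∉ xs → occurrences xs v ≡ 0F
occurrences-∉ []       v∉ = refl
occurrences-∉ (x ∷ xs) {v} v∉ = trans (cong₂ _+_ (𝟙-no (v ℕ.≟ x) (v∉ ∘ here)) (occurrences-∉ xs (v∉ ∘ there))) (+-identityʳ 0F)

occurrences-∈ : ∀ xs {v} → v ∈.∈ xs → 1F ≤ occurrences xs v
occurrences-∈ (x ∷ xs) {v} (here refl) = subst (_≤ 𝟙 (v ℕ.≟ v) + occurrences xs v) (trans (+-identityʳ _) (𝟙-yes (v ℕ.≟ v) refl)) (+-mono-≤ ≤-refl (occurrences-nonneg xs v))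
occurrences-∈ (x ∷ xs) {v} (there m)   = subst (_≤ 𝟙 (v ℕ.≟ x) + occurrences xs v) (+-identityˡ 1F) (+-mono-≤ (𝟙-nonneg (v ℕ.≟ x)) (occurrences-∈ xs m))

∉-from-≢ : ∀ {x : ℕ} (xs : List ℕ) → All (x ≢_) xs → x ∈.∉ xs
∉-from-≢ (y ∷ ys) (p ∷ ps) (here e)  = p e
∉-from-≢ (y ∷ ys) (p ∷ ps) (there m) = ∉-from-≢ ys ps m

occurrences-unique : ∀ (xs : List ℕ) → AllPairs _≢_ xs → ∀ v → occurrences xs v ≤ 1F
occurrences-unique []       _        v = 0≤1
occurrences-unique (x ∷ xs) (d ∷ ds) v with v ℕ.≟ x
... | yes refl = ≤-reflexive (trans (cong (1F +_) (occurrences-∉ xs (∉-from-≢ xs d))) (+-identityʳ 1F))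
... | no _     = subst (_≤ 1F) (sym (+-identityˡ _)) (occurrences-unique xs ds v)

module _ {n : ℕ} {P : ℕ → Set} (P? : ∀ v → Dec (P v)) where

  -- The list accounts for at most as many elements as its length. Repetitions are allowed, so a
  -- list can be padded to a given threshold.
  avoiding : ∀ xs → ¬ ∑ n (λ v → 𝟙 (P? v)) ≤ # (List.length xs) → ∃ λ v → v ℕ.< n × P v × v ∈.∉ xs
  avoiding xs many = cases (ℕ.anyUpTo? (λ v → P? v ×-dec ¬? (any? (v ℕ.≟_) xs)) n)
    where
    cases : Dec (∃ λ v → v ℕ.< n × (P v × v ∈.∉ xs)) → ∃ λ v → v ℕ.< n × P v × v ∈.∉ xs
    cases (yes found) = found
    cases (no none)   = ⊥-elim (many (≤-trans (∑-mono n λ v v<n → bound v v<n (any? (v ℕ.≟_) xs)) (∑-occurrences-≤ n xs)))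
      where
      bound : ∀ v → v ℕ.< n → Dec (v ∈.∈ xs) → 𝟙 (P? v) ≤ occurrences xs v
      bound v v<n (yes m) = ≤-trans (𝟙≤1 (P? v)) (occurrences-∈ xs m)
      bound v v<n (no m)  = subst (_≤ occurrences xs v) (sym (𝟙-no (P? v) λ p → none (v , v<n , p , m))) (occurrences-nonneg xs v)

  at-least-distinct : ∀ xs → AllPairs _≢_ xs → All (λ v → v ℕ.< n × P v) xs → # (List.length xs) ≤ ∑ n (λ v → 𝟙 (P? v))
  at-least-distinct xs distinct ps = ≤-trans (∑-occurrences-≥ xs (All.map proj₁ ps)) (∑-mono n λ v _ → bound v (any? (v ℕ.≟_) xs))
    where
    bound : ∀ v → Dec (v ∈.∈ xs) → occurrences xs v ≤ 𝟙 (P? v)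
    bound v (yes m) = subst (occurrences xs v ≤_) (sym (𝟙-yes (P? v) (proj₂ (All.lookup ps m)))) (occurrences-unique xs distinct v)
    bound v (no m)  = subst (_≤ 𝟙 (P? v)) (sym (occurrences-∉ xs m)) (𝟙-nonneg (P? v))

rank : ∀ {n} → Subset n → ℕ → ℕ
rank []          _       = 0
rank (b ∷ h)     zero    = 0
rank (true ∷ h)  (suc v) = suc (rank h v)
rank (false ∷ h) (suc v) = rank h v

∑-rank : ∀ {n} (h : Subset n) (f : ℕ → F) → ∑ n (λ v → 𝟙ᵇ (mem h v) * f (rank h v)) ≡ ∑ ∣ h ∣ f
∑-rank []                  f = refl
∑-rank {suc n} (true ∷ h)  f = trans (∑-head n (λ v → 𝟙ᵇ (mem (true ∷ h) v) * f (rank (true ∷ h) v)))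
  (trans (cong₂ _+_ (*-identityˡ (f 0)) (∑-rank h (f ∘ suc))) (sym (∑-head ∣ h ∣ f)))
∑-rank {suc n} (false ∷ h) f = trans (∑-head n (λ v → 𝟙ᵇ (mem (false ∷ h) v) * f (rank (false ∷ h) v))) (trans (cong₂ _+_ (zeroˡ (f 0)) (∑-rank h f)) (+-identityˡ _))

Near : ℕ → ℕ → Set
Near r j = r ℕ.≤ j ℕ.+ 8 × j ℕ.≤ r ℕ.+ 8

near? : ∀ r j → Dec (Near r j)
near? r j = (r ℕ.≤? j ℕ.+ 8) ×-dec (j ℕ.≤? r ℕ.+ 8)

near-upper : ∀ r s → ∑ s (λ j → 𝟙 (near? r j)) ≤ # 17
near-upper r s = ≤-trans (∑-mono s λ j _ → pointwise j (near? r j)) (subst (_≤ # 17) (sym (∑-swap s 17 (λ j i → 𝟙 (8 ℕ.+ j ℕ.≟ r ℕ.+ i))))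
    (≤-trans (∑-mono 17 λ i _ → ∑-hits s 8 (r ℕ.+ i)) (≤-reflexive (trans (∑-const 17 1F) (trans (*-identityʳ _) (ι-# 17))))))
  where
  pointwise : ∀ j (d : Dec (Near r j)) → 𝟙 d ≤ ∑ 17 (λ i → 𝟙 (8 ℕ.+ j ℕ.≟ r ℕ.+ i))
  pointwise j (no _) = ∑-nonneg 17 λ i _ → 𝟙-nonneg (8 ℕ.+ j ℕ.≟ r ℕ.+ i)
  pointwise j (yes (p , q)) = subst (_≤ ∑ 17 (λ i → 𝟙 (8 ℕ.+ j ℕ.≟ r ℕ.+ i))) (𝟙-yes (8 ℕ.+ j ℕ.≟ r ℕ.+ i₀) eq)
      (∑-term (λ i → 𝟙 (8 ℕ.+ j ℕ.≟ r ℕ.+ i)) i₀<17 λ i _ → 𝟙-nonneg (8 ℕ.+ j ℕ.≟ r ℕ.+ i))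
    where
    r≤ : r ℕ.≤ 8 ℕ.+ j
    r≤ = subst (r ℕ.≤_) (ℕ.+-comm j 8) p
    i₀ = 8 ℕ.+ j ℕ.∸ r
    eq : 8 ℕ.+ j ≡ r ℕ.+ i₀
    eq = sym (ℕ.m+[n∸m]≡n r≤)
    i₀<17 : i₀ ℕ.< 17
    i₀<17 = s≤s (ℕ.+-cancelˡ-≤ r i₀ 16 (subst (ℕ._≤ r ℕ.+ 16) eq (ℕ.≤-trans (ℕ.+-monoʳ-≤ 8 q) (ℕ.≤-reflexive (trans (ℕ.+-comm 8 (r ℕ.+ 8)) (ℕ.+-assoc r 8 8))))))

-- A block of t ≤ 9 consecutive positions that starts at r, or earlier if it would pass s, stays
-- within distance 8 of r.
near-lower : ∀ r s t → r ℕ.< s → t ℕ.≤ s → t ℕ.≤ 9 → ι t ≤ ∑ s (λ j → 𝟙 (near? r j))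
near-lower r s t r<s t≤s t≤9 = ≤-trans (≤-reflexive (trans (sym (*-identityʳ (ι t))) (sym block))) (≤-trans partial (∑-monoˡ f a+t≤s λ j → 𝟙-nonneg (near? r j)))
  where
  f : ℕ → F
  f j = 𝟙 (near? r j)
  a = r ℕ.⊓ (s ℕ.∸ t)
  a+t≤s : a ℕ.+ t ℕ.≤ s
  a+t≤s = ℕ.≤-trans (ℕ.+-monoˡ-≤ t (ℕ.m⊓n≤n r (s ℕ.∸ t))) (ℕ.≤-reflexive (ℕ.m∸n+n≡m t≤s))
  r≤a+8 : r ℕ.≤ a ℕ.+ 8
  r≤a+8 = [ (λ e → subst (λ z → r ℕ.≤ z ℕ.+ 8) (sym e) (ℕ.m≤m+n r 8))
          , (λ e → subst (λ z → r ℕ.≤ z ℕ.+ 8) (sym e) (ℕ.s≤s⁻¹ (ℕ.≤-trans r<s (ℕ.≤-trans (ℕ.≤-reflexive (sym (ℕ.m∸n+n≡m t≤s))) (ℕ.≤-trans (ℕ.+-monoʳ-≤ (s ℕ.∸ t) t≤9) (ℕ.≤-reflexive (ℕ.+-suc (s ℕ.∸ t) 8)))))))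
          ]′ (ℕ.⊓-sel r (s ℕ.∸ t))
  hit : ∀ i → i ℕ.< t → Near r (a ℕ.+ i)
  hit i i<t = ℕ.≤-trans r≤a+8 (ℕ.+-monoˡ-≤ 8 (ℕ.m≤m+n a i)) , ℕ.+-mono-≤ (ℕ.m⊓n≤m r (s ℕ.∸ t)) (ℕ.s≤s⁻¹ (ℕ.≤-trans i<t t≤9))
  block : ∑ t (λ i → f (a ℕ.+ i)) ≡ ι t * 1F
  block = trans (∑-cong t λ i p → 𝟙-yes (near? r (a ℕ.+ i)) (hit i p)) (∑-const t 1F)
  partial : ∑ t (λ i → f (a ℕ.+ i)) ≤ ∑ (a ℕ.+ t) f
  partial = subst (∑ t (λ i → f (a ℕ.+ i)) ≤_) (sym (∑-split a t f)) (subst (_≤ ∑ a f + ∑ t (λ i → f (a ℕ.+ i))) (+-identityˡ _) (+-mono-≤ (∑-nonneg a λ j _ → 𝟙-nonneg (near? r j)) ≤-refl))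

∉⇒≢ : ∀ {v : ℕ} (xs : List ℕ) → v ∈.∉ xs → All (v ≢_) xs
∉⇒≢ []       v∉ = []
∉⇒≢ (x ∷ xs) v∉ = (v∉ ∘ here) ∷ ∉⇒≢ xs (v∉ ∘ there)

search : ∀ n {P : ℕ → Set} → (∀ v → Dec (P v)) → (∃ λ v → v ℕ.< n × P v) ⊎ (∀ v → v ℕ.< n → ¬ P v)
search n P? = cases (ℕ.anyUpTo? P? n)
  where
  cases : Dec _ → _
  cases (yes found) = inj₁ found
  cases (no none)   = inj₂ λ v v<n p → none (v , v<n , p)

-- A graph without paths on four vertices is a disjoint union of stars and triangles.
module PathFree {n : ℕ} {P : ℕ → Set} (P? : ∀ v → Dec (P v)) {E : ℕ → ℕ → Set} (E? : ∀ u v → Dec (E u v))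
                (bounded : ∀ {u} → P u → u ℕ.< n) (E⇒P : ∀ {u v} → E u v → P u) (E-sym : ∀ {u v} → E u v → E v u) (E⇒≢ : ∀ {u v} → E u v → u ≢ v)
                (path-free : ∀ {u v w x} → AllPairs _≢_ (u ∷ v ∷ w ∷ x ∷ []) → E u v → E v w → E w x → ⊥) where

  size : F
  size = ∑ n (λ v → 𝟙 (P? v))

  deg : ℕ → F
  deg u = ∑ n (λ v → 𝟙 (E? u v))

  edges : F
  edges = ∑ n deg

  neighbour : ∀ u xs → ¬ deg u ≤ # (List.length xs) → ∃ λ v → E u v × All (v ≢_) xs
  neighbour u xs many = convert (avoiding {n} (E? u) xs many)
    where
    convert : _ → ∃ λ v → E u v × All (v ≢_) xs
    convert (v , _ , e , v∉) = v , e , ∉⇒≢ xs v∉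

  deg-≥ : ∀ {u} xs → AllPairs _≢_ xs → All (E u) xs → # (List.length xs) ≤ deg u
  deg-≥ {u} xs ds es = at-least-distinct {n} (E? u) xs ds (All.map (λ e → bounded (E⇒P (E-sym e)) , e) es)

  isolated : ∀ {u} → ¬ P u → deg u ≡ 0F
  isolated {u} ¬p = ∑-zero n λ v _ → 𝟙-no (E? u v) (¬p ∘ E⇒P)

  -- Each edge is charged to its ends: a vertex of degree 1 pays for both ends, one of degree 2 for itself, and one
  -- of larger degree, being the centre of a star, for nothing. So no vertex is charged more than 2.
  share : F → F
  share d = 𝟙 (d ≤? # 1) + 𝟙 (d ≤? # 2)

  share-1 : ∀ {d} → d ≤ # 1 → share d ≡ # 2
  share-1 {d} p = trans (cong₂ _+_ (𝟙-yes (d ≤? # 1) p) (𝟙-yes (d ≤? # 2) (lin (d ∷ []) (from (p & []))))) (lin [] (from []))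

  share-2 : ∀ {d} → d ≤ # 2 → 1F ≤ share d
  share-2 {d} p = subst (_≤ share d) (trans (cong (0F +_) (𝟙-yes (d ≤? # 2) p)) (+-identityˡ _)) (+-mono-≤ (𝟙-nonneg (d ≤? # 1)) ≤-refl)

  share-nonneg : ∀ d → 0F ≤ share d
  share-nonneg d = +-nonneg (𝟙-nonneg (d ≤? # 1)) (𝟙-nonneg (d ≤? # 2))

  share-3 : ∀ {d} → ¬ d ≤ # 2 → share d ≡ 0F
  share-3 {d} p = trans (cong₂ _+_ (𝟙-no (d ≤? # 1) λ q → p (≤-trans q (lin [] (from [])))) (𝟙-no (d ≤? # 2) p)) (+-identityʳ 0F)

  d*share≤2 : ∀ d → 0F ≤ d → d * share d ≤ # 2
  d*share≤2 d 0≤d = cases (d ≤? # 1) (d ≤? # 2)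
    where
    cases : (p : Dec (d ≤ # 1)) (q : Dec (d ≤ # 2)) → d * (𝟙 p + 𝟙 q) ≤ # 2
    cases (yes p) (yes q) = lin (d ∷ []) (from (p & []))
    cases (yes p) (no q)  = lin (d ∷ []) (from (p & []))
    cases (no p)  (yes q) = lin (d ∷ []) (from (q & []))
    cases (no p)  (no q)  = lin (d ∷ []) (from [])

  0≤deg : ∀ u → 0F ≤ deg u
  0≤deg u = ∑-nonneg n λ v _ → 𝟙-nonneg (E? u v)

  charge : ℕ → F
  charge u = deg u * share (deg u)

  charge≤ : ∀ u → charge u ≤ # 2 * 𝟙 (P? u)
  charge≤ u = cases (P? u)
    where
    cases : (p : Dec (P u)) → charge u ≤ # 2 * 𝟙 p
    cases (yes p) = subst (charge u ≤_) (sym (*-identityʳ (# 2))) (d*share≤2 (deg u) (0≤deg u))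
    cases (no ¬p) = ≤-reflexive (trans (cong (_* share (deg u)) (isolated ¬p)) (trans (zeroˡ _) (sym (zeroʳ (# 2)))))

  -- A vertex of degree at least 3 has only leaves as neighbours: another edge at a neighbour v,
  -- followed by v u and one more edge at u, would be a path on four vertices.
  shares : ∀ {u v} → E u v → # 2 ≤ share (deg u) + share (deg v)
  shares {u} {v} e = cases (deg u ≤? # 2) (deg v ≤? # 2)
    where
    small-≤ : ∀ {a b} → a ≡ # 2 → 0F ≤ b → # 2 ≤ b + a
    small-≤ {a} {b} p q = lin (a ∷ b ∷ []) (from (p & q & []))
    high : ∀ {u v} → E u v → ¬ deg u ≤ # 2 → deg v ≤ # 1
    high {u} {v} e many = decide (deg v ≤? # 1)
      where
      decide : Dec (deg v ≤ # 1) → deg v ≤ # 1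
      decide (yes p) = p
      decide (no p)  = go (neighbour v (u ∷ []) p)
        where
        go : _ → deg v ≤ # 1
        go (a , va , a≢u ∷ []) = go′ (neighbour u (v ∷ a ∷ []) many)
          where
          go′ : _ → deg v ≤ # 1
          go′ (c , uc , c≢v ∷ c≢a ∷ []) = ⊥-elim (path-free
            ((E⇒≢ (E-sym va) ∷ a≢u ∷ (c≢a ∘ sym) ∷ []) ∷ (E⇒≢ (E-sym e) ∷ (c≢v ∘ sym) ∷ []) ∷ (E⇒≢ uc ∷ []) ∷ [] ∷ []) (E-sym va) (E-sym e) uc)
    cases : Dec (deg u ≤ # 2) → Dec (deg v ≤ # 2) → # 2 ≤ share (deg u) + share (deg v)
    cases (no p)  _       = small-≤ (share-1 (high e p)) (share-nonneg (deg u))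
    cases (yes _) (no q)  = subst (# 2 ≤_) (+-comm (share (deg v)) (share (deg u))) (small-≤ (share-1 (high (E-sym e) q)) (share-nonneg (deg v)))
    cases (yes p) (yes q) = subst (_≤ share (deg u) + share (deg v)) (lin [] (from [])) (+-mono-≤ (share-2 p) (share-2 q))

  edges≤charge : edges ≤ ∑ n charge
  edges≤charge = half-≤ edges (∑ n charge) (subst₂ _≤_ lhs rhs (∑-mono n λ u _ → ∑-mono n λ v _ → pointwise u v (E? u v)))
    where
    half-≤ : ∀ a b → # 2 * a ≤ b + b → a ≤ b
    half-≤ a b p = lin (a ∷ b ∷ []) (from (p & []))
    pointwise : ∀ u v (d : Dec (E u v)) → # 2 * 𝟙 d ≤ 𝟙 d * share (deg u) + 𝟙 d * share (deg v)
    pointwise u v (yes e) = subst₂ _≤_ (sym (*-identityʳ (# 2))) (sym (cong₂ _+_ (*-identityˡ _) (*-identityˡ _))) (shares e)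
    pointwise u v (no _)  = ≤-reflexive (trans (zeroʳ (# 2)) (sym (trans (cong₂ _+_ (zeroˡ _) (zeroˡ _)) (+-identityʳ 0F))))
    lhs : ∑ n (λ u → ∑ n (λ v → # 2 * 𝟙 (E? u v))) ≡ # 2 * edges
    lhs = trans (∑-ext n λ u → ∑-* n (# 2) (λ v → 𝟙 (E? u v))) (∑-* n (# 2) deg)
    first : ∑ n (λ u → ∑ n (λ v → 𝟙 (E? u v) * share (deg u))) ≡ ∑ n charge
    first = ∑-ext n λ u → ∑-*ʳ n (share (deg u)) (λ v → 𝟙 (E? u v))
    second : ∑ n (λ u → ∑ n (λ v → 𝟙 (E? u v) * share (deg v))) ≡ ∑ n charge
    second = trans (∑-swap n n (λ u v → 𝟙 (E? u v) * share (deg v)))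
      (trans (∑-ext n λ v → ∑-ext n λ u → cong (_* share (deg v)) (𝟙-cong (E? u v) (E? v u) E-sym E-sym)) first)
    rhs : ∑ n (λ u → ∑ n (λ v → 𝟙 (E? u v) * share (deg u) + 𝟙 (E? u v) * share (deg v))) ≡ ∑ n charge + ∑ n charge
    rhs = trans (∑-ext n λ u → ∑-+ n (λ v → 𝟙 (E? u v) * share (deg u)) (λ v → 𝟙 (E? u v) * share (deg v)))
      (trans (∑-+ n (λ u → ∑ n (λ v → 𝟙 (E? u v) * share (deg u))) (λ u → ∑ n (λ v → 𝟙 (E? u v) * share (deg v)))) (cong₂ _+_ first second))

  2size : ∑ n (λ u → # 2 * 𝟙 (P? u)) ≡ # 2 * size
  2size = ∑-* n (# 2) (λ u → 𝟙 (P? u))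

  edges≤ : edges ≤ # 2 * size
  edges≤ = ≤-trans edges≤charge (subst (∑ n charge ≤_) 2size (∑-mono n λ u _ → charge≤ u))

  -- Every vertex is allowed 2; each listed one uses at most 2 - d.
  deficit : ∀ f → (∀ u → f u ≤ # 2 * 𝟙 (P? u)) → ∀ {d} xs → AllPairs _≢_ xs → All (λ u → P u × f u + d ≤ # 2) xs → 0F ≤ d →
            ∑ n f + # (List.length xs) * d ≤ # 2 * size
  deficit f f≤ {d} xs distinct ps 0≤d =
      ≤-trans (+-mono-≤ (≤-refl {∑ n f}) (≤-trans (subst₂ _≤_ (*-comm d _) (*-comm d _) (*-monoˡ 0≤d (∑-occurrences-≥ xs (All.map (bounded ∘ proj₁) ps)))) ≤-refl))
        (subst₂ _≤_ (trans (∑-+ n f (λ u → occurrences xs u * d)) (cong (∑ n f +_) (∑-*ʳ n d (occurrences xs)))) 2size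
          (∑-mono n λ u _ → pointwise u (any? (u ℕ.≟_) xs)))
    where
    pointwise : ∀ u → Dec _ → f u + occurrences xs u * d ≤ # 2 * 𝟙 (P? u)
    pointwise u (no u∉)  = subst (_≤ # 2 * 𝟙 (P? u)) (sym (trans (cong (λ o → f u + o * d) (occurrences-∉ xs u∉)) (trans (cong (f u +_) (zeroˡ d)) (+-identityʳ _)))) (f≤ u)
    pointwise u (yes u∈) = subst (λ i → f u + occurrences xs u * d ≤ # 2 * i) (sym (𝟙-yes (P? u) (proj₁ (All.lookup ps u∈))))
        (step (f u) (occurrences xs u) d (occurrences-unique xs distinct u) 0≤d (proj₂ (All.lookup ps u∈)))
      where
      step : ∀ f o d → o ≤ 1F → 0F ≤ d → f + d ≤ # 2 → f + o * d ≤ # 2 * 1F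
      step f o d p q r = lin (f ∷ o ∷ d ∷ []) (from (*-monoˡ q p & r & []))

  -- Four or five vertices cannot be covered by disjoint triangles. A vertex that is isolated or the
  -- centre of a star saves 2; otherwise degrees are 1 or 2, and a leaf leads to a second leaf, each
  -- saving 1. If all degrees were 2, a triangle and a vertex outside it with two further neighbours
  -- would make six vertices.
  edges-small : ¬ size ≤ # 3 → size ≤ # 5 → edges + # 2 ≤ # 2 * size
  edges-small ¬s≤3 s≤5 = extreme (search n λ u → P? u ×-dec zero-or-high u)
    where
    zero-or-high : ∀ u → Dec (share (deg u) * deg u ≤ 0F)
    zero-or-high u = (share (deg u) * deg u) ≤? 0F
    two : ∀ {a b} → a + # 1 * # 2 ≤ b → a + # 2 ≤ b
    two {a} {b} p = lin (a ∷ b ∷ []) (from (p & []))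
    two′ : ∀ {a b} → a + # 2 * # 1 ≤ b → a + # 2 ≤ b
    two′ {a} {b} p = lin (a ∷ b ∷ []) (from (p & []))
    extreme : (∃ λ u → u ℕ.< n × P u × share (deg u) * deg u ≤ 0F) ⊎ (∀ u → u ℕ.< n → ¬ (P u × share (deg u) * deg u ≤ 0F)) → edges + # 2 ≤ # 2 * size
    extreme (inj₁ (u , _ , p , z)) = ≤-trans (+-mono-≤ edges≤charge ≤-refl)
      (two (deficit charge charge≤ (u ∷ []) ([] ∷ []) ((p , plus (deg u) (share (deg u)) z) ∷ []) (0≤# 2)))
      where
      plus : ∀ d s → s * d ≤ 0F → d * s + # 2 ≤ # 2
      plus d s z = lin (d ∷ s ∷ []) (from (z & []))
    extreme (inj₂ none) = leaf (search n λ u → P? u ×-dec (deg u ≤? # 1))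
      where
      positive : ∀ {u} → P u → ¬ deg u ≤ # 0
      positive {u} p z = none u (bounded p) (p , plus (share (deg u)) (deg u) (share-nonneg (deg u)) z)
        where
        plus : ∀ s d → 0F ≤ s → d ≤ # 0 → s * d ≤ 0F
        plus s d p q = lin (s ∷ d ∷ []) (from (*-monoˡ p q & []))
      ≤2 : ∀ {u} → P u → deg u ≤ # 2
      ≤2 {u} p = decide (deg u ≤? # 2)
        where
        decide : Dec (deg u ≤ # 2) → deg u ≤ # 2
        decide (yes q) = q
        decide (no q)  = ⊥-elim (none u (bounded p) (p , ≤-reflexive (trans (cong (_* deg u) (share-3 q)) (zeroˡ _))))
      deg≤ : ∀ u → deg u ≤ # 2 * 𝟙 (P? u)
      deg≤ u = cases (P? u)
        where
        cases : (p : Dec (P u)) → deg u ≤ # 2 * 𝟙 p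
        cases (yes p) = subst (deg u ≤_) (sym (*-identityʳ (# 2))) (≤2 p)
        cases (no ¬p) = ≤-reflexive (trans (isolated ¬p) (sym (zeroʳ (# 2))))
      leaf : (∃ λ w → w ℕ.< n × P w × deg w ≤ # 1) ⊎ (∀ w → w ℕ.< n → ¬ (P w × deg w ≤ # 1)) → edges + # 2 ≤ # 2 * size
      leaf (inj₁ (w , _ , pw , w≤1)) = start (neighbour w [] (positive pw))
        where
        leaves : ∀ {v} → w ≢ v → P v → deg v ≤ # 1 → edges + # 2 ≤ # 2 * size
        leaves {v} w≢v pv v≤1 = two′ (deficit deg deg≤ (w ∷ v ∷ []) ((w≢v ∷ []) ∷ [] ∷ []) ((pw , plus (deg w) w≤1) ∷ (pv , plus (deg v) v≤1) ∷ []) (0≤# 1))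
          where
          plus : ∀ d → d ≤ # 1 → d + # 1 ≤ # 2
          plus d p = lin (d ∷ []) (from (p & []))
        start : _ → edges + # 2 ≤ # 2 * size
        start (v , wv , _) = middle (deg v ≤? # 1)
          where
          middle : Dec (deg v ≤ # 1) → edges + # 2 ≤ # 2 * size
          middle (yes q) = leaves (E⇒≢ wv) (E⇒P (E-sym wv)) q
          middle (no q)  = next (neighbour v (w ∷ []) q)
            where
            next : _ → edges + # 2 ≤ # 2 * size
            next (a , va , a≢w ∷ []) = end (deg a ≤? # 1)
              where
              end : Dec (deg a ≤ # 1) → edges + # 2 ≤ # 2 * size
              end (yes r) = leaves (a≢w ∘ sym) (E⇒P (E-sym va)) r
              end (no r)  = stop (neighbour a (v ∷ []) r)
                where
                1≱2 : # 2 ≤ # 1 → ⊥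
                1≱2 p = lin [] (from (p & []))
                stop : _ → edges + # 2 ≤ # 2 * size
                stop (c , ac , c≢v ∷ []) = ⊥-elim (same (w ℕ.≟ c))
                  where
                  same : Dec (w ≡ c) → ⊥
                  same (yes refl) = 1≱2 (≤-trans (deg-≥ (v ∷ a ∷ []) ((E⇒≢ va ∷ []) ∷ [] ∷ []) (wv ∷ E-sym ac ∷ [])) w≤1)
                  same (no w≢c)   = path-free ((E⇒≢ wv ∷ (a≢w ∘ sym) ∷ w≢c ∷ []) ∷ (E⇒≢ va ∷ (c≢v ∘ sym) ∷ []) ∷ (E⇒≢ ac ∷ []) ∷ [] ∷ []) wv va ac
      leaf (inj₂ none₁) = ⊥-elim (pick (avoiding {n} P? [] (λ p → ¬s≤3 (≤-trans p (lin [] (from []))))))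
        where
        >1 : ∀ {w} → P w → ¬ deg w ≤ # 1
        >1 {w} p q = none₁ w (bounded p) (p , q)
        pick : _ → ⊥
        pick (u , _ , pu , _) = one (neighbour u [] (positive pu))
          where
          one : _ → ⊥
          one (a , ua , _) = other (neighbour u (a ∷ []) (>1 pu))
            where
            other : _ → ⊥
            other (b , ub , b≢a ∷ []) = outside (avoiding {n} P? (u ∷ a ∷ b ∷ []) ¬s≤3)
              where
              a≢b = b≢a ∘ sym
              outside : _ → ⊥
              outside (w , _ , pw , w∉) = fresh (∉⇒≢ (u ∷ a ∷ b ∷ []) w∉)
                where
                fresh : All (w ≢_) (u ∷ a ∷ b ∷ []) → ⊥
                fresh (w≢u ∷ w≢a ∷ w≢b ∷ []) = first (neighbour w [] (positive pw))
                  where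
                  closed : ∀ {p} → E w p → All (p ≢_) (u ∷ a ∷ b ∷ [])
                  closed wp =
                    (λ { refl → too-many (≤-trans (deg-≥ (a ∷ b ∷ w ∷ []) ((a≢b ∷ (w≢a ∘ sym) ∷ []) ∷ ((w≢b ∘ sym) ∷ []) ∷ [] ∷ []) (ua ∷ ub ∷ E-sym wp ∷ [])) (≤2 pu)) }) ∷
                    (λ { refl → path-free ((w≢a ∷ w≢u ∷ w≢b ∷ []) ∷ (E⇒≢ (E-sym ua) ∷ a≢b ∷ []) ∷ (E⇒≢ ub ∷ []) ∷ [] ∷ []) wp (E-sym ua) ub }) ∷
                    (λ { refl → path-free ((w≢b ∷ w≢u ∷ w≢a ∷ []) ∷ (E⇒≢ (E-sym ub) ∷ b≢a ∷ []) ∷ (E⇒≢ ua ∷ []) ∷ [] ∷ []) wp (E-sym ub) ua }) ∷ []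
                    where
                    too-many : # 3 ≤ # 2 → ⊥
                    too-many p = lin [] (from (p & []))
                  first : _ → ⊥
                  first (p , wp , _) = last (neighbour w (p ∷ []) (>1 pw))
                    where
                    6≰5 : # 6 ≤ # 5 → ⊥
                    6≰5 p = lin [] (from (p & []))
                    last : _ → ⊥
                    last (q , wq , q≢p ∷ []) = 6≰5 (≤-trans (at-least-distinct {n} P? (q ∷ p ∷ w ∷ u ∷ a ∷ b ∷ [])
                      ((q≢p ∷ E⇒≢ (E-sym wq) ∷ closed wq) ∷ (E⇒≢ (E-sym wp) ∷ closed wp) ∷ (w≢u ∷ w≢a ∷ w≢b ∷ []) ∷ (E⇒≢ ua ∷ E⇒≢ ub ∷ []) ∷ (a≢b ∷ []) ∷ [] ∷ [])
                      (All.map (λ p → bounded p , p) (E⇒P (E-sym wq) ∷ E⇒P (E-sym wp) ∷ pw ∷ pu ∷ E⇒P (E-sym ua) ∷ E⇒P (E-sym ub) ∷ []))) s≤5)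

-- Joined pairs in a Berge-C₄-free hypergraph.

𝟙-× : ∀ {P Q : Set} (p : Dec P) (q : Dec Q) → 𝟙 (p ×-dec q) ≡ 𝟙 p * 𝟙 q
𝟙-× (yes _) (yes _) = sym (*-identityˡ 1F)
𝟙-× (yes _) (no _)  = sym (zeroʳ 1F)
𝟙-× (no _)  q       = sym (zeroˡ (𝟙 q))

has : ∀ {n} → Hypergraph n → ℕ → ℕ → Bool
has []      _       _ = false
has (h ∷ H) zero    v = mem h v
has (h ∷ H) (suc e) v = has H e v

order : ∀ {n} → Hypergraph n → ℕ → ℕ
order []      _       = 0
order (h ∷ H) zero    = ∣ h ∣
order (h ∷ H) (suc e) = order H e

position : ∀ {n} → Hypergraph n → ℕ → ℕ → ℕ
position []      _       _ = 0
position (h ∷ H) zero    v = rank h v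
position (h ∷ H) (suc e) v = position H e v

𝟙-true : ∀ b → 𝟙 (b Bool.≟ true) ≡ 𝟙ᵇ b
𝟙-true true  = refl
𝟙-true false = refl

∑-position : ∀ {n} (H : Hypergraph n) e (f : ℕ → F) → ∑ n (λ v → 𝟙 (has H e v Bool.≟ true) * f (position H e v)) ≡ ∑ (order H e) f
∑-position {n} []  e       f = ∑-zero n λ _ _ → zeroˡ (f 0)
∑-position {n} (h ∷ H) zero    f = trans (∑-ext n λ v → cong (_* f (rank h v)) (𝟙-true (mem h v))) (∑-rank h f)
∑-position (h ∷ H) (suc e) f = ∑-position H e f

rank< : ∀ {n} (h : Subset n) v → mem h v ≡ true → rank h v ℕ.< ∣ h ∣
rank< (true ∷ h)  zero    p = s≤s z≤n
rank< (true ∷ h)  (suc v) p = s≤s (rank< h v p)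
rank< (false ∷ h) (suc v) p = rank< h v p

position< : ∀ {n} (H : Hypergraph n) e v → has H e v ≡ true → position H e v ℕ.< order H e
position< (h ∷ H) zero    v p = rank< h v p
position< (h ∷ H) (suc e) v p = position< H e v p

mem⇒< : ∀ {n} (h : Subset n) v → mem h v ≡ true → v ℕ.< n
mem⇒< (b ∷ h) zero    p = s≤s z≤n
mem⇒< (b ∷ h) (suc v) p = s≤s (mem⇒< h v p)

has⇒< : ∀ {n} (H : Hypergraph n) e v → has H e v ≡ true → e ℕ.< List.length H × v ℕ.< n
has⇒< (h ∷ H) zero    v p = s≤s z≤n , mem⇒< h v p
has⇒< (h ∷ H) (suc e) v p = s≤s (proj₁ (has⇒< H e v p)) , proj₂ (has⇒< H e v p)

has-toℕ : ∀ {n} (H : Hypergraph n) i v → has H (toℕ i) v ≡ mem (edge H i) v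
has-toℕ (h ∷ H) zero    v = refl
has-toℕ (h ∷ H) (suc i) v = has-toℕ H i v

has⇒∈ : ∀ {n} (H : Hypergraph n) i v → has H (toℕ i) (toℕ v) ≡ true → v ∈ edge H i
has⇒∈ H i v p = Vec.lookup⇒[]= v (edge H i) (trans (sym (mem-toℕ (edge H i) v)) (trans (sym (has-toℕ H i (toℕ v))) p))

as-Fin : ∀ {n k} → k ℕ.< n → ∃ λ (i : Fin n) → toℕ i ≡ k
as-Fin p = fromℕ< p , Fin.toℕ-fromℕ< p

weight-order : ∀ {n} (H : Hypergraph n) → ∑ (List.length H) (λ e → ι (order H e) - # 3) ≡ ζ (weight H)
weight-order []      = sym ζ0
weight-order (h ∷ H) = trans (∑-head (List.length H) (λ e → ι (order (h ∷ H) e) - # 3)) (trans (cong₂ _+_ first (weight-order H)) (sym (ζ-+ (ℤ.+ ∣ h ∣ ℤ.- ℤ.+ 3) (weight H))))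
  where
  first : ι ∣ h ∣ - # 3 ≡ ζ (ℤ.+ ∣ h ∣ ℤ.- ℤ.+ 3)
  first = sym (trans (ζ-+ (ℤ.+ ∣ h ∣) (ℤ.- ℤ.+ 3)) (trans (cong (_+ ζ (ℤ.- ℤ.+ 3)) (sym (ι-# ∣ h ∣))) (step (ι ∣ h ∣))))
    where
    step : ∀ a → a + ζ (ℤ.- ℤ.+ 3) ≡ a - # 3
    step a = lin (a ∷ []) (from [])

module Colouring {n : ℕ} (H : Hypergraph n) (free : BergeC4Free H) where

  m : ℕ
  m = List.length H

  In : ℕ → ℕ → Set
  In e v = has H e v ≡ true

  In? : ∀ e v → Dec (In e v)
  In? e v = has H e v Bool.≟ true

  no-C4 : ∀ {v₁ v₂ v₃ v₄ e₁ e₂ e₃ e₄} → AllPairs _≢_ (v₁ ∷ v₂ ∷ v₃ ∷ v₄ ∷ []) → AllPairs _≢_ (e₁ ∷ e₂ ∷ e₃ ∷ e₄ ∷ []) →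
          In e₁ v₁ → In e₁ v₂ → In e₂ v₂ → In e₂ v₃ → In e₃ v₃ → In e₃ v₄ → In e₄ v₄ → In e₄ v₁ → ⊥
  no-C4 {v₁} {v₂} {v₃} {v₄} {e₁} {e₂} {e₃} {e₄} ds es i₁ i₁′ i₂ i₂′ i₃ i₃′ i₄ i₄′ =
      build (as-Fin (proj₂ (has⇒< H e₁ v₁ i₁))) (as-Fin (proj₂ (has⇒< H e₂ v₂ i₂))) (as-Fin (proj₂ (has⇒< H e₃ v₃ i₃))) (as-Fin (proj₂ (has⇒< H e₄ v₄ i₄)))
            (as-Fin (proj₁ (has⇒< H e₁ v₁ i₁))) (as-Fin (proj₁ (has⇒< H e₂ v₂ i₂))) (as-Fin (proj₁ (has⇒< H e₃ v₃ i₃))) (as-Fin (proj₁ (has⇒< H e₄ v₄ i₄))) ds es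
    where
    apart : ∀ {k} {a b c d : Fin k} → AllPairs _≢_ (toℕ a ∷ toℕ b ∷ toℕ c ∷ toℕ d ∷ []) → (a ≢ b) × (a ≢ c) × (a ≢ d) × (b ≢ c) × (b ≢ d) × (c ≢ d)
    apart ((p ∷ q ∷ r ∷ []) ∷ (s ∷ t ∷ []) ∷ (u ∷ []) ∷ [] ∷ []) = p ∘ cong toℕ , q ∘ cong toℕ , r ∘ cong toℕ , s ∘ cong toℕ , t ∘ cong toℕ , u ∘ cong toℕ
    build : (∃ λ (a : Fin n) → toℕ a ≡ v₁) → (∃ λ (a : Fin n) → toℕ a ≡ v₂) → (∃ λ (a : Fin n) → toℕ a ≡ v₃) → (∃ λ (a : Fin n) → toℕ a ≡ v₄) →
            (∃ λ (a : Fin m) → toℕ a ≡ e₁) → (∃ λ (a : Fin m) → toℕ a ≡ e₂) → (∃ λ (a : Fin m) → toℕ a ≡ e₃) → (∃ λ (a : Fin m) → toℕ a ≡ e₄) →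
            AllPairs _≢_ (v₁ ∷ v₂ ∷ v₃ ∷ v₄ ∷ []) → AllPairs _≢_ (e₁ ∷ e₂ ∷ e₃ ∷ e₄ ∷ []) → ⊥
    build (a₁ , refl) (a₂ , refl) (a₃ , refl) (a₄ , refl) (b₁ , refl) (b₂ , refl) (b₃ , refl) (b₄ , refl) ds es = free record
      { v₁ = a₁ ; v₂ = a₂ ; v₃ = a₃ ; v₄ = a₄ ; h₁ = b₁ ; h₂ = b₂ ; h₃ = b₃ ; h₄ = b₄
      ; v-distinct = apart ds ; h-distinct = apart es
      ; in₁ = has⇒∈ H b₁ a₁ i₁ , has⇒∈ H b₁ a₂ i₁′ ; in₂ = has⇒∈ H b₂ a₂ i₂ , has⇒∈ H b₂ a₃ i₂′
      ; in₃ = has⇒∈ H b₃ a₃ i₃ , has⇒∈ H b₃ a₄ i₃′ ; in₄ = has⇒∈ H b₄ a₄ i₄ , has⇒∈ H b₄ a₁ i₄′ }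

  codegree : ℕ → ℕ → F
  codegree u v = ∑ m (λ e → 𝟙 (In? e u ×-dec In? e v))

  -- The threshold serves the greedy choice in `bad-path-free`: a pair that is not good has a
  -- hyperedge outside any three given ones.
  Good : ℕ → ℕ → Set
  Good u v = codegree u v ≤ # 3

  Good? : ∀ u v → Dec (Good u v)
  Good? u v = codegree u v ≤? # 3

  Good-sym : ∀ {u v} → Good u v → Good v u
  Good-sym {u} {v} = subst (_≤ # 3) (∑-ext m λ e → 𝟙-cong (In? e u ×-dec In? e v) (In? e v ×-dec In? e u) (λ (a , b) → b , a) (λ (a , b) → b , a))

  Bad : ℕ → ℕ → ℕ → Set
  Bad e u v = (In e u × In e v) × u ≢ v × ¬ Good u v

  Bad? : ∀ e u v → Dec (Bad e u v)
  Bad? e u v = (In? e u ×-dec In? e v) ×-dec (¬? (u ℕ.≟ v) ×-dec ¬? (Good? u v))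

  -- Its edges lie in four hyperedges each, so e and three further distinct ones close the path to a Berge cycle.
  bad-path-free : ∀ {e u v w x} → AllPairs _≢_ (u ∷ v ∷ w ∷ x ∷ []) → In e u → In e x → ¬ Good u v → ¬ Good v w → ¬ Good w x → ⊥
  -- Repeated entries pad the excluded lists to length 3, the threshold of `Good`.
  bad-path-free {e} {u} {v} {w} {x} ds eu ex uv vw wx = one (avoiding {m} (λ f → In? f u ×-dec In? f v) (e ∷ e ∷ e ∷ []) uv)
    where
    one : _ → ⊥
    one (f , _ , (fu , fv) , f∉) = two (avoiding {m} (λ g → In? g v ×-dec In? g w) (f ∷ e ∷ e ∷ []) vw) (∉⇒≢ (e ∷ e ∷ e ∷ []) f∉)
      where
      two : _ → _ → ⊥
      two (g , _ , (gv , gw) , g∉) (f≢e ∷ _) = three (avoiding {m} (λ h → In? h w ×-dec In? h x) (f ∷ g ∷ e ∷ []) wx) (∉⇒≢ (f ∷ e ∷ e ∷ []) g∉)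
        where
        three : _ → _ → ⊥
        three (h , _ , (hw , hx) , h∉) (g≢f ∷ g≢e ∷ _) = four (∉⇒≢ (f ∷ g ∷ e ∷ []) h∉)
          where
          four : All (h ≢_) (f ∷ g ∷ e ∷ []) → ⊥
          four (h≢f ∷ h≢g ∷ h≢e ∷ []) = no-C4 ds (((g≢f ∘ sym) ∷ (h≢f ∘ sym) ∷ f≢e ∷ []) ∷ ((h≢g ∘ sym) ∷ g≢e ∷ []) ∷ (h≢e ∷ []) ∷ [] ∷ [])
            fu fv gv gw hw hx ex eu

  module Graph (e : ℕ) = PathFree {n} {In e} (In? e) {Bad e} (Bad? e) (λ {u} p → proj₂ (has⇒< H e u p)) (λ ((p , _) , _) → p)
    (λ {u} {v} ((p , q) , r , s) → (q , p) , (r ∘ sym) , (s ∘ Good-sym {v} {u})) (λ (_ , r , _) → r)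
    (λ ds ((p , _) , _ , a) (_ , _ , b) ((_ , q) , _ , c) → bad-path-free {e} ds p q a b c)

  -- Restricting to near positions keeps degrees bounded; it still leaves at least 8 neighbours per vertex on large hyperedges.
  Joined : ℕ → ℕ → ℕ → Set
  Joined e u v = (In e u × In e v) × u ≢ v × Near (position H e u) (position H e v) × Good u v

  Joined? : ∀ e u v → Dec (Joined e u v)
  Joined? e u v = (In? e u ×-dec In? e v) ×-dec (¬? (u ℕ.≟ v) ×-dec (near? (position H e u) (position H e v) ×-dec Good? u v))

  Joined-sym : ∀ {e u v} → Joined e u v → Joined e v u
  Joined-sym {u = u} {v} ((p , q) , r , (s , s′) , t) = (q , p) , (r ∘ sym) , (s′ , s) , Good-sym {u} {v} t

  near-sum : ∀ e r → ∑ n (λ v → 𝟙 (In? e v) * 𝟙 (near? r (position H e v))) ≡ ∑ (order H e) (λ j → 𝟙 (near? r j))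
  near-sum e r = ∑-position H e (λ j → 𝟙 (near? r j))

  joined-degree : ∀ e u → ∑ n (λ v → 𝟙 (Joined? e u v)) ≤ # 17
  joined-degree e u = ≤-trans (∑-mono n λ v _ → subst (𝟙 (Joined? e u v) ≤_) (𝟙-× (In? e v) (near? (position H e u) (position H e v)))
      (𝟙-mono (Joined? e u v) (In? e v ×-dec near? (position H e u) (position H e v)) λ ((_ , q) , _ , s , _) → q , s))
    (subst (_≤ # 17) (sym (near-sum e (position H e u))) (near-upper (position H e u) (order H e)))

  joined-codegree : ∀ u v → ∑ m (λ e → 𝟙 (Joined? e u v)) ≤ # 3
  joined-codegree u v = cases (Good? u v)
    where
    cases : Dec (Good u v) → ∑ m (λ e → 𝟙 (Joined? e u v)) ≤ # 3
    cases (yes g) = ≤-trans (∑-mono m λ e _ → 𝟙-mono (Joined? e u v) (In? e u ×-dec In? e v) proj₁) g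
    cases (no ¬g) = subst (_≤ # 3) (sym (∑-zero m λ e _ → 𝟙-no (Joined? e u v) λ (_ , _ , _ , g) → ¬g g)) (0≤# 3)

  size-order : ∀ e → Graph.size e ≡ ι (order H e)
  size-order e = trans (∑-ext n λ v → sym (*-identityʳ (𝟙 (In? e v)))) (trans (∑-position H e (λ _ → 1F)) (trans (∑-const (order H e) 1F) (*-identityʳ _)))

  -- Every ordered pair at near positions lies on the diagonal, is bad, or is joined.
  joined-count : ∀ e t → t ℕ.≤ order H e → t ℕ.≤ 9 → ι (order H e) * ι t ≤ (∑ n (λ u → ∑ n (λ v → 𝟙 (Joined? e u v))) + ι (order H e)) + Graph.edges e
  joined-count e t t≤s t≤9 = ≤-trans total (≤-trans (∑-mono n λ u _ → ∑-mono n λ v _ → pointwise u v) rhs)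
    where
    p : ℕ → ℕ
    p = position H e
    near : ℕ → ℕ → F
    near u v = 𝟙 (In? e v) * 𝟙 (near? (p u) (p v))
    total : ι (order H e) * ι t ≤ ∑ n (λ u → ∑ n (λ v → 𝟙 (In? e u) * near u v))
    total = subst₂ _≤_ (trans (∑-*ʳ n (ι t) (λ u → 𝟙 (In? e u))) (cong (_* ι t) (size-order e))) (∑-ext n λ u → sym (∑-* n (𝟙 (In? e u)) (near u)))
        (∑-mono n λ u _ → row u (In? e u))
      where
      row : ∀ u (d : Dec (In e u)) → 𝟙 d * ι t ≤ 𝟙 d * ∑ n (near u)
      row u (yes i) = *-monoˡ 0≤1 (subst (ι t ≤_) (sym (near-sum e (p u))) (near-lower (p u) (order H e) t (position< H e u i) t≤s t≤9))
      row u (no _)  = ≤-reflexive (trans (zeroˡ _) (sym (zeroˡ _)))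
    pointwise : ∀ u v → 𝟙 (In? e u) * near u v ≤ (𝟙 (Joined? e u v) + 𝟙 (In? e u) * 𝟙 (v ℕ.≟ u)) + 𝟙 (Bad? e u v)
    pointwise u v = cases (In? e u) (In? e v) (v ℕ.≟ u) (u ℕ.≟ v) (near? (p u) (p v)) (Good? u v)
      where
      cases : (a : Dec (In e u)) (b : Dec (In e v)) (c : Dec (v ≡ u)) (c′ : Dec (u ≡ v)) (d : Dec (Near (p u) (p v))) (g : Dec (Good u v)) →
              𝟙 a * (𝟙 b * 𝟙 d) ≤ (𝟙 ((a ×-dec b) ×-dec (¬? c′ ×-dec (d ×-dec g))) + 𝟙 a * 𝟙 c) + 𝟙 ((a ×-dec b) ×-dec (¬? c′ ×-dec ¬? g))
      cases (no _)  b       c       c′      d       g       = lin (𝟙 b ∷ 𝟙 d ∷ 𝟙 c ∷ []) (from [])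
      cases (yes _) (no _)  (no _)  c′      d       g       = lin (𝟙 d ∷ []) (from [])
      cases (yes _) (no _)  (yes _) c′      d       g       = lin (𝟙 d ∷ []) (from [])
      cases (yes _) (yes _) (yes c) (no c′) d       g       = ⊥-elim (c′ (sym c))
      cases (yes _) (yes _) (yes _) (yes _) d       g       = lin (𝟙 d ∷ []) (from (𝟙≤1 d & []))
      cases (yes _) (yes _) (no c)  (yes c′) d      g       = ⊥-elim (c (sym c′))
      cases (yes _) (yes _) (no _)  (no _)  (no _)  (yes _) = lin [] (from [])
      cases (yes _) (yes _) (no _)  (no _)  (no _)  (no _)  = lin [] (from [])
      cases (yes _) (yes _) (no _)  (no _)  (yes _) (yes _) = lin [] (from [])
      cases (yes _) (yes _) (no _)  (no _)  (yes _) (no _)  = lin [] (from [])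
    Q S B : ℕ → F
    Q u = ∑ n (λ v → 𝟙 (Joined? e u v))
    S u = ∑ n (λ v → 𝟙 (In? e u) * 𝟙 (v ℕ.≟ u))
    B u = ∑ n (λ v → 𝟙 (Bad? e u v))
    S≤ : ∑ n S ≤ ι (order H e)
    S≤ = subst (∑ n S ≤_) (size-order e) (∑-mono n λ u _ → subst₂ _≤_ (sym (∑-* n (𝟙 (In? e u)) (λ v → 𝟙 (v ℕ.≟ u)))) (*-identityʳ _) (*-monoˡ (𝟙-nonneg (In? e u)) (∑-hits n 0 u)))
    rhs : ∑ n (λ u → ∑ n (λ v → (𝟙 (Joined? e u v) + 𝟙 (In? e u) * 𝟙 (v ℕ.≟ u)) + 𝟙 (Bad? e u v))) ≤ (∑ n Q + ι (order H e)) + ∑ n B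
    rhs = subst (_≤ (∑ n Q + ι (order H e)) + ∑ n B)
      (sym (trans (∑-ext n λ u → trans (∑-+ n (λ v → 𝟙 (Joined? e u v) + 𝟙 (In? e u) * 𝟙 (v ℕ.≟ u)) (λ v → 𝟙 (Bad? e u v)))
                                       (cong (_+ B u) (∑-+ n (λ v → 𝟙 (Joined? e u v)) (λ v → 𝟙 (In? e u) * 𝟙 (v ℕ.≟ u)))))
           (trans (∑-+ n (λ u → Q u + S u) B) (cong (_+ ∑ n B) (∑-+ n Q S)))))
      (+-mono-≤ (+-mono-≤ ≤-refl S≤) ≤-refl)

  -- For order s, the count leaves s · min (s, 9) - s less at most 2 s bad pairs. For s > 9 this is
  -- 6 s; for 6 ≤ s ≤ 9 it suffices that (s - 3)(s - 6) ≥ 0; for s = 4 and 5 the two pairs gained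
  -- from `edges-small` give exactly 6 (s - 3).
  joined-lower : ∀ e → # 6 * (ι (order H e) - # 3) ≤ ∑ n (λ u → ∑ n (λ v → 𝟙 (Joined? e u v)))
  joined-lower e = cases (order H e ℕ.≤? 3) (order H e ℕ.≤? 5) (order H e ℕ.≤? 9)
    where
    s Q B : F
    s = ι (order H e)
    Q = ∑ n (λ u → ∑ n (λ v → 𝟙 (Joined? e u v)))
    B = Graph.edges e
    0≤Q : 0F ≤ Q
    0≤Q = ∑-nonneg n λ u _ → ∑-nonneg n λ v _ → 𝟙-nonneg (Joined? e u v)
    B≤ : B ≤ # 2 * s
    B≤ = subst (λ s → B ≤ # 2 * s) (size-order e) (Graph.edges≤ e)
    ι≤ : ∀ {k l} → k ℕ.≤ l → ι k ≤ # l
    ι≤ {k} {l} p = subst (ι k ≤_) (ι-# l) (ι-mono p)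
    #≤ : ∀ {k l} → l ℕ.≤ k → # l ≤ ι k
    #≤ {k} {l} p = subst (_≤ ι k) (ι-# l) (ι-mono p)
    few : ∀ s Q → s ≤ # 3 → 0F ≤ Q → # 6 * (s - # 3) ≤ Q
    few s Q p q = lin (s ∷ Q ∷ []) (from (p & q & []))
    some : ∀ s Q B → s ≡ # 4 ⊎ s ≡ # 5 → s * s ≤ (Q + s) + B → B + # 2 ≤ # 2 * s → # 6 * (s - # 3) ≤ Q
    some s Q B (inj₁ p) r t = lin (s ∷ Q ∷ B ∷ []) (from (square-nonneg (s - # 4) & p & r & t & []))
    some s Q B (inj₂ p) r t = lin (s ∷ Q ∷ B ∷ []) (from (square-nonneg (s - # 5) & p & r & t & []))
    many : ∀ s Q B → # 6 ≤ s → s * s ≤ (Q + s) + B → B ≤ # 2 * s → # 6 * (s - # 3) ≤ Q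
    many s Q B p r t = lin (s ∷ Q ∷ B ∷ []) (from (*-nonneg (≤⇒0≤ p) (≤⇒0≤ p) & p & r & t & []))
    exactly : ¬ order H e ℕ.≤ 3 → order H e ℕ.≤ 5 → s ≡ # 4 ⊎ s ≡ # 5
    exactly p q = [ (λ r → inj₁ (≤-antisym (ι≤ (ℕ.s≤s⁻¹ r)) (#≤ (ℕ.≰⇒> p)))) , (λ r → inj₂ (trans (cong ι r) (ι-# 5))) ]′ (ℕ.m≤n⇒m<n∨m≡n q)
    most : ∀ s Q B → s * # 9 ≤ (Q + s) + B → B ≤ # 2 * s → # 6 * (s - # 3) ≤ Q
    most s Q B r t = lin (s ∷ Q ∷ B ∷ []) (from (r & t & []))
    cases : Dec (order H e ℕ.≤ 3) → Dec (order H e ℕ.≤ 5) → Dec (order H e ℕ.≤ 9) → # 6 * (s - # 3) ≤ Q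
    cases (yes p) _       _       = few s Q (ι≤ p) 0≤Q
    cases (no p)  (yes q) _       = some s Q B (exactly p q) (joined-count e (order H e) ℕ.≤-refl (ℕ.≤-trans q (ℕ.m≤m+n 5 4)))
        (subst (λ s → B + # 2 ≤ # 2 * s) (size-order e) (Graph.edges-small e (λ r → absurd s 4≤s (subst (_≤ # 3) (size-order e) r)) (subst (_≤ # 5) (sym (size-order e)) (ι≤ q))))
      where
      4≤s : # 4 ≤ s
      4≤s = #≤ (ℕ.≰⇒> p)
      absurd : ∀ s → # 4 ≤ s → s ≤ # 3 → ⊥
      absurd s p q = lin (s ∷ []) (from (p & q & []))
    cases (no _)  (no q)  (yes r) = many s Q B (#≤ (ℕ.≰⇒> q)) (joined-count e (order H e) ℕ.≤-refl r) B≤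
    cases (no _)  (no q)  (no r)  = most s Q B (subst (λ t → s * t ≤ (Q + s) + B) (ι-# 9) (joined-count e 9 (ℕ.<⇒≤ (ℕ.≰⇒> r)) ℕ.≤-refl)) B≤

-- Counting cherries.

𝟙-≥ : ∀ {P : Set} (d : Dec P) → P → 1F ≤ 𝟙 d
𝟙-≥ d p = ≤-reflexive (sym (𝟙-yes d p))

1≤* : ∀ {a b} → 1F ≤ a → 1F ≤ b → 1F ≤ a * b
1≤* {a} {b} p q = subst (_≤ a * b) (*-identityʳ 1F) (*-mono 0≤1 (≤-trans 0≤1 q) p q)

∑-≥ : ∀ {n k a} f → (∀ i → 0F ≤ f i) → k ℕ.< n → a ≤ f k → a ≤ ∑ n f
∑-≥ f f≥0 k<n p = ≤-trans p (∑-term f k<n λ i _ → f≥0 i)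

∑-product : ∀ n m (f g : ℕ → F) → ∑ n f * ∑ m g ≡ ∑ n (λ i → ∑ m (λ j → f i * g j))
∑-product n m f g = trans (sym (∑-*ʳ n (∑ m g) f)) (∑-ext n λ i → sym (∑-* m (f i) g))

∑-push : ∀ n m (a : ℕ → ℕ → F) (g : ℕ → ℕ → ℕ → F) →
         ∑ n (λ y → ∑ n (λ z → ∑ m (λ e → a z e * g y z e))) ≡ ∑ n (λ z → ∑ m (λ e → a z e * ∑ n (λ y → g y z e)))
∑-push n m a g = trans (∑-swap n n (λ y z → ∑ m (λ e → a z e * g y z e))) (∑-ext n λ z →
  trans (∑-swap n m (λ y e → a z e * g y z e)) (∑-ext m λ e → ∑-* n (a z e) (λ y → g y z e)))

∑-hits-* : ∀ n c (t : ℕ → F) → (∀ i → 0F ≤ t i) → ∑ n (λ i → 𝟙 (i ℕ.≟ c) * t c) ≤ t c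
∑-hits-* n c t t≥0 = subst₂ _≤_ (sym (∑-*ʳ n (t c) (λ i → 𝟙 (i ℕ.≟ c)))) (*-identityˡ (t c))
  (subst₂ _≤_ (*-comm (t c) _) (*-comm (t c) _) (*-monoˡ (t≥0 c) (∑-hits n 0 c)))

-- Expand the sum of the squares of n D(z) - M, with M the sum of D, and cancel n.
cauchy : ∀ n (D : ℕ → F) → ∑ n D * ∑ n D ≤ ι n * ∑ n (λ z → D z * D z)
cauchy zero        D = ≤-reflexive (trans (zeroˡ 0F) (sym (zeroʳ (ι 0))))
cauchy n@(suc n-1) D = *-cancel (1≤ι {n} (s≤s z≤n)) (step (ι n) (∑ n D) (∑ n (λ z → D z * D z)) (subst (0F ≤_) expand (∑-nonneg n λ z _ → square-nonneg (ι n * D z - ∑ n D))))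
  where
  N = ι n
  M = ∑ n D
  S = ∑ n (λ z → D z * D z)
  term : ∀ N d M → (N * d - M) * (N * d - M) ≡ (N * N) * (d * d) + ((M * M) - (# 2 * N * M) * d)
  term N d M = lin (N ∷ d ∷ M ∷ []) (from [])
  expand : ∑ n (λ z → (N * D z - M) * (N * D z - M)) ≡ (N * N) * S + (N * (M * M) - (# 2 * N * M) * M)
  expand = trans (∑-ext n λ z → term N (D z) M) (trans (∑-+ n (λ z → (N * N) * (D z * D z)) (λ z → M * M - (# 2 * N * M) * D z))
    (cong₂ _+_ (∑-* n (N * N) (λ z → D z * D z)) (trans (∑-- n (λ _ → M * M) (λ z → (# 2 * N * M) * D z)) (cong₂ _-_ (∑-const n (M * M)) (∑-* n (# 2 * N * M) D)))))
  step : ∀ N M S → 0F ≤ (N * N) * S + (N * (M * M) - (# 2 * N * M) * M) → N * (M * M) ≤ N * (N * S)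
  step N M S p = lin (N ∷ M ∷ S ∷ []) (from (p & []))

module Cherries (n m : ℕ) {In : ℕ → ℕ → Set} (In? : ∀ e v → Dec (In e v)) {Good : ℕ → ℕ → Set} (Good? : ∀ u v → Dec (Good u v))
  {C : ℕ → ℕ → ℕ → Set} (C? : ∀ e u v → Dec (C e u v))
  (In-< : ∀ {e v} → In e v → e ℕ.< m × v ℕ.< n)
  (C⇒In : ∀ {e u v} → C e u v → In e u × In e v)
  (C⇒≢ : ∀ {e u v} → C e u v → u ≢ v)
  (C⇒Good : ∀ {e u v} → C e u v → Good u v)
  (C-sym : ∀ {e u v} → C e u v → C e v u)
  (degree : ∀ e u → ∑ n (λ v → 𝟙 (C? e u v)) ≤ # 17)
  (multiplicity : ∀ u v → ∑ m (λ e → 𝟙 (C? e u v)) ≤ # 3)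
  (codegree : ∀ {u v} → Good u v → ∑ m (λ e → 𝟙 (In? e u ×-dec In? e v)) ≤ # 3)
  (no-C4 : ∀ {v₁ v₂ v₃ v₄ e₁ e₂ e₃ e₄} → AllPairs _≢_ (v₁ ∷ v₂ ∷ v₃ ∷ v₄ ∷ []) → AllPairs _≢_ (e₁ ∷ e₂ ∷ e₃ ∷ e₄ ∷ []) →
           In e₁ v₁ → In e₁ v₂ → In e₂ v₂ → In e₂ v₃ → In e₃ v₃ → In e₃ v₄ → In e₄ v₄ → In e₄ v₁ → ⊥)
  (bad-path-free : ∀ {e u v w x} → AllPairs _≢_ (u ∷ v ∷ w ∷ x ∷ []) → In e u → In e x → ¬ Good u v → ¬ Good v w → ¬ Good w x → ⊥)
  where

  c : ℕ → ℕ → ℕ → F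
  c e u v = 𝟙 (C? e u v)

  0≤c : ∀ e u v → 0F ≤ c e u v
  0≤c e u v = 𝟙-nonneg (C? e u v)

  c-sym : ∀ e u v → c e u v ≡ c e v u
  c-sym e u v = 𝟙-cong (C? e u v) (C? e v u) C-sym C-sym

  mult : ℕ → ℕ → F
  mult x z = ∑ m (λ e → c e x z)

  0≤mult : ∀ x z → 0F ≤ mult x z
  0≤mult x z = ∑-nonneg m λ e _ → 0≤c e x z

  mult-sym : ∀ x z → mult x z ≡ mult z x
  mult-sym x z = ∑-ext m λ e → c-sym e x z

  total : F
  total = ∑ n (λ z → ∑ n (λ x → mult x z))

  total-sym : ∑ n (λ x → ∑ n (λ z → mult x z)) ≡ total
  total-sym = ∑-ext n λ x → ∑-ext n λ z → mult-sym x z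

  Cherry : ℕ → ℕ → ℕ → ℕ → ℕ → Set
  Cherry x y z e f = (C e x z × C f z y) × (e ≢ f × x ≢ y)

  Cherry? : ∀ x y z e f → Dec (Cherry x y z e f)
  Cherry? x y z e f = (C? e x z ×-dec C? f z y) ×-dec (¬? (e ℕ.≟ f) ×-dec ¬? (x ℕ.≟ y))

  through : ℕ → ℕ → ℕ → F
  through x y z = ∑ m (λ e → ∑ m (λ f → 𝟙 (Cherry? x y z e f)))

  cherries : ℕ → ℕ → F
  cherries x y = ∑ n (through x y)

  0≤through : ∀ x y z → 0F ≤ through x y z
  0≤through x y z = ∑-nonneg m λ e _ → ∑-nonneg m λ f _ → 𝟙-nonneg (Cherry? x y z e f)

  through≤ : ∀ x y z → through x y z ≤ mult x z * mult z y
  through≤ x y z = subst (through x y z ≤_) (sym (∑-product m m (λ e → c e x z) (λ f → c f z y))) (∑-mono m λ e _ → ∑-mono m λ f _ →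
    subst (𝟙 (Cherry? x y z e f) ≤_) (𝟙-× (C? e x z) (C? f z y)) (𝟙-mono (Cherry? x y z e f) (C? e x z ×-dec C? f z y) proj₁))

  through≤9 : ∀ x y z → through x y z ≤ # 9
  through≤9 x y z = ≤-trans (through≤ x y z) (subst (mult x z * mult z y ≤_) nine (*-mono (0≤mult x z) (0≤# 3) (multiplicity x z) (multiplicity z y)))
    where
    nine : # 3 * # 3 ≡ # 9
    nine = lin [] (from [])

  Cherry-< : ∀ {x y z e f} → Cherry x y z e f → z ℕ.< n × e ℕ.< m × f ℕ.< m
  Cherry-< ((p , q) , _) = proj₂ (In-< (proj₂ (C⇒In p))) , proj₁ (In-< (proj₁ (C⇒In p))) , proj₁ (In-< (proj₁ (C⇒In q)))

  cherries≤ : ∀ {x y} {Q : ℕ → Set} (Q? : ∀ z → Dec (Q z)) → (∀ {z e f} → Cherry x y z e f → Q z) → cherries x y ≤ # 9 * ∑ n (λ z → 𝟙 (Q? z))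
  cherries≤ {x} {y} {Q} Q? all = subst (cherries x y ≤_) (∑-* n (# 9) (λ z → 𝟙 (Q? z))) (∑-mono n λ z _ → pointwise z (Q? z))
    where
    pointwise : ∀ z (d : Dec (Q z)) → through x y z ≤ # 9 * 𝟙 d
    pointwise z (yes _) = subst (through x y z ≤_) (sym (*-identityʳ _)) (through≤9 x y z)
    pointwise z (no ¬q) = ≤-reflexive (trans (∑-zero m λ e _ → ∑-zero m λ f _ → 𝟙-no (Cherry? x y z e f) (¬q ∘ all)) (sym (zeroʳ _)))

  cherry-search : ∀ x y {R : ℕ → ℕ → ℕ → Set} (R? : ∀ z e f → Dec (R z e f)) →
                  (∃ λ z → ∃ λ e → ∃ λ f → Cherry x y z e f × R z e f) ⊎ (∀ {z e f} → Cherry x y z e f → ¬ R z e f)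
  cherry-search x y {R} R? = convert (search n λ z → ℕ.anyUpTo? (λ e → ℕ.anyUpTo? (λ f → Cherry? x y z e f ×-dec R? z e f) m) m)
    where
    convert : _ → (∃ λ z → ∃ λ e → ∃ λ f → Cherry x y z e f × R z e f) ⊎ (∀ {z e f} → Cherry x y z e f → ¬ R z e f)
    convert (inj₁ (z , _ , e , _ , f , _ , p)) = inj₁ (z , e , f , p)
    convert (inj₂ none) = inj₂ λ {z} {e} {f} p r → none z (proj₁ (Cherry-< p)) (e , proj₁ (proj₂ (Cherry-< p)) , f , proj₂ (proj₂ (Cherry-< p)) , p , r)

  -- Otherwise x e z f y f′ z′ e′ would be a Berge cycle.
  share-edge : ∀ {x y z e f z′ e′ f′} → z ≢ z′ → Cherry x y z e f → Cherry x y z′ e′ f′ → e ≢ e′ → f ≢ f′ → e ≢ f′ → f ≢ e′ → ⊥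
  share-edge z≢z′ ((p , q) , e≢f , x≢y) ((p′ , q′) , e′≢f′ , _) ee ff ef fe = no-C4
    ((C⇒≢ p ∷ x≢y ∷ C⇒≢ p′ ∷ []) ∷ (C⇒≢ q ∷ z≢z′ ∷ []) ∷ (C⇒≢ (C-sym q′) ∷ []) ∷ [] ∷ [])
    ((e≢f ∷ ef ∷ ee ∷ []) ∷ (ff ∷ fe ∷ []) ∷ ((e′≢f′ ∘ sym) ∷ []) ∷ [] ∷ [])
    (proj₁ (C⇒In p)) (proj₂ (C⇒In p)) (proj₁ (C⇒In q)) (proj₂ (C⇒In q)) (proj₂ (C⇒In q′)) (proj₁ (C⇒In q′)) (proj₂ (C⇒In p′)) (proj₁ (C⇒In p′))

  -- 612 = 9 · (4 · 17): every middle vertex is joined to x or y inside one of the two hyperedges of a fixed cherry.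
  cherries≤612 : ∀ x y → cherries x y ≤ # 612
  cherries≤612 x y = cases (cherry-search x y (λ _ _ _ → yes refl))
    where
    cases : (∃ λ z → ∃ λ e → ∃ λ f → Cherry x y z e f × 0 ≡ 0) ⊎ (∀ {z e f} → Cherry x y z e f → ¬ 0 ≡ 0) → cherries x y ≤ # 612
    cases (inj₂ none) = ≤-trans (cherries≤ (λ z → z ℕ.≟ 0) (λ p → ⊥-elim (none p refl))) (step _ (∑-hits n 0 0))
      where
      step : ∀ a → a ≤ 1F → # 9 * a ≤ # 612
      step a p = lin (a ∷ []) (from (p & []))
    cases (inj₁ (z₀ , e₀ , f₀ , p₀ , _)) = ≤-trans (cherries≤ Q? covered) (step _ _ _ _ _ count (degree e₀ x) (degree f₀ y) (degree f₀ x) (degree e₀ y))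
      where
      step : ∀ s a b c d → s ≤ (a + b) + (c + d) → a ≤ # 17 → b ≤ # 17 → c ≤ # 17 → d ≤ # 17 → # 9 * s ≤ # 612
      step s a b c d p q r t u = lin (s ∷ a ∷ b ∷ c ∷ d ∷ []) (from (p & q & r & t & u & []))
      Q : ℕ → Set
      Q z = (C e₀ x z ⊎ C f₀ y z) ⊎ (C f₀ x z ⊎ C e₀ y z)
      Q? : ∀ z → Dec (Q z)
      Q? z = (C? e₀ x z ⊎-dec C? f₀ y z) ⊎-dec (C? f₀ x z ⊎-dec C? e₀ y z)
      covered : ∀ {z e f} → Cherry x y z e f → Q z
      covered {z} {e} {f} p′@((a , b) , _) = go (z ℕ.≟ z₀) (e₀ ℕ.≟ e) (f₀ ℕ.≟ f) (e₀ ℕ.≟ f) (f₀ ℕ.≟ e)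
        where
        go : Dec (z ≡ z₀) → Dec (e₀ ≡ e) → Dec (f₀ ≡ f) → Dec (e₀ ≡ f) → Dec (f₀ ≡ e) → Q z
        go (yes refl) _ _ _ _ = inj₁ (inj₁ (proj₁ (proj₁ p₀)))
        go (no _) (yes refl) _ _ _ = inj₁ (inj₁ a)
        go (no _) (no _) (yes refl) _ _ = inj₁ (inj₂ (C-sym b))
        go (no _) (no _) (no _) (yes refl) _ = inj₂ (inj₂ (C-sym b))
        go (no _) (no _) (no _) (no _) (yes refl) = inj₂ (inj₁ a)
        go (no z≢) (no p) (no q) (no r) (no s) = ⊥-elim (share-edge (z≢ ∘ sym) p₀ p′ p q r s)
      𝟙-⊎ : ∀ {A B : Set} (a : Dec A) (b : Dec B) → 𝟙 (a ⊎-dec b) ≤ 𝟙 a + 𝟙 b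
      𝟙-⊎ (yes _) b       = subst (_≤ 1F + 𝟙 b) (+-identityʳ 1F) (+-mono-≤ ≤-refl (𝟙-nonneg b))
      𝟙-⊎ (no _)  (yes _) = ≤-reflexive (sym (+-identityˡ 1F))
      𝟙-⊎ (no _)  (no _)  = ≤-reflexive (sym (+-identityˡ 0F))
      count : ∑ n (λ z → 𝟙 (Q? z)) ≤ (∑ n (c e₀ x) + ∑ n (c f₀ y)) + (∑ n (c f₀ x) + ∑ n (c e₀ y))
      count = ≤-trans (∑-mono n λ z _ → ≤-trans (𝟙-⊎ (C? e₀ x z ⊎-dec C? f₀ y z) (C? f₀ x z ⊎-dec C? e₀ y z)) (+-mono-≤ (𝟙-⊎ (C? e₀ x z) (C? f₀ y z)) (𝟙-⊎ (C? f₀ x z) (C? e₀ y z))))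
        (≤-reflexive (trans (∑-+ n (λ z → c e₀ x z + c f₀ y z) (λ z → c f₀ x z + c e₀ y z)) (cong₂ _+_ (∑-+ n (c e₀ x) (c f₀ y)) (∑-+ n (c f₀ x) (c e₀ y)))))

  -- Two middles z and z′ joined to x in one hyperedge e, weighted by the ways `K` of completing
  -- them to y.
  forks : (ℕ → ℕ → ℕ → F) → ℕ → ℕ → F
  forks K x y = ∑ n (λ z → ∑ m (λ e → c e x z * ∑ n (λ z′ → c e x z′ * K z z′ y)))

  forks-nonneg : ∀ K → (∀ z z′ y → 0F ≤ K z z′ y) → ∀ x y → 0F ≤ forks K x y
  forks-nonneg K K≥0 x y = ∑-nonneg n λ z _ → ∑-nonneg m λ e _ → *-nonneg (0≤c e x z) (∑-nonneg n λ z′ _ → *-nonneg (0≤c e x z′) (K≥0 z z′ y))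

  forks-≥ : ∀ K → (∀ z z′ y → 0F ≤ K z z′ y) → ∀ {x y e z z′} → C e x z → C e x z′ → 1F ≤ K z z′ y → 1F ≤ forks K x y
  forks-≥ K K≥0 {x} {y} {e} {z} {z′} p p′ k =
    ∑-≥ _ (λ z → ∑-nonneg m λ e _ → inner z e) (proj₂ (In-< (proj₂ (C⇒In p))))
      (∑-≥ _ (inner z) (proj₁ (In-< (proj₂ (C⇒In p))))
        (1≤* (𝟙-≥ (C? e x z) p) (∑-≥ (λ z′ → c e x z′ * K z z′ y) (λ z′ → *-nonneg (0≤c e x z′) (K≥0 z z′ y)) (proj₂ (In-< (proj₂ (C⇒In p′))))
          (1≤* (𝟙-≥ (C? e x z′) p′) k))))
    where
    inner : ∀ z e → 0F ≤ c e x z * ∑ n (λ z′ → c e x z′ * K z z′ y)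
    inner z e = *-nonneg (0≤c e x z) (∑-nonneg n λ z′ _ → *-nonneg (0≤c e x z′) (K≥0 z z′ y))

  -- `total` counts the choices of x, z and e; the degree bound leaves 17 choices of z′, and `b`
  -- bounds the weighted choices of y.
  forks-total : ∀ K {b} → 0F ≤ b → (∀ z z′ → ∑ n (K z z′) ≤ b) → ∑ n (λ x → ∑ n (forks K x)) ≤ total * (# 17 * b)
  forks-total K {b} 0≤b K≤ = ≤-trans (∑-mono n λ x _ → row x) (≤-reflexive (trans (∑-*ʳ n (# 17 * b) (λ x → ∑ n (λ z → mult x z))) (cong (_* (# 17 * b)) total-sym)))
    where
    row : ∀ x → ∑ n (forks K x) ≤ ∑ n (λ z → mult x z) * (# 17 * b)
    row x = subst₂ _≤_ (sym (∑-push n m (λ z e → c e x z) (λ y z e → ∑ n (λ z′ → c e x z′ * K z z′ y))))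
        (trans (∑-ext n λ z → ∑-*ʳ m (# 17 * b) (λ e → c e x z)) (∑-*ʳ n (# 17 * b) (λ z → mult x z)))
        (∑-mono n λ z _ → ∑-mono m λ e _ → *-monoˡ (0≤c e x z) (cell z e))
      where
      cell : ∀ z e → ∑ n (λ y → ∑ n (λ z′ → c e x z′ * K z z′ y)) ≤ # 17 * b
      cell z e = subst (_≤ # 17 * b) (sym (trans (∑-swap n n (λ y z′ → c e x z′ * K z z′ y)) (∑-ext n λ z′ → ∑-* n (c e x z′) (K z z′))))
        (≤-trans (∑-mono n λ z′ _ → *-monoˡ (0≤c e x z′) (K≤ z z′)) (subst₂ _≤_ (trans (*-comm b _) (sym (∑-*ʳ n b (c e x)))) (*-comm b (# 17)) (*-monoˡ 0≤b (degree e x))))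

  triples : ℕ → ℕ → F
  triples x y = ∑ n (λ z → ∑ m (λ f → c f z y * ∑ m (λ e → 𝟙 (In? e y) * c e x z)))

  0≤triples : ∀ x y → 0F ≤ triples x y
  0≤triples x y = ∑-nonneg n λ z _ → ∑-nonneg m λ f _ → *-nonneg (0≤c f z y) (∑-nonneg m λ e _ → *-nonneg (𝟙-nonneg (In? e y)) (0≤c e x z))

  triples-≥ : ∀ {x y z e f} → C e x z → In e y → C f z y → 1F ≤ triples x y
  triples-≥ {x} {y} {z} {e} {f} p i q =
    ∑-≥ _ (λ z → ∑-nonneg m λ f _ → inner z f) (proj₂ (In-< (proj₂ (C⇒In p)))) (∑-≥ _ (inner z) (proj₁ (In-< (proj₁ (C⇒In q))))
      (1≤* (𝟙-≥ (C? f z y) q) (∑-≥ (λ e → 𝟙 (In? e y) * c e x z) (λ e → *-nonneg (𝟙-nonneg (In? e y)) (0≤c e x z)) (proj₁ (In-< i)) (1≤* (𝟙-≥ (In? e y) i) (𝟙-≥ (C? e x z) p)))))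
    where
    inner : ∀ z f → 0F ≤ c f z y * ∑ m (λ e → 𝟙 (In? e y) * c e x z)
    inner z f = *-nonneg (0≤c f z y) (∑-nonneg m λ e _ → *-nonneg (𝟙-nonneg (In? e y)) (0≤c e x z))

  -- Fix y, z and f. The pair z, y is joined and hence good, so at most three hyperedges e contain
  -- it, each with at most 17 choices of x.
  triples-total : ∑ n (λ x → ∑ n (triples x)) ≤ total * # 51
  triples-total = subst (_≤ total * # 51) (∑-swap n n (λ y x → triples x y)) (≤-trans (∑-mono n λ y _ → row y)
      (≤-reflexive (trans (∑-*ʳ n (# 51) (λ y → ∑ n (λ z → mult z y))) refl)))
    where
    row : ∀ y → ∑ n (λ x → triples x y) ≤ ∑ n (λ z → mult z y) * # 51
    row y = subst₂ _≤_ (sym (∑-push n m (λ z f → c f z y) (λ x z f → ∑ m (λ e → 𝟙 (In? e y) * c e x z))))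
        (trans (∑-ext n λ z → ∑-*ʳ m (# 51) (λ f → c f z y)) (∑-*ʳ n (# 51) (λ z → mult z y)))
        (∑-mono n λ z _ → ∑-mono m λ f _ → cell z f (C? f z y))
      where
      degree′ : ∀ e z → ∑ n (λ x → c e x z) ≤ # 17 * 𝟙 (In? e z)
      degree′ e z = cases (In? e z)
        where
        cases : (d : Dec (In e z)) → ∑ n (λ x → c e x z) ≤ # 17 * 𝟙 d
        cases (yes _) = subst₂ _≤_ (∑-ext n λ x → c-sym e z x) (sym (*-identityʳ _)) (degree e z)
        cases (no ¬i) = ≤-reflexive (trans (∑-zero n λ x _ → 𝟙-no (C? e x z) (¬i ∘ proj₂ ∘ C⇒In)) (sym (zeroʳ _)))
      swapped : ∀ z → ∑ n (λ x → ∑ m (λ e → 𝟙 (In? e y) * c e x z)) ≤ # 17 * ∑ m (λ e → 𝟙 (In? e z ×-dec In? e y))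
      swapped z = subst₂ _≤_ (sym (trans (∑-swap n m (λ x e → 𝟙 (In? e y) * c e x z)) (∑-ext m λ e → ∑-* n (𝟙 (In? e y)) (λ x → c e x z))))
          (∑-* m (# 17) (λ e → 𝟙 (In? e z ×-dec In? e y)))
          (∑-mono m λ e _ → subst (𝟙 (In? e y) * ∑ n (λ x → c e x z) ≤_) (trans (step (𝟙 (In? e y)) (𝟙 (In? e z))) (cong (# 17 *_) (sym (𝟙-× (In? e z) (In? e y)))))
            (*-monoˡ (𝟙-nonneg (In? e y)) (degree′ e z)))
        where
        step : ∀ a b → a * (# 17 * b) ≡ # 17 * (b * a)
        step a b = lin (a ∷ b ∷ []) (from [])
      cell : ∀ z f (d : Dec (C f z y)) → 𝟙 d * ∑ n (λ x → ∑ m (λ e → 𝟙 (In? e y) * c e x z)) ≤ 𝟙 d * # 51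
      cell z f (no _)  = ≤-reflexive (trans (zeroˡ _) (sym (zeroˡ _)))
      cell z f (yes q) = *-monoˡ 0≤1 (≤-trans (swapped z) (step _ (codegree (C⇒Good q))))
        where
        step : ∀ a → a ≤ # 3 → # 17 * a ≤ # 51
        step a p = lin (a ∷ []) (from (p & []))

  linked : ℕ → ℕ → ℕ → F
  linked z z′ f = 𝟙 ((In? f z ×-dec In? f z′) ×-dec Good? z z′)

  0≤linked : ∀ z z′ f → 0F ≤ linked z z′ f
  0≤linked z z′ f = 𝟙-nonneg ((In? f z ×-dec In? f z′) ×-dec Good? z z′)

  linked≤3 : ∀ z z′ → ∑ m (linked z z′) ≤ # 3
  linked≤3 z z′ = cases (Good? z z′)
    where
    cases : (d : Dec (Good z z′)) → ∑ m (λ f → 𝟙 ((In? f z ×-dec In? f z′) ×-dec d)) ≤ # 3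
    cases (yes g) = ≤-trans (∑-mono m λ f _ → 𝟙-mono ((In? f z ×-dec In? f z′) ×-dec yes g) (In? f z ×-dec In? f z′) proj₁) (codegree g)
    cases (no ¬g) = subst (_≤ # 3) (sym (∑-zero m λ f _ → 𝟙-no ((In? f z ×-dec In? f z′) ×-dec no ¬g) (¬g ∘ proj₂))) (0≤# 3)

  closing : ℕ → ℕ → ℕ → F
  closing z z′ y = ∑ m (λ f → linked z z′ f * c f z y)

  0≤closing : ∀ z z′ y → 0F ≤ closing z z′ y
  0≤closing z z′ y = ∑-nonneg m λ f _ → *-nonneg (0≤linked z z′ f) (0≤c f z y)

  closing-total : ∀ z z′ → ∑ n (closing z z′) ≤ # 51
  closing-total z z′ = subst (_≤ # 51) (sym (trans (∑-swap n m (λ y f → linked z z′ f * c f z y)) (∑-ext m λ f → ∑-* n (linked z z′ f) (c f z))))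
      (≤-trans (∑-mono m λ f _ → *-monoˡ (0≤linked z z′ f) (degree f z)) (subst (_≤ # 51) (sym (∑-*ʳ m (# 17) (linked z z′))) (step _ (linked≤3 z z′))))
    where
    step : ∀ a → a ≤ # 3 → a * # 17 ≤ # 51
    step a p = lin (a ∷ []) (from (p & []))

  -- Sources of further cherries over x, y: a hyperedge through x, z and y, two cherries x e z f y and x e z′ f′ y,
  -- or two cherries x e z f y and x e z′ f y for which z, z′ lie in at most three hyperedges.
  exceptions : ℕ → ℕ → F
  exceptions x y = ((triples x y + triples y x) + (forks through x y + forks through y x)) + forks closing x y

  module _ (x y : ℕ) where

    private
      parts : ∀ {a b c d e} → 0F ≤ a → 0F ≤ b → 0F ≤ c → 0F ≤ d → 0F ≤ e → (1F ≤ a ⊎ 1F ≤ b) ⊎ ((1F ≤ c ⊎ 1F ≤ d) ⊎ 1F ≤ e) → 1F ≤ ((a + b) + (c + d)) + e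
      parts {a} {b} {c} {d} {e} p q r s t = [ [ go₁ , go₂ ]′ , [ [ go₃ , go₄ ]′ , go₅ ]′ ]′
        where
        go₁ : 1F ≤ a → 1F ≤ ((a + b) + (c + d)) + e
        go₁ u = lin (a ∷ b ∷ c ∷ d ∷ e ∷ []) (from (u & q & r & s & t & []))
        go₂ : 1F ≤ b → 1F ≤ ((a + b) + (c + d)) + e
        go₂ u = lin (a ∷ b ∷ c ∷ d ∷ e ∷ []) (from (u & p & r & s & t & []))
        go₃ : 1F ≤ c → 1F ≤ ((a + b) + (c + d)) + e
        go₃ u = lin (a ∷ b ∷ c ∷ d ∷ e ∷ []) (from (u & p & q & s & t & []))
        go₄ : 1F ≤ d → 1F ≤ ((a + b) + (c + d)) + e
        go₄ u = lin (a ∷ b ∷ c ∷ d ∷ e ∷ []) (from (u & p & q & r & t & []))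
        go₅ : 1F ≤ e → 1F ≤ ((a + b) + (c + d)) + e
        go₅ u = lin (a ∷ b ∷ c ∷ d ∷ e ∷ []) (from (u & p & q & r & s & []))

    0≤exceptions : 0F ≤ exceptions x y
    0≤exceptions = +-nonneg (+-nonneg (+-nonneg (0≤triples x y) (0≤triples y x)) (+-nonneg (forks-nonneg through 0≤through x y) (forks-nonneg through 0≤through y x)))
      (forks-nonneg closing 0≤closing x y)

    Exceptional : Set
    Exceptional = (1F ≤ triples x y ⊎ 1F ≤ triples y x) ⊎ ((1F ≤ forks through x y ⊎ 1F ≤ forks through y x) ⊎ 1F ≤ forks closing x y)

    exceptional : Exceptional → 1F ≤ exceptions x y
    exceptional = parts (0≤triples x y) (0≤triples y x) (forks-nonneg through 0≤through x y) (forks-nonneg through 0≤through y x) (forks-nonneg closing 0≤closing x y)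

    through-≥ : ∀ {x y z e f} → Cherry x y z e f → 1F ≤ through x y z
    through-≥ {x} {y} {z} {e} {f} p = ∑-≥ _ (λ e → ∑-nonneg m λ f _ → 𝟙-nonneg (Cherry? x y z e f)) (proj₁ (proj₂ (Cherry-< p)))
      (∑-≥ _ (λ f → 𝟙-nonneg (Cherry? x y z e f)) (proj₂ (proj₂ (Cherry-< p))) (𝟙-≥ (Cherry? x y z e f) p))

    -- By `share-edge` the cherries share a hyperedge. Shared crosswise, it contains x, y and a
    -- middle; if only e or only f is shared, the rest is a cherry over the two middles.
    compare : ∀ {z e f z′ e′ f′} → z ≢ z′ → Cherry x y z e f → Cherry x y z′ e′ f′ → Exceptional ⊎ (e ≡ e′ × f ≡ f′)
    compare {z} {e} {f} {z′} {e′} {f′} z≢z′ P@((p , q) , _) P′@((p′ , q′) , _) = go (e ℕ.≟ f′) (f ℕ.≟ e′) (e ℕ.≟ e′) (f ℕ.≟ f′)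
      where
      go : Dec (e ≡ f′) → Dec (f ≡ e′) → Dec (e ≡ e′) → Dec (f ≡ f′) → Exceptional ⊎ (e ≡ e′ × f ≡ f′)
      go (yes refl) _ _ _ = inj₁ (inj₁ (inj₁ (triples-≥ p (proj₂ (C⇒In q′)) q)))
      go (no _) (yes refl) _ _ = inj₁ (inj₁ (inj₂ (triples-≥ (C-sym q) (proj₁ (C⇒In p′)) (C-sym p))))
      go (no _) (no _) (yes refl) (yes refl) = inj₂ (refl , refl)
      go (no _) (no _) (yes refl) (no f≢f′) = inj₁ (inj₂ (inj₁ (inj₁ (forks-≥ through 0≤through p p′ (through-≥ ((q , C-sym q′) , f≢f′ , z≢z′))))))
      go (no _) (no _) (no e≢e′) (yes refl) = inj₁ (inj₂ (inj₁ (inj₂ (forks-≥ through 0≤through (C-sym q) (C-sym q′) (through-≥ ((C-sym p , p′) , e≢e′ , z≢z′))))))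
      go (no a) (no b) (no c) (no d) = ⊥-elim (share-edge z≢z′ P P′ c d a b)

    cherries≤9 : ∀ z₀ → (∀ {z e f} → Cherry x y z e f → z ≡ z₀) → cherries x y ≤ # 9
    cherries≤9 z₀ all = ≤-trans (cherries≤ (λ z → z ℕ.≟ z₀) all) (step _ (∑-hits n 0 z₀))
      where
      step : ∀ a → a ≤ 1F → # 9 * a ≤ # 9
      step a p = lin (a ∷ []) (from (p & []))

    -- With more than 9 cherries there are four middles, all in `e₀`. Three consecutive bad pairs
    -- among them contradict `bad-path-free`, and a good pair is a fork counted by `closing`.
    uniform : ∀ {e₀ f₀} → (∀ {z e f} → Cherry x y z e f → e ≡ e₀ × f ≡ f₀) → Exceptional ⊎ cherries x y ≤ # 9
    uniform {e₀} {f₀} all = cases (cherries x y ≤? # 9)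
      where
      count : cherries x y ≤ ∑ n (λ z → 𝟙 (Cherry? x y z e₀ f₀))
      count = ∑-mono n λ z _ → ≤-trans (∑-mono m λ e _ → ∑-mono m λ f _ → pointwise z e f (Cherry? x y z e f))
          (≤-trans (∑-mono m λ e _ → subst (_≤ 𝟙 (e ℕ.≟ e₀) * k z) (sym (∑-* m (𝟙 (e ℕ.≟ e₀)) (λ f → 𝟙 (f ℕ.≟ f₀) * k z)))
                     (*-monoˡ (𝟙-nonneg (e ℕ.≟ e₀)) (∑-hits-* m f₀ (λ _ → k z) λ _ → k≥0 z)))
            (∑-hits-* m e₀ (λ _ → k z) λ _ → k≥0 z))
        where
        k : ℕ → F
        k z = 𝟙 (Cherry? x y z e₀ f₀)
        k≥0 : ∀ z → 0F ≤ k z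
        k≥0 z = 𝟙-nonneg (Cherry? x y z e₀ f₀)
        pointwise : ∀ z e f (d : Dec (Cherry x y z e f)) → 𝟙 d ≤ 𝟙 (e ℕ.≟ e₀) * (𝟙 (f ℕ.≟ f₀) * k z)
        pointwise z e f (no _)  = *-nonneg (𝟙-nonneg (e ℕ.≟ e₀)) (*-nonneg (𝟙-nonneg (f ℕ.≟ f₀)) (k≥0 z))
        pointwise z e f (yes p) = 1≤* (𝟙-≥ (e ℕ.≟ e₀) (proj₁ (all p))) (1≤* (𝟙-≥ (f ℕ.≟ f₀) (proj₂ (all p)))
          (𝟙-≥ (Cherry? x y z e₀ f₀) (subst₂ (Cherry x y z) (proj₁ (all p)) (proj₂ (all p)) p)))
      cases : Dec (cherries x y ≤ # 9) → Exceptional ⊎ cherries x y ≤ # 9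
      cases (yes p) = inj₂ p
      cases (no ¬p) = inj₁ (inj₂ (inj₂ (one (avoiding {n} Q? (0 ∷ 0 ∷ 0 ∷ []) many))))
        where
        Q? : ∀ z → Dec (Cherry x y z e₀ f₀)
        Q? z = Cherry? x y z e₀ f₀
        many : ¬ ∑ n (λ z → 𝟙 (Q? z)) ≤ # 3
        many q = ¬p (≤-trans count (step _ q))
          where
          step : ∀ a → a ≤ # 3 → a ≤ # 9
          step a p = lin (a ∷ []) (from (p & []))
        close : ∀ {a b} → Cherry x y a e₀ f₀ → Cherry x y b e₀ f₀ → Good a b → 1F ≤ forks closing x y
        close {a} {b} ((p , q) , _) ((p′ , q′) , _) g = forks-≥ closing 0≤closing p p′
          (∑-≥ _ (λ f → *-nonneg (0≤linked a b f) (0≤c f a y)) (proj₁ (In-< (proj₁ (C⇒In q))))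
            (1≤* (𝟙-≥ ((In? f₀ a ×-dec In? f₀ b) ×-dec Good? a b) ((proj₁ (C⇒In q) , proj₁ (C⇒In q′)) , g)) (𝟙-≥ (C? f₀ a y) q)))
        one : _ → 1F ≤ forks closing x y
        one (z₁ , _ , c₁ , _) = two (avoiding {n} Q? (z₁ ∷ z₁ ∷ z₁ ∷ []) many)
          where
          two : _ → 1F ≤ forks closing x y
          two (z₂ , _ , c₂ , z₂∉) = three (avoiding {n} Q? (z₁ ∷ z₂ ∷ z₂ ∷ []) many)
            where
            three : _ → 1F ≤ forks closing x y
            three (z₃ , _ , c₃ , z₃∉) = four (avoiding {n} Q? (z₁ ∷ z₂ ∷ z₃ ∷ []) many)
              where
              four : _ → 1F ≤ forks closing x y
              four (z₄ , _ , c₄ , z₄∉) = decide (∉⇒≢ (z₁ ∷ z₁ ∷ z₁ ∷ []) z₂∉) (∉⇒≢ (z₁ ∷ z₂ ∷ z₂ ∷ []) z₃∉) (∉⇒≢ (z₁ ∷ z₂ ∷ z₃ ∷ []) z₄∉) (Good? z₁ z₂) (Good? z₂ z₃) (Good? z₃ z₄)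
                where
                decide : All (z₂ ≢_) (z₁ ∷ z₁ ∷ z₁ ∷ []) → All (z₃ ≢_) (z₁ ∷ z₂ ∷ z₂ ∷ []) → All (z₄ ≢_) (z₁ ∷ z₂ ∷ z₃ ∷ []) →
                         Dec (Good z₁ z₂) → Dec (Good z₂ z₃) → Dec (Good z₃ z₄) → 1F ≤ forks closing x y
                decide _ _ _ (yes g) _ _ = close c₁ c₂ g
                decide _ _ _ (no _) (yes g) _ = close c₂ c₃ g
                decide _ _ _ (no _) (no _) (yes g) = close c₃ c₄ g
                decide (a ∷ _) (b ∷ b′ ∷ _) (d ∷ d′ ∷ d″ ∷ []) (no g) (no h) (no i) = ⊥-elim (bad-path-free
                  (((a ∘ sym) ∷ (b ∘ sym) ∷ (d ∘ sym) ∷ []) ∷ ((b′ ∘ sym) ∷ (d′ ∘ sym) ∷ []) ∷ ((d″ ∘ sym) ∷ []) ∷ [] ∷ [])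
                  (proj₂ (C⇒In (proj₁ (proj₁ c₁)))) (proj₂ (C⇒In (proj₁ (proj₁ c₄)))) g h i)

    exceptional-or-few : Exceptional ⊎ cherries x y ≤ # 9
    exceptional-or-few = one (cherry-search x y (λ z e f → z ℕ.≟ z))
      where
      one : (∃ λ z → ∃ λ e → ∃ λ f → Cherry x y z e f × z ≡ z) ⊎ (∀ {z e f} → Cherry x y z e f → ¬ z ≡ z) → Exceptional ⊎ cherries x y ≤ # 9
      one (inj₂ none) = inj₂ (cherries≤9 0 λ p → ⊥-elim (none p refl))
      one (inj₁ (z₀ , e₀ , f₀ , p₀ , _)) = two (cherry-search x y (λ z e f → ¬? (z ℕ.≟ z₀)))
        where
        two : (∃ λ z → ∃ λ e → ∃ λ f → Cherry x y z e f × z ≢ z₀) ⊎ (∀ {z e f} → Cherry x y z e f → ¬ z ≢ z₀) → Exceptional ⊎ cherries x y ≤ # 9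
        two (inj₂ same) = inj₂ (cherries≤9 z₀ λ {z} p → decidable-stable (z ℕ.≟ z₀) (same p))
        two (inj₁ (z₁ , e₁ , f₁ , p₁ , z₁≢z₀)) = [ inj₁ , three ]′ (compare (z₁≢z₀ ∘ sym) p₀ p₁)
          where
          three : e₀ ≡ e₁ × f₀ ≡ f₁ → Exceptional ⊎ cherries x y ≤ # 9
          three (e₀≡e₁ , f₀≡f₁) = four (cherry-search x y (λ z e f → ¬? ((e ℕ.≟ e₀) ×-dec (f ℕ.≟ f₀))))
            where
            four : (∃ λ z → ∃ λ e → ∃ λ f → Cherry x y z e f × ¬ (e ≡ e₀ × f ≡ f₀)) ⊎ (∀ {z e f} → Cherry x y z e f → ¬ ¬ (e ≡ e₀ × f ≡ f₀)) → Exceptional ⊎ cherries x y ≤ # 9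
            four (inj₂ same) = uniform λ {z} {e} {f} p → decidable-stable ((e ℕ.≟ e₀) ×-dec (f ℕ.≟ f₀)) (same p)
            four (inj₁ (z , e , f , p , differ)) = against (z ℕ.≟ z₀)
              where
              -- The deviating cherry is compared with whichever of `p₀` and `p₁` has a different
              -- middle.
              against : Dec (z ≡ z₀) → Exceptional ⊎ cherries x y ≤ # 9
              against (no z≢z₀)  = [ inj₁ , (λ same → ⊥-elim (differ same)) ]′ (compare z≢z₀ p p₀)
              against (yes refl) = [ inj₁ , (λ (a , b) → ⊥-elim (differ (trans a (sym e₀≡e₁) , trans b (sym f₀≡f₁)))) ]′ (compare (z₁≢z₀ ∘ sym) p p₁)

    cherries-bound : cherries x y ≤ # 9 + # 612 * exceptions x y
    cherries-bound = [ (λ q → many (cherries x y) (exceptions x y) (exceptional q) (cherries≤612 x y)) , few (cherries x y) (exceptions x y) 0≤exceptions ]′ exceptional-or-few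
      where
      many : ∀ a t → 1F ≤ t → a ≤ # 612 → a ≤ # 9 + # 612 * t
      many a t p q = lin (a ∷ t ∷ []) (from (p & q & []))
      few : ∀ a t → 0F ≤ t → a ≤ # 9 → a ≤ # 9 + # 612 * t
      few a t p q = lin (a ∷ t ∷ []) (from (p & q & []))

  ∑∑ : (ℕ → ℕ → F) → F
  ∑∑ f = ∑ n (λ x → ∑ n (f x))

  ∑∑-+ : ∀ f g → ∑∑ (λ x y → f x y + g x y) ≡ ∑∑ f + ∑∑ g
  ∑∑-+ f g = trans (∑-ext n λ x → ∑-+ n (f x) (g x)) (∑-+ n (λ x → ∑ n (f x)) (λ x → ∑ n (g x)))

  exceptions-total : ∑∑ exceptions ≤ # 21777 * total
  exceptions-total = subst (_≤ # 21777 * total) (sym expand)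
      (step _ _ _ total triples-total (forks-total through (0≤# 612) (λ z z′ → cherries≤612 z z′)) (forks-total closing (0≤# 51) closing-total))
    where
    expand : ∑∑ exceptions ≡ ((∑∑ triples + ∑∑ triples) + (∑∑ (forks through) + ∑∑ (forks through))) + ∑∑ (forks closing)
    expand = trans (∑∑-+ (λ x y → (triples x y + triples y x) + (forks through x y + forks through y x)) (forks closing)) (cong (_+ ∑∑ (forks closing))
      (trans (∑∑-+ (λ x y → triples x y + triples y x) (λ x y → forks through x y + forks through y x))
        (cong₂ _+_ (trans (∑∑-+ triples (λ x y → triples y x)) (cong (∑∑ triples +_) (∑-swap n n (λ x y → triples y x))))
                   (trans (∑∑-+ (forks through) (λ x y → forks through y x)) (cong (∑∑ (forks through) +_) (∑-swap n n (λ x y → forks through y x)))))))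
    -- 21777 = 2 · 51 + 2 · 17 · 612 + 17 · 51.
    step : ∀ a b d M → a ≤ M * # 51 → b ≤ M * (# 17 * # 612) → d ≤ M * (# 17 * # 51) → ((a + a) + (b + b)) + d ≤ # 21777 * M
    step a b d M p q r = lin (a ∷ b ∷ d ∷ M ∷ []) (from (p & q & r & []))

  cherries-total : ∑∑ cherries ≤ # 9 * (ι n * ι n) + # 13327524 * total
  cherries-total = ≤-trans (∑-mono n λ x _ → ∑-mono n λ y _ → cherries-bound x y)
      (subst (_≤ # 9 * (ι n * ι n) + # 13327524 * total) (sym expand) (step (ι n) (∑∑ exceptions) total exceptions-total))
    where
    expand : ∑∑ (λ x y → # 9 + # 612 * exceptions x y) ≡ ι n * (ι n * # 9) + # 612 * ∑∑ exceptions
    expand = trans (∑∑-+ (λ _ _ → # 9) (λ x y → # 612 * exceptions x y)) (cong₂ _+_ (trans (∑-ext n λ _ → ∑-const n (# 9)) (∑-const n (ι n * # 9)))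
      (trans (∑-ext n λ x → ∑-* n (# 612) (exceptions x)) (∑-* n (# 612) (λ x → ∑ n (exceptions x)))))
    step : ∀ N t M → t ≤ # 21777 * M → N * (N * # 9) + # 612 * t ≤ # 9 * (N * N) + # 13327524 * M
    step N t M p = lin (N ∷ t ∷ M ∷ []) (from (p & []))

  -- In the expanded product, terms with distinct hyperedges and distinct ends are cherries. A
  -- common hyperedge and a common end are bounded separately, in total by 17 and 3 times
  -- `mult x z`.
  square-split : ∀ x y z → mult x z * mult z y ≤ (through x y z + ∑ m (λ e → c e x z * c e z y)) + 𝟙 (y ℕ.≟ x) * (mult x z * # 3)
  square-split x y z = cases (y ℕ.≟ x)
    where
    t : ℕ → F
    t e = c e x z * c e z y
    t≥0 : ∀ e → 0F ≤ t e
    t≥0 e = *-nonneg (0≤c e x z) (0≤c e z y)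
    cases : (d : Dec (y ≡ x)) → mult x z * mult z y ≤ (through x y z + ∑ m t) + 𝟙 d * (mult x z * # 3)
    cases (yes _)  = step (mult x z * mult z y) (through x y z) (∑ m t) (mult x z * # 3) (*-monoˡ (0≤mult x z) (multiplicity z y)) (0≤through x y z) (∑-nonneg m λ e _ → t≥0 e)
      where
      step : ∀ p a b q → p ≤ q → 0F ≤ a → 0F ≤ b → p ≤ (a + b) + 1F * q
      step p a b q r s u = lin (p ∷ a ∷ b ∷ q ∷ []) (from (r & s & u & []))
    cases (no y≢x) = subst₂ _≤_ (sym (∑-product m m (λ e → c e x z) (λ f → c f z y))) (sym (trans (cong ((through x y z + ∑ m t) +_) (zeroˡ _)) (+-identityʳ _)))
        (≤-trans (∑-mono m λ e _ → ∑-mono m λ f _ → pointwise e f (f ℕ.≟ e)) gather)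
      where
      gather : ∑ m (λ e → ∑ m (λ f → 𝟙 (Cherry? x y z e f) + 𝟙 (f ℕ.≟ e) * t e)) ≤ through x y z + ∑ m t
      gather = subst (_≤ through x y z + ∑ m t)
        (sym (trans (∑-ext m λ e → ∑-+ m (λ f → 𝟙 (Cherry? x y z e f)) (λ f → 𝟙 (f ℕ.≟ e) * t e))
          (∑-+ m (λ e → ∑ m (λ f → 𝟙 (Cherry? x y z e f))) (λ e → ∑ m (λ f → 𝟙 (f ℕ.≟ e) * t e)))))
        (+-mono-≤ ≤-refl (∑-mono m λ e _ → ∑-hits-* m e t t≥0))
      pointwise : ∀ e f (d : Dec (f ≡ e)) → c e x z * c f z y ≤ 𝟙 (Cherry? x y z e f) + 𝟙 d * t e
      pointwise e f (yes refl) = subst (_≤ 𝟙 (Cherry? x y z e f) + 1F * t e) (+-identityˡ _) (+-mono-≤ (𝟙-nonneg (Cherry? x y z e f)) (≤-reflexive (sym (*-identityˡ _))))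
      pointwise e f (no f≢e)   = subst₂ _≤_ (𝟙-× (C? e x z) (C? f z y)) (sym (trans (cong (𝟙 (Cherry? x y z e f) +_) (zeroˡ _)) (+-identityʳ _)))
        (𝟙-mono (C? e x z ×-dec C? f z y) (Cherry? x y z e f) λ p → p , (f≢e ∘ sym) , (y≢x ∘ sym))

  degree-sum : ℕ → F
  degree-sum z = ∑ n (λ x → mult x z)

  squares : ∑ n (λ z → degree-sum z * degree-sum z) ≤ ∑∑ cherries + # 20 * total
  squares = ≤-trans (∑-mono n λ z _ → row z) (subst (_≤ ∑∑ cherries + # 20 * total) (sym expand) ≤-refl)
    where
    row : ∀ z → degree-sum z * degree-sum z ≤ ∑∑ (λ x y → through x y z) + # 20 * degree-sum z
    row z = subst (_≤ ∑∑ (λ x y → through x y z) + # 20 * degree-sum z)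
        (sym (trans (cong (degree-sum z *_) (∑-ext n λ y → mult-sym y z)) (∑-product n n (λ x → mult x z) (λ y → mult z y))))
        (≤-trans (∑-mono n λ x _ → ≤-trans (∑-mono n λ y _ → square-split x y z) (cell x))
          (≤-reflexive (trans (∑-+ n (λ x → ∑ n (λ y → through x y z)) (λ x → # 20 * mult x z)) (cong (∑∑ (λ x y → through x y z) +_) (∑-* n (# 20) (λ x → mult x z))))))
      where
      cell : ∀ x → ∑ n (λ y → (through x y z + ∑ m (λ e → c e x z * c e z y)) + 𝟙 (y ℕ.≟ x) * (mult x z * # 3)) ≤ ∑ n (λ y → through x y z) + # 20 * mult x z
      cell x = subst (_≤ ∑ n (λ y → through x y z) + # 20 * mult x z)
          (sym (trans (∑-+ n (λ y → through x y z + ∑ m (λ e → c e x z * c e z y)) (λ y → 𝟙 (y ℕ.≟ x) * (mult x z * # 3)))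
            (cong (_+ ∑ n (λ y → 𝟙 (y ℕ.≟ x) * (mult x z * # 3))) (∑-+ n (λ y → through x y z) (λ y → ∑ m (λ e → c e x z * c e z y))))))
          (step _ _ _ _ same-edge (∑-hits-* n x (λ _ → mult x z * # 3) λ _ → *-nonneg (0≤mult x z) (0≤# 3)))
        where
        step : ∀ a b d p → b ≤ p * # 17 → d ≤ p * # 3 → (a + b) + d ≤ a + # 20 * p
        step a b d p q r = lin (a ∷ b ∷ d ∷ p ∷ []) (from (q & r & []))
        same-edge : ∑ n (λ y → ∑ m (λ e → c e x z * c e z y)) ≤ mult x z * # 17
        same-edge = subst₂ _≤_ (sym (trans (∑-swap n m (λ y e → c e x z * c e z y)) (∑-ext m λ e → ∑-* n (c e x z) (c e z)))) (∑-*ʳ m (# 17) (λ e → c e x z))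
          (∑-mono m λ e _ → *-monoˡ (0≤c e x z) (degree e z))
    expand : ∑ n (λ z → ∑∑ (λ x y → through x y z) + # 20 * degree-sum z) ≡ ∑∑ cherries + # 20 * total
    expand = trans (∑-+ n (λ z → ∑∑ (λ x y → through x y z)) (λ z → # 20 * degree-sum z)) (cong₂ _+_
      (trans (∑-swap n n (λ z x → ∑ n (λ y → through x y z))) (∑-ext n λ x → ∑-swap n n (λ z y → through x y z)))
      (∑-* n (# 20) degree-sum))

  -- 13327544 = 612 · 21777 + 20, where 20 comes from the terms that are not cherries.
  total-square : total * total ≤ # 9 * (ι n * ι n * ι n) + # 13327544 * (ι n * total)
  total-square = ≤-trans (cauchy n degree-sum) (step (ι n) _ (∑∑ cherries) total (0≤ι n) squares cherries-total)
    where
    step : ∀ N s r M → 0F ≤ N → s ≤ r + # 20 * M → r ≤ # 9 * (N * N) + # 13327524 * M → N * s ≤ # 9 * (N * N * N) + # 13327544 * (N * M)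
    step N s r M p q t = lin (N ∷ s ∷ r ∷ M ∷ []) (from (*-monoˡ p q & *-monoˡ p t & []))

-- Upper bound: from cherry counts to n^(3/2).

weight-bound : ∀ {n} (H : Hypergraph n) → BergeC4Free H → ∃ λ M → # 6 * ζ (weight H) ≤ M × M * M ≤ # 9 * (ι n * ι n * ι n) + # 13327544 * (ι n * M)
weight-bound {n} H free = total , lower , total-square
  where
  open Colouring H free
  open Cherries n m In? Good? Joined? (has⇒< H _ _) proj₁ (proj₁ ∘ proj₂) (λ (_ , _ , _ , g) → g) (λ {e} {u} {v} → Joined-sym {e} {u} {v})
    joined-degree joined-codegree id no-C4 (λ {e} → bad-path-free {e})
  lower : # 6 * ζ (weight H) ≤ total
  lower = subst₂ _≤_ (trans (∑-* m (# 6) (λ e → ι (order H e) - # 3)) (cong (# 6 *_) (weight-order H)))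
    (trans (∑-swap m n (λ e z → ∑ n (λ x → c e z x))) (∑-ext n λ z → trans (∑-swap m n (λ e x → c e z x)) (∑-ext n λ x → mult-sym z x)))
    (∑-mono m λ e _ → joined-lower e)

-- If M is too large by the factor 1 + t, the term K N M must cover the excess 18 t N³, so N² is
-- O(M). Inserted into the upper bound this gives M = O(N), and the two together bound N. Here r =
-- 1/t.
small-order : ∀ {N M K t r} → # 1 ≤ N → # 1 ≤ M → 0F ≤ K → 0F ≤ r → 0F ≤ t → r * t ≡ 1F →
              M * M ≤ # 9 * (N * N * N) + K * (N * M) → # 9 * ((1F + t) * (1F + t)) * (N * N * N) ≤ M * M → N ≤ (K * r) * ((K * r) * # 9 + K)
small-order {N} {M} {K} {t} {r} 1≤N 1≤M 0≤K 0≤r 0≤t rt upper lower = N≤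
  where
  0≤N : 0F ≤ N
  0≤N = ≤-trans (0≤# 1) 1≤N
  0≤N² : 0F ≤ N * N
  0≤N² = square-nonneg N
  0≤N³ : 0F ≤ N * N * N
  0≤N³ = *-nonneg 0≤N² 0≤N
  excess : N * (# 18 * (t * (N * N))) ≤ N * (K * M)
  excess = lin (N ∷ M ∷ K ∷ t ∷ []) (from (upper & lower & *-nonneg (*-nonneg 0≤t 0≤t) 0≤N³ & []))
  g : F
  g = K * r
  0≤g : 0F ≤ g
  0≤g = *-nonneg 0≤K 0≤r
  N²≤ : N * N ≤ g * M
  N²≤ = lin (N ∷ M ∷ K ∷ t ∷ r ∷ []) (from (*-monoˡ 0≤r (*-cancel 1≤N excess) & cong (_* (N * N)) rt & 0≤N² & []))
  M≤ : M ≤ N * (g * # 9 + K)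
  M≤ = *-cancel 1≤M (lin (N ∷ M ∷ K ∷ r ∷ []) (from (upper & *-monoˡ 0≤N N²≤ & [])))
  N≤ : N ≤ g * (g * # 9 + K)
  N≤ = *-cancel 1≤N (lin (N ∷ M ∷ K ∷ r ∷ []) (from (N²≤ & *-monoˡ 0≤g M≤ & [])))

opaque
  constant : ℕ
  constant = 13327544

  ι-constant : ι constant ≡ # 13327544
  ι-constant = ι-# 13327544

upper-bound : (k : ℕ) → ∃ λ N → (n : ℕ) → n ℕ.≥ N → (H : Hypergraph n) → BergeC4Free H →
              AtMostSqrt (ℤ→ℚ (weight H)) ((ℚ.1ℚ ℚ.+ ε k) ℚ.* (ℤ.+ 1 ℚ./ 2)) (ℕ→ℚ (n ^ 3))
upper-bound k = suc threshold , λ n big H free → at-most (weight H) k (n ^ 3) (decide n big (weight H) (weight-bound H free))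
  where
  g threshold : ℕ
  g = constant ℕ.* suc k
  threshold = g ℕ.* (g ℕ.* 9 ℕ.+ constant)
  t : F
  t = inv (suc k)
  ι-threshold : ι threshold ≡ (# 13327544 * ι (suc k)) * ((# 13327544 * ι (suc k)) * # 9 + # 13327544)
  ι-threshold = trans (ι-* g (g ℕ.* 9 ℕ.+ constant)) (cong₂ _*_ ι-g (trans (ι-+ (g ℕ.* 9) constant) (cong₂ _+_ (trans (ι-* g 9) (cong₂ _*_ ι-g (ι-# 9))) ι-constant)))
    where
    ι-g : ι g ≡ # 13327544 * ι (suc k)
    ι-g = trans (ι-* constant (suc k)) (cong (_* ι (suc k)) ι-constant)
  decide : ∀ n → n ℕ.≥ suc threshold → (w : ℤ) → (∃ λ M → # 6 * ζ w ≤ M × M * M ≤ # 9 * (ι n * ι n * ι n) + # 13327544 * (ι n * M)) →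
           ζ w ≤ 0F ⊎ ζ w * ζ w ≤ ((1F + inv (suc k)) * inv 2) * ((1F + inv (suc k)) * inv 2) * ζ (ℤ.+ (n ^ 3))
  decide n big w (M , 6W≤M , M²≤) = cases (ζ w ≤? 0F) (≤-total (ζ w * ζ w) (((1F + inv (suc k)) * inv 2) * ((1F + inv (suc k)) * inv 2) * ζ (ℤ.+ (n ^ 3))))
    where
    half : # 2 * inv 2 ≡ 1F
    half = ι*inv 1
    -- 36 · 1/4 = 9: the factor 6 between weight and `M` turns the constant 1/2 of the theorem into
    -- the 9 of the cherry count.
    scale : ∀ h t P W M → # 2 * h ≡ 1F → # 0 ≤ W → # 6 * W ≤ M → ((1F + t) * h) * ((1F + t) * h) * P ≤ W * W → # 9 * ((1F + t) * (1F + t)) * P ≤ M * M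
    scale h t P W M p 0≤W q r = lin (h ∷ t ∷ P ∷ W ∷ M ∷ [])
        (from (cong (_* ((1F + t) * (1F + t) * P)) 4h² & *-mono 0≤6W (≤-trans 0≤6W q) q q & r & []))
      where
      4h² : # 4 * (h * h) ≡ 1F
      4h² = lin (h ∷ []) (from (cong (_* h) p & p & []))
      0≤6W : 0F ≤ # 6 * W
      0≤6W = lin (W ∷ []) (from (0≤W & []))
    positive : ¬ ζ w ≤ 0F → # 1 ≤ ζ w
    positive ¬p = ζ-mono (ℤ.i<j⇒suc[i]≤j (ℤ.≰⇒> λ q → ¬p (subst (ζ w ≤_) ζ0 (ζ-mono q))))
    cases : Dec (ζ w ≤ 0F) → _ → _
    cases (yes p) _        = inj₁ p
    cases (no _)  (inj₁ q) = inj₂ q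
    cases (no ¬p) (inj₂ q) = ⊥-elim (ℕ.<⇒≱ big (ι-cancel (subst (ι n ≤_) (sym ι-threshold)
        (small-order (1≤ι (ℕ.≤-trans (s≤s z≤n) big)) 1≤M (0≤# 13327544) (0≤ι (suc k)) (0≤inv (suc k)) (ι-inv {suc k} (s≤s z≤n)) M²≤
          (scale (inv 2) t (ι n * ι n * ι n) (ζ w) M half (≤-trans (lin [] (from [])) (positive ¬p)) 6W≤M
            (subst (λ P → ((1F + t) * inv 2) * ((1F + t) * inv 2) * P ≤ ζ w * ζ w) (ι-cube n) q))))))
      where
      1≤M : # 1 ≤ M
      1≤M = step (ζ w) M (positive ¬p) 6W≤M
        where
        step : ∀ W M → # 1 ≤ W → # 6 * W ≤ M → # 1 ≤ M
        step W M p q = lin (W ∷ M ∷ []) (from (p & q & []))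

theorem1 :
    -- upper bound: Σ (|h|-3) ≤ (1 + o(1)) · (1/2) · n^{3/2}
    ((k : ℕ) → ∃ λ N → (n : ℕ) → n ≥ N → (H : Hypergraph n) → BergeC4Free H →
        AtMostSqrt (ℤ→ℚ (weight H)) ((1ℚ ℚ.+ ε k) ℚ.* (ℤ.+ 1 ℚ./ 2)) (ℕ→ℚ (n ^ 3)))
    ×
    -- lower bound: Berge-C4-free H with Σ (|h|-3) ≥ (1 + o(1)) · n^{3/2} / (2√6)
    -- (the square of the constant (1 - ε) / (2√6) is (1 - ε)² / 24)
    ((k : ℕ) → ∃ λ N → (n : ℕ) → n ≥ N → Σ (Hypergraph n) λ H → BergeC4Free H ×
        AtLeastSqrt (ℤ→ℚ (weight H)) (1ℚ ℚ.- ε k) (ℕ→ℚ (n ^ 3) ℚ.* (ℤ.+ 1 ℚ./ 24)))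
theorem1 = upper-bound , lower-bound
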